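{- Let $k\geq 2$ be an integer. For all integers $n$ with $3k\leq n\leq 2k^{2}-k+2$, $$ar(n, kC_{3})\leq\left\lfloor\frac{(n-k+2)^{2}}{4}\right\rfloor+(k-2)(n-k+2)+\binom{k-2}{2}+(k-1)^{2}-\frac{n-3k}{2}+1.$$
   Context: An edge-coloring of a graph assigns a color to each edge; an edge-colored graph is rainbow if all colors on its edges are distinct. For a positive integer $n$ and a graph $F$, the anti-Ramsey number $ar(n,F)$ is the maximum number of colors in an edge-coloring of the complete graph $K_n$ containing no rainbow copy of $F$. $kC_3$ denotes the graph consisting of $k$ vertex-disjoint triangles. -}

module Defs where

open import Data.Nat using (ℕ; _<ᵇ_; _≤_)
open import Data.Nat.Properties using (_≟_)
open import Data.Fin using (Fin; toℕ; zero; suc)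
open import Data.Product using (_×_; _,_)
open import Data.List using (List; []; _∷_; concatMap; map; length; deduplicate; allFin)
open import Data.Bool using (if_then_else_)
open import Relation.Binary.PropositionalEquality using (_≡_)
open import Function.Definitions using (Injective)
open import Relation.Nullary using (¬_)

-- An edge-colouring of K_n: a symmetric assignment of colours (natural numbers)
-- to ordered pairs of vertices; only pairs i ≠ j (edges) are relevant.
record EdgeColouring (n : ℕ) : Set where
  field
    col : Fin n → Fin n → ℕ
    sym : ∀ i j → col i j ≡ col j i
open EdgeColouring public

edges : (n : ℕ) → List (Fin n × Fin n)
edges n = concatMap (λ i → concatMap (λ j → if toℕ i <ᵇ toℕ j then (i , j) ∷ [] else []) (allFin n)) (allFin n)

numColours : ∀ {n} → EdgeColouring n → ℕ
numColours {n} c = length (deduplicate _≟_ (map (λ e → col c (Data.Product.proj₁ e) (Data.Product.proj₂ e)) (edges n)))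

-- A copy of kC_3 in K_n: k triangles with 3k distinct vertices,
-- given by an injective map (triangle index, corner) ↦ vertex.
record CopyKC3 (n k : ℕ) : Set where
  field
    vtx : Fin k × Fin 3 → Fin n
    inj : Injective _≡_ _≡_ vtx
open CopyKC3 public

edgeColour : ∀ {n k} → EdgeColouring n → CopyKC3 n k → Fin k × Fin 3 → ℕ
edgeColour c T (a , zero) = col c (vtx T (a , zero)) (vtx T (a , suc zero))
edgeColour c T (a , suc zero) = col c (vtx T (a , suc zero)) (vtx T (a , suc (suc zero)))
edgeColour c T (a , suc (suc zero)) = col c (vtx T (a , zero)) (vtx T (a , suc (suc zero)))

Rainbow : ∀ {n k} → EdgeColouring n → CopyKC3 n k → Set
Rainbow c T = Injective _≡_ _≡_ (edgeColour c T)

NoRainbowKC3 : ∀ {n} → (k : ℕ) → EdgeColouring n → Set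
NoRainbowKC3 {n} k c = (T : CopyKC3 n k) → ¬ Rainbow c T

{-# OPTIONS --safe #-}

-- Choosing one edge of each colour gives a rainbow graph g with as many edges as there are colours. Inserting an
-- edge into a rainbow graph and dropping the edge of the same colour loses no edge, so g may be changed freely,
-- and a rainbow packing of triangles found anywhere can be made part of g. For n = 3k + m we bound the number of
-- edges of g, when there is no rainbow copy of k disjoint triangles, by induction on k, then on m. Deleting one or two
-- vertices gives degree conditions; four ends of two disjoint edges outside a packing that send nine edges to one
-- of its triangles T form two triangles with T. For even m ≥ 2 this is Dirac's argument. For odd m ≥ 3 a
-- packing that cannot grow receives exactly eight such edges per triangle, and the colour of one missing edge
-- decides. For m = 0 the complement has at most 3k - 3 edges and triangles are removed greedily; for m = 1 only
-- four vertices stay outside k - 1 triangles and edge counting suffices, except on seven vertices, where all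
-- graphs are searched.
module Submission where

open import Defs renaming (sym to col-sym)
open import Data.Nat
open import Data.Nat.Properties hiding (_≟_)
open import Data.Nat.DivMod using (m*n/n≡m; /-monoˡ-≤)
open import Data.Nat.Combinatorics using (_C_; nC1≡n; nCk+nC[k+1]≡[n+1]C[k+1])
open import Data.Nat.Tactic.RingSolver using (solve-∀)
open import Data.Fin using (Fin; zero; suc; toℕ) renaming (_≟_ to _≟ᶠ_)
open import Data.Fin.Properties using (toℕ-injective)
open import Data.Vec.Properties using (lookup∘tabulate; lookup-map)
open import Data.Fin.Patterns
open import Data.Vec as Vec using (Vec; []; _∷_; lookup; toList)
open import Data.List using (List; []; _∷_; _++_; length; map; allFin; filterᵇ)
open import Data.List.Properties using (++-assoc; ++-identityʳ; map-∘; length-++; length-map; length-tabulate)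
open import Data.List.Relation.Binary.Permutation.Propositional renaming (swap to pswap; trans to ptrans)
open import Data.List.Relation.Binary.Permutation.Propositional.Properties hiding (++-assoc; ++-identityʳ)
import Data.List.Relation.Binary.Permutation.Setoid.Properties as PermS
open import Data.List.Relation.Unary.All as All using (All; []; _∷_)
import Data.List.Relation.Unary.All.Properties as All
open import Data.List.Relation.Unary.Any using (here; there)
open import Data.List.Relation.Unary.AllPairs as AllPairs using ([]; _∷_)
open import Data.List.Relation.Unary.Unique.Propositional using (Unique)
open import Data.List.Membership.Propositional using (_∈_)
open import Data.List.Membership.Propositional.Properties using (∈-∃++; ∈-++⁺ˡ; ∈-++⁺ʳ; ∈-map⁺; ∈-map⁻; ∈-filter⁺; ∈-deduplicate⁻; ∈-allFin)
open import Data.Bool using (Bool; true; false; T; _∧_; _∨_; not; if_then_else_)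
open import Data.List.Relation.Unary.Unique.Propositional.Properties using (allFin⁺)
open import Data.List.Relation.Unary.Unique.DecPropositional.Properties using (deduplicate-!)
open import Data.Bool.ListAction using (any; all)
open import Data.Bool.Properties using (T?)
open import Function using (_∘_)
open import Data.Product using (_×_; _,_; proj₁; proj₂; ∃-syntax)
open import Data.Sum as Sum using (_⊎_; inj₁; inj₂)
open import Data.Unit using (⊤; tt)
open import Data.Empty using (⊥; ⊥-elim)
open import Relation.Nullary using (yes; no; does; ¬_)
open import Relation.Nullary.Decidable using (dec-true; dec-false)
open import Relation.Binary.PropositionalEquality hiding ([_])

-- Linear arithmetic over ℕ by certificates

-- The first three terms of the bound count the edges of a complete graph on k - 2 vertices joined
-- to a balanced complete bipartite graph, which has no k - 1 disjoint triangles. The surplus (k-1)²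
-- - (n-3k)/2 vanishes at n = 2k² - k + 2 and is rounded down in `bound`; the rounding separates the
-- parities. For even n - 3k ≥ 2, deleting one vertex gives adjacent vertices the degree sum n + k,
-- exactly what Dirac's argument uses. For odd n - 3k ≥ 3 the available deletions give only n + k -
-- 1, so the last triangle must come from the case of equality. Counting alone cannot settle n = 3k:
-- there k + 1 pairwise non-adjacent vertices exclude k disjoint triangles, and for k = 2 and k = 3
-- they account for only 3k - 3 non-edges. In this case, as in the equality case for odd n - 3k, the
-- colour of a non-edge has to enter. Such an exchange helps only if the new graph satisfies the
-- same hypotheses; hence `Bounded` speaks of all rainbow graphs of the colouring at once, and
-- degree conditions hold again after each exchange.

infixl 6 _⊕_
infixl 7 _⊗_
infix 5 _⊑_
infixr 3 _·_

data Expr (n : ℕ) : Set where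
  var : Fin n → Expr n
  K   : ℕ → Expr n
  _⊕_ : Expr n → Expr n → Expr n
  _⊗_ : ℕ → Expr n → Expr n

⟦_⟧ : ∀ {n} → Expr n → Vec ℕ n → ℕ
⟦ var i ⟧ ρ = lookup ρ i
⟦ K k ⟧ ρ = k
⟦ a ⊕ b ⟧ ρ = ⟦ a ⟧ ρ + ⟦ b ⟧ ρ
⟦ k ⊗ a ⟧ ρ = k * ⟦ a ⟧ ρ

dot : ∀ {n} → Vec ℕ n → Vec ℕ n → ℕ
dot [] [] = 0
dot (a ∷ u) (x ∷ ρ) = a * x + dot u ρ

zeros : ∀ n → Vec ℕ n
zeros zero = []
zeros (suc n) = 0 ∷ zeros n

unit : ∀ {n} → Fin n → Vec ℕ n
unit zero = 1 ∷ zeros _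
unit (suc i) = 0 ∷ unit i

_⊞_ : ∀ {n} → Vec ℕ n → Vec ℕ n → Vec ℕ n
[] ⊞ [] = []
(a ∷ u) ⊞ (b ∷ v) = a + b ∷ u ⊞ v

scale : ∀ {n} → ℕ → Vec ℕ n → Vec ℕ n
scale k [] = []
scale k (a ∷ u) = k * a ∷ scale k u

dot-zeros : ∀ {n} (ρ : Vec ℕ n) → dot (zeros n) ρ ≡ 0
dot-zeros [] = refl
dot-zeros (x ∷ ρ) = dot-zeros ρ

dot-unit : ∀ {n} (i : Fin n) ρ → dot (unit i) ρ ≡ lookup ρ i
dot-unit zero (x ∷ ρ) = trans (cong (1 * x +_) (dot-zeros ρ)) (trans (+-identityʳ _) (*-identityˡ x))
dot-unit (suc i) (x ∷ ρ) = dot-unit i ρ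

dot-⊞ : ∀ {n} (u v ρ : Vec ℕ n) → dot (u ⊞ v) ρ ≡ dot u ρ + dot v ρ
dot-⊞ [] [] [] = refl
dot-⊞ (a ∷ u) (b ∷ v) (x ∷ ρ) rewrite dot-⊞ u v ρ = rearrange a b x (dot u ρ) (dot v ρ)
  where
  rearrange : ∀ a b x p q → (a + b) * x + (p + q) ≡ (a * x + p) + (b * x + q)
  rearrange = solve-∀

dot-scale : ∀ {n} k (u ρ : Vec ℕ n) → dot (scale k u) ρ ≡ k * dot u ρ
dot-scale k [] [] = sym (*-zeroʳ k)
dot-scale k (a ∷ u) (x ∷ ρ) rewrite dot-scale k u ρ = rearrange k a x (dot u ρ)
  where
  rearrange : ∀ k a x p → k * a * x + k * p ≡ k * (a * x + p)
  rearrange = solve-∀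

-- The head is the constant term, paired with the value 1.
coeffs : ∀ {n} → Expr n → Vec ℕ (suc n)
coeffs (var i) = 0 ∷ unit i
coeffs (K k) = k ∷ zeros _
coeffs (a ⊕ b) = coeffs a ⊞ coeffs b
coeffs (k ⊗ a) = scale k (coeffs a)

coeffs-sound : ∀ {n} (a : Expr n) ρ → dot (coeffs a) (1 ∷ ρ) ≡ ⟦ a ⟧ ρ
coeffs-sound (var i) ρ = dot-unit i ρ
coeffs-sound (K k) ρ = trans (cong (k * 1 +_) (dot-zeros ρ)) (trans (+-identityʳ _) (*-identityʳ k))
coeffs-sound (a ⊕ b) ρ = trans (dot-⊞ (coeffs a) (coeffs b) (1 ∷ ρ)) (cong₂ _+_ (coeffs-sound a ρ) (coeffs-sound b ρ))
coeffs-sound (k ⊗ a) ρ = trans (dot-scale k (coeffs a) (1 ∷ ρ)) (cong (k *_) (coeffs-sound a ρ))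

record Ineq (n : ℕ) : Set where
  constructor _⊑_
  field lhs rhs : Expr n
open Ineq

data Certificate (n : ℕ) : Set where
  done : Certificate n
  _·_ : ℕ × Ineq n → Certificate n → Certificate n

Holds : ∀ {n} → Certificate n → Vec ℕ n → Set
Holds done ρ = ⊤
Holds ((_ , h) · hs) ρ = ⟦ lhs h ⟧ ρ ≤ ⟦ rhs h ⟧ ρ × Holds hs ρ

combine : ∀ {n} → (Ineq n → Expr n) → Certificate n → Expr n
combine side done = K 0
combine side ((m , h) · hs) = m ⊗ side h ⊕ combine side hs

combine-≤ : ∀ {n} (hs : Certificate n) ρ → Holds hs ρ → ⟦ combine lhs hs ⟧ ρ ≤ ⟦ combine rhs hs ⟧ ρ
combine-≤ done ρ _ = z≤n
combine-≤ ((m , h) · hs) ρ (p , ps) = +-mono-≤ (*-monoʳ-≤ m p) (combine-≤ hs ρ ps)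

_≤ᵛ_ : ∀ {n} → Vec ℕ n → Vec ℕ n → Bool
[] ≤ᵛ [] = true
(a ∷ u) ≤ᵛ (b ∷ v) = (a ≤ᵇ b) ∧ (u ≤ᵛ v)

T-∧ : ∀ a {b} → T (a ∧ b) → T a × T b
T-∧ true p = tt , p

dot-mono : ∀ {n} (u v ρ : Vec ℕ n) → T (u ≤ᵛ v) → dot u ρ ≤ dot v ρ
dot-mono [] [] [] _ = z≤n
dot-mono (a ∷ u) (b ∷ v) (x ∷ ρ) p =
  +-mono-≤ (*-monoˡ-≤ x (≤ᵇ⇒≤ a b (proj₁ (T-∧ (a ≤ᵇ b) p)))) (dot-mono u v ρ (proj₂ (T-∧ (a ≤ᵇ b) p)))

-- The weighted sum of the hypotheses reads l ≤ r, while l exceeds r coefficientwise and in the constant term.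
contradictory : ∀ {n} → Certificate n → Bool
contradictory hs = coeffs (K 1 ⊕ combine rhs hs) ≤ᵛ coeffs (combine lhs hs)

-- For an explicit certificate `contradictory` evaluates to `true`, so the implicit argument has
-- type `⊤` and is found by η.
refute : ∀ {n} (ρ : Vec ℕ n) (hs : Certificate n) {_ : T (contradictory hs)} → Holds hs ρ → ⊥
refute ρ hs {ok} ps = <⇒≱ (subst₂ _≤_ (coeffs-sound (K 1 ⊕ combine rhs hs) ρ) (coeffs-sound (combine lhs hs) ρ)
  (dot-mono (coeffs (K 1 ⊕ combine rhs hs)) (coeffs (combine lhs hs)) (1 ∷ ρ) ok)) (combine-≤ hs ρ ps)

-- The negated goal joins the hypotheses with multiplier `m`. A value above one amounts to a
-- division: only that multiple of the goal is a combination of the hypotheses.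
deduce : ∀ {n} (ρ : Vec ℕ n) (m : ℕ) (goal : Ineq n) (hs : Certificate n)
  {_ : T (contradictory ((m , K 1 ⊕ rhs goal ⊑ lhs goal) · hs))} → Holds hs ρ → ⟦ lhs goal ⟧ ρ ≤ ⟦ rhs goal ⟧ ρ
deduce ρ m goal hs {ok} ps =
  ≮⇒≥ λ lt → refute ρ ((m , K 1 ⊕ rhs goal ⊑ lhs goal) · hs) {ok} (lt , ps)
pattern x0 = var zero
pattern x1 = var (suc zero)
pattern x2 = var (suc (suc zero))
pattern x3 = var (suc (suc (suc zero)))
pattern x4 = var (suc (suc (suc (suc zero))))
pattern x5 = var (suc (suc (suc (suc (suc zero)))))
pattern x6 = var (suc (suc (suc (suc (suc (suc zero))))))
pattern x7 = var (suc (suc (suc (suc (suc (suc (suc zero)))))))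
pattern x8 = var (suc (suc (suc (suc (suc (suc (suc (suc zero))))))))
pattern x9 = var (suc (suc (suc (suc (suc (suc (suc (suc (suc zero)))))))))
pattern x10 = var (suc (suc (suc (suc (suc (suc (suc (suc (suc (suc zero))))))))))
pattern x11 = var (suc (suc (suc (suc (suc (suc (suc (suc (suc (suc (suc zero)))))))))))

pattern x12 = var (suc (suc (suc (suc (suc (suc (suc (suc (suc (suc (suc (suc zero))))))))))))
pattern x13 = var (suc (suc (suc (suc (suc (suc (suc (suc (suc (suc (suc (suc (suc zero)))))))))))))
pattern x14 = var (suc (suc (suc (suc (suc (suc (suc (suc (suc (suc (suc (suc (suc (suc zero))))))))))))))
pattern x15 = var (suc (suc (suc (suc (suc (suc (suc (suc (suc (suc (suc (suc (suc (suc (suc zero)))))))))))))))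
pattern x16 = var (suc (suc (suc (suc (suc (suc (suc (suc (suc (suc (suc (suc (suc (suc (suc (suc zero))))))))))))))))
pattern x17 = var (suc (suc (suc (suc (suc (suc (suc (suc (suc (suc (suc (suc (suc (suc (suc (suc (suc zero)))))))))))))))))
pattern x18 = var (suc (suc (suc (suc (suc (suc (suc (suc (suc (suc (suc (suc (suc (suc (suc (suc (suc (suc zero))))))))))))))))))
pattern x19 = var (suc (suc (suc (suc (suc (suc
    (suc (suc (suc (suc (suc (suc (suc (suc (suc (suc (suc (suc (suc zero)))))))))))))))))))

-- Sums over lists and permutations

∑ : {A : Set} → (A → ℕ) → List A → ℕ
∑ f [] = 0
∑ f (x ∷ xs) = f x + ∑ f xs

∑-++ : {A : Set} (f : A → ℕ) (xs ys : List A) → ∑ f (xs ++ ys) ≡ ∑ f xs + ∑ f ys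
∑-++ f [] ys = refl
∑-++ f (x ∷ xs) ys = trans (cong (f x +_) (∑-++ f xs ys)) (sym (+-assoc (f x) _ _))

exchange : ∀ a b s → a + (b + s) ≡ b + (a + s)
exchange = solve-∀

∑-↭ : {A : Set} (f : A → ℕ) {xs ys : List A} → xs ↭ ys → ∑ f xs ≡ ∑ f ys
∑-↭ f refl = refl
∑-↭ f (prep x p) = cong (f x +_) (∑-↭ f p)
∑-↭ f (pswap x y p) = trans (exchange (f x) (f y) _) (cong (λ s → f y + (f x + s)) (∑-↭ f p))
∑-↭ f (ptrans p q) = trans (∑-↭ f p) (∑-↭ f q)

∑-mono : {A : Set} {f h : A → ℕ} (xs : List A) → (∀ x → f x ≤ h x) → ∑ f xs ≤ ∑ h xs
∑-mono [] le = z≤n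
∑-mono (x ∷ xs) le = +-mono-≤ (le x) (∑-mono xs le)

∑-cong : {A : Set} {f h : A → ℕ} (xs : List A) → (∀ x → f x ≡ h x) → ∑ f xs ≡ ∑ h xs
∑-cong [] e = refl
∑-cong (x ∷ xs) e = cong₂ _+_ (e x) (∑-cong xs e)

∑-distrib : {A : Set} (f h : A → ℕ) (xs : List A) → ∑ (λ x → f x + h x) xs ≡ ∑ f xs + ∑ h xs
∑-distrib f h [] = refl
∑-distrib f h (x ∷ xs) = trans (cong (f x + h x +_) (∑-distrib f h xs)) (interleave (f x) (h x) _ _)
  where
  interleave : ∀ a b s t → a + b + (s + t) ≡ a + s + (b + t)
  interleave = solve-∀

∑-bound : {A : Set} (f : A → ℕ) (c : ℕ) {xs : List A} → All (λ x → f x ≤ c) xs → ∑ f xs ≤ c * length xs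
∑-bound f c [] = z≤n
∑-bound f c {_ ∷ xs} (p ∷ ps) = ≤-trans (+-mono-≤ p (∑-bound f c ps)) (≤-reflexive (sym (*-suc c (length xs))))

-- Throughout, to find an element means to give a permutation that brings it to the front, so that
-- the others stay available.
search : {A : Set} {P Q : A → Set} → (∀ x → P x ⊎ Q x) → (xs : List A) →
  (∃[ x ] ∃[ ys ] xs ↭ x ∷ ys × P x) ⊎ All Q xs
search dec [] = inj₂ []
search dec (x ∷ xs) with dec x
... | inj₁ p = inj₁ (x , xs , refl , p)
... | inj₂ q with search dec xs
...   | inj₁ (y , ys , σ , p) = inj₁ (y , x ∷ ys , ptrans (prep x σ) (pswap x y refl) , p)
...   | inj₂ qs = inj₂ (q ∷ qs)

pigeonhole : {A : Set} (f : A → ℕ) (c : ℕ) (xs : List A) → c * length xs < ∑ f xs →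
  ∃[ x ] ∃[ ys ] xs ↭ x ∷ ys × c < f x
pigeonhole f c xs lt with search (λ x → <-≤-connex c (f x)) xs
... | inj₁ found = found
... | inj₂ small = ⊥-elim (<⇒≱ lt (∑-bound f c small))

++-interchange : {A : Set} (as bs cs ds : List A) → (as ++ bs) ++ (cs ++ ds) ↭ (as ++ cs) ++ (bs ++ ds)
++-interchange as bs cs ds = begin
  (as ++ bs) ++ (cs ++ ds) ≡⟨ ++-assoc as bs (cs ++ ds) ⟩
  as ++ (bs ++ (cs ++ ds)) ↭⟨ ++⁺ˡ as (shifts bs cs) ⟩
  as ++ (cs ++ (bs ++ ds)) ≡⟨ sym (++-assoc as cs (bs ++ ds)) ⟩
  (as ++ cs) ++ (bs ++ ds) ∎
  where open PermutationReasoning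

-- Permutations of explicit tuples

idx : ∀ m → List (Fin m)
idx zero = []
idx (suc m) = zero ∷ map suc (idx m)

insert : ∀ {m} → Fin m → List (Fin m) → List (Fin m)
insert i [] = i ∷ []
insert i (j ∷ js) = if toℕ i ≤ᵇ toℕ j then i ∷ j ∷ js else j ∷ insert i js

isort : ∀ {m} → List (Fin m) → List (Fin m)
isort [] = []
isort (i ∷ is) = insert i (isort is)

insert-↭ : ∀ {m} (i : Fin m) js → insert i js ↭ i ∷ js
insert-↭ i [] = refl
insert-↭ i (j ∷ js) with toℕ i ≤ᵇ toℕ j
... | true = refl
... | false = ptrans (prep j (insert-↭ i js)) (pswap j i refl)

isort-↭ : ∀ {m} (is : List (Fin m)) → isort is ↭ is
isort-↭ [] = refl
isort-↭ (i ∷ is) = ptrans (insert-↭ i (isort is)) (prep i (isort-↭ is))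

map-lookup-idx : {A : Set} {m : ℕ} (vs : Vec A m) → map (lookup vs) (idx m) ≡ toList vs
map-lookup-idx [] = refl
map-lookup-idx {m = suc m} (v ∷ vs) = cong (v ∷_) (trans (sym (map-∘ (idx m))) (map-lookup-idx vs))

-- Sorting decides whether the indices form a permutation; for explicit `is` the premise is `refl`.
shuffle : {A : Set} {m : ℕ} (vs : Vec A m) (is : List (Fin m)) → isort is ≡ idx m → map (lookup vs) is ↭ toList vs
shuffle {m = m} vs is sorted = begin
  map (lookup vs) is         ↭⟨ map⁺ (lookup vs) (isort-↭ is) ⟨
  map (lookup vs) (isort is) ≡⟨ cong (map (lookup vs)) sorted ⟩
  map (lookup vs) (idx m)    ≡⟨ map-lookup-idx vs ⟩
  toList vs                  ∎
  where open PermutationReasoning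

-- Graphs given by boolean adjacency, on vertex lists

ind : Bool → ℕ
ind true = 1
ind false = 0

ind≤1 : ∀ b → ind b ≤ 1
ind≤1 true = ≤-refl
ind≤1 false = z≤n

ind-true : ∀ {b} → 1 ≤ ind b → b ≡ true
ind-true {true} _ = refl

Graph : Set → Set
Graph V = V → V → Bool

record Simple {V : Set} (g : Graph V) : Set where
  field
    symm : ∀ u v → g u v ≡ g v u
    irrefl : ∀ v → g v v ≡ false
open Simple public

Triple : Set → Set
Triple V = V × V × V

module _ {V : Set} where

  deg : Graph V → V → List V → ℕ
  deg g v X = ∑ (λ w → ind (g v w)) X

  cut : Graph V → List V → List V → ℕ
  cut g X Y = ∑ (λ v → deg g v Y) X

  e : Graph V → List V → ℕ
  e g [] = 0
  e g (v ∷ X) = deg g v X + e g X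

  corners : Triple V → List V
  corners (x , y , z) = x ∷ y ∷ z ∷ []

  flat : List (Triple V) → List V
  flat [] = []
  flat (t ∷ P) = corners t ++ flat P

  IsTri : Graph V → Triple V → Set
  IsTri g (x , y , z) = g x y ≡ true × g x z ≡ true × g y z ≡ true

  flip-edge : {g : Graph V} → Simple g → ∀ {u v} → g u v ≡ true → g v u ≡ true
  flip-edge s {u} {v} p = trans (symm s v u) p

  edge-≢ : {g : Graph V} → Simple g → ∀ {u v} → g u v ≡ true → u ≢ v
  edge-≢ s {u} p refl with trans (sym p) (irrefl s u)
  ... | ()

  deg≤length : ∀ g v X → deg g v X ≤ length X
  deg≤length g v [] = z≤n
  deg≤length g v (w ∷ X) = +-mono-≤ (ind≤1 (g v w)) (deg≤length g v X)

  e-↭ : {g : Graph V} → Simple g → ∀ {X Y} → X ↭ Y → e g X ≡ e g Y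
  e-↭ s refl = refl
  e-↭ s (prep x p) = cong₂ _+_ (∑-↭ _ p) (e-↭ s p)
  e-↭ {g} s {x ∷ y ∷ xs} {y ∷ x ∷ ys} (pswap x y p)
    rewrite symm s x y | ∑-↭ (λ w → ind (g x w)) p | ∑-↭ (λ w → ind (g y w)) p | e-↭ s p =
      rearrange (ind (g y x)) (deg g x ys) (deg g y ys) (e g ys)
    where
    rearrange : ∀ i a b c → i + a + (b + c) ≡ i + b + (a + c)
    rearrange = solve-∀
  e-↭ s (ptrans p q) = trans (e-↭ s p) (e-↭ s q)

  cut-++ʳ : ∀ g X Y Z → cut g X (Y ++ Z) ≡ cut g X Y + cut g X Z
  cut-++ʳ g X Y Z = trans (∑-cong X (λ v → ∑-++ _ Y Z)) (∑-distrib (λ v → deg g v Y) (λ v → deg g v Z) X)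

  e-++ : ∀ g X Y → e g (X ++ Y) ≡ e g X + e g Y + cut g X Y
  e-++ g [] Y = sym (+-identityʳ _)
  e-++ g (v ∷ X) Y rewrite ∑-++ (λ w → ind (g v w)) X Y | e-++ g X Y =
    rearrange (deg g v X) (deg g v Y) (e g X) (e g Y) (cut g X Y)
    where
    rearrange : ∀ a b c d f → a + b + (c + d + f) ≡ a + c + d + (b + f)
    rearrange = solve-∀

  cut-flip : {g : Graph V} → Simple g → ∀ X Y → cut g X Y ≡ cut g Y X
  cut-flip s [] [] = refl
  cut-flip s [] (y ∷ Y) = cut-flip s [] Y
  cut-flip s (x ∷ X) [] = cut-flip s X []
  cut-flip {g} s (x ∷ X) (y ∷ Y)
    rewrite cut-flip s X (y ∷ Y) | sym (cut-flip s (x ∷ X) Y) | cut-flip s X Y | symm s x y =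
      rearrange (ind (g y x)) (deg g x Y) (deg g y X) (cut g Y X)
    where
    rearrange : ∀ i a b c → i + a + (b + c) ≡ i + b + (a + c)
    rearrange = solve-∀

  length-flat : ∀ (P : List (Triple V)) → length (flat P) ≡ 3 * length P
  length-flat [] = refl
  length-flat (_ ∷ P) = trans (cong (3 +_) (length-flat P)) (sym (*-suc 3 (length P)))

  flat-++ : ∀ (P Q : List (Triple V)) → flat (P ++ Q) ≡ flat P ++ flat Q
  flat-++ [] Q = refl
  flat-++ (t ∷ P) Q = cong (corners t ++_) (flat-++ P Q)

  flat-↭ : {P Q : List (Triple V)} → P ↭ Q → flat P ↭ flat Q
  flat-↭ refl = refl
  flat-↭ (prep t p) = ++⁺ˡ (corners t) (flat-↭ p)
  flat-↭ (pswap s t p) = ptrans (shifts (corners s) (corners t)) (++⁺ˡ (corners t) (++⁺ˡ (corners s) (flat-↭ p)))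
  flat-↭ (ptrans p q) = ptrans (flat-↭ p) (flat-↭ q)

  deg-flat : ∀ g v P → deg g v (flat P) ≡ ∑ (λ t → deg g v (corners t)) P
  deg-flat g v [] = refl
  deg-flat g v (t ∷ P) = trans (∑-++ _ (corners t) (flat P)) (cong (deg g v (corners t) +_) (deg-flat g v P))

  neighbour? : ∀ g v X → (∃[ w ] ∃[ Y ] X ↭ w ∷ Y × g v w ≡ true) ⊎ deg g v X ≡ 0
  neighbour? g v [] = inj₂ refl
  neighbour? g v (w ∷ X) with g v w in eq
  ... | true = inj₁ (w , X , refl , eq)
  ... | false with neighbour? g v X
  ...   | inj₁ (u , Y , σ , p) = inj₁ (u , w ∷ Y , ptrans (prep w σ) (pswap w u refl) , p)
  ...   | inj₂ z = inj₂ z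

  edge? : ∀ g X → (∃[ a ] ∃[ b ] ∃[ Y ] X ↭ a ∷ b ∷ Y × g a b ≡ true) ⊎ e g X ≡ 0
  edge? g [] = inj₂ refl
  edge? g (v ∷ X) with neighbour? g v X
  ... | inj₁ (w , Y , σ , p) = inj₁ (v , w , Y , prep v σ , p)
  ... | inj₂ z with edge? g X
  ...   | inj₁ (a , b , Y , σ , p) = inj₁ (a , b , v ∷ Y ,
            ptrans (prep v σ) (ptrans (pswap v a refl) (prep a (pswap v b refl))) , p)
  ...   | inj₂ z′ = inj₂ (cong₂ _+_ z z′)

  -- A vertex of `X` that is not a common neighbour adds at most one to the two degrees together.
  common? : ∀ g a b X →
    (∃[ x ] ∃[ Y ] X ↭ x ∷ Y × g a x ≡ true × g b x ≡ true) ⊎ deg g a X + deg g b X ≤ length X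
  common? g a b [] = inj₂ z≤n
  common? g a b (x ∷ X) with common? g a b X
  ... | inj₁ (y , Y , σ , p) = inj₁ (y , x ∷ Y , ptrans (prep x σ) (pswap x y refl) , p)
  ... | inj₂ le with g a x in eqa | g b x in eqb
  ...   | true | true = inj₁ (x , X , refl , eqa , eqb)
  ...   | true | false = inj₂ (s≤s le)
  ...   | false | true = inj₂ (subst (_≤ suc (length X)) (sym (+-suc _ _)) (s≤s le))
  ...   | false | false = inj₂ (m≤n⇒m≤1+n le)

  TriangleIn : Graph V → List V → Set
  TriangleIn g X = ∃[ x ] ∃[ y ] ∃[ z ] ∃[ Y ] X ↭ x ∷ y ∷ z ∷ Y × IsTri g (x , y , z)

  -- The step behind Mantel's theorem: without a common neighbour the vertices other than `a` and
  -- `b` contribute at most one each, and the edge itself contributes two.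
  triangle-on-edge? : {g : Graph V} → Simple g → ∀ {a b X Y} → X ↭ a ∷ b ∷ Y → g a b ≡ true →
    TriangleIn g X ⊎ deg g a X + deg g b X ≤ length X
  triangle-on-edge? {g} s {a} {b} {X} {Y} σ ab with common? g a b Y
  ... | inj₁ (x , Z , τ , ax , bx) = inj₁ (a , b , x , Z , ptrans σ (prep a (prep b τ)) , ab , ax , bx)
  ... | inj₂ le = inj₂ (begin
    deg g a X + deg g b X
      ≡⟨ cong₂ _+_ (∑-↭ _ σ) (∑-↭ _ σ) ⟩
    deg g a (a ∷ b ∷ Y) + deg g b (a ∷ b ∷ Y)
      ≡⟨ cong₂ (λ i j → ind i + (ind (g a b) + deg g a Y) + (ind (g b a) + (ind j + deg g b Y))) (irrefl s a) (irrefl s b) ⟩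
    ind (g a b) + deg g a Y + (ind (g b a) + deg g b Y)
      ≤⟨ drop _ _ _ _ _ (ind≤1 (g a b)) (ind≤1 (g b a)) le ⟩
    2 + length Y
      ≡⟨ ↭-length σ ⟨
    length X ∎)
    where
    open ≤-Reasoning
    drop : ∀ i p j q l → i ≤ 1 → j ≤ 1 → p + q ≤ l → i + p + (j + q) ≤ 2 + l
    drop i p j q l h0 h1 h2 = deduce (i ∷ p ∷ j ∷ q ∷ l ∷ []) 1 (x0 ⊕ x1 ⊕ (x2 ⊕ x3) ⊑ K 2 ⊕ x4)
        (1 , x0 ⊑ K 1 · 1 , x2 ⊑ K 1 · 1 , x1 ⊕ x3 ⊑ x4 · done) (h0 , h1 , h2 , tt)

-- Exhaustive search over small graphs

  isEdge : Graph V → ∀ {m} → Vec V m → Fin m → Fin m → Bool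
  isEdge g vs i j = g (lookup vs i) (lookup vs j)

Entry : ℕ → Set
Entry m = (Fin m × Fin m) × Bool

_==_ : ∀ {m} → Fin m → Fin m → Bool
i == j = toℕ i ≡ᵇ toℕ j

==⇒≡ : ∀ {m} (i j : Fin m) → (i == j) ≡ true → i ≡ j
==⇒≡ i j p = toℕ-injective (≡ᵇ⇒≡ (toℕ i) (toℕ j) (subst T (sym p) tt))

∧-true : ∀ {a b} → a ∧ b ≡ true → a ≡ true × b ≡ true
∧-true {true} p = refl , p

∨-true : ∀ {a b} → a ∨ b ≡ true → a ≡ true ⊎ b ≡ true
∨-true {true} p = inj₁ refl
∨-true {false} p = inj₂ p

has : ∀ {m} → List (Entry m) → Fin m → Fin m → Bool
has [] i j = false
has (((a , b) , v) ∷ es) i j = (v ∧ ((a == i ∧ b == j) ∨ (a == j ∧ b == i))) ∨ has es i j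

-- One inclusion suffices, because a shape that has been found survives the addition of edges.
has-sound : ∀ {m} {G : Graph (Fin m)} → (∀ i j → G i j ≡ G j i) → {es : List (Entry m)} →
  All (λ { ((a , b) , v) → v ≡ true → G a b ≡ true }) es → ∀ i j → has es i j ≡ true → G i j ≡ true
has-sound sy (p ∷ ps) i j h with ∨-true h
... | inj₂ h′ = has-sound sy ps i j h′
has-sound {G = G} sy {((a , b) , true) ∷ es} (p ∷ ps) i j h | inj₁ q with ∨-true q
... | inj₁ r = subst₂ (λ i j → G i j ≡ true) (==⇒≡ a i (proj₁ (∧-true r))) (==⇒≡ b j (proj₂ (∧-true {a == i} r))) (p refl)
... | inj₂ r = trans (sy i j) (subst₂ (λ i j → G i j ≡ true) (==⇒≡ a j (proj₁ (∧-true r))) (==⇒≡ b i (proj₂ (∧-true {a == j} r)))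
    (p refl))

has-sound sy {((a , b) , false) ∷ es} (p ∷ ps) i j h | inj₁ ()

eqList : ∀ {m} → List (Fin m) → List (Fin m) → Bool
eqList [] [] = true
eqList (i ∷ is) (j ∷ js) = i == j ∧ eqList is js
eqList _ _ = false

eqList⇒≡ : ∀ {m} (is js : List (Fin m)) → eqList is js ≡ true → is ≡ js
eqList⇒≡ [] [] p = refl
eqList⇒≡ (i ∷ is) (j ∷ js) p = cong₂ _∷_ (==⇒≡ i j (proj₁ (∧-true p))) (eqList⇒≡ is js (proj₂ (∧-true {i == j} p)))

Arrangement : ℕ → Set
Arrangement m = Vec (Fin m) m

fitsEdges : ∀ {m} → List (Fin m × Fin m) → (Fin m → Fin m → Bool) → Arrangement m → Bool
fitsEdges [] G π = true
fitsEdges ((p , q) ∷ shape) G π = G (lookup π p) (lookup π q) ∧ fitsEdges shape G π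

fits : ∀ {m} → List (Fin m × Fin m) → (Fin m → Fin m → Bool) → Arrangement m → Bool
fits {m} shape G π = fitsEdges shape G π ∧ eqList (isort (toList π)) (idx m)

anyFits : ∀ {m} → List (Fin m × Fin m) → (Fin m → Fin m → Bool) → List (Arrangement m) → Bool
anyFits shape G [] = false
anyFits shape G (π ∷ πs) = fits shape G π ∨ anyFits shape G πs

Fits : ∀ {m} → List (Fin m × Fin m) → Graph (Fin m) → Set
Fits {m} shape G = ∃[ π ] All (λ { (p , q) → G (lookup π p) (lookup π q) ≡ true }) shape × isort (toList π) ≡ idx m

fitsEdges-sound : ∀ {m} (shape : List (Fin m × Fin m)) {G G′ : Graph (Fin m)} (π : Arrangement m) →
  (∀ i j → G i j ≡ true → G′ i j ≡ true) → fitsEdges shape G π ≡ true →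
  All (λ { (p , q) → G′ (lookup π p) (lookup π q) ≡ true }) shape
fitsEdges-sound [] π le f = []
fitsEdges-sound ((p , q) ∷ shape) {G} π le f =
  le _ _ (proj₁ (∧-true f)) ∷ fitsEdges-sound shape π le (proj₂ (∧-true {G (lookup π p) (lookup π q)} f))

anyFits-sound : ∀ {m} (shape : List (Fin m × Fin m)) {G G′ : Graph (Fin m)} (πs : List (Arrangement m)) →
  (∀ i j → G i j ≡ true → G′ i j ≡ true) → anyFits shape G πs ≡ true → Fits shape G′
anyFits-sound shape {G} (π ∷ πs) le f with ∨-true {fits shape G π} f
... | inj₁ h = π , fitsEdges-sound shape π le (proj₁ (∧-true h)) ,
               eqList⇒≡ _ _ (proj₂ (∧-true {fitsEdges shape G π} h))
... | inj₂ h = anyFits-sound shape πs le h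

allBools : ∀ n → (Vec Bool n → Bool) → Bool
allBools zero f = f []
allBools (suc n) f = allBools n (λ b → f (true ∷ b)) ∧ allBools n (λ b → f (false ∷ b))

allBools-sound : ∀ n f → allBools n f ≡ true → ∀ b → f b ≡ true
allBools-sound zero f p [] = p
allBools-sound (suc n) f p (true ∷ b) = allBools-sound n _ (proj₁ (∧-true p)) b
allBools-sound (suc n) f p (false ∷ b) = allBools-sound n _ (proj₂ (∧-true {allBools n (λ b → f (true ∷ b))} p)) b

count : ∀ {n} → Vec Bool n → ℕ
count [] = 0
count (b ∷ bs) = ind b + count bs

entries : ∀ {m n} → List (Fin m × Fin m) → Vec (Fin m × Fin m) n → Vec Bool n → List (Entry m)
entries known [] [] = map (_, true) known
entries known (p ∷ ps) (b ∷ bs) = (p , b) ∷ entries known ps bs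

actual : ∀ {m n} → Graph (Fin m) → Vec (Fin m × Fin m) n → Vec Bool n
actual G [] = []
actual G ((i , j) ∷ ps) = G i j ∷ actual G ps

entries-sound : ∀ {m n} {G : Graph (Fin m)} (known : List (Fin m × Fin m)) (ps : Vec (Fin m × Fin m) n) →
  All (λ { (i , j) → G i j ≡ true }) known →
  All (λ { ((a , b) , v) → v ≡ true → G a b ≡ true }) (entries known ps (actual G ps))
entries-sound [] [] [] = []
entries-sound (_ ∷ known) [] (k ∷ ks) = (λ _ → k) ∷ entries-sound known [] ks
entries-sound known (p ∷ ps) ks = (λ q → q) ∷ entries-sound known ps ks

-- The premise on `allBools` runs through all truth values of the unknown pairs and is passed as
-- `refl`; assignments with fewer than `c` edges are exempt. The list `πs` contains just the
-- arrangements that a proof by hand would produce.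
exhaust : ∀ {m n} (shape known : List (Fin m × Fin m)) (unknown : Vec (Fin m × Fin m) n) (c : ℕ) (πs : List (Arrangement m)) →
  allBools n (λ b → (count b <ᵇ c) ∨ anyFits shape (has (entries known unknown b)) πs) ≡ true →
  (G : Graph (Fin m)) → (∀ i j → G i j ≡ G j i) → All (λ { (i , j) → G i j ≡ true }) known →
  c ≤ count (actual G unknown) → Fits shape G
exhaust shape known unknown c πs ok G sy ks le
  with ∨-true {count (actual G unknown) <ᵇ c} (allBools-sound _ _ ok (actual G unknown))
... | inj₁ lt = ⊥-elim (<⇒≱ (<ᵇ⇒< _ _ (subst T (sym lt) tt)) le)
... | inj₂ h = anyFits-sound shape πs (has-sound sy (entries-sound known unknown ks)) h

-- Trading a triangle against outside vertices

module _ {V : Set} {g : Graph V} (s : Simple g) where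

  -- Of five edges, one of `w`, `w′` takes three and the other at least two. The former replaces, in
  -- the triangle, a corner adjacent to the latter.
  exchange-lemma : ∀ {x y z w w′} → IsTri g (x , y , z) →
    4 < deg g w (x ∷ y ∷ z ∷ []) + deg g w′ (x ∷ y ∷ z ∷ []) →
    ∃[ t ] ∃[ p ] ∃[ q ] IsTri g t × g p q ≡ true × corners t ++ p ∷ q ∷ [] ↭ x ∷ y ∷ z ∷ w ∷ w′ ∷ []
  exchange-lemma {x} {y} {z} {w} {w′} (xy , xz , yz) lt
    with exhaust shape ((0F , 1F) ∷ (0F , 2F) ∷ (1F , 2F) ∷ [])
           ((3F , 0F) ∷ (3F , 1F) ∷ (3F , 2F) ∷ (4F , 0F) ∷ (4F , 1F) ∷ (4F , 2F) ∷ []) 5 πs refl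
           (isEdge g vs) (λ i j → symm s (lookup vs i) (lookup vs j)) (xy ∷ xz ∷ yz ∷ [])
           (flatten (ind (g w x)) (ind (g w y)) (ind (g w z)) (ind (g w′ x)) (ind (g w′ y)) (ind (g w′ z)) lt)
    where
    vs = x ∷ y ∷ z ∷ w ∷ w′ ∷ []
    shape : List (Fin 5 × Fin 5)
    shape = (0F , 1F) ∷ (0F , 2F) ∷ (1F , 2F) ∷ (3F , 4F) ∷ []
    πs : List (Arrangement 5)
    πs = (3F ∷ 1F ∷ 2F ∷ 4F ∷ 0F ∷ []) ∷ (3F ∷ 0F ∷ 2F ∷ 4F ∷ 1F ∷ []) ∷ (3F ∷ 0F ∷ 1F ∷ 4F ∷ 2F ∷ []) ∷
         (4F ∷ 1F ∷ 2F ∷ 3F ∷ 0F ∷ []) ∷ (4F ∷ 0F ∷ 2F ∷ 3F ∷ 1F ∷ []) ∷ (4F ∷ 0F ∷ 1F ∷ 3F ∷ 2F ∷ []) ∷ []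
    flatten : ∀ a b c d f h → 4 < a + (b + (c + 0)) + (d + (f + (h + 0))) → 5 ≤ a + (b + (c + (d + (f + (h + 0)))))
    flatten a b c d f h h0 = deduce (a ∷ b ∷ c ∷ d ∷ f ∷ h ∷ []) 1 (K 5 ⊑ x0 ⊕ (x1 ⊕ (x2 ⊕ (x3 ⊕ (x4 ⊕ (x5 ⊕ K 0))))))
        (1 , K 1 ⊕ K 4 ⊑ x0 ⊕ (x1 ⊕ (x2 ⊕ K 0)) ⊕ (x3 ⊕ (x4 ⊕ (x5 ⊕ K 0))) · done) (h0 , tt)
  ... | (i ∷ j ∷ k ∷ l ∷ m ∷ []) , (ij ∷ ik ∷ jk ∷ lm ∷ []) , sorted =
    (at i , at j , at k) , at l , at m , (ij , ik , jk) , lm , shuffle (x ∷ y ∷ z ∷ w ∷ w′ ∷ []) (i ∷ j ∷ k ∷ l ∷ m ∷ []) sorted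
    where at = lookup (x ∷ y ∷ z ∷ w ∷ w′ ∷ [])

  -- One of the edges, say `ab`, sends at least five edges to the triangle, so its ends share two
  -- corners. If `a′b′` sends four or more, its ends share a corner too, and different corners
  -- complete the two edges. Otherwise `ab` sends six and `a′b′` three: an end of `a′b′` forms a
  -- triangle with two corners, and `ab` takes the third.
  two-triangles : ∀ {x y z a b a′ b′} → IsTri g (x , y , z) → g a b ≡ true → g a′ b′ ≡ true →
    8 < deg g a (x ∷ y ∷ z ∷ []) + deg g b (x ∷ y ∷ z ∷ []) + (deg g a′ (x ∷ y ∷ z ∷ []) + deg g b′ (x ∷ y ∷ z ∷ [])) →
    ∃[ t ] ∃[ t′ ] ∃[ l ] IsTri g t × IsTri g t′ × flat (t ∷ t′ ∷ []) ++ l ∷ [] ↭ x ∷ y ∷ z ∷ a ∷ b ∷ a′ ∷ b′ ∷ []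
  two-triangles {x} {y} {z} {a} {b} {a′} {b′} (xy , xz , yz) ab a′b′ lt
    with exhaust shape ((0F , 1F) ∷ (0F , 2F) ∷ (1F , 2F) ∷ (3F , 4F) ∷ (5F , 6F) ∷ [])
           ((3F , 0F) ∷ (3F , 1F) ∷ (3F , 2F) ∷ (4F , 0F) ∷ (4F , 1F) ∷ (4F , 2F) ∷
            (5F , 0F) ∷ (5F , 1F) ∷ (5F , 2F) ∷ (6F , 0F) ∷ (6F , 1F) ∷ (6F , 2F) ∷ []) 9 πs refl
           (isEdge g vs) (λ i j → symm s (lookup vs i) (lookup vs j)) (xy ∷ xz ∷ yz ∷ ab ∷ a′b′ ∷ [])
           (flatten (ind (g a x)) (ind (g a y)) (ind (g a z)) (ind (g b x)) (ind (g b y)) (ind (g b z))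
                    (ind (g a′ x)) (ind (g a′ y)) (ind (g a′ z)) (ind (g b′ x)) (ind (g b′ y)) (ind (g b′ z)) lt)
    where
    vs = x ∷ y ∷ z ∷ a ∷ b ∷ a′ ∷ b′ ∷ []
    shape : List (Fin 7 × Fin 7)
    shape = (0F , 1F) ∷ (0F , 2F) ∷ (1F , 2F) ∷ (3F , 4F) ∷ (3F , 5F) ∷ (4F , 5F) ∷ []
    πs : List (Arrangement 7)
    πs = (3F ∷ 4F ∷ 0F ∷ 5F ∷ 6F ∷ 1F ∷ 2F ∷ []) ∷ (3F ∷ 4F ∷ 0F ∷ 5F ∷ 6F ∷ 2F ∷ 1F ∷ []) ∷
         (3F ∷ 4F ∷ 1F ∷ 5F ∷ 6F ∷ 0F ∷ 2F ∷ []) ∷ (3F ∷ 4F ∷ 1F ∷ 5F ∷ 6F ∷ 2F ∷ 0F ∷ []) ∷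
         (3F ∷ 4F ∷ 2F ∷ 5F ∷ 6F ∷ 0F ∷ 1F ∷ []) ∷ (3F ∷ 4F ∷ 2F ∷ 5F ∷ 6F ∷ 1F ∷ 0F ∷ []) ∷
         (3F ∷ 4F ∷ 0F ∷ 1F ∷ 2F ∷ 5F ∷ 6F ∷ []) ∷ (3F ∷ 4F ∷ 1F ∷ 0F ∷ 2F ∷ 5F ∷ 6F ∷ []) ∷
         (3F ∷ 4F ∷ 2F ∷ 0F ∷ 1F ∷ 5F ∷ 6F ∷ []) ∷ (3F ∷ 4F ∷ 0F ∷ 1F ∷ 2F ∷ 6F ∷ 5F ∷ []) ∷
         (3F ∷ 4F ∷ 1F ∷ 0F ∷ 2F ∷ 6F ∷ 5F ∷ []) ∷ (3F ∷ 4F ∷ 2F ∷ 0F ∷ 1F ∷ 6F ∷ 5F ∷ []) ∷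
         (5F ∷ 6F ∷ 0F ∷ 1F ∷ 2F ∷ 3F ∷ 4F ∷ []) ∷ (5F ∷ 6F ∷ 1F ∷ 0F ∷ 2F ∷ 3F ∷ 4F ∷ []) ∷
         (5F ∷ 6F ∷ 2F ∷ 0F ∷ 1F ∷ 3F ∷ 4F ∷ []) ∷ (5F ∷ 6F ∷ 0F ∷ 1F ∷ 2F ∷ 4F ∷ 3F ∷ []) ∷
         (5F ∷ 6F ∷ 1F ∷ 0F ∷ 2F ∷ 4F ∷ 3F ∷ []) ∷ (5F ∷ 6F ∷ 2F ∷ 0F ∷ 1F ∷ 4F ∷ 3F ∷ []) ∷ []
    flatten : ∀ a b c d f h a' b' c' d' f' h' → 8 < a + (b + (c + 0)) + (d + (f + (h + 0))) +
        (a' + (b' + (c' + 0)) + (d' + (f' + (h' + 0)))) → 9 ≤ a +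
        (b + (c + (d + (f + (h + (a' + (b' + (c' + (d' + (f' + (h' + 0)))))))))))
    flatten a b c d f h a' b' c' d' f' h' h0 = deduce (a ∷ b ∷ c ∷ d ∷ f ∷ h ∷ a' ∷ b' ∷ c' ∷ d' ∷ f' ∷ h' ∷ []) 1
        (K 9 ⊑ x0 ⊕ (x1 ⊕ (x2 ⊕ (x3 ⊕ (x4 ⊕ (x5 ⊕ (x6 ⊕ (x7 ⊕ (x8 ⊕ (x9 ⊕ (x10 ⊕ (x11 ⊕ K 0))))))))))))
        (1 , K 1 ⊕ K 8 ⊑ x0 ⊕ (x1 ⊕ (x2 ⊕ K 0)) ⊕ (x3 ⊕ (x4 ⊕ (x5 ⊕ K 0))) ⊕
        (x6 ⊕ (x7 ⊕ (x8 ⊕ K 0)) ⊕ (x9 ⊕ (x10 ⊕ (x11 ⊕ K 0)))) · done) (h0 , tt)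
  ... | (i ∷ j ∷ k ∷ l ∷ m ∷ n ∷ o ∷ []) , (ij ∷ ik ∷ jk ∷ lm ∷ ln ∷ mn ∷ []) , sorted =
    (at i , at j , at k) , (at l , at m , at n) , at o , (ij , ik , jk) , (lm , ln , mn) ,
    shuffle (x ∷ y ∷ z ∷ a ∷ b ∷ a′ ∷ b′ ∷ []) (i ∷ j ∷ k ∷ l ∷ m ∷ n ∷ o ∷ []) sorted
    where at = lookup (x ∷ y ∷ z ∷ a ∷ b ∷ a′ ∷ b′ ∷ [])

-- Triangle packings

module _ {V : Set} where

  record Packing (g : Graph V) (P : List (Triple V)) (R L : List V) : Set where
    constructor _,_
    field
      triangles : All (IsTri g) P
      partition : flat P ++ R ↭ L
  open Packing public

  Packs : Graph V → ℕ → List V → Set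
  Packs g t L = ∃[ P ] ∃[ R ] length P ≡ t × Packing g P R L

  reorder : ∀ {g P Q R L} → P ↭ Q → Packing g P R L → Packing g Q R L
  reorder {R = R} σ (ts , π) = All-resp-↭ σ ts , ptrans (++⁺ʳ R (flat-↭ (↭-sym σ))) π

  reorder-rest : ∀ {g P R R′ L} → R ↭ R′ → Packing g P R L → Packing g P R′ L
  reorder-rest {P = P} σ (ts , π) = ts , ptrans (++⁺ˡ (flat P) (↭-sym σ)) π

  -- Makes exchanges local: only the triangles and outside vertices involved have to be permuted.
  repartition : ∀ Ts Qs (X Y : List V) {P R L} → flat Qs ++ Y ↭ flat Ts ++ X →
    flat (Ts ++ P) ++ (X ++ R) ↭ L → flat (Qs ++ P) ++ (Y ++ R) ↭ L
  repartition Ts Qs X Y {P} {R} {L} σ π = begin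
    flat (Qs ++ P) ++ (Y ++ R)        ≡⟨ cong (_++ (Y ++ R)) (flat-++ Qs P) ⟩
    (flat Qs ++ flat P) ++ (Y ++ R)   ↭⟨ ++-interchange (flat Qs) (flat P) Y R ⟩
    (flat Qs ++ Y) ++ (flat P ++ R)   ↭⟨ ++⁺ʳ _ σ ⟩
    (flat Ts ++ X) ++ (flat P ++ R)   ↭⟨ ++-interchange (flat Ts) X (flat P) R ⟩
    (flat Ts ++ flat P) ++ (X ++ R)   ≡⟨ cong (_++ (X ++ R)) (flat-++ Ts P) ⟨
    flat (Ts ++ P) ++ (X ++ R)        ↭⟨ π ⟩
    L                                 ∎
    where open PermutationReasoning

  replace : ∀ {g} Ts Qs X Y {P R L} → All (IsTri g) Qs → flat Qs ++ Y ↭ flat Ts ++ X →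
    Packing g (Ts ++ P) (X ++ R) L → Packing g (Qs ++ P) (Y ++ R) L
  replace Ts Qs X Y {P} {R} qs σ (ts , π) = All.++⁺ qs (All.++⁻ʳ Ts ts) , repartition Ts Qs X Y {P} {R} σ π

  add-triangle : ∀ {g P R R′ L x y z} → IsTri g (x , y , z) → R ↭ x ∷ y ∷ z ∷ R′ →
    Packing g P R L → Packing g ((x , y , z) ∷ P) R′ L
  add-triangle {x = x} {y} {z} t σ pk =
    replace [] ((x , y , z) ∷ []) (x ∷ y ∷ z ∷ []) [] (t ∷ []) refl (reorder-rest σ pk)

  grow-by-triangle : ∀ {g P R L} → TriangleIn g R → Packing g P R L → Packs g (suc (length P)) L
  grow-by-triangle (x , y , z , Y , σ , t) pk = _ , _ , refl , add-triangle t σ pk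

  packing-length : ∀ {g P R L} → Packing g P R L → 3 * length P + length R ≡ length L
  packing-length {P = P} {R} (_ , π) =
    trans (cong (_+ length R) (sym (length-flat P))) (trans (sym (length-++ (flat P))) (↭-length π))

  packing-deg : ∀ {g P R L} → Packing g P R L → ∀ v → deg g v L ≡ ∑ (λ t → deg g v (corners t)) P + deg g v R
  packing-deg {g} {P} {R} (_ , π) v =
    trans (sym (∑-↭ _ π)) (trans (∑-++ _ (flat P) R) (cong (_+ deg g v R) (deg-flat g v P)))

  load : Graph V → V → List (Triple V) → ℕ
  load g v P = ∑ (λ t → deg g v (corners t)) P

  rest-in : ∀ {g P R L} → Packing g P R L → ∀ {A : V → Set} → All A L → All A R
  rest-in {P = P} (_ , π) al = All.++⁻ʳ (flat P) (All-resp-↭ (↭-sym π) al)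

  rest-front : ∀ {g P X R L} → Packing g P (X ++ R) L → L ↭ X ++ (flat P ++ R)
  rest-front {P = P} {X} {R} (_ , π) = ptrans (↭-sym π) (shifts (flat P) X)

  module _ {g : Graph V} (s : Simple g) where

    -- A triangle that receives five edges gives way to another one on the same five vertices. The
    -- number of triangles stays, and an edge appears outside.
    exchange-step : ∀ {P w w′ X L} → Packing g P (w ∷ w′ ∷ X) L →
      (∃[ Q ] ∃[ p ] ∃[ q ] length Q ≡ length P × Packing g Q (p ∷ q ∷ X) L × g p q ≡ true)
      ⊎ All (λ t → deg g w (corners t) + deg g w′ (corners t) ≤ 4) P
    exchange-step {P} {w} {w′} {X} pk
      with search (λ t → <-≤-connex 4 (deg g w (corners t) + deg g w′ (corners t))) P
    ... | inj₂ small = inj₂ small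
    ... | inj₁ ((x , y , z) , P′ , σ , lt) with reorder σ pk
    ...   | pk′@((t ∷ _) , _) with exchange-lemma s t lt
    ...     | t′ , p , q , tri , pq , τ = inj₁ (t′ ∷ P′ , p , q , sym (↭-length σ) ,
              replace ((x , y , z) ∷ []) (t′ ∷ []) (w ∷ w′ ∷ []) (p ∷ q ∷ []) (tri ∷ []) τ pk′ , pq)

    -- A triangle that receives nine edges can be traded for two, which is why eight is the limit in
    -- a packing that cannot grow.
    augment-step : ∀ {P a b a′ b′ X L} → Packing g P (a ∷ b ∷ a′ ∷ b′ ∷ X) L → g a b ≡ true → g a′ b′ ≡ true →
      Packs g (suc (length P)) L
      ⊎ All (λ t → deg g a (corners t) + deg g b (corners t) + (deg g a′ (corners t) + deg g b′ (corners t)) ≤ 8) P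
    augment-step {P} {a} {b} {a′} {b′} {X} pk ab a′b′
      with search (λ t → <-≤-connex 8 (deg g a (corners t) + deg g b (corners t) +
          (deg g a′ (corners t) + deg g b′ (corners t)))) P
    ... | inj₂ small = inj₂ small
    ... | inj₁ ((x , y , z) , P′ , σ , lt) with reorder σ pk
    ...   | pk′@((t ∷ _) , _) with two-triangles s t ab a′b′ lt
    ...     | t₁ , t₂ , l , tri₁ , tri₂ , τ = inj₁ (t₁ ∷ t₂ ∷ P′ , l ∷ X , cong suc (sym (↭-length σ)) ,
              replace ((x , y , z) ∷ []) (t₁ ∷ t₂ ∷ []) (a ∷ b ∷ a′ ∷ b′ ∷ []) (l ∷ []) (tri₁ ∷ tri₂ ∷ []) τ pk′)

    record Matched (t : ℕ) (L : List V) : Set where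
      constructor matched
      field
        {P} : List (Triple V)
        {a b a′ b′} : V
        {X} : List V
        size : length P ≡ t
        packing : Packing g P (a ∷ b ∷ a′ ∷ b′ ∷ X) L
        ab : g a b ≡ true
        a′b′ : g a′ b′ ≡ true

    -- `small` and `few` limit the degrees of `w` and `w′` to 4t + 2 together, so a star disappears
    -- as soon as all degrees reach 2t + 2.
    record Starred (t : ℕ) (L : List V) : Set where
      constructor starred
      field
        {P} : List (Triple V)
        {u v w w′} : V
        {X} : List V
        size : length P ≡ t
        packing : Packing g P (u ∷ v ∷ w ∷ w′ ∷ X) L
        uv : g u v ≡ true
        uw : g u w ≡ true
        uw′ : g u w′ ≡ true
        few : deg g w (u ∷ v ∷ w ∷ w′ ∷ X) + deg g w′ (u ∷ v ∷ w ∷ w′ ∷ X) ≤ 2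
        small : All (λ t → deg g w (corners t) + deg g w′ (corners t) ≤ 4) P

    small-sum : ∀ {P w w′ R L} → Packing g P R L →
      All (λ t → deg g w (corners t) + deg g w′ (corners t) ≤ 4) P →
      deg g w L + deg g w′ L ≤ 4 * length P + (deg g w R + deg g w′ R)
    small-sum {P} {w} {w′} {R} pk small = combine′ _ _ (load g w P) (load g w′ P) (deg g w R) (deg g w′ R) _ (packing-deg pk w)
        (packing-deg pk w′)
      (subst (_≤ 4 * length P) (∑-distrib (λ t → deg g w (corners t)) (λ t → deg g w′ (corners t)) P)
        (∑-bound (λ t → deg g w (corners t) + deg g w′ (corners t)) 4 small))
      where
      combine′ : ∀ x y p q i j k → x ≡ p + i → y ≡ q + j → p + q ≤ k → x + y ≤ k + (i + j)
      combine′ x y p q i j k h0 h1 h2 = deduce (x ∷ y ∷ p ∷ q ∷ i ∷ j ∷ k ∷ []) 1 (x0 ⊕ x1 ⊑ x6 ⊕ (x4 ⊕ x5))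
          (1 , x0 ⊑ x2 ⊕ x4 · 1 , x1 ⊑ x3 ⊕ x5 · 1 , x2 ⊕ x3 ⊑ x6 · done) (≤-reflexive h0 , ≤-reflexive h1 , h2 , tt)

    private
      sum₄ : ∀ {a b c d i j k l} → a ≡ i → b ≡ j → c ≡ k → d ≡ l → ind a + ind b + (ind c + ind d) ≡ ind i + ind j +
          (ind k + ind l)
      sum₄ refl refl refl refl = refl

      -- With t triangles, `w` and `w′` have degree sum at least 4t + 2, and the triangles absorb at
      -- most 4t of it. All their edges in the rest end in `u` or `v`, so there are at least two of
      -- these.
      too-few : ∀ {P u v w w′ X L m} → Packing g P (u ∷ v ∷ w ∷ w′ ∷ X) L → e g (w ∷ w′ ∷ X) ≡ 0 →
        All (λ t → deg g w (corners t) + deg g w′ (corners t) ≤ 4) P → All (λ v → 2 * length P + 1 ≤ deg g v L) L →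
        ind (g w u) + ind (g w v) + (ind (g w′ u) + ind (g w′ v)) ≡ m → m ≤ 1 → ⊥
      too-few {P} {u} {v} {w} {w′} {X} pk none small δ eq m≤1 with rest-in pk δ
      ... | _ ∷ _ ∷ δw ∷ δw′ ∷ _ = contradict (ind (g w u)) (ind (g w v)) (ind (g w′ u)) (ind (g w′ v)) _ _ _ _ _ (deg g w X)
          (deg g w′ X) (e g X) _ _ (length P) none eq m≤1 (cong ind (irrefl s w)) (cong ind (irrefl s w′))
          (cong ind (symm s w w′)) δw δw′ (small-sum pk small)
        where
        contradict : ∀ a b c d m i i' j j' p q f x y t → j + p + (q + f) ≡ 0 → a + b + (c + d) ≡ m → m ≤ 1 → i ≡ 0 → i' ≡ 0 → j ≡
            j' → 2 * t + 1 ≤ x → 2 * t + 1 ≤ y → x + y ≤ 4 * t + (a + (b + (i + (j + p))) + (c + (d + (j' + (i' + q))))) → ⊥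
        contradict a b c d m i i' j j' p q f x y t h0 h1 h2 h3 h4 h5 h6 h7 h8 = refute
            (a ∷ b ∷ c ∷ d ∷ m ∷ i ∷ i' ∷ j ∷ j' ∷ p ∷ q ∷ f ∷ x ∷ y ∷ t ∷ []) (2 , x7 ⊕ x9 ⊕ (x10 ⊕ x11) ⊑ K 0 · 1 , x0 ⊕ x1 ⊕
            (x2 ⊕ x3) ⊑ x4 · 1 , x4 ⊑ K 1 · 1 , x5 ⊑ K 0 · 1 , x6 ⊑ K 0 · 1 , x8 ⊑ x7 · 1 , 2 ⊗ x14 ⊕ K 1 ⊑ x12 · 1 , 2 ⊗ x14 ⊕ K
            1 ⊑ x13 · 1 , x12 ⊕ x13 ⊑ 4 ⊗ x14 ⊕ (x0 ⊕ (x1 ⊕ (x5 ⊕ (x7 ⊕ x9))) ⊕ (x2 ⊕ (x3 ⊕ (x8 ⊕ (x6 ⊕ x10))))) · done)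
            (≤-reflexive h0 , ≤-reflexive h1 , h2 , ≤-reflexive h3 , ≤-reflexive h4 , ≤-reflexive (sym h5) , h6 , h7 , h8 , tt)

      -- If no second edge is available, `w` and `w′` send two edges to the ends of `uv`. Two edges
      -- from the same vertex close a triangle, two edges to different ends are disjoint, and two
      -- edges to the same end make a star.
      from-edge : ∀ {P u v X L} → 2 ≤ length X → All (λ v → 2 * length P + 1 ≤ deg g v L) L →
        Packing g P (u ∷ v ∷ X) L → g u v ≡ true →
        Packs g (suc (length P)) L ⊎ Matched (length P) L ⊎ Starred (length P) L
      from-edge {P} {u} {v} {X} {L} big δ pk uv with edge? g X
      ... | inj₁ (a , b , Y , σ , ab) =
        inj₂ (inj₁ (matched refl (reorder-rest (prep u (prep v σ)) pk) uv ab))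
      from-edge {X = _ ∷ []} (s≤s ()) _ _ _ | inj₂ none
      from-edge {P} {u} {v} {w ∷ w′ ∷ X} {L} big δ pk uv | inj₂ none
        with exchange-step (reorder-rest (shuffled u v w w′) pk)
        where
        shuffled : ∀ u v w w′ → u ∷ v ∷ w ∷ w′ ∷ X ↭ w ∷ w′ ∷ u ∷ v ∷ X
        shuffled u v w w′ = shifts (u ∷ v ∷ []) (w ∷ w′ ∷ [])
      ... | inj₁ (Q , p , q , len , pk′ , pq) =
        inj₂ (inj₁ (matched len (reorder-rest (shifts (p ∷ q ∷ []) (u ∷ v ∷ [])) pk′) uv pq))
      ... | inj₂ small with g w u in wu | g w v in wv | g w′ u in w′u | g w′ v in w′v
      ...   | true | true | _ | _ = inj₁ (grow-by-triangle
              (u , v , w , w′ ∷ X , refl , uv , flip-edge s wu , flip-edge s wv) pk)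
      ...   | _ | _ | true | true = inj₁ (grow-by-triangle
              (u , v , w′ , w ∷ X , prep u (prep v (pswap w w′ refl)) , uv , flip-edge s w′u , flip-edge s w′v) pk)
      ...   | true | false | false | true = inj₂ (inj₁ (matched refl (reorder-rest
                (++⁺ʳ X (shuffle (u ∷ v ∷ w ∷ w′ ∷ []) (2F ∷ 0F ∷ 3F ∷ 1F ∷ []) refl ⁻¹)) pk) wu w′v))
        where _⁻¹ = ↭-sym
      ...   | false | true | true | false = inj₂ (inj₁ (matched refl (reorder-rest
                (++⁺ʳ X (shuffle (u ∷ v ∷ w ∷ w′ ∷ []) (2F ∷ 1F ∷ 3F ∷ 0F ∷ []) refl ⁻¹)) pk) wv w′u))
        where _⁻¹ = ↭-sym
      ...   | true | false | true | false = inj₂ (inj₂ (starred refl pk uv (flip-edge s wu) (flip-edge s w′u)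
                (few′ _ _ _ _ _ _ _ _ (deg g w X) (deg g w′ X) (e g X) none (cong ind wu) (cong ind wv) (cong ind w′u)
                    (cong ind w′v) (cong ind (irrefl s w)) (cong ind (irrefl s w′)) (cong ind (symm s w w′))) small))
        where
        few′ : ∀ a b c d i i' j j' p q f → j + p + (q + f) ≡ 0 → a ≡ 1 → b ≡ 0 → c ≡ 1 → d ≡ 0 → i ≡ 0 → i' ≡ 0 → j ≡ j' → a +
            (b + (i + (j + p))) + (c + (d + (j' + (i' + q)))) ≤ 2
        few′ a b c d i i' j j' p q f h0 h1 h2 h3 h4 h5 h6 h7 = deduce (a ∷ b ∷ c ∷ d ∷ i ∷ i' ∷ j ∷ j' ∷ p ∷ q ∷ f ∷ []) 1
            (x0 ⊕ (x1 ⊕ (x4 ⊕ (x6 ⊕ x8))) ⊕ (x2 ⊕ (x3 ⊕ (x7 ⊕ (x5 ⊕ x9)))) ⊑ K 2) (2 , x6 ⊕ x8 ⊕ (x9 ⊕ x10) ⊑ K 0 · 1 , x0 ⊑ K 1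
            · 1 , x1 ⊑ K 0 · 1 , x2 ⊑ K 1 · 1 , x3 ⊑ K 0 · 1 , x4 ⊑ K 0 · 1 , x5 ⊑ K 0 · 1 , x7 ⊑ x6 · done)
            (≤-reflexive h0 , ≤-reflexive h1 , ≤-reflexive h2 , ≤-reflexive h3 , ≤-reflexive h4 , ≤-reflexive h5 , ≤-reflexive h6
            , ≤-reflexive (sym h7) , tt)
      ...   | false | true | false | true = inj₂ (inj₂ (starred refl (reorder-rest (pswap u v refl) pk)
                (flip-edge s uv) (flip-edge s wv) (flip-edge s w′v)
                (few′ _ _ _ _ _ _ _ _ (deg g w X) (deg g w′ X) (e g X) none (cong ind wu) (cong ind wv) (cong ind w′u)
                    (cong ind w′v) (cong ind (irrefl s w)) (cong ind (irrefl s w′)) (cong ind (symm s w w′))) small))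
        where
        few′ : ∀ a b c d i i' j j' p q f → j + p + (q + f) ≡ 0 → a ≡ 0 → b ≡ 1 → c ≡ 0 → d ≡ 1 → i ≡ 0 → i' ≡ 0 → j ≡ j' → b +
            (a + (i + (j + p))) + (d + (c + (j' + (i' + q)))) ≤ 2
        few′ a b c d i i' j j' p q f h0 h1 h2 h3 h4 h5 h6 h7 = deduce (a ∷ b ∷ c ∷ d ∷ i ∷ i' ∷ j ∷ j' ∷ p ∷ q ∷ f ∷ []) 1
            (x1 ⊕ (x0 ⊕ (x4 ⊕ (x6 ⊕ x8))) ⊕ (x3 ⊕ (x2 ⊕ (x7 ⊕ (x5 ⊕ x9)))) ⊑ K 2) (2 , x6 ⊕ x8 ⊕ (x9 ⊕ x10) ⊑ K 0 · 1 , x0 ⊑ K 0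
            · 1 , x1 ⊑ K 1 · 1 , x2 ⊑ K 0 · 1 , x3 ⊑ K 1 · 1 , x4 ⊑ K 0 · 1 , x5 ⊑ K 0 · 1 , x7 ⊑ x6 · done)
            (≤-reflexive h0 , ≤-reflexive h1 , ≤-reflexive h2 , ≤-reflexive h3 , ≤-reflexive h4 , ≤-reflexive h5 , ≤-reflexive h6
            , ≤-reflexive (sym h7) , tt)
      ...   | false | false | false | false = ⊥-elim (too-few pk none small δ (sum₄ wu wv w′u w′v) z≤n)
      ...   | true | false | false | false = ⊥-elim (too-few pk none small δ (sum₄ wu wv w′u w′v) ≤-refl)
      ...   | false | true | false | false = ⊥-elim (too-few pk none small δ (sum₄ wu wv w′u w′v) ≤-refl)
      ...   | false | false | true | false = ⊥-elim (too-few pk none small δ (sum₄ wu wv w′u w′v) ≤-refl)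
      ...   | false | false | false | true = ⊥-elim (too-few pk none small δ (sum₄ wu wv w′u w′v) ≤-refl)

    -- If the rest has no edge, two of its vertices send at least 4t + 2 edges to the t triangles,
    -- and an exchange at one of these creates an edge.
    find-matching : ∀ {P R L} → Packing g P R L → 4 ≤ length R → All (λ v → 2 * length P + 1 ≤ deg g v L) L →
      Packs g (suc (length P)) L ⊎ Matched (length P) L ⊎ Starred (length P) L
    find-matching {P} {R} pk r≥4 δ with edge? g R
    ... | inj₁ (u , v , X , σ , uv) = from-edge (+-cancelˡ-≤ 2 _ _ (subst (4 ≤_) (↭-length σ) r≥4)) δ (reorder-rest σ pk) uv
    find-matching {R = _ ∷ []} pk (s≤s ()) δ | inj₂ none
    find-matching {P} {w ∷ w′ ∷ X} pk r≥4 δ | inj₂ none with exchange-step pk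
    ... | inj₁ (Q , p , q , len , pk′ , pq) rewrite sym len = from-edge (+-cancelˡ-≤ 2 _ _ r≥4) δ pk′ pq
    ... | inj₂ small with rest-in pk δ
    ...   | δw ∷ δw′ ∷ _ = ⊥-elim (isolated _ _ _ _ (deg g w X) (deg g w′ X) (e g X) _ _ (length P) none (cong ind (irrefl s w))
        (cong ind (irrefl s w′)) (cong ind (symm s w w′)) δw δw′ (small-sum pk small))
      where
      isolated : ∀ i i' j j' p q f x y t → j + p + (q + f) ≡ 0 → i ≡ 0 → i' ≡ 0 → j ≡ j' → 2 * t + 1 ≤ x → 2 * t + 1 ≤ y → x + y
          ≤ 4 * t + (i + (j + p) + (j' + (i' + q))) → ⊥
      isolated i i' j j' p q f x y t h0 h1 h2 h3 h4 h5 h6 = refute (i ∷ i' ∷ j ∷ j' ∷ p ∷ q ∷ f ∷ x ∷ y ∷ t ∷ [])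
          (2 , x2 ⊕ x4 ⊕ (x5 ⊕ x6) ⊑ K 0 · 1 , x0 ⊑ K 0 · 1 , x1 ⊑ K 0 · 1 , x3 ⊑ x2 · 1 , 2 ⊗ x9 ⊕ K 1 ⊑ x7 · 1 , 2 ⊗ x9 ⊕ K 1 ⊑
          x8 · 1 , x7 ⊕ x8 ⊑ 4 ⊗ x9 ⊕ (x0 ⊕ (x2 ⊕ x4) ⊕ (x3 ⊕ (x1 ⊕ x5))) · done) (≤-reflexive h0 , ≤-reflexive h1 , ≤-reflexive
          h2 , ≤-reflexive (sym h3) , h4 , h5 , h6 , tt)

    Starred-degree : ∀ {t L} → Starred t L → All (λ v → 2 * t + 2 ≤ deg g v L) L → ⊥
    Starred-degree (starred {P} {u} {v} {w} {w′} {X} refl pk _ _ _ few small) δ with rest-in pk δ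
    ... | _ ∷ _ ∷ δw ∷ δw′ ∷ _ = contradict _ _ (deg g w (u ∷ v ∷ w ∷ w′ ∷ X)) (deg g w′ (u ∷ v ∷ w ∷ w′ ∷ X)) (length P) few δw
        δw′ (small-sum pk small)
      where
      contradict : ∀ x y p q t → p + q ≤ 2 → 2 * t + 2 ≤ x → 2 * t + 2 ≤ y → x + y ≤ 4 * t + (p + q) → ⊥
      contradict x y p q t h0 h1 h2 h3 = refute (x ∷ y ∷ p ∷ q ∷ t ∷ []) (1 , x2 ⊕ x3 ⊑ K 2 · 1 , 2 ⊗ x4 ⊕ K 2 ⊑ x0 · 1 , 2 ⊗ x4
          ⊕ K 2 ⊑ x1 · 1 , x0 ⊕ x1 ⊑ 4 ⊗ x4 ⊕ (x2 ⊕ x3) · done) (h0 , h1 , h2 , h3 , tt)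

    -- Ore's condition, imposed on adjacent instead of non-adjacent pairs.
    EdgeDegree : ℕ → List V → Set
    EdgeDegree d L = ∀ {a b X} → L ↭ a ∷ b ∷ X → g a b ≡ true → d ≤ deg g a L + deg g b L

    -- An edge of the rest that lies in no triangle there keeps at most the size of the rest from
    -- its degree sum; everything else goes to the packing.
    edge-to-packing : ∀ {P a b X Y L} → Packing g P (X ++ a ∷ b ∷ Y) L → g a b ≡ true →
      Packs g (suc (length P)) L
      ⊎ deg g a L + deg g b L ≤ ∑ (λ t → deg g a (corners t) + deg g b (corners t)) P + (2 + length (X ++ Y))
    edge-to-packing {P} {a} {b} {X} {Y} {L} pk ab with triangle-on-edge? s (shifts X (a ∷ b ∷ [])) ab
    ... | inj₁ tri = inj₁ (grow-by-triangle tri pk)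
    ... | inj₂ le = inj₂ (bound (deg g a L) (deg g b L) (load g a P) (load g b P) (deg g a (X ++ a ∷ b ∷ Y))
        (deg g b (X ++ a ∷ b ∷ Y)) (length (X ++ Y)) (∑ (λ t → deg g a (corners t) + deg g b (corners t)) P) (packing-deg pk a)
        (packing-deg pk b)
            (∑-distrib (λ t → deg g a (corners t)) (λ t → deg g b (corners t)) P)
            (subst (deg g a (X ++ a ∷ b ∷ Y) + deg g b (X ++ a ∷ b ∷ Y) ≤_) (↭-length (shifts X (a ∷ b ∷ []))) le))
      where
      bound : ∀ x y p q i j l pq → x ≡ p + i → y ≡ q + j → pq ≡ p + q → i + j ≤ 2 + l → x + y ≤ pq + (2 + l)
      bound x y p q i j l pq h0 h1 h2 h3 = deduce (x ∷ y ∷ p ∷ q ∷ i ∷ j ∷ l ∷ pq ∷ []) 1 (x0 ⊕ x1 ⊑ x7 ⊕ (K 2 ⊕ x6))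
          (1 , x0 ⊑ x2 ⊕ x4 · 1 , x1 ⊑ x3 ⊕ x5 · 1 , x2 ⊕ x3 ⊑ x7 · 1 , x4 ⊕ x5 ⊑ K 2 ⊕ x6 · done)
          (≤-reflexive h0 , ≤-reflexive h1 , ≤-reflexive (sym h2) , h3 , tt)

    -- With t triangles and r vertices left, n = 3t + r. Each of two disjoint outside edges has
    -- degree sum at least n + t + 1, of which at most r stays in the rest, so it sends at least 4t
    -- + 1 edges to the packing. Together this exceeds 8t.
    extend : ∀ {P R L} → Packing g P R L → 4 ≤ length R → All (λ v → 2 * length P + 2 ≤ deg g v L) L →
      EdgeDegree (length L + length P + 1) L → Packs g (suc (length P)) L
    extend {P} {R} {L} pk r≥4 δ ed with find-matching pk r≥4 (All.map (≤-trans (+-monoʳ-≤ (2 * length P) (s≤s z≤n))) δ)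
    ... | inj₁ larger = larger
    ... | inj₂ (inj₂ star) = ⊥-elim (Starred-degree star δ)
    ... | inj₂ (inj₁ (matched {Q} {a} {b} {a′} {b′} {X} len pk′ ab a′b′)) rewrite sym len
      with augment-step pk′ ab a′b′ | edge-to-packing {X = []} pk′ ab | edge-to-packing {X = a ∷ b ∷ []} pk′ a′b′
    ...   | inj₁ larger | _ | _ = larger
    ...   | inj₂ _ | inj₁ larger | _ = larger
    ...   | inj₂ _ | inj₂ _ | inj₁ larger = larger
    ...   | inj₂ small | inj₂ le | inj₂ le′ = ⊥-elim
        (contradict (length Q) (length X) _ _ _ (∑ (λ t → deg g a (corners t) + deg g b (corners t)) Q)
        (∑ (λ t → deg g a′ (corners t) + deg g b′ (corners t)) Q) (packing-length pk′)
            (ed (rest-front {X = a ∷ b ∷ []} pk′) ab)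
            (ed (rest-front {X = a′ ∷ b′ ∷ []} (reorder-rest (shifts (a ∷ b ∷ []) (a′ ∷ b′ ∷ [])) pk′)) a′b′) le le′
            (subst (_≤ 8 * length Q) (∑-distrib (λ t → deg g a (corners t) + deg g b (corners t))
                (λ t → deg g a′ (corners t) + deg g b′ (corners t)) Q)
              (∑-bound _ 8 small)))
      where
      contradict : ∀ t r n x y p q → 3 * t + (4 + r) ≡ n → n + t + 1 ≤ x → n + t + 1 ≤ y → x ≤ p + (2 + (2 + r)) → y ≤ q +
          (2 + (2 + r)) → p + q ≤ 8 * t → ⊥
      contradict t r n x y p q h0 h1 h2 h3 h4 h5 = refute (t ∷ r ∷ n ∷ x ∷ y ∷ p ∷ q ∷ [])
          (2 , 3 ⊗ x0 ⊕ (K 4 ⊕ x1) ⊑ x2 · 1 , x2 ⊕ x0 ⊕ K 1 ⊑ x3 · 1 , x2 ⊕ x0 ⊕ K 1 ⊑ x4 · 1 , x3 ⊑ x5 ⊕ (K 2 ⊕ (K 2 ⊕ x1)) · 1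
          , x4 ⊑ x6 ⊕ (K 2 ⊕ (K 2 ⊕ x1)) · 1 , x5 ⊕ x6 ⊑ 8 ⊗ x0 · done) (≤-reflexive h0 , h1 , h2 , h3 , h4 , h5 , tt)

    -- Dirac's theorem on disjoint triangles, under an Ore-type condition.
    disjoint-triangles : ∀ T {L} → All (λ v → 2 * T ≤ deg g v L) L → EdgeDegree (length L + T) L → 3 * T + 1 ≤ length L → Packs g
        T L
    disjoint-triangles T {L} δ ed long = build T ≤-refl
      where
      build : ∀ t → t ≤ T → Packs g t L
      build zero _ = [] , L , refl , ([] , refl)
      build (suc t) t<T with build t (<⇒≤ t<T)
      ... | P , R , refl , pk = extend pk (room (length P) T (length R) _ t<T (packing-length pk) long)
              (All.map (≤-trans (degree (length P) T t<T)) δ) (λ σ ab → ≤-trans (ore (length L) (length P) T t<T) (ed σ ab))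
        where
        room : ∀ t T r n → t < T → 3 * t + r ≡ n → 3 * T + 1 ≤ n → 4 ≤ r
        room t T r n h0 h1 h2 = deduce (t ∷ T ∷ r ∷ n ∷ []) 1 (K 4 ⊑ x2) (3 , K 1 ⊕ x0 ⊑ x1 · 1 , x3 ⊑ 3 ⊗ x0 ⊕ x2 · 1 , 3 ⊗ x1 ⊕
            K 1 ⊑ x3 · done) (h0 , ≤-reflexive (sym h1) , h2 , tt)
        degree : ∀ t T → t < T → 2 * t + 2 ≤ 2 * T
        degree t T h0 = deduce (t ∷ T ∷ []) 1 (2 ⊗ x0 ⊕ K 2 ⊑ 2 ⊗ x1) (2 , K 1 ⊕ x0 ⊑ x1 · done) (h0 , tt)
        ore : ∀ n t T → t < T → n + t + 1 ≤ n + T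
        ore n t T h0 = deduce (n ∷ t ∷ T ∷ []) 1 (x0 ⊕ x1 ⊕ K 1 ⊑ x0 ⊕ x2) (1 , K 1 ⊕ x1 ⊑ x2 · done) (h0 , tt)

-- The bound

pairs : ℕ → ℕ
pairs zero = 0
pairs (suc n) = n + pairs n

-- This is ⌊m²/4⌋, in the steps of two that the induction for Mantel's theorem takes.
quarter : ℕ → ℕ
quarter zero = 0
quarter (suc zero) = 0
quarter (suc (suc m)) = quarter m + suc m

double : ℕ → ℕ
double zero = 0
double (suc i) = suc (suc (double i))

double≡2* : ∀ i → double i ≡ 2 * i
double≡2* zero = refl
double≡2* (suc i) = trans (cong (2 +_) (double≡2* i)) (sym (*-suc 2 i))

even-or-odd : ∀ m → ∃[ i ] (m ≡ double i ⊎ m ≡ suc (double i))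
even-or-odd zero = 0 , inj₁ refl
even-or-odd (suc m) with even-or-odd m
... | i , inj₁ refl = i , inj₂ refl
... | i , inj₂ refl = suc i , inj₁ refl

quarter-even : ∀ i → quarter (double (suc i)) ≡ quarter (suc (double i)) + suc i
quarter-even zero = refl
quarter-even (suc i) = step _ _ _ _ (quarter-even i)
  where
  step : ∀ a b d i → a ≡ b + suc i → a + suc (suc (suc d)) ≡ b + suc (suc d) + suc (suc i)
  step a b d i refl = rearrange b i d
    where
    rearrange : ∀ b i d → b + suc i + suc (suc (suc d)) ≡ b + suc (suc d) + suc (suc i)
    rearrange = solve-∀

quarter-odd : ∀ i → quarter (suc (double (suc i))) ≡ quarter (double (suc i)) + suc i
quarter-odd zero = refl
quarter-odd (suc i) = step _ _ _ _ (quarter-odd i)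
  where
  step : ∀ a b d i → a ≡ b + suc i → a + suc (suc (suc (suc d))) ≡ b + suc (suc (suc d)) + suc (suc i)
  step a b d i refl = rearrange b i d
    where
    rearrange : ∀ b i d → b + suc i + suc (suc (suc (suc d))) ≡ b + suc (suc (suc d)) + suc (suc i)
    rearrange = solve-∀

half-even : ∀ i → ⌈ double i /2⌉ ≡ i
half-even zero = refl
half-even (suc i) = cong suc (half-even i)

half-odd : ∀ i → ⌈ suc (double i) /2⌉ ≡ suc i
half-odd zero = refl
half-odd (suc i) = cong suc (half-odd i)

-- The induction lowers `j` while `m` stays or even grows, and so leaves the range
-- `m ≤ 2 * ((1 + j) * (1 + j))`. Truncated subtraction keeps the bound meaningful there.
excess : ℕ → ℕ → ℕ
excess j m = (1 + j) * (1 + j) ∸ ⌈ m /2⌉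

-- With k = j + 2 and n = 3k + m: ⌊(n-k+2)²/4⌋ + (k-2)(n-k+2) + C(k-2,2) + 1 + ((k-1)² ∸ ⌈(n-3k)/2⌉).
bound : ℕ → ℕ → ℕ
bound j m = (j + 3) * (j + 3) + (j + 3) * m + quarter m + j * (2 * j + 6 + m) + pairs j + 1 + excess j m

bound-expand : ∀ j m → bound j m ≡ 3 * (j * j) + 12 * j + 10 + pairs j + 2 * (j * m) + 3 * m + quarter m + excess j m
bound-expand j m = expand j m (quarter m) (pairs j) (excess j m)
  where
  expand : ∀ j m q p x → (j + 3) * (j + 3) + (j + 3) * m + q + j * (2 * j + 6 + m) + p + 1 + x ≡
    3 * (j * j) + 12 * j + 10 + p + 2 * (j * m) + 3 * m + q + x
  expand = solve-∀

-- Increments of the bound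

∸-step : ∀ a b → a ∸ b ≤ 1 + (a ∸ suc b)
∸-step zero zero = z≤n
∸-step zero (suc b) = z≤n
∸-step (suc a) zero = ≤-refl
∸-step (suc a) (suc b) = ∸-step a b

-- From odd to even `m` the value ⌈m/2⌉ does not move, so the excess loses nothing.
bound-even : ∀ j i → bound j (suc (double i)) + (2 * j + 3) + suc i ≤ bound j (double (suc i))
bound-even j i = step j i d (j * j) (pairs j) (bound j (suc d)) (bound j (suc (suc d))) (j * d) (j * suc d) (j * suc (suc d))
  (quarter (suc d)) (quarter (suc (suc d))) (excess j (suc d)) (excess j (suc (suc d)))
  (bound-expand j (suc d)) (bound-expand j (suc (suc d))) (quarter-even i)
  (≤-reflexive (cong ((1 + j) * (1 + j) ∸_) (trans (half-odd i) (sym (half-even (suc i))))))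
  (*-suc j d) (*-suc j (suc d))
  where
  d = double i
  step : ∀ j i d s p a b jd ja jb q q' x x' → a ≡ 3 * s + 12 * j + 10 + p + 2 * ja + 3 * (1 + d) + q + x → b ≡ 3 * s + 12 * j +
      10 + p + 2 * jb + 3 * (2 + d) + q' + x' → q' ≡ q + (1 + i) → x ≤ x' → ja ≡ j + jd → jb ≡ j + ja → a + (2 * j + 3) + (1 + i)
      ≤ b
  step j i d s p a b jd ja jb q q' x x' h0 h1 h2 h3 _ h5 = deduce (j ∷ i ∷ d ∷ s ∷ p ∷ a ∷ b ∷ jd ∷ ja ∷ jb ∷ q ∷ q' ∷ x ∷ x' ∷
      []) 1 (x5 ⊕ (2 ⊗ x0 ⊕ K 3) ⊕ (K 1 ⊕ x1) ⊑ x6) (1 , x5 ⊑ 3 ⊗ x3 ⊕ 12 ⊗ x0 ⊕ K 10 ⊕ x4 ⊕ 2 ⊗ x8 ⊕ 3 ⊗ (K 1 ⊕ x2) ⊕ x10 ⊕ x12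
      · 1 , 3 ⊗ x3 ⊕ 12 ⊗ x0 ⊕ K 10 ⊕ x4 ⊕ 2 ⊗ x9 ⊕ 3 ⊗ (K 2 ⊕ x2) ⊕ x11 ⊕ x13 ⊑ x6 · 1 , x10 ⊕ (K 1 ⊕ x1) ⊑ x11 · 1 , x12 ⊑ x13
      · 2 , x0 ⊕ x8 ⊑ x9 · done) (≤-reflexive h0 , ≤-reflexive (sym h1) , ≤-reflexive (sym h2) , h3 , ≤-reflexive (sym h5) , tt)

-- Here ⌈m/2⌉ grows and may take one from the excess. This unit is what makes odd `m` hard.
bound-odd : ∀ j i → bound j (double (suc i)) + (2 * j + 2) + suc i ≤ bound j (suc (double (suc i)))
bound-odd j i = step j i d (j * j) (pairs j) (bound j d) (bound j (suc d)) (j * d) (j * suc d)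
  (quarter d) (quarter (suc d)) (excess j d) (excess j (suc d))
  (bound-expand j d) (bound-expand j (suc d)) (quarter-odd i)
  (subst₂ (λ h h′ → (1 + j) * (1 + j) ∸ h ≤ 1 + ((1 + j) * (1 + j) ∸ h′)) (sym (half-even (suc i))) (sym (half-odd (suc i)))
      (∸-step ((1 + j) * (1 + j)) (suc i)))
  (*-suc j d)
  where
  d = double (suc i)
  step : ∀ j i d s p a b ja jb q q' x x' → a ≡ 3 * s + 12 * j + 10 + p + 2 * ja + 3 * d + q + x → b ≡ 3 * s + 12 * j + 10 + p + 2
      * jb + 3 * (1 + d) + q' + x' → q' ≡ q + (1 + i) → x ≤ 1 + x' → jb ≡ j + ja → a + (2 * j + 2) + (1 + i) ≤ b
  step j i d s p a b ja jb q q' x x' h0 h1 h2 h3 h4 = deduce (j ∷ i ∷ d ∷ s ∷ p ∷ a ∷ b ∷ ja ∷ jb ∷ q ∷ q' ∷ x ∷ x' ∷ []) 1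
      (x5 ⊕ (2 ⊗ x0 ⊕ K 2) ⊕ (K 1 ⊕ x1) ⊑ x6) (1 , x5 ⊑ 3 ⊗ x3 ⊕ 12 ⊗ x0 ⊕ K 10 ⊕ x4 ⊕ 2 ⊗ x7 ⊕ 3 ⊗ x2 ⊕ x9 ⊕ x11 · 1 , 3 ⊗ x3 ⊕
      12 ⊗ x0 ⊕ K 10 ⊕ x4 ⊕ 2 ⊗ x8 ⊕ 3 ⊗ (K 1 ⊕ x2) ⊕ x10 ⊕ x12 ⊑ x6 · 1 , x9 ⊕ (K 1 ⊕ x1) ⊑ x10 · 1 , x11 ⊑ K 1 ⊕ x12 · 2 , x0 ⊕
      x7 ⊑ x8 · done) (≤-reflexive h0 , ≤-reflexive (sym h1) , ≤-reflexive (sym h2) , h3 , ≤-reflexive (sym h4) , tt)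

-- For `j = 0` the excess is 1 ∸ ⌈m/2⌉ and has reached zero at m = 2, so the unit is not lost.
bound-odd₀ : ∀ i → bound 0 (double (suc i)) + 3 + suc i ≤ bound 0 (suc (double (suc i)))
bound-odd₀ i = step i d (bound 0 d) (bound 0 (suc d)) (quarter d) (quarter (suc d)) (excess 0 d) (excess 0 (suc d))
  (bound-expand 0 d) (bound-expand 0 (suc d)) (quarter-odd i)
  (≤-trans (≤-reflexive (trans (cong (1 ∸_) (half-even (suc i))) (0∸n≡0 i))) z≤n)
  where
  d = double (suc i)
  step : ∀ i d a b q q' x x' → a ≡ 10 + 3 * d + q + x → b ≡ 10 + 3 * (1 + d) + q' + x' → q' ≡ q + (1 + i) → x ≤ x' → a + 3 +
      (1 + i) ≤ b
  step i d a b q q' x x' h0 h1 h2 h3 = deduce (i ∷ d ∷ a ∷ b ∷ q ∷ q' ∷ x ∷ x' ∷ []) 1 (x2 ⊕ K 3 ⊕ (K 1 ⊕ x0) ⊑ x3)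
      (1 , x2 ⊑ K 10 ⊕ 3 ⊗ x1 ⊕ x4 ⊕ x6 · 1 , K 10 ⊕ 3 ⊗ (K 1 ⊕ x1) ⊕ x5 ⊕ x7 ⊑ x3 · 1 , x4 ⊕ (K 1 ⊕ x0) ⊑ x5 · 1 , x6 ⊑ x7 ·
      done) (≤-reflexive h0 , ≤-reflexive (sym h1) , ≤-reflexive (sym h2) , h3 , tt)

bound-one : ∀ j → bound j 0 + (2 * j + 2) ≤ bound j 1
bound-one j = step j (j * j) (pairs j) (bound j 0) (bound j 1) (j * 0) (j * 1) (excess j 0) (excess j 1)
  (bound-expand j 0) (bound-expand j 1) (∸-step ((1 + j) * (1 + j)) 0) (*-suc j 0)
  where
  step : ∀ j s p a b ja jb x x' → a ≡ 3 * s + 12 * j + 10 + p + 2 * ja + 0 + 0 + x → b ≡ 3 * s + 12 * j + 10 + p + 2 * jb + 3 + 0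
      + x' → x ≤ 1 + x' → jb ≡ j + ja → a + (2 * j + 2) ≤ b
  step j s p a b ja jb x x' h0 h1 h2 h3 = deduce (j ∷ s ∷ p ∷ a ∷ b ∷ ja ∷ jb ∷ x ∷ x' ∷ []) 1 (x3 ⊕ (2 ⊗ x0 ⊕ K 2) ⊑ x4)
      (1 , x3 ⊑ 3 ⊗ x1 ⊕ 12 ⊗ x0 ⊕ K 10 ⊕ x2 ⊕ 2 ⊗ x5 ⊕ K 0 ⊕ K 0 ⊕ x7 · 1 , 3 ⊗ x1 ⊕ 12 ⊗ x0 ⊕ K 10 ⊕ x2 ⊕ 2 ⊗ x6 ⊕ K 3 ⊕ K 0 ⊕
      x8 ⊑ x4 · 1 , x7 ⊑ K 1 ⊕ x8 · 2 , x0 ⊕ x5 ⊑ x6 · done) (≤-reflexive h0 , ≤-reflexive (sym h1) , h2 , ≤-reflexive (sym h3) ,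
      tt)

bound-two : ∀ j m → bound j m + (4 * j + 4) + (2 + m) ≤ bound j (suc (suc m))
bound-two j m = step j m (j * j) (pairs j) (bound j m) (bound j (suc (suc m))) (j * m) (j * suc m) (j * suc (suc m))
  (quarter m) (excess j m) (excess j (suc (suc m)))
  (bound-expand j m) (bound-expand j (suc (suc m))) (∸-step ((1 + j) * (1 + j)) ⌈ m /2⌉) (*-suc j m) (*-suc j (suc m))
  where
  step : ∀ j m s p a b ja jc jb q x x' → a ≡ 3 * s + 12 * j + 10 + p + 2 * ja + 3 * m + q + x → b ≡ 3 * s + 12 * j + 10 + p + 2 *
      jb + 3 * (2 + m) + (q + (1 + m)) + x' → x ≤ 1 + x' → jc ≡ j + ja → jb ≡ j + jc → a + (4 * j + 4) + (2 + m) ≤ b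
  step j m s p a b ja jc jb q x x' h0 h1 h2 h3 h4 = deduce (j ∷ m ∷ s ∷ p ∷ a ∷ b ∷ ja ∷ jc ∷ jb ∷ q ∷ x ∷ x' ∷ []) 1
      (x4 ⊕ (4 ⊗ x0 ⊕ K 4) ⊕ (K 2 ⊕ x1) ⊑ x5) (1 , x4 ⊑ 3 ⊗ x2 ⊕ 12 ⊗ x0 ⊕ K 10 ⊕ x3 ⊕ 2 ⊗ x6 ⊕ 3 ⊗ x1 ⊕ x9 ⊕ x10 · 1 , 3 ⊗ x2 ⊕
      12 ⊗ x0 ⊕ K 10 ⊕ x3 ⊕ 2 ⊗ x8 ⊕ 3 ⊗ (K 2 ⊕ x1) ⊕ (x9 ⊕ (K 1 ⊕ x1)) ⊕ x11 ⊑ x5 · 1 , x10 ⊑ K 1 ⊕ x11 · 2 , x0 ⊕ x6 ⊑ x7 · 2 ,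
      x0 ⊕ x7 ⊑ x8 · done) (≤-reflexive h0 , ≤-reflexive (sym h1) , h2 , ≤-reflexive (sym h3) , ≤-reflexive (sym h4) , tt)

square-suc : ∀ j → suc j * suc j ≡ j * j + 2 * j + 1
square-suc = solve-∀

bound-suc : ∀ j m → bound j m + (7 * j + 15) + 2 * m ≤ bound (suc j) m
bound-suc j m = step j m (j * j) (suc j * suc j) (pairs j) (bound j m) (bound (suc j) m) (j * m) (suc j * m)
  (quarter m) (excess j m) (excess (suc j) m)
  (bound-expand j m) (bound-expand (suc j) m) (∸-monoˡ-≤ ⌈ m /2⌉ (*-mono-≤ (n≤1+n (1 + j)) (n≤1+n (1 + j)))) (square-suc j) refl
  where
  step : ∀ j m s t p a b ja jb q x x' → a ≡ 3 * s + 12 * j + 10 + p + 2 * ja + 3 * m + q + x → b ≡ 3 * t + 12 * (1 + j) + 10 +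
      (j + p) + 2 * jb + 3 * m + q + x' → x ≤ x' → t ≡ s + 2 * j + 1 → jb ≡ m + ja → a + (7 * j + 15) + 2 * m ≤ b
  step j m s t p a b ja jb q x x' h0 h1 h2 h3 h4 = deduce (j ∷ m ∷ s ∷ t ∷ p ∷ a ∷ b ∷ ja ∷ jb ∷ q ∷ x ∷ x' ∷ []) 1
      (x5 ⊕ (7 ⊗ x0 ⊕ K 15) ⊕ 2 ⊗ x1 ⊑ x6) (1 , x5 ⊑ 3 ⊗ x2 ⊕ 12 ⊗ x0 ⊕ K 10 ⊕ x4 ⊕ 2 ⊗ x7 ⊕ 3 ⊗ x1 ⊕ x9 ⊕ x10 · 1 , 3 ⊗ x3 ⊕ 12
      ⊗ (K 1 ⊕ x0) ⊕ K 10 ⊕ (x0 ⊕ x4) ⊕ 2 ⊗ x8 ⊕ 3 ⊗ x1 ⊕ x9 ⊕ x11 ⊑ x6 · 1 , x10 ⊑ x11 · 3 , x2 ⊕ 2 ⊗ x0 ⊕ K 1 ⊑ x3 · 2 , x1 ⊕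
      x7 ⊑ x8 · done) (≤-reflexive h0 , ≤-reflexive (sym h1) , h2 , ≤-reflexive (sym h3) , ≤-reflexive (sym h4) , tt)

-- Both sides concern the same number of vertices: 3(j + 2) + 4 = 3(j + 3) + 1.
bound-previous : ∀ j → bound j 4 ≤ bound (suc j) 1
bound-previous j = step j (j * j) (suc j * suc j) (pairs j) (bound j 4) (bound (suc j) 1) (j * 4) (suc j * 1) (excess j 4)
    (excess (suc j) 1)
  (bound-expand j 4) (bound-expand (suc j) 1) (four j) (*-identityʳ (suc j)) (square-suc j)
  (∸-mono (*-mono-≤ (n≤1+n (1 + j)) (n≤1+n (1 + j))) (s≤s (z≤n {1})))
  where
  four : ∀ j → j * 4 ≡ 4 * j
  four = solve-∀
  step : ∀ j s t p a b j4 j1 x x' → a ≡ 3 * s + 12 * j + 10 + p + 2 * j4 + 12 + 4 + x → b ≡ 3 * t + 12 * (1 + j) + 10 + (j + p) +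
      2 * j1 + 3 + 0 + x' → j4 ≡ 4 * j → j1 ≡ 1 + j → t ≡ s + 2 * j + 1 → x ≤ x' → a ≤ b
  step j s t p a b j4 j1 x x' h0 h1 h2 h3 h4 h5 = deduce (j ∷ s ∷ t ∷ p ∷ a ∷ b ∷ j4 ∷ j1 ∷ x ∷ x' ∷ []) 1 (x4 ⊑ x5)
      (1 , x4 ⊑ 3 ⊗ x1 ⊕ 12 ⊗ x0 ⊕ K 10 ⊕ x3 ⊕ 2 ⊗ x6 ⊕ K 12 ⊕ K 4 ⊕ x8 · 1 , 3 ⊗ x2 ⊕ 12 ⊗ (K 1 ⊕ x0) ⊕ K 10 ⊕ (x0 ⊕ x3) ⊕ 2 ⊗
      x7 ⊕ K 3 ⊕ K 0 ⊕ x9 ⊑ x5 · 2 , x6 ⊑ 4 ⊗ x0 · 2 , K 1 ⊕ x0 ⊑ x7 · 3 , x1 ⊕ 2 ⊗ x0 ⊕ K 1 ⊑ x2 · 1 , x8 ⊑ x9 · done)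
      (≤-reflexive h0 , ≤-reflexive (sym h1) , ≤-reflexive h2 , ≤-reflexive (sym h3) , ≤-reflexive (sym h4) , h5 , tt)

pairs-double : ∀ n → 2 * pairs n + n ≡ n * n
pairs-double zero = refl
pairs-double (suc n) = trans (step n (pairs n)) (trans (cong (λ s → s + 2 * n + 1) (pairs-double n)) (sym (square-suc n)))
  where
  step : ∀ n p → 2 * (n + p) + suc n ≡ 2 * p + n + 2 * n + 1
  step = solve-∀

-- Hence more than `bound j 0` edges on 3k vertices leave at most 3j + 3 = 3k - 3 non-edges.
bound-zero : ∀ j → pairs (3 * j + 6) ≤ bound j 0 + (3 * j + 4)
bound-zero j = step j (j * j) (pairs j) (pairs (3 * j + 6)) ((3 * j + 6) * (3 * j + 6)) (bound j 0) (j * 0) (suc j * suc j)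
  (bound-expand j 0) (pairs-double j) (pairs-double (3 * j + 6)) (square j) (*-zeroʳ j) (square-suc j)
  where
  square : ∀ j → (3 * j + 6) * (3 * j + 6) ≡ 9 * (j * j) + 36 * j + 36
  square = solve-∀
  step : ∀ j s p r t b j0 x → b ≡ 3 * s + 12 * j + 10 + p + 2 * j0 + 0 + 0 + x → 2 * p + j ≡ s → 2 * r + (3 * j + 6) ≡ t → t ≡ 9
      * s + 36 * j + 36 → j0 ≡ 0 → x ≡ s + 2 * j + 1 → r ≤ b + (3 * j + 4)
  step j s p r t b j0 x h0 h1 h2 h3 _ h5 = deduce (j ∷ s ∷ p ∷ r ∷ t ∷ b ∷ j0 ∷ x ∷ []) 2 (x3 ⊑ x5 ⊕ (3 ⊗ x0 ⊕ K 4))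
      (2 , 3 ⊗ x1 ⊕ 12 ⊗ x0 ⊕ K 10 ⊕ x2 ⊕ 2 ⊗ x6 ⊕ K 0 ⊕ K 0 ⊕ x7 ⊑ x5 · 1 , x1 ⊑ 2 ⊗ x2 ⊕ x0 · 1 , 2 ⊗ x3 ⊕ (3 ⊗ x0 ⊕ K 6) ⊑ x4
      · 1 , x4 ⊑ 9 ⊗ x1 ⊕ 36 ⊗ x0 ⊕ K 36 · 2 , x1 ⊕ 2 ⊗ x0 ⊕ K 1 ⊑ x7 · done) (≤-reflexive (sym h0) , ≤-reflexive (sym h1) ,
      ≤-reflexive h2 , ≤-reflexive h3 , ≤-reflexive (sym h5) , tt)

-- Given k - 1 triangles and four vertices outside, the estimates are C(3j + 3, 2) edges on the
-- triangles, 8(j + 1) edges from the four vertices to them, and 4 among the four. A graph above the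
-- bound falls short of this total by at most one.
bound-one-pairs : ∀ j → pairs (3 * j + 3) + (8 * j + 10) ≤ bound j 1
bound-one-pairs j = step j (j * j) (pairs j) (pairs (3 * j + 3)) ((3 * j + 3) * (3 * j + 3)) (bound j 1) (j * 1) (excess j 1)
    (suc j * suc j)
  (bound-expand j 1) (pairs-double j) (pairs-double (3 * j + 3)) (square j) (*-identityʳ j)
      (m∸n+n≡m {suc j * suc j} {1} (s≤s z≤n)) (square-suc j)
  where
  square : ∀ j → (3 * j + 3) * (3 * j + 3) ≡ 9 * (j * j) + 18 * j + 9
  square = solve-∀
  step : ∀ j s p r t b j1 x v → b ≡ 3 * s + 12 * j + 10 + p + 2 * j1 + 3 + 0 + x → 2 * p + j ≡ s → 2 * r + (3 * j + 3) ≡ t → t ≡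
      9 * s + 18 * j + 9 → j1 ≡ j → x + 1 ≡ v → v ≡ s + 2 * j + 1 → r + (8 * j + 10) ≤ b
  step j s p r t b j1 x v h0 h1 h2 h3 h4 h5 h6 = deduce (j ∷ s ∷ p ∷ r ∷ t ∷ b ∷ j1 ∷ x ∷ v ∷ []) 2 (x3 ⊕ (8 ⊗ x0 ⊕ K 10) ⊑ x5)
      (2 , 3 ⊗ x1 ⊕ 12 ⊗ x0 ⊕ K 10 ⊕ x2 ⊕ 2 ⊗ x6 ⊕ K 3 ⊕ K 0 ⊕ x7 ⊑ x5 · 1 , x1 ⊑ 2 ⊗ x2 ⊕ x0 · 1 , 2 ⊗ x3 ⊕ (3 ⊗ x0 ⊕ K 3) ⊑ x4
      · 1 , x4 ⊑ 9 ⊗ x1 ⊕ 18 ⊗ x0 ⊕ K 9 · 4 , x0 ⊑ x6 · 2 , x8 ⊑ x7 ⊕ K 1 · 2 , x1 ⊕ 2 ⊗ x0 ⊕ K 1 ⊑ x8 · done)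
      (≤-reflexive (sym h0) , ≤-reflexive (sym h1) , ≤-reflexive h2 , ≤-reflexive h3 , ≤-reflexive (sym h4) , ≤-reflexive
      (sym h5) , ≤-reflexive (sym h6) , tt)

-- Graphs on seven vertices as upper triangular matrices

Upper : ℕ → Set
Upper zero = ⊤
Upper (suc n) = Vec Bool n × Upper n

cell : ∀ {n} → Upper n → Fin n → Fin n → Bool
cell (r , M) zero zero = false
cell (r , M) zero (suc j) = lookup r j
cell (r , M) (suc i) zero = lookup r i
cell (r , M) (suc i) (suc j) = cell M i j

upper : ∀ {n} → Graph (Fin n) → Upper n
upper {zero} G = tt
upper {suc n} G = Vec.tabulate (λ j → G zero (suc j)) , upper (λ i j → G (suc i) (suc j))

cell-upper : ∀ {n} {G : Graph (Fin n)} → Simple G → ∀ i j → cell (upper G) i j ≡ G i j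
cell-upper s zero zero = sym (irrefl s zero)
cell-upper s zero (suc j) = lookup∘tabulate _ j
cell-upper s (suc i) zero = trans (lookup∘tabulate _ i) (symm s zero (suc i))
cell-upper s (suc i) (suc j) = cell-upper (record { symm = λ u v → symm s (suc u) (suc v) ; irrefl = λ v → irrefl s (suc v) }) i j

matrix : {V : Set} → Graph V → ∀ {n} → Vec V n → Upper n
matrix g [] = tt
matrix g (v ∷ vs) = Vec.map (g v) vs , matrix g vs

edgeCount : ∀ {n} → Upper n → ℕ
edgeCount {zero} M = 0
edgeCount {suc n} (r , M) = count r + edgeCount M

count-map : {V : Set} (f : V → Bool) {n : ℕ} (vs : Vec V n) → count (Vec.map f vs) ≡ ∑ (λ w → ind (f w)) (toList vs)
count-map f [] = refl
count-map f (v ∷ vs) = cong (ind (f v) +_) (count-map f vs)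

edgeCount-matrix : {V : Set} (g : Graph V) {n : ℕ} (vs : Vec V n) → edgeCount (matrix g vs) ≡ e g (toList vs)
edgeCount-matrix g [] = refl
edgeCount-matrix g (v ∷ vs) = cong₂ _+_ (count-map (g v) vs) (edgeCount-matrix g vs)

cell-matrix : {V : Set} {g : Graph V} → Simple g → ∀ {n} (vs : Vec V n) i j → cell (matrix g vs) i j ≡ isEdge g vs i j
cell-matrix s (v ∷ vs) zero zero = sym (irrefl s v)
cell-matrix {g = g} s (v ∷ vs) zero (suc j) = lookup-map j (g v) vs
cell-matrix {g = g} s (v ∷ vs) (suc i) zero = trans (lookup-map i (g v) vs) (symm s v (lookup vs i))
cell-matrix s (v ∷ vs) (suc i) (suc j) = cell-matrix s vs i j

matches : ∀ {n} → Fin n × Fin n → Graph (Fin n)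
matches (a , b) i j = (a == i ∧ b == j) ∨ (a == j ∧ b == i)

-- With `e = (0F , 0F)`, a pair on the empty diagonal, nothing is deleted; this represents a colour
-- that the graph lacks.
insert-delete : ∀ {n} → Upper n → Fin n × Fin n → Fin n × Fin n → Upper n
insert-delete M f e = upper (λ i j → matches f i j ∨ (cell M i j ∧ not (matches e i j)))

pairsOf : {A : Set} → List A → List (A × A)
pairsOf [] = []
pairsOf (x ∷ xs) = map (x ,_) xs ++ pairsOf xs

any-sound : {A : Set} (p : A → Bool) (xs : List A) → any p xs ≡ true → ∃[ x ] p x ≡ true
any-sound p (x ∷ xs) q with ∨-true {p x} q
... | inj₁ r = x , r
... | inj₂ r = any-sound p xs r

all-sound : {A : Set} (p : A → Bool) {xs : List A} → all p xs ≡ true → ∀ {x} → x ∈ xs → p x ≡ true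
all-sound p {x ∷ xs} q (here refl) = proj₁ (∧-true q)
all-sound p {x ∷ xs} q (there m) = all-sound p (proj₂ (∧-true {p x} q)) m

choose₃ : {A : Set} → List A → List ((A × A × A) × List A)
choose₂ : {A : Set} → List A → List ((A × A) × List A)
choose₁ : {A : Set} → List A → List (A × List A)
choose₁ [] = []
choose₁ (x ∷ xs) = (x , xs) ∷ map (λ (y , ys) → y , x ∷ ys) (choose₁ xs)
choose₂ [] = []
choose₂ (x ∷ xs) = map (λ (y , ys) → (x , y) , ys) (choose₁ xs) ++ map (λ (p , ys) → p , x ∷ ys) (choose₂ xs)
choose₃ [] = []
choose₃ (x ∷ xs) = map (λ ((y , z) , ys) → (x , y , z) , ys) (choose₂ xs) ++ map (λ (t , ys) → t , x ∷ ys) (choose₃ xs)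

triples-of-rest : Fin 7 × Fin 7 × Fin 7 → List ((Fin 7 × Fin 7 × Fin 7) × List (Fin 7)) → List (Arrangement 7)
triples-of-rest _ [] = []
triples-of-rest t@(a , b , c) (((d , e , f) , g ∷ []) ∷ rs) = (a ∷ b ∷ c ∷ d ∷ e ∷ f ∷ g ∷ []) ∷ triples-of-rest t rs
triples-of-rest t (_ ∷ rs) = triples-of-rest t rs

two-triples : List ((Fin 7 × Fin 7 × Fin 7) × List (Fin 7)) → List (Arrangement 7)
two-triples [] = []
two-triples ((t , rest) ∷ cs) = triples-of-rest t (choose₃ rest) ++ two-triples cs

-- The order within a triple is immaterial for the shape, so 35 · 4 arrangements replace all 7! of
-- them.
arrangements : List (Arrangement 7)
arrangements = two-triples (choose₃ (idx 7))

two-triangle-shape : List (Fin 7 × Fin 7)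
two-triangle-shape = (0F , 1F) ∷ (0F , 2F) ∷ (1F , 2F) ∷ (3F , 4F) ∷ (3F , 5F) ∷ (4F , 5F) ∷ []

rowCount : ∀ {n} → Upper n → Fin n → ℕ
rowCount M i = ∑ (λ j → ind (cell M i j)) (idx _)

-- On seven vertices a rainbow graph above the bound has minimum degree three, so a poor row is as
-- contradictory as two disjoint triangles.
spoiled : Upper 7 → Bool
spoiled M = any (λ i → rowCount M i <ᵇ 3) (idx 7) ∨ anyFits two-triangle-shape (cell M) arrangements

-- Some non-edge f can be inserted so that the graph is spoiled whichever edge shares its colour.
refutable : List (List (Fin 7 × Fin 7)) → Upper 7 → Bool
insertable : List (List (Fin 7 × Fin 7)) → Upper 7 → Fin 7 × Fin 7 → Bool
deletable : List (List (Fin 7 × Fin 7)) → Upper 7 → Fin 7 × Fin 7 → Fin 7 × Fin 7 → Bool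
refutable [] M = spoiled M
refutable (fs ∷ fss) M = spoiled M ∨ any (insertable fss M) fs
insertable fss M (p , q) = (not (cell M p q) ∧ not (p == q)) ∧ (refutable fss (insert-delete M (p , q) (0F , 0F)) ∧ all
    (deletable fss M (p , q)) (pairsOf (idx 7)))
deletable fss M f (i , j) = not (cell M i j) ∨ refutable fss (insert-delete M f (i , j))

-- One list per round of insertion. Two rounds suffice, the second one restricted to the chords of
-- the path; short lists keep the search tree small.
candidates : List (List (Fin 7 × Fin 7))
candidates = ((3F , 5F) ∷ (4F , 6F) ∷ (0F , 3F) ∷ (0F , 4F) ∷ (0F , 5F) ∷ (0F , 6F) ∷ (1F , 3F) ∷ (1F , 4F) ∷ (1F , 5F) ∷
    (1F , 6F) ∷
  (2F , 3F) ∷ (2F , 4F) ∷ (2F , 5F) ∷ (2F , 6F) ∷ []) ∷ ((3F , 5F) ∷ (4F , 6F) ∷ []) ∷ []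

-- A triangle on 0 1 2 and the path 3 4 5 6, without the chords 35 and 46.
seven : (k₁ k₂ k₃ k₄ k₅ k₆ k₇ k₈ : Bool) → Vec Bool 13 → Upper 7
seven k₁ k₂ k₃ k₄ k₅ k₆ k₇ k₈ (xa ∷ xb ∷ xa′ ∷ xb′ ∷ ya ∷ yb ∷ ya′ ∷ yb′ ∷ za ∷ zb ∷ za′ ∷ zb′ ∷ ab′ ∷ []) =
  (k₁ ∷ k₂ ∷ xa ∷ xb ∷ xa′ ∷ xb′ ∷ []) , (k₃ ∷ ya ∷ yb ∷ ya′ ∷ yb′ ∷ []) , (za ∷ zb ∷ za′ ∷ zb′ ∷ []) ,
  (k₄ ∷ k₇ ∷ ab′ ∷ []) , (k₅ ∷ k₈ ∷ []) , (k₆ ∷ []) , [] , tt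

-- Fourteen is one more than `bound 0 1`. The thirteen free pairs are the twelve between the
-- triangle and the path, and the two ends of the path.
seven-check : Vec Bool 13 → Bool
seven-check b = (edgeCount (seven true true true true true true false false b) <ᵇ 14) ∨
  refutable candidates (seven true true true true true true false false b)

seven-refutable : allBools 13 seven-check ≡ true
seven-refutable = refl

module Coloured {N : ℕ} (𝒞 : EdgeColouring N) where

  -- Rainbow subgraphs of a coloured complete graph

  V : Set
  V = Fin N

  c : V → V → ℕ
  c = col 𝒞

  SameEdge : V → V → V → V → Set
  SameEdge a b x y = (a ≡ x × b ≡ y) ⊎ (a ≡ y × b ≡ x)

  record RainbowGraph (g : Graph V) : Set where
    constructor rainbow
    field
      simple : Simple g
      injective : ∀ {a b x y} → g a b ≡ true → g x y ≡ true → c a b ≡ c x y → SameEdge a b x y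
  open RainbowGraph public

  same : V → V → Bool
  same u v = does (u ≟ᶠ v)

  same⇒≡ : ∀ u v → same u v ≡ true → u ≡ v
  same⇒≡ u v p with u ≟ᶠ v
  ... | yes q = q

  hasColour : ℕ → V → V → Bool
  hasColour γ a b = does (c a b ≟ γ)

  hasColour⇒≡ : ∀ γ a b → hasColour γ a b ≡ true → c a b ≡ γ
  hasColour⇒≡ γ a b p = ≡ᵇ⇒≡ (c a b) γ (subst T (sym p) tt)

  sameEdge : V → V → Graph V
  sameEdge u w a b = (same a u ∧ same b w) ∨ (same a w ∧ same b u)

  sameEdge-sound : ∀ {u w a b} → sameEdge u w a b ≡ true → SameEdge a b u w
  sameEdge-sound {u} {w} {a} {b} p with ∨-true {same a u ∧ same b w} p
  ... | inj₁ q = inj₁ (same⇒≡ a u (proj₁ (∧-true q)) , same⇒≡ b w (proj₂ (∧-true {same a u} q)))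
  ... | inj₂ q = inj₂ (same⇒≡ a w (proj₁ (∧-true q)) , same⇒≡ b u (proj₂ (∧-true {same a w} q)))

  same-refl : ∀ u → same u u ≡ true
  same-refl u = dec-true (u ≟ᶠ u) refl

  sameEdge-complete : ∀ {u w a b} → SameEdge a b u w → sameEdge u w a b ≡ true
  sameEdge-complete {u} {w} (inj₁ (refl , refl)) rewrite same-refl u | same-refl w = refl
  sameEdge-complete {u} {w} (inj₂ (refl , refl)) rewrite same-refl u | same-refl w with same w u ∧ same u w
  ... | true = refl
  ... | false = refl

  sameEdge-colour : ∀ {a b x y} → SameEdge a b x y → c a b ≡ c x y
  sameEdge-colour (inj₁ (refl , refl)) = refl
  sameEdge-colour {a} {b} (inj₂ (refl , refl)) = col-sym 𝒞 a b

  SameEdge-flip : ∀ {a b x y} → SameEdge a b x y → SameEdge b a x y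
  SameEdge-flip (inj₁ (p , q)) = inj₂ (q , p)
  SameEdge-flip (inj₂ (p , q)) = inj₁ (q , p)

  bool-ext : ∀ {a b : Bool} → (a ≡ true → b ≡ true) → (b ≡ true → a ≡ true) → a ≡ b
  bool-ext {true} f h = sym (f refl)
  bool-ext {false} {true} f h = h refl
  bool-ext {false} {false} f h = refl

  avoid : Graph V → ℕ → Graph V
  avoid g γ a b = g a b ∧ not (hasColour γ a b)

  -- Since g is rainbow, at most one edge is lost to the new one.
  exchange-edge : Graph V → V → V → Graph V
  exchange-edge g u w a b = sameEdge u w a b ∨ avoid g (c u w) a b

  not-true : ∀ {b} → not b ≡ true → b ≡ true → ⊥
  not-true {true} () _

  avoid-sound : ∀ {g γ a b} → avoid g γ a b ≡ true → g a b ≡ true × c a b ≢ γ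
  avoid-sound {g} {γ} {a} {b} p = proj₁ (∧-true p) , λ q →
    not-true (proj₂ (∧-true {g a b} p)) (dec-true (c a b ≟ γ) q)

  avoid-complete : ∀ {g γ a b} → g a b ≡ true → c a b ≢ γ → avoid g γ a b ≡ true
  avoid-complete {g} {γ} {a} {b} p q rewrite p | dec-false (c a b ≟ γ) q = refl

  hasColour-sym : ∀ γ a b → hasColour γ a b ≡ hasColour γ b a
  hasColour-sym γ a b = cong (λ k → does (k ≟ γ)) (col-sym 𝒞 a b)

  avoid-simple : ∀ {g} γ → Simple g → Simple (avoid g γ)
  avoid-simple γ s .symm a b = cong₂ (λ p q → p ∧ not q) (symm s a b) (hasColour-sym γ a b)
  avoid-simple γ s .irrefl a = cong (_∧ _) (irrefl s a)

  ∨-introˡ : ∀ {a b} → a ≡ true → a ∨ b ≡ true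
  ∨-introˡ refl = refl

  ∨-introʳ : ∀ {a b} → b ≡ true → a ∨ b ≡ true
  ∨-introʳ {true} _ = refl
  ∨-introʳ {false} p = p

  false-if : ∀ {b} → (b ≡ true → ⊥) → b ≡ false
  false-if {true} f = ⊥-elim (f refl)
  false-if {false} f = refl

  module _ {g : Graph V} (R : RainbowGraph g) {u w : V} (u≢w : u ≢ w) where

    kept : ∀ {a b} → g a b ≡ true → c a b ≢ c u w → exchange-edge g u w a b ≡ true
    kept p q = ∨-introʳ (avoid-complete {g} p q)

    added : exchange-edge g u w u w ≡ true
    added = ∨-introˡ (sameEdge-complete {u} {w} (inj₁ (refl , refl)))

    exchanged : ∀ {a b} → exchange-edge g u w a b ≡ true → SameEdge a b u w ⊎ (g a b ≡ true × c a b ≢ c u w)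
    exchanged {a} {b} p with ∨-true {sameEdge u w a b} p
    ... | inj₁ q = inj₁ (sameEdge-sound q)
    ... | inj₂ q = inj₂ (avoid-sound {g} q)

    exchange-flip : ∀ {a b} → exchange-edge g u w a b ≡ true → exchange-edge g u w b a ≡ true
    exchange-flip p with exchanged p
    ... | inj₁ q = ∨-introˡ (sameEdge-complete (SameEdge-flip q))
    ... | inj₂ (q , r) = kept (flip-edge (simple R) q) (λ eq → r (trans (col-sym 𝒞 _ _) eq))

    exchange-rainbow : RainbowGraph (exchange-edge g u w)
    exchange-rainbow .simple .symm a b = bool-ext exchange-flip exchange-flip
    exchange-rainbow .simple .irrefl a = false-if λ p → loop (exchanged p)
      where
      loop : SameEdge a a u w ⊎ (g a a ≡ true × c a a ≢ c u w) → ⊥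
      loop (inj₁ (inj₁ (refl , q))) = u≢w q
      loop (inj₁ (inj₂ (refl , q))) = u≢w (sym q)
      loop (inj₂ (p , _)) = edge-≢ (simple R) p refl
    exchange-rainbow .injective {a} {b} {x} {y} p q eq with exchanged p | exchanged q
    ... | inj₂ (p′ , _) | inj₂ (q′ , _) = injective R p′ q′ eq
    ... | inj₁ s | inj₂ (_ , d) = ⊥-elim (d (trans (sym eq) (sameEdge-colour s)))
    ... | inj₂ (_ , d) | inj₁ s = ⊥-elim (d (trans eq (sameEdge-colour s)))
    ... | inj₁ (inj₁ (refl , refl)) | inj₁ (inj₁ (refl , refl)) = inj₁ (refl , refl)
    ... | inj₁ (inj₁ (refl , refl)) | inj₁ (inj₂ (refl , refl)) = inj₂ (refl , refl)
    ... | inj₁ (inj₂ (refl , refl)) | inj₁ (inj₁ (refl , refl)) = inj₂ (refl , refl)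
    ... | inj₁ (inj₂ (refl , refl)) | inj₁ (inj₂ (refl , refl)) = inj₁ (refl , refl)

  Unique-↭ : ∀ {X Y : List V} → X ↭ Y → Unique X → Unique Y
  Unique-↭ σ = PermS.Unique-resp-↭ (setoid V) (↭⇒↭ₛ σ)

  ∈-front : ∀ {v : V} {X} → v ∈ X → ∃[ Y ] X ↭ v ∷ Y
  ∈-front {v} v∈X with ∈-∃++ v∈X
  ... | xs , ys , refl = xs ++ ys , shift v xs ys

  ∈-front₂ : ∀ {u w : V} {X} → u ∈ X → w ∈ X → u ≢ w → ∃[ Y ] X ↭ u ∷ w ∷ Y
  ∈-front₂ {u} u∈X w∈X u≢w with ∈-front u∈X
  ... | Y , σ with ∈-resp-↭ σ w∈X
  ...   | here refl = ⊥-elim (u≢w refl)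
  ...   | there w∈Y with ∈-front w∈Y
  ...     | Z , τ = Z , ptrans σ (prep u τ)

  front-∈ : ∀ {v : V} {X Y} → X ↭ v ∷ Y → v ∈ X
  front-∈ σ = ∈-resp-↭ (↭-sym σ) (here refl)

  front₂-∈ : ∀ {u v : V} {X Y} → X ↭ u ∷ v ∷ Y → v ∈ X
  front₂-∈ σ = ∈-resp-↭ (↭-sym σ) (there (here refl))

  e-additive : ∀ {g f h : Graph V} → (∀ a b → ind (g a b) ≡ ind (f a b) + ind (h a b)) → ∀ X → e g X ≡ e f X + e h X
  e-additive eq [] = refl
  e-additive {g} {f} {h} eq (v ∷ X) rewrite e-additive {g} {f} {h} eq X | ∑-cong X (eq v) | ∑-distrib (λ w → ind (f v w))
      (λ w → ind (h v w)) X =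
    interleave (deg f v X) (deg h v X) (e f X) (e h X)
    where
    interleave : ∀ a b s t → a + b + (s + t) ≡ a + s + (b + t)
    interleave = solve-∀

  e-mono : ∀ {f h : Graph V} → (∀ a b → ind (f a b) ≤ ind (h a b)) → ∀ X → e f X ≤ e h X
  e-mono le [] = z≤n
  e-mono le (v ∷ X) = +-mono-≤ (∑-mono X (le v)) (e-mono le X)

  ind-mono : ∀ {a b} → (a ≡ true → b ≡ true) → ind a ≤ ind b
  ind-mono {true} f rewrite f refl = ≤-refl
  ind-mono {false} f = z≤n

  e-single : ∀ {h : Graph V} → Simple h → (∀ {a b x y} → h a b ≡ true → h x y ≡ true → SameEdge a b x y) →
    ∀ {X} → Unique X → e h X ≤ 1
  e-single s one [] = z≤n
  e-single {h} s one {v ∷ X} (v∉X ∷ uX) with neighbour? h v X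
  ... | inj₂ none = subst (λ d → d + e h X ≤ 1) (sym none) (e-single s one uX)
  ... | inj₁ (w , Y , σ , vw) with edge? h X
  ...   | inj₁ (a , b , Z , τ , ab) = ⊥-elim (absurd (one vw ab))
    where
    absurd : SameEdge v w a b → ⊥
    absurd (inj₁ (refl , _)) = All.lookup v∉X (front-∈ τ) refl
    absurd (inj₂ (refl , _)) = All.lookup v∉X (front₂-∈ τ) refl
  ...   | inj₂ none with neighbour? h v Y
  ...     | inj₂ none′ = ≤-reflexive (cong₂ _+_ (trans (∑-↭ _ σ) (cong₂ _+_ (cong ind vw) none′)) none)
  ...     | inj₁ (w′ , Z , τ , vw′) = ⊥-elim (absurd (one vw vw′) (Unique-↭ σ uX))
    where
    absurd : SameEdge v w v w′ → Unique (w ∷ Y) → ⊥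
    absurd (inj₁ (_ , refl)) (w∉Y ∷ _) = All.lookup w∉Y (front-∈ τ) refl
    absurd (inj₂ (refl , refl)) _ = edge-≢ s vw refl

  module _ {g : Graph V} (R : RainbowGraph g) {u w : V} (u≢w : u ≢ w) where

    -- In a rainbow graph, deleting a colour costs at most one edge. The pair `uw` is certainly
    -- absent after the deletion of its own colour, so inserting it gains one.
    e-exchange : ∀ {L} → Unique L → u ∈ L → w ∈ L → e g L ≤ e (exchange-edge g u w) L
    e-exchange {L} uL u∈L w∈L with ∈-front₂ u∈L w∈L u≢w
    ... | Y , σ = begin
      e g L                             ≡⟨ e-additive {g} {avoid g γ} {lost} split L ⟩
      e (avoid g γ) L + e lost L        ≤⟨ +-monoʳ-≤ (e (avoid g γ) L) (e-single lost-simple lost-one uL) ⟩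
      e (avoid g γ) L + 1               ≡⟨ cong (_+ 1) (e-↭ (avoid-simple γ (simple R)) σ) ⟩
      e (avoid g γ) (u ∷ w ∷ Y) + 1     ≤⟨ gain (cong ind absent) (cong ind (added R u≢w))
                                            (∑-mono Y (λ v → mono u v)) (∑-mono Y (λ v → mono w v)) (e-mono mono Y) ⟩
      e (exchange-edge g u w) (u ∷ w ∷ Y) ≡⟨ e-↭ (simple (exchange-rainbow R u≢w)) σ ⟨
      e (exchange-edge g u w) L         ∎
      where
      open ≤-Reasoning
      γ = c u w
      lost : Graph V
      lost a b = g a b ∧ hasColour γ a b
      split : ∀ a b → ind (g a b) ≡ ind (avoid g γ a b) + ind (lost a b)
      split a b with g a b | hasColour γ a b
      ... | true | true = refl
      ... | true | false = refl
      ... | false | _ = refl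
      lost-simple : Simple lost
      lost-simple .symm a b = cong₂ _∧_ (symm (simple R) a b) (hasColour-sym γ a b)
      lost-simple .irrefl a = cong (_∧ hasColour γ a a) (irrefl (simple R) a)
      lost-one : ∀ {a b x y} → lost a b ≡ true → lost x y ≡ true → SameEdge a b x y
      lost-one {a} {b} {x} {y} p q = injective R (proj₁ (∧-true p)) (proj₁ (∧-true q))
        (trans (hasColour⇒≡ γ a b (proj₂ (∧-true {g a b} p))) (sym (hasColour⇒≡ γ x y (proj₂ (∧-true {g x y} q)))))
      mono : ∀ a b → ind (avoid g γ a b) ≤ ind (exchange-edge g u w a b)
      mono a b = ind-mono (∨-introʳ {sameEdge u w a b})
      absent : avoid g γ u w ≡ false
      absent = false-if λ p → proj₂ (avoid-sound {g} p) refl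
      gain′ : ∀ i i' a b f a' b' f' → i ≡ 0 → i' ≡ 1 → a ≤ a' → b ≤ b' → f ≤ f' → i + a + (b + f) + 1 ≤ i' + a' + (b' + f')
      gain′ i i' a b f a' b' f' h0 h1 h2 h3 h4 = deduce (i ∷ i' ∷ a ∷ b ∷ f ∷ a' ∷ b' ∷ f' ∷ []) 1
          (x0 ⊕ x2 ⊕ (x3 ⊕ x4) ⊕ K 1 ⊑ x1 ⊕ x5 ⊕ (x6 ⊕ x7)) (1 , x0 ⊑ K 0 · 1 , K 1 ⊑ x1 · 1 , x2 ⊑ x5 · 1 , x3 ⊑ x6 · 1 , x4 ⊑
          x7 · done) (≤-reflexive h0 , ≤-reflexive (sym h1) , h2 , h3 , h4 , tt)
      gain = gain′ (ind (avoid g γ u w)) (ind (exchange-edge g u w u w)) (deg (avoid g γ) u Y) (deg (avoid g γ) w Y)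
          (e (avoid g γ) Y) (deg (exchange-edge g u w) u Y) (deg (exchange-edge g u w) w Y) (e (exchange-edge g u w) Y)

  -- Inserting the edges of another rainbow graph

  record Absorbed (g : Graph V) (es : List (V × V)) : Set where
    field
      graph : Graph V
      rainbows : RainbowGraph graph
      inserted : All (λ { (u , w) → graph u w ≡ true }) es
      preserved : ∀ {a b} → g a b ≡ true → All (λ { (u , w) → c a b ≢ c u w }) es → graph a b ≡ true
      larger : ∀ {L} → Unique L → All (λ { (u , w) → u ∈ L × w ∈ L }) es → e g L ≤ e graph L
  open Absorbed public

  -- An insertion can only expel an earlier inserted edge if their colours agree. Both belong to the
  -- rainbow graph `h`, so they are then the same edge.
  absorb : ∀ {g h} → RainbowGraph g → RainbowGraph h → (es : List (V × V)) → All (λ { (u , w) → h u w ≡ true }) es → Absorbed g es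
  absorb R S [] [] = record { graph = _ ; rainbows = R ; inserted = [] ; preserved = λ p _ → p ; larger = λ _ _ → ≤-refl }
  absorb {g} {h} R S ((u , w) ∷ es) (uw ∷ hs) with absorb R S es hs
  ... | A = record
    { graph = exchange-edge (graph A) u w
    ; rainbows = exchange-rainbow (rainbows A) u≢w
    ; inserted = added (rainbows A) u≢w ∷ still (inserted A) hs
    ; preserved = λ { p (d ∷ ds) → kept (rainbows A) u≢w (preserved A p ds) d }
    ; larger = λ { uL ((u∈L , w∈L) ∷ ins) → ≤-trans (larger A uL ins) (e-exchange (rainbows A) u≢w uL u∈L w∈L) }
    }
    where
    u≢w = edge-≢ (simple S) uw
    still : ∀ {fs : List (V × V)} → All (λ { (u , w) → graph A u w ≡ true }) fs → All (λ { (u , w) → h u w ≡ true }) fs →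
      All (λ { (a , b) → exchange-edge (graph A) u w a b ≡ true }) fs
    still [] [] = []
    still {(a , b) ∷ fs} (p ∷ ps) (q ∷ qs) with c a b ≟ c u w
    ... | no d = kept (rainbows A) u≢w p d ∷ still ps qs
    ... | yes eq = ∨-introˡ (sameEdge-complete (injective S q uw eq)) ∷ still ps qs

  -- The graph is existential: whether a packing exists depends on the colouring alone, so its
  -- absence outlasts every exchange of edges.
  RainbowPacking : List V → ℕ → Set
  RainbowPacking L k = ∃[ g ] RainbowGraph g × Packs g k L

  sides : List (Triple V) → List (V × V)
  sides [] = []
  sides ((x , y , z) ∷ P) = (x , y) ∷ (x , z) ∷ (y , z) ∷ sides P

  tri⇒sides : ∀ {g P} → All (IsTri g) P → All (λ { (u , w) → g u w ≡ true }) (sides P)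
  tri⇒sides [] = []
  tri⇒sides ((p , q , r) ∷ ts) = p ∷ q ∷ r ∷ tri⇒sides ts

  sides⇒tri : ∀ {g} P → All (λ { (u , w) → g u w ≡ true }) (sides P) → All (IsTri g) P
  sides⇒tri [] [] = []
  sides⇒tri (_ ∷ P) (p ∷ q ∷ r ∷ ss) = (p , q , r) ∷ sides⇒tri P ss

  sides⊆flat : ∀ P → All (λ { (u , w) → u ∈ flat P × w ∈ flat P }) (sides P)
  sides⊆flat [] = []
  sides⊆flat (_ ∷ P) = (here refl , there (here refl)) ∷ (here refl , there (there (here refl))) ∷
    (there (here refl) , there (there (here refl))) ∷
    All.map (λ { (p , q) → there (there (there p)) , there (there (there q)) }) (sides⊆flat P)

  flat⊆ : ∀ {g P R L v} → Packing {V} g P R L → v ∈ flat P → v ∈ L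
  flat⊆ pk v∈P = ∈-resp-↭ (partition pk) (∈-++⁺ˡ v∈P)

  -- Absorbing the sides of the triangles costs no edge, so a packing found in some other rainbow
  -- graph may be taken to lie in a dense one.
  with-packing : ∀ {g L t} → RainbowGraph g → Unique L → RainbowPacking L t →
    ∃[ g′ ] RainbowGraph g′ × e g L ≤ e g′ L × Packs g′ t L
  with-packing R uL (h , S , P , X , len , pk) with absorb R S (sides P) (tri⇒sides (triangles pk))
  ... | A = graph A , rainbows A , larger A uL (All.map (λ { (p , q) → flat⊆ pk p , flat⊆ pk q }) (sides⊆flat P)) ,
    P , X , len , (sides⇒tri P (inserted A) , partition pk)

  -- The three sides are absorbed into the graph of the packing. This expels only edges with their
  -- colours, and no such edge lies inside `L`.
  join-triangle : ∀ {g x y z L k} → RainbowGraph g → IsTri g (x , y , z) →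
    (∀ {p q} → p ∈ L → q ∈ L → p ≢ q → c p q ≢ c x y × c p q ≢ c x z × c p q ≢ c y z) →
    RainbowPacking L k → RainbowPacking (x ∷ y ∷ z ∷ L) (suc k)
  join-triangle {x = x} {y} {z} {L} R (xy , xz , yz) clean (h , S , P , X , len , pk)
    with absorb S R ((x , y) ∷ (x , z) ∷ (y , z) ∷ []) (xy ∷ xz ∷ yz ∷ [])
  ... | A = graph A , rainbows A , (x , y , z) ∷ P , X , cong suc len ,
    ((All.head (sides⇒tri ((x , y , z) ∷ []) (inserted A)) ∷ keep) , prep x (prep y (prep z (partition pk))))
    where
    survives : ∀ {P} → All (λ { (u , w) → h u w ≡ true }) (sides P) → All (λ { (u , w) → u ∈ L × w ∈ L }) (sides P) → All
        (λ { (u , w) → graph A u w ≡ true }) (sides P)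
    survives {P} ps qs = All.zipWith (λ { {u , w} (p , u∈L , w∈L) → let d₁ , d₂ , d₃ = clean u∈L w∈L (edge-≢ (simple S) p) in
      preserved A p (d₁ ∷ d₂ ∷ d₃ ∷ []) }) (ps , qs)
    keep = sides⇒tri P (survives {P} (tri⇒sides (triangles pk)) (All.map (λ { (p , q) → flat⊆ pk p , flat⊆ pk q })
        (sides⊆flat P)))

  -- Where the colour of an inserted edge occurs

  monochrome : ℕ → Graph V
  monochrome γ a b = not (same a b) ∧ hasColour γ a b

  monochrome-simple : ∀ γ → Simple (monochrome γ)
  monochrome-simple γ .symm a b = cong₂ (λ p q → not p ∧ q) (bool-ext (flip a b) (flip b a)) (hasColour-sym γ a b)
    where
    flip : ∀ a b → same a b ≡ true → same b a ≡ true
    flip a b p with same⇒≡ a b p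
    ... | refl = p
  monochrome-simple γ .irrefl a rewrite same-refl a = refl

  e-zero : ∀ {h : Graph V} → Simple h → ∀ {X p q} → e h X ≡ 0 → p ∈ X → q ∈ X → p ≢ q → h p q ≡ true → ⊥
  e-zero {h} s {X} {p} {q} z p∈X q∈X p≢q pq with ∈-front₂ p∈X q∈X p≢q
  ... | Y , σ with trans (sym z) (e-↭ s σ)
  ...   | eq rewrite pq with eq
  ...     | ()

  colour? : ∀ γ X → (∃[ p ] ∃[ q ] ∃[ Y ] X ↭ p ∷ q ∷ Y × p ≢ q × c p q ≡ γ)
    ⊎ (∀ {p q} → p ∈ X → q ∈ X → p ≢ q → c p q ≢ γ)
  colour? γ X with edge? (monochrome γ) X
  ... | inj₁ (p , q , Y , σ , m) = inj₁ (p , q , Y , σ , edge-≢ (monochrome-simple γ) m ,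
          hasColour⇒≡ γ p q (proj₂ (∧-true {not (same p q)} m)))
  ... | inj₂ z = inj₂ λ {p} {q} p∈X q∈X p≢q eq → e-zero (monochrome-simple γ) z p∈X q∈X p≢q
          (cong₂ (λ a b → not a ∧ b) (dec-false (p ≟ᶠ q) p≢q) (dec-true (c p q ≟ γ) eq))

  ∑-tight : {A : Set} (f : A → ℕ) (k : ℕ) {xs : List A} → All (λ x → f x ≤ k) xs → k * length xs ≤ ∑ f xs →
    All (λ x → k ≤ f x) xs
  ∑-tight f k [] _ = []
  ∑-tight f k {x ∷ xs} (p ∷ ps) le = first (f x) k (∑ f xs) (k * length xs) le′ (∑-bound f k ps) ∷
    ∑-tight f k ps (later (f x) k (∑ f xs) (k * length xs) le′ p)
    where
    le′ : k + k * length xs ≤ f x + ∑ f xs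
    le′ = ≤-trans (≤-reflexive (sym (*-suc k (length xs)))) le
    first : ∀ a k s l → k + l ≤ a + s → s ≤ l → k ≤ a
    first a k s l h0 h1 = deduce (a ∷ k ∷ s ∷ l ∷ []) 1 (x1 ⊑ x0) (1 , x1 ⊕ x3 ⊑ x0 ⊕ x2 · 1 , x2 ⊑ x3 · done) (h0 , h1 , tt)
    later : ∀ a k s l → k + l ≤ a + s → a ≤ k → l ≤ s
    later a k s l h0 h1 = deduce (a ∷ k ∷ s ∷ l ∷ []) 1 (x3 ⊑ x2) (1 , x1 ⊕ x3 ⊑ x0 ⊕ x2 · 1 , x0 ⊑ x1 · done) (h0 , h1 , tt)

  unique-apart : ∀ {u v : V} {X} → Unique (u ∷ X) → v ∈ X → u ≢ v
  unique-apart (p ∷ _) v∈X = All.lookup p v∈X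

  SideColour : ℕ → Triple V → Set
  SideColour γ (x , y , z) = c x y ≡ γ ⊎ c x z ≡ γ ⊎ c y z ≡ γ

  sideColour? : ∀ γ t → SideColour γ t ⊎ (let x , y , z = t in c x y ≢ γ × c x z ≢ γ × c y z ≢ γ)
  sideColour? γ (x , y , z) with c x y ≟ γ | c x z ≟ γ | c y z ≟ γ
  ... | yes p | _ | _ = inj₁ (inj₁ p)
  ... | no _ | yes p | _ = inj₁ (inj₂ (inj₁ p))
  ... | no _ | no _ | yes p = inj₁ (inj₂ (inj₂ p))
  ... | no p | no q | no r = inj₂ (p , q , r)

  module _ {g : Graph V} (R : RainbowGraph g) where

    coloured-side : ∀ {γ t} → IsTri g t → SideColour γ t →
      ∃[ p ] ∃[ q ] p ∈ corners t × q ∈ corners t × g p q ≡ true × c p q ≡ γ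
    coloured-side {t = x , y , z} (xy , xz , yz) (inj₁ p) = x , y , here refl , there (here refl) , xy , p
    coloured-side {t = x , y , z} (xy , xz , yz) (inj₂ (inj₁ p)) = x , z , here refl , there (there (here refl)) , xz , p
    coloured-side {t = x , y , z} (xy , xz , yz) (inj₂ (inj₂ p)) = y , z , there (here refl) , there (there (here refl)) , yz , p

    outside-colour : ∀ {γ t a b} → IsTri g t → SideColour γ t → (∀ {v} → v ∈ corners t → v ≢ a) → g a b ≡ true → c a b ≢ γ
    outside-colour tri side a∉t ab eq with coloured-side tri side
    ... | p , q , p∈t , q∈t , pq , refl with injective R ab pq eq
    ...   | inj₁ (refl , _) = a∉t p∈t refl
    ...   | inj₂ (refl , _) = a∉t q∈t refl

    module _ {u w : V} (u≢w : u ≢ w) where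

      g′ = exchange-edge g u w

      kept-triangle : ∀ {x y z} → IsTri g (x , y , z) → c x y ≢ c u w × c x z ≢ c u w × c y z ≢ c u w → IsTri g′ (x , y , z)
      kept-triangle (xy , xz , yz) (p , q , r) = kept R u≢w xy p , kept R u≢w xz q , kept R u≢w yz r

      kept-triangles : ∀ {P} → All (IsTri g) P → All (λ t → let x , y , z = t in c x y ≢ c u w × c x z ≢ c u w × c y z ≢ c u w) P → All (IsTri g′) P
      kept-triangles ts ps = All.zipWith (λ (p , q) → kept-triangle p q) (ts , ps)

      module _ {t : Triple V} (tri : IsTri g t) (side : SideColour (c u w) t) {X : List V} (uX : Unique (corners t ++ X)) where

        apart : ∀ {a} → a ∈ X → ∀ {v} → v ∈ corners t → v ≢ a
        apart a∈X (here refl) = unique-apart uX (there (there a∈X))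
        apart a∈X (there (here refl)) = unique-apart (AllPairs.tail uX) (there a∈X)
        apart a∈X (there (there (here refl))) = unique-apart (AllPairs.tail (AllPairs.tail uX)) a∈X

        -- The only edge of `g` with the inserted colour is a side of `t`, and `a` is no corner of
        -- `t`.
        kept-outside : ∀ {a b} → a ∈ X → g a b ≡ true → g′ a b ≡ true
        kept-outside a∈X ab = kept R u≢w ab (outside-colour tri side (apart a∈X) ab)

        kept-all-outside : ∀ {P} → (∀ {v} → v ∈ flat P → v ∈ X) → All (IsTri g) P → All (IsTri g′) P
        kept-all-outside {[]} sub [] = []
        kept-all-outside {_ ∷ P} sub ((xy , xz , yz) ∷ ts) =
          (kept-outside (sub (here refl)) xy , kept-outside (sub (here refl)) xz , kept-outside (sub (there (here refl))) yz)
          ∷ kept-all-outside (λ v∈P → sub (there (there (there v∈P)))) ts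

    -- An edge ab of the rest, disjoint from a cherry x u y there, with a common neighbour in t.
    record Spare (x y : V) (rest : List V) (t : Triple V) : Set where
      constructor spare
      field
        {u a b} : V
        {X} : List V
        split : rest ↭ x ∷ y ∷ u ∷ a ∷ b ∷ X
        xu : g x u ≡ true
        yu : g y u ≡ true
        ab : g a b ≡ true
        many : 4 ≤ deg g a (corners t) + deg g b (corners t)

    -- Inserting xy closes a triangle at v or v′, unless its colour lies on a triangle t of the packing;
    -- then t gives way to xyu and to abz with z in t.
    close-cherry : ∀ {P x y v v′ X L} → Unique L → Packing g P (x ∷ y ∷ v ∷ v′ ∷ X) L →
      g x v ≡ true → g y v ≡ true → g x v′ ≡ true → g y v′ ≡ true →
      All (Spare x y (x ∷ y ∷ v ∷ v′ ∷ X)) P → RainbowPacking L (suc (length P))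
    close-cherry {P} {x} {y} {v} {v′} {X} {L} uL pk xv yv xv′ yv′ spares
      with search (sideColour? (c x y)) P
    ... | inj₂ free = exchange-edge g x y , exchange-rainbow R x≢y , cherry
      where
      uR : Unique (x ∷ y ∷ v ∷ v′ ∷ (X ++ flat P))
      uR = Unique-↭ (↭-sym (ptrans (++-comm (x ∷ y ∷ v ∷ v′ ∷ X) (flat P)) (partition pk))) uL
      x≢y = unique-apart uR (here refl)
      v≢v′ : v ≢ v′
      v≢v′ = unique-apart (AllPairs.tail (AllPairs.tail uR)) (here refl)
      pk′ : Packing (exchange-edge g x y) P (x ∷ y ∷ v ∷ v′ ∷ X) L
      pk′ = kept-triangles x≢y (triangles pk) free , partition pk
      x≢v = edge-≢ (simple R) xv
      y≢v = edge-≢ (simple R) yv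
      through : ∀ {u Y} → x ∷ y ∷ v ∷ v′ ∷ X ↭ x ∷ y ∷ u ∷ Y → g x u ≡ true → g y u ≡ true → c x u ≢ c x y → c y u ≢ c x y →
        Packs (exchange-edge g x y) (suc (length P)) L
      through σ xu yu p q = _ , _ , refl , add-triangle (added R x≢y , kept R x≢y xu p , kept R x≢y yu q) σ pk′
      -- An edge at `v` and an edge at `v′` of the two cherries are distinct, so the colour of `xy`
      -- can spoil only one of the cherries.
      separate : ∀ {s t} → (s ≡ x ⊎ s ≡ y) → (t ≡ x ⊎ t ≡ y) → g s v ≡ true → g t v′ ≡ true → c s v ≡ c x y → c t v′ ≢ c x y
      separate s∈ t∈ sv tv′ p q with injective R sv tv′ (trans p (sym q))
      ... | inj₁ (_ , eq) = v≢v′ eq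
      separate s∈ (inj₁ refl) sv tv′ p q | inj₂ (_ , eq) = x≢v (sym eq)
      separate s∈ (inj₂ refl) sv tv′ p q | inj₂ (_ , eq) = y≢v (sym eq)
      cherry : Packs (exchange-edge g x y) (suc (length P)) L
      cherry with c x v ≟ c x y | c y v ≟ c x y
      ... | no p | no q = through refl xv yv p q
      ... | yes p | _ = through (prep x (prep y (pswap v v′ refl))) xv′ yv′
              (separate (inj₁ refl) (inj₁ refl) xv xv′ p) (separate (inj₁ refl) (inj₂ refl) xv yv′ p)
      ... | no _ | yes p = through (prep x (prep y (pswap v v′ refl))) xv′ yv′
              (separate (inj₂ refl) (inj₁ refl) yv xv′ p) (separate (inj₂ refl) (inj₂ refl) yv yv′ p)
    ... | inj₁ (t , P′ , σ , side) with reorder σ pk | All-resp-↭ σ spares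
    -- Four edges into three corners give `a` and `b` a common corner `z`.
    ...   | pk₁ | spare {u} {a} {b} {Y} τ xu yu ab many ∷ _ with common? g a b (corners t)
    ...     | inj₂ few = ⊥-elim (<⇒≱ many few)
    ...     | inj₁ (z , Z , ρ , az , bz) = exchange-edge g x y , exchange-rainbow R x≢y ,
              (x , y , u) ∷ (z , a , b) ∷ P′ , Z ++ Y , cong suc (sym (↭-length σ)) ,
              ((added R x≢y , keep x∈ xu , keep y∈ yu) ∷
               (exchange-flip R x≢y (keep a∈ az) , exchange-flip R x≢y (keep b∈ bz) , keep a∈ ab) ∷
               kept-all-outside x≢y tri side uT ∈-++⁺ˡ (All.tail (triangles pk₂)) ,
               repartition (t ∷ []) ((x , y , u) ∷ (z , a , b) ∷ []) (x ∷ y ∷ u ∷ a ∷ b ∷ []) Z {P′} {Y} moved (partition pk₂))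
      where
      pk₂ : Packing g (t ∷ P′) (x ∷ y ∷ u ∷ a ∷ b ∷ Y) L
      pk₂ = reorder-rest τ pk₁
      tri = All.head (triangles pk₂)
      uT : Unique (corners t ++ (flat P′ ++ (x ∷ y ∷ u ∷ a ∷ b ∷ Y)))
      uT = Unique-↭ (↭-sym (partition pk₂)) uL
      uR : Unique (x ∷ y ∷ u ∷ a ∷ b ∷ (Y ++ flat (t ∷ P′)))
      uR = Unique-↭ (↭-sym (ptrans (++-comm (x ∷ y ∷ u ∷ a ∷ b ∷ Y) (flat (t ∷ P′))) (partition pk₂))) uL
      x≢y = unique-apart uR (here refl)
      keep : ∀ {s s′} → s ∈ x ∷ y ∷ u ∷ a ∷ b ∷ Y → g s s′ ≡ true → exchange-edge g x y s s′ ≡ true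
      keep s∈ = kept-outside x≢y tri side uT (∈-++⁺ʳ (flat P′) s∈)
      x∈ = here refl
      y∈ = there (here refl)
      a∈ = there (there (there (here refl)))
      b∈ = there (there (there (there (here refl))))
      moved : flat ((x , y , u) ∷ (z , a , b) ∷ []) ++ Z ↭ flat (t ∷ []) ++ (x ∷ y ∷ u ∷ a ∷ b ∷ [])
      moved = begin
        (x ∷ y ∷ u ∷ z ∷ a ∷ b ∷ []) ++ Z   ↭⟨ ++⁺ʳ Z (shift z (x ∷ y ∷ u ∷ []) (a ∷ b ∷ [])) ⟩
        z ∷ ((x ∷ y ∷ u ∷ a ∷ b ∷ []) ++ Z) ↭⟨ prep z (++-comm (x ∷ y ∷ u ∷ a ∷ b ∷ []) Z) ⟩
        (z ∷ Z) ++ (x ∷ y ∷ u ∷ a ∷ b ∷ []) ↭⟨ ++⁺ʳ (x ∷ y ∷ u ∷ a ∷ b ∷ []) ρ ⟨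
        corners t ++ (x ∷ y ∷ u ∷ a ∷ b ∷ []) ≡⟨ cong (_++ (x ∷ y ∷ u ∷ a ∷ b ∷ [])) (++-identityʳ (corners t)) ⟨
        flat (t ∷ []) ++ (x ∷ y ∷ u ∷ a ∷ b ∷ []) ∎
        where open PermutationReasoning

  -- Packings one short of Dirac's degree sum

  module Critical {g : Graph V} (R : RainbowGraph g) {L : List V} (uL : Unique L) (t : ℕ)
    (ed : EdgeDegree (simple R) (length L + t) L) where

    private
      s = simple R

    Larger : Set
    Larger = Packs g (suc t) L

    weight : V → Triple V → ℕ
    weight v T = deg g v (corners T)

    record Tight (P : List (Triple V)) (p q p′ q′ : V) (rest : List V) : Set where
      field
        exact : All (λ T → weight p T + weight q T + (weight p′ T + weight q′ T) ≡ 8) P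
        full : length rest ≤ deg g p rest + deg g q rest
        full′ : length rest ≤ deg g p′ rest + deg g q′ rest
    open Tight

    -- The degree sum is one less than in `extend`, so each edge sends at least 4t edges to the
    -- packing. As both together send at most 8t, equality holds at every triangle and in the rest.
    tight : ∀ {P p q p′ q′ X} → length P ≡ t → Packing g P (p ∷ q ∷ p′ ∷ q′ ∷ X) L → g p q ≡ true → g p′ q′ ≡ true →
      Larger ⊎ Tight P p q p′ q′ (p ∷ q ∷ p′ ∷ q′ ∷ X)
    tight {P} {p} {q} {p′} {q′} {X} refl pk pq p′q′
      with augment-step s pk pq p′q′ | edge-to-packing s {X = []} pk pq | edge-to-packing s {X = p ∷ q ∷ []} pk p′q′
    ... | inj₁ larger | _ | _ = inj₁ larger
    ... | inj₂ _ | inj₁ larger | _ = inj₁ larger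
    ... | inj₂ _ | inj₂ _ | inj₁ larger = inj₁ larger
    ... | inj₂ small | inj₂ le | inj₂ le′ = inj₂ record
      { exact = All.zipWith (λ (x , y) → ≤-antisym x y) (small , ∑-tight (λ T → w T + w′ T) 8 small
          (≤-trans (eights (length P) (length X) (∑ w P) (∑ w′ P) _ _ _ size ed₁ ed₂ le le′)
              (≤-reflexive (sym (∑-distrib w w′ P)))))
      ; full = filled (length P) (length X) (∑ w P) (∑ w′ P) (deg g p rest) (deg g q rest) (load g p P) (load g q P) _ _ _ _
          size ed₁ ed₂ le′ total (packing-deg pk p) (packing-deg pk q) (∑-distrib (weight p) (weight q) P)
      ; full′ = filled (length P) (length X) (∑ w′ P) (∑ w P) (deg g p′ rest) (deg g q′ rest) (load g p′ P) (load g q′ P) _ _ _ _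
          size ed₂ ed₁ le (≤-trans (≤-reflexive (+-comm (∑ w′ P) (∑ w P))) total)
          (packing-deg pk p′) (packing-deg pk q′) (∑-distrib (weight p′) (weight q′) P)
      }
      where
      rest = p ∷ q ∷ p′ ∷ q′ ∷ X
      w = λ T → weight p T + weight q T
      w′ = λ T → weight p′ T + weight q′ T
      size = packing-length pk
      ed₁ = ed (rest-front {X = p ∷ q ∷ []} pk) pq
      ed₂ = ed (rest-front {X = p′ ∷ q′ ∷ []} (reorder-rest (shifts (p ∷ q ∷ []) (p′ ∷ q′ ∷ [])) pk)) p′q′
      total = subst (_≤ 8 * length P) (∑-distrib w w′ P) (∑-bound (λ T → w T + w′ T) 8 small)
      eights : ∀ t r a b n x y → 3 * t + (4 + r) ≡ n → n + t ≤ x → n + t ≤ y → x ≤ a + (2 + (2 + r)) → y ≤ b + (2 + (2 + r)) → 8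
          * t ≤ a + b
      eights t r a b n x y h0 h1 h2 h3 h4 = deduce (t ∷ r ∷ a ∷ b ∷ n ∷ x ∷ y ∷ []) 1 (8 ⊗ x0 ⊑ x2 ⊕ x3)
          (2 , 3 ⊗ x0 ⊕ (K 4 ⊕ x1) ⊑ x4 · 1 , x4 ⊕ x0 ⊑ x5 · 1 , x4 ⊕ x0 ⊑ x6 · 1 , x5 ⊑ x2 ⊕ (K 2 ⊕ (K 2 ⊕ x1)) · 1 , x6 ⊑ x3 ⊕
          (K 2 ⊕ (K 2 ⊕ x1)) · done) (≤-reflexive h0 , h1 , h2 , h3 , h4 , tt)
      filled : ∀ t r a b i j lp lq n u1 u2 y → 3 * t + (4 + r) ≡ n → n + t ≤ u1 + u2 → n + t ≤ y → y ≤ b + (2 + (2 + r)) → a + b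
          ≤ 8 * t → u1 ≡ lp + i → u2 ≡ lq + j → a ≡ lp + lq → 4 + r ≤ i + j
      filled t r a b i j lp lq n u1 u2 y h0 h1 h2 h3 h4 h5 h6 h7 = deduce (t ∷ r ∷ a ∷ b ∷ i ∷ j ∷ lp ∷ lq ∷ n ∷ u1 ∷ u2 ∷ y ∷
          []) 1 (K 4 ⊕ x1 ⊑ x4 ⊕ x5) (2 , 3 ⊗ x0 ⊕ (K 4 ⊕ x1) ⊑ x8 · 1 , x8 ⊕ x0 ⊑ x9 ⊕ x10 · 1 , x8 ⊕ x0 ⊑ x11 · 1 , x11 ⊑ x3 ⊕
          (K 2 ⊕ (K 2 ⊕ x1)) · 1 , x2 ⊕ x3 ⊑ 8 ⊗ x0 · 1 , x9 ⊑ x6 ⊕ x4 · 1 , x10 ⊑ x7 ⊕ x5 · 1 , x6 ⊕ x7 ⊑ x2 · done)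
          (≤-reflexive h0 , h1 , h2 , h3 , h4 , ≤-reflexive h5 , ≤-reflexive h6 , ≤-reflexive (sym h7) , tt)

    -- If `w` missed both ends, the full degree sum would fall on one vertex less and force a
    -- triangle on `pq`.
    adjacent-to-one : ∀ {P w p q Y} → length P ≡ t → Packing g P (w ∷ p ∷ q ∷ Y) L → g p q ≡ true →
      length (w ∷ p ∷ q ∷ Y) ≤ deg g p (w ∷ p ∷ q ∷ Y) + deg g q (w ∷ p ∷ q ∷ Y) →
      Larger ⊎ g w p ≡ true ⊎ g w q ≡ true
    adjacent-to-one {P} {w} {p} {q} {Y} refl pk pq full with g p w in pw | g q w in qw
    ... | true | _ = inj₂ (inj₁ (flip-edge s pw))
    ... | false | true = inj₂ (inj₂ (flip-edge s qw))
    ... | false | false with triangle-on-edge? s {X = p ∷ q ∷ Y} refl pq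
    ...   | inj₁ (x , y , z , Z , σ , tri) = inj₁ (grow-by-triangle
        (x , y , z , w ∷ Z , ptrans (prep w σ) (↭-sym (shift w (x ∷ y ∷ z ∷ []) Z)) , tri) pk)
    ...   | inj₂ le = ⊥-elim (<⇒≱ full le)

    full-↭ : ∀ {p q X Y} → X ↭ Y → length X ≤ deg g p X + deg g q X → length Y ≤ deg g p Y + deg g q Y
    full-↭ {p} {q} σ = subst₂ _≤_ (↭-length σ) (cong₂ _+_ (∑-↭ (λ w → ind (g p w)) σ) (∑-↭ (λ w → ind (g q w)) σ))

    finish : Larger → RainbowPacking L (suc t)
    finish larger = g , R , larger

    halves : ∀ {a b} → a + b ≡ 8 → 4 ≤ a ⊎ 4 ≤ b
    halves {a} {b} eq with 4 ≤? a
    ... | yes p = inj₁ p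
    ... | no ¬p = inj₂ (at-least-4 a b eq (≰⇒> ¬p))
      where
      at-least-4 : ∀ a b → a + b ≡ 8 → a < 4 → 4 ≤ b
      at-least-4 a b h0 h1 = deduce (a ∷ b ∷ []) 1 (K 4 ⊑ x1) (1 , K 8 ⊑ x0 ⊕ x1 · 1 , K 1 ⊕ x0 ⊑ K 4 · done)
          (≤-reflexive (sym h0) , h1 , tt)

    -- Inserting `ww′` closes cherries at `p` and at `q`. At each triangle one of `pp̄` and `qq̄`
    -- sends four of the eight edges; it is the spare edge, and the cherry at the other edge is
    -- used.
    same-ends : ∀ {P p p̄ q q̄ w w′ X} → length P ≡ t → Packing g P (p ∷ p̄ ∷ q ∷ q̄ ∷ w ∷ w′ ∷ X) L →
      g p p̄ ≡ true → g q q̄ ≡ true → g w p ≡ true → g w′ p ≡ true → g w q ≡ true → g w′ q ≡ true →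
      RainbowPacking L (suc t)
    same-ends {P} {p} {p̄} {q} {q̄} {w} {w′} {X} refl pk pp̄ qq̄ wp w′p wq w′q with tight refl pk pp̄ qq̄
    ... | inj₁ larger = finish larger
    ... | inj₂ τ = close-cherry R uL (reorder-rest (++⁺ʳ X (↭-sym σ)) pk) wp w′p wq w′q (All.map choose (exact τ))
      where
      vs = p ∷ p̄ ∷ q ∷ q̄ ∷ w ∷ w′ ∷ []
      σ : w ∷ w′ ∷ p ∷ q ∷ p̄ ∷ q̄ ∷ [] ↭ p ∷ p̄ ∷ q ∷ q̄ ∷ w ∷ w′ ∷ []
      σ = shuffle vs (4F ∷ 5F ∷ 0F ∷ 2F ∷ 1F ∷ 3F ∷ []) refl
      choose : ∀ {T} → weight p T + weight p̄ T + (weight q T + weight q̄ T) ≡ 8 → Spare R w w′ (w ∷ w′ ∷ p ∷ q ∷ p̄ ∷ q̄ ∷ X) T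
      choose {T} eq with halves {weight p T + weight p̄ T} eq
      ... | inj₁ many = spare (++⁺ʳ X (shuffle (w ∷ w′ ∷ q ∷ p ∷ p̄ ∷ q̄ ∷ []) (0F ∷ 1F ∷ 3F ∷ 2F ∷ 4F ∷ 5F ∷ []) refl)) wq w′q
          pp̄ many
      ... | inj₂ many = spare (++⁺ʳ X (shuffle (w ∷ w′ ∷ p ∷ q ∷ q̄ ∷ p̄ ∷ []) (0F ∷ 1F ∷ 2F ∷ 3F ∷ 5F ∷ 4F ∷ []) refl)) wp w′p
          qq̄ many

    -- The disjoint edges `wp`, `w′p̄`, `qq̄` are tight in pairs, so each sends exactly four edges
    -- to every triangle. Since `wp̄` would close a triangle, `w` is adjacent to `w′`. Then `w` and
    -- `p̄` have the common neighbours `p` and `w′`, and `qq̄` is the spare edge.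
    opposite-ends : ∀ {P p p̄ q q̄ w w′ X} → length P ≡ t → Packing g P (p ∷ p̄ ∷ q ∷ q̄ ∷ w ∷ w′ ∷ X) L →
      g p p̄ ≡ true → g q q̄ ≡ true → g w p ≡ true → g w′ p̄ ≡ true → RainbowPacking L (suc t)
    opposite-ends {P} {p} {p̄} {q} {q̄} {w} {w′} {X} refl pk pp̄ qq̄ wp w′p̄
      with tight refl pk₁ wp w′p̄ | tight refl pk₂ wp qq̄ | tight refl pk₃ w′p̄ qq̄
      where
      vs = p ∷ p̄ ∷ q ∷ q̄ ∷ w ∷ w′ ∷ []
      pk₁ = reorder-rest (++⁺ʳ X (↭-sym (shuffle vs (4F ∷ 0F ∷ 5F ∷ 1F ∷ 2F ∷ 3F ∷ []) refl))) pk
      pk₂ = reorder-rest (++⁺ʳ X (↭-sym (shuffle vs (4F ∷ 0F ∷ 2F ∷ 3F ∷ 5F ∷ 1F ∷ []) refl))) pk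
      pk₃ = reorder-rest (++⁺ʳ X (↭-sym (shuffle vs (5F ∷ 1F ∷ 2F ∷ 3F ∷ 4F ∷ 0F ∷ []) refl))) pk
    ... | inj₁ larger | _ | _ = finish larger
    ... | inj₂ _ | inj₁ larger | _ = finish larger
    ... | inj₂ _ | inj₂ _ | inj₁ larger = finish larger
    ... | inj₂ τ₁ | inj₂ τ₂ | inj₂ τ₃
      with adjacent-to-one {w = w} {w′} {p̄} refl pk₄ w′p̄
          (full-↭ (++⁺ʳ X (shuffle (w ∷ w′ ∷ p̄ ∷ p ∷ q ∷ q̄ ∷ []) (0F ∷ 3F ∷ 1F ∷ 2F ∷ 4F ∷ 5F ∷ []) refl)) (full′ τ₁))
      where
      pk₄ : Packing g P (w ∷ w′ ∷ p̄ ∷ p ∷ q ∷ q̄ ∷ X) L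
      pk₄ = reorder-rest (++⁺ʳ X (↭-sym (shuffle (p ∷ p̄ ∷ q ∷ q̄ ∷ w ∷ w′ ∷ []) (4F ∷ 5F ∷ 1F ∷ 0F ∷ 2F ∷ 3F ∷ []) refl))) pk
    ... | inj₁ larger = finish larger
    ... | inj₂ (inj₂ wp̄) = finish (grow-by-triangle (w , p , p̄ , q ∷ q̄ ∷ w′ ∷ X ,
            ++⁺ʳ X (↭-sym (shuffle (p ∷ p̄ ∷ q ∷ q̄ ∷ w ∷ w′ ∷ []) (4F ∷ 0F ∷ 1F ∷ 2F ∷ 3F ∷ 5F ∷ []) refl)) , wp , wp̄ , pp̄) pk)
    ... | inj₂ (inj₁ ww′) = close-cherry R uL (reorder-rest (++⁺ʳ X (↭-sym σ)) pk) wp (flip-edge s pp̄) ww′ (flip-edge s w′p̄)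
            (All.zipWith (λ (x , y , z) → choose x y z) (exact τ₁ , All.zip (exact τ₂ , exact τ₃)))
      where
      σ : w ∷ p̄ ∷ p ∷ w′ ∷ q ∷ q̄ ∷ [] ↭ p ∷ p̄ ∷ q ∷ q̄ ∷ w ∷ w′ ∷ []
      σ = shuffle (p ∷ p̄ ∷ q ∷ q̄ ∷ w ∷ w′ ∷ []) (4F ∷ 1F ∷ 0F ∷ 5F ∷ 2F ∷ 3F ∷ []) refl
      choose : ∀ {T} → weight w T + weight p T + (weight w′ T + weight p̄ T) ≡ 8 → weight w T + weight p T +
          (weight q T + weight q̄ T) ≡ 8 →
        weight w′ T + weight p̄ T + (weight q T + weight q̄ T) ≡ 8 → Spare R w p̄ (w ∷ p̄ ∷ p ∷ w′ ∷ q ∷ q̄ ∷ X) T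
      choose {T} x y z = spare (++⁺ʳ X (shuffle (w ∷ p̄ ∷ p ∷ q ∷ q̄ ∷ w′ ∷ []) (0F ∷ 1F ∷ 2F ∷ 5F ∷ 3F ∷ 4F ∷ []) refl)) wp
          (flip-edge s pp̄) qq̄
        (four (weight w T + weight p T) (weight w′ T + weight p̄ T) (weight q T + weight q̄ T) x y z)
        where
        four : ∀ a b c → a + b ≡ 8 → a + c ≡ 8 → b + c ≡ 8 → 4 ≤ c
        four a b c h0 h1 h2 = deduce (a ∷ b ∷ c ∷ []) 2 (K 4 ⊑ x2) (1 , x0 ⊕ x1 ⊑ K 8 · 1 , K 8 ⊑ x0 ⊕ x2 · 1 , K 8 ⊑ x1 ⊕ x2 ·
            done) (≤-reflexive h0 , ≤-reflexive (sym h1) , ≤-reflexive (sym h2) , tt)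

    -- Six remaining vertices leave `w` and `w′` beside the two disjoint edges, and tightness joins
    -- each of them to an end of either edge. Different ends at one edge lead to `opposite-ends`,
    -- equal ends at both to `same-ends`.
    critical : ∀ {P X} → length P ≡ t → Packing g P X L → 6 ≤ length X → All (λ v → 2 * t + 2 ≤ deg g v L) L → RainbowPacking L
        (suc t)
    critical {P} {X} refl pk big δ with find-matching s pk (≤-trans (m≤m+n 4 2) big)
        (All.map (≤-trans (+-monoʳ-≤ (2 * length P) (s≤s z≤n))) δ)
    ... | inj₁ larger = finish larger
    ... | inj₂ (inj₂ star) = ⊥-elim (Starred-degree s star δ)
    ... | inj₂ (inj₁ (matched {X = []} len pk′ ab a′b′)) = ⊥-elim (short (length P) _ _ _ len big (packing-length pk)
        (packing-length pk′))
      where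
      short : ∀ t t' r n → t' ≡ t → 6 ≤ r → 3 * t + r ≡ n → 3 * t' + 4 ≡ n → ⊥
      short t t' r n h0 h1 h2 h3 = refute (t ∷ t' ∷ r ∷ n ∷ []) (3 , x1 ⊑ x0 · 1 , K 6 ⊑ x2 · 1 , 3 ⊗ x0 ⊕ x2 ⊑ x3 · 1 , x3 ⊑ 3 ⊗
          x1 ⊕ K 4 · done) (≤-reflexive h0 , h1 , ≤-reflexive h2 , ≤-reflexive (sym h3) , tt)
    ... | inj₂ (inj₁ (matched {X = _ ∷ []} len pk′ ab a′b′)) = ⊥-elim (short (length P) _ _ _ len big (packing-length pk)
        (packing-length pk′))
      where
      short : ∀ t t' r n → t' ≡ t → 6 ≤ r → 3 * t + r ≡ n → 3 * t' + 5 ≡ n → ⊥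
      short t t' r n h0 h1 h2 h3 = refute (t ∷ t' ∷ r ∷ n ∷ []) (3 , x1 ⊑ x0 · 1 , K 6 ⊑ x2 · 1 , 3 ⊗ x0 ⊕ x2 ⊑ x3 · 1 , x3 ⊑ 3 ⊗
          x1 ⊕ K 5 · done) (≤-reflexive h0 , h1 , ≤-reflexive h2 , ≤-reflexive (sym h3) , tt)
    ... | inj₂ (inj₁ (matched {Q} {a} {b} {a′} {b′} {w ∷ w′ ∷ Y} len pk′ ab a′b′)) with tight len pk′ ab a′b′
    ...   | inj₁ larger = finish larger
    ...   | inj₂ τ = decide (ends {4F} {0F} {1F} {2F} {3F} {5F} refl ab (full τ))
        (ends {5F} {0F} {1F} {2F} {3F} {4F} refl ab (full τ))
                            (ends {4F} {2F} {3F} {0F} {1F} {5F} refl a′b′ (full′ τ))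
                                (ends {5F} {2F} {3F} {0F} {1F} {4F} refl a′b′ (full′ τ))
      where
      vs = a ∷ b ∷ a′ ∷ b′ ∷ w ∷ w′ ∷ []
      rest = a ∷ b ∷ a′ ∷ b′ ∷ w ∷ w′ ∷ Y
      moved : ∀ is → isort is ≡ idx 6 → rest ↭ map (lookup vs) is ++ Y
      moved is ok = ++⁺ʳ Y (↭-sym (shuffle vs is ok))
      ends : ∀ {i j k l m n} → let is = i ∷ j ∷ k ∷ l ∷ m ∷ n ∷ [] in isort is ≡ idx 6 → g (lookup vs j) (lookup vs k) ≡ true →
        length rest ≤ deg g (lookup vs j) rest + deg g (lookup vs k) rest →
        Larger ⊎ g (lookup vs i) (lookup vs j) ≡ true ⊎ g (lookup vs i) (lookup vs k) ≡ true
      ends {i} {j} {k} {l} {m} {n} ok pq fl = adjacent-to-one len (reorder-rest (moved is ok) pk′) pq (full-↭ (moved is ok) fl)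
        where is = i ∷ j ∷ k ∷ l ∷ m ∷ n ∷ []
      at : ∀ is → isort is ≡ idx 6 → Packing g Q (map (lookup vs) is ++ Y) L
      at is ok = reorder-rest (moved is ok) pk′
      decide : Larger ⊎ g w a ≡ true ⊎ g w b ≡ true → Larger ⊎ g w′ a ≡ true ⊎ g w′ b ≡ true →
        Larger ⊎ g w a′ ≡ true ⊎ g w b′ ≡ true → Larger ⊎ g w′ a′ ≡ true ⊎ g w′ b′ ≡ true → RainbowPacking L (suc t)
      decide (inj₁ larger) _ _ _ = finish larger
      decide _ (inj₁ larger) _ _ = finish larger
      decide _ _ (inj₁ larger) _ = finish larger
      decide _ _ _ (inj₁ larger) = finish larger
      decide (inj₂ (inj₁ wa)) (inj₂ (inj₂ w′b)) _ _ = opposite-ends len pk′ ab a′b′ wa w′b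
      decide (inj₂ (inj₂ wb)) (inj₂ (inj₁ w′a)) _ _ =
        opposite-ends len (at (1F ∷ 0F ∷ 2F ∷ 3F ∷ 4F ∷ 5F ∷ []) refl) (flip-edge s ab) a′b′ wb w′a
      decide _ _ (inj₂ (inj₁ wa′)) (inj₂ (inj₂ w′b′)) =
        opposite-ends len (at (2F ∷ 3F ∷ 0F ∷ 1F ∷ 4F ∷ 5F ∷ []) refl) a′b′ ab wa′ w′b′
      decide _ _ (inj₂ (inj₂ wb′)) (inj₂ (inj₁ w′a′)) =
        opposite-ends len (at (3F ∷ 2F ∷ 0F ∷ 1F ∷ 4F ∷ 5F ∷ []) refl) (flip-edge s a′b′) ab wb′ w′a′
      decide (inj₂ (inj₁ wa)) (inj₂ (inj₁ w′a)) (inj₂ (inj₁ wa′)) (inj₂ (inj₁ w′a′)) =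
        same-ends len pk′ ab a′b′ wa w′a wa′ w′a′
      decide (inj₂ (inj₁ wa)) (inj₂ (inj₁ w′a)) (inj₂ (inj₂ wb′)) (inj₂ (inj₂ w′b′)) =
        same-ends len (at (0F ∷ 1F ∷ 3F ∷ 2F ∷ 4F ∷ 5F ∷ []) refl) ab (flip-edge s a′b′) wa w′a wb′ w′b′
      decide (inj₂ (inj₂ wb)) (inj₂ (inj₂ w′b)) (inj₂ (inj₁ wa′)) (inj₂ (inj₁ w′a′)) =
        same-ends len (at (1F ∷ 0F ∷ 2F ∷ 3F ∷ 4F ∷ 5F ∷ []) refl) (flip-edge s ab) a′b′ wb w′b wa′ w′a′
      decide (inj₂ (inj₂ wb)) (inj₂ (inj₂ w′b)) (inj₂ (inj₂ wb′)) (inj₂ (inj₂ w′b′)) =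
        same-ends len (at (1F ∷ 0F ∷ 3F ∷ 2F ∷ 4F ∷ 5F ∷ []) refl) (flip-edge s ab) (flip-edge s a′b′) wb w′b wb′ w′b′

  -- Deleting vertices from a counterexample

  RainbowPacking-↭ : ∀ {X Y k} → X ↭ Y → RainbowPacking X k → RainbowPacking Y k
  RainbowPacking-↭ σ (g , R , P , Z , len , (ts , π)) = g , R , P , Z , len , (ts , ptrans π σ)

  RainbowPacking-∷ : ∀ {v X k} → RainbowPacking X k → RainbowPacking (v ∷ X) k
  RainbowPacking-∷ {v} (g , R , P , Z , len , (ts , π)) =
    g , R , P , v ∷ Z , len , (ts , ptrans (shift v (flat P) Z) (prep v π))

  -- It covers all vertex lists, for deletions, and all rainbow graphs, for exchanges of edges.
  Bounded : ℕ → ℕ → Set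
  Bounded j m = ∀ {L} → Unique L → length L ≡ 3 * j + 6 + m → ∀ {g} → RainbowGraph g →
    ¬ RainbowPacking L (2 + j) → e g L ≤ bound j m

  remove-vertex : ∀ {g : Graph V} → Simple g → ∀ {L v Y} → L ↭ v ∷ Y → e g L ≡ deg g v L + e g Y
  remove-vertex {g} s {L} {v} {Y} σ = trans (e-↭ s σ)
      (cong (_+ e g Y) (sym (trans (∑-↭ _ σ) (cong (λ b → ind b + deg g v Y) (irrefl s v)))))

  touch : Graph V → V → V → List V → ℕ
  touch g a b X = ind (g a b) + (deg g a X + deg g b X)

  remove-edge : ∀ {g : Graph V} → Simple g → ∀ {L a b Y} → L ↭ a ∷ b ∷ Y → e g L ≡ touch g a b Y + e g Y
  remove-edge {g} s {L} {a} {b} {Y} σ = trans (e-↭ s σ) (rearrange (ind (g a b)) (deg g a Y) (deg g b Y) (e g Y))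
    where
    rearrange : ∀ i p q r → i + p + (q + r) ≡ i + (p + q) + r
    rearrange = solve-∀

  touch-degrees : ∀ {g : Graph V} → Simple g → ∀ {L a b Y} → L ↭ a ∷ b ∷ Y → g a b ≡ true →
    deg g a L + deg g b L ≡ 1 + touch g a b Y
  touch-degrees {g} s {L} {a} {b} {Y} σ ab
    rewrite ∑-↭ (λ w → ind (g a w)) σ | ∑-↭ (λ w → ind (g b w)) σ | irrefl s a | irrefl s b | symm s b a | ab =
    +-suc (suc (deg g a Y)) (deg g b Y)

  All-by-front : ∀ {A : V → Set} (L : List V) → (∀ {v Y} → L ↭ v ∷ Y → A v) → All A L
  All-by-front L f = All.tabulate λ v∈L → f (proj₂ (∈-front v∈L))

  minimum-degree : ∀ {j m L} → Unique L → length L ≡ 3 * j + 6 + suc m → ∀ {g} → RainbowGraph g → ¬ RainbowPacking L (2 + j) →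
    Bounded j m → ∀ {v Y} → L ↭ v ∷ Y → e g L ≤ deg g v L + bound j m
  minimum-degree {j} {m} {L} uL len {g} R ¬rp ih {v} {Y} σ = subst (_≤ deg g v L + bound j m) (sym (remove-vertex (simple R) σ))
    (+-monoʳ-≤ (deg g v L) (ih (AllPairs.tail (Unique-↭ σ uL)) (size (length L) (length Y) (↭-length σ) len) R
      λ rp → ¬rp (RainbowPacking-↭ (↭-sym σ) (RainbowPacking-∷ rp))))
    where
    size : ∀ l y → l ≡ suc y → l ≡ 3 * j + 6 + suc m → y ≡ 3 * j + 6 + m
    size l y refl eq = suc-injective (trans eq (+-suc _ m))

  -- Even m

  module _ {j i : ℕ} where

    -- Deleting one vertex shows that all degrees are at least 2j + i + 5, and twice this is exactly
    -- n + k.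
    even-case : Bounded j (suc (double i)) → Bounded j (double (suc i))
    even-case ih {L} uL len {g} R ¬rp = ≮⇒≥ λ dense → ¬rp (g , R , disjoint-triangles (simple R) (2 + j) (δ dense) (ed dense)
        long)
      where
      degree : bound j (double (suc i)) < e g L → ∀ {v Y} → L ↭ v ∷ Y → 2 * j + i + 5 ≤ deg g v L
      degree dense σ = step j i (bound j (suc (double i))) _ _ _ (bound-even j i) dense (minimum-degree {j} uL len R ¬rp ih σ)
        where
        step : ∀ j i a b n d → a + (2 * j + 3) + (1 + i) ≤ b → b < n → n ≤ d + a → 2 * j + i + 5 ≤ d
        step j i a b n d h0 h1 h2 = deduce (j ∷ i ∷ a ∷ b ∷ n ∷ d ∷ []) 1 (2 ⊗ x0 ⊕ x1 ⊕ K 5 ⊑ x5)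
            (1 , x2 ⊕ (2 ⊗ x0 ⊕ K 3) ⊕ (K 1 ⊕ x1) ⊑ x3 · 1 , K 1 ⊕ x3 ⊑ x4 · 1 , x4 ⊑ x5 ⊕ x2 · done) (h0 , h1 , h2 , tt)
      δ : bound j (double (suc i)) < e g L → All (λ v → 2 * (2 + j) ≤ deg g v L) L
      δ dense = All-by-front L λ σ → ≤-trans (step j i) (degree dense σ)
        where
        step : ∀ j i → 2 * (2 + j) ≤ 2 * j + i + 5
        step j i = deduce (j ∷ i ∷ []) 1 (2 ⊗ (K 2 ⊕ x0) ⊑ 2 ⊗ x0 ⊕ x1 ⊕ K 5) (done) (tt)
      ed : bound j (double (suc i)) < e g L → EdgeDegree (simple R) (length L + (2 + j)) L
      ed dense {a} {b} {X} σ ab = step j i (length L) (double i) _ _ len (double≡2* i) (degree dense σ)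
          (degree dense (ptrans σ (pswap a b refl)))
        where
        step : ∀ j i n d x y → n ≡ 3 * j + 6 + (2 + d) → d ≡ 2 * i → 2 * j + i + 5 ≤ x → 2 * j + i + 5 ≤ y → n + (2 + j) ≤ x + y
        step j i n d x y h0 h1 h2 h3 = deduce (j ∷ i ∷ n ∷ d ∷ x ∷ y ∷ []) 1 (x2 ⊕ (K 2 ⊕ x0) ⊑ x4 ⊕ x5)
            (1 , x2 ⊑ 3 ⊗ x0 ⊕ K 6 ⊕ (K 2 ⊕ x3) · 1 , x3 ⊑ 2 ⊗ x1 · 1 , 2 ⊗ x0 ⊕ x1 ⊕ K 5 ⊑ x4 · 1 , 2 ⊗ x0 ⊕ x1 ⊕ K 5 ⊑ x5 ·
            done) (≤-reflexive h0 , ≤-reflexive h1 , h2 , h3 , tt)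
      long : 3 * (2 + j) + 1 ≤ length L
      long = step j (length L) (double i) len
        where
        step : ∀ j n d → n ≡ 3 * j + 6 + (2 + d) → 3 * (2 + j) + 1 ≤ n
        step j n d h0 = deduce (j ∷ n ∷ d ∷ []) 1 (3 ⊗ (K 2 ⊕ x0) ⊕ K 1 ⊑ x1) (1 , 3 ⊗ x0 ⊕ K 6 ⊕ (K 2 ⊕ x2) ⊑ x1 · done)
            (≤-reflexive (sym h0) , tt)

  -- Degree sums of adjacent vertices

  module _ {j m : ℕ} {L : List V} (uL : Unique L) (len : length L ≡ 3 * j + 9 + (2 + m))
    {g : Graph V} (R : RainbowGraph g) (¬rp : ¬ RainbowPacking L (3 + j)) (dense : bound (suc j) (2 + m) < e g L)
    (ih : Bounded (suc j) m) (ihₖ : Bounded j (2 + m)) where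

    private
      s = simple R

    rest-bounded : ∀ {a b Y} → L ↭ a ∷ b ∷ Y → ∀ {h} → RainbowGraph h → e h Y ≤ bound (suc j) m
    rest-bounded {a} {b} {Y} σ S = ih (AllPairs.tail (AllPairs.tail (Unique-↭ σ uL)))
        (size (length L) (length Y) j m (↭-length σ) len) S
      λ rp → ¬rp (RainbowPacking-↭ (↭-sym σ) (RainbowPacking-∷ (RainbowPacking-∷ rp)))
      where
      size : ∀ l y j m → l ≡ suc (suc y) → l ≡ 3 * j + 9 + suc (suc m) → y ≡ 3 * suc j + 6 + m
      size l y j m refl eq = ≤-antisym (below y j m eq) (above y j m eq)
        where
        below : ∀ y j m → 2 + y ≡ 3 * j + 9 + (2 + m) → y ≤ 3 * (1 + j) + 6 + m
        below y j m h0 = deduce (y ∷ j ∷ m ∷ []) 1 (x0 ⊑ 3 ⊗ (K 1 ⊕ x1) ⊕ K 6 ⊕ x2)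
            (1 , K 2 ⊕ x0 ⊑ 3 ⊗ x1 ⊕ K 9 ⊕ (K 2 ⊕ x2) · done) (≤-reflexive h0 , tt)
        above : ∀ y j m → 2 + y ≡ 3 * j + 9 + (2 + m) → 3 * (1 + j) + 6 + m ≤ y
        above y j m h0 = deduce (y ∷ j ∷ m ∷ []) 1 (3 ⊗ (K 1 ⊕ x1) ⊕ K 6 ⊕ x2 ⊑ x0)
            (1 , 3 ⊗ x1 ⊕ K 9 ⊕ (K 2 ⊕ x2) ⊑ K 2 ⊕ x0 · done) (≤-reflexive (sym h0) , tt)

    -- If the colour of a side recurs at pq, inserting pq destroys that side; the bound obtained by deleting a and b improves by one.
    recoloured-touch : ∀ {a b x Y p q} → L ↭ a ∷ b ∷ x ∷ Y → IsTri g (a , b , x) → p ∈ Y → q ∈ Y → p ≢ q →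
      c p q ≡ c a b ⊎ c p q ≡ c a x ⊎ c p q ≡ c b x → bound (suc j) m + touch g a b (x ∷ Y) ≥ 1 + e g L
    recoloured-touch {a} {b} {x} {Y} {p} {q} σ (ab , ax , bx) p∈Y q∈Y p≢q colour =
      step (e g L) (e g″ L) (touch g″ a b (x ∷ Y)) (touch g a b (x ∷ Y)) (e g″ (x ∷ Y)) (bound (suc j) m)
        (e-exchange R p≢q uL (p∈L p∈Y) (p∈L q∈Y)) (remove-edge (simple S) σ) (rest-bounded σ S)
        (drop (ind (g″ a b)) (ind (g″ a x)) (deg g″ a Y) (ind (g″ b x)) (deg g″ b Y) (ind (g a b)) (ind (g a x)) (deg g a Y)
            (ind (g b x)) (deg g b Y)
          (lost colour) (∑-mono Y (below a∉Y)) (∑-mono Y (below b∉Y)))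
      where
      g″ = exchange-edge g p q
      S = exchange-rainbow R p≢q
      uσ = Unique-↭ σ uL
      p∈L : ∀ {p} → p ∈ Y → p ∈ L
      p∈L p∈Y = ∈-resp-↭ (↭-sym σ) (there (there (there p∈Y)))
      a∉Y : ∀ {v} → v ∈ Y → a ≢ v
      a∉Y v∈Y = unique-apart uσ (there (there v∈Y))
      b∉Y : ∀ {v} → v ∈ Y → b ≢ v
      b∉Y v∈Y = unique-apart (AllPairs.tail uσ) (there v∈Y)
      old : ∀ {u w} → (∀ {v} → v ∈ Y → u ≢ v) → g″ u w ≡ true → g u w ≡ true × c u w ≢ c p q
      old u∉Y t with exchanged R p≢q t
      ... | inj₁ (inj₁ (refl , _)) = ⊥-elim (u∉Y p∈Y refl)
      ... | inj₁ (inj₂ (refl , _)) = ⊥-elim (u∉Y q∈Y refl)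
      ... | inj₂ r = r
      below : ∀ {u} → (∀ {v} → v ∈ Y → u ≢ v) → ∀ w → ind (g″ u w) ≤ ind (g u w)
      below u∉Y w = ind-mono (λ t → proj₁ (old u∉Y t))
      gone : ∀ {u w} → (∀ {v} → v ∈ Y → u ≢ v) → g u w ≡ true → c p q ≡ c u w → 1 + ind (g″ u w) ≤ ind (g u w)
      gone {u} {w} u∉Y uw eq = subst (1 + ind (g″ u w) ≤_) (sym (cong ind uw))
        (s≤s (≤-reflexive (cong ind (false-if {g″ u w} λ t → proj₂ (old u∉Y t) (sym eq)))))
      lost : c p q ≡ c a b ⊎ c p q ≡ c a x ⊎ c p q ≡ c b x →
        1 + (ind (g″ a b) + ind (g″ a x) + ind (g″ b x)) ≤ ind (g a b) + ind (g a x) + ind (g b x)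
      lost (inj₁ eq) = +-mono-≤ (+-mono-≤ (gone a∉Y ab eq) (below a∉Y x)) (below b∉Y x)
      lost (inj₂ (inj₁ eq)) = first _ _ _ _ _ _ (below a∉Y b) (gone a∉Y ax eq) (below b∉Y x)
        where
        first : ∀ i j k i' j' k' → i ≤ i' → 1 + j ≤ j' → k ≤ k' → 1 + (i + j + k) ≤ i' + j' + k'
        first i j k i' j' k' h0 h1 h2 = deduce (i ∷ j ∷ k ∷ i' ∷ j' ∷ k' ∷ []) 1 (K 1 ⊕ (x0 ⊕ x1 ⊕ x2) ⊑ x3 ⊕ x4 ⊕ x5)
            (1 , x0 ⊑ x3 · 1 , K 1 ⊕ x1 ⊑ x4 · 1 , x2 ⊑ x5 · done) (h0 , h1 , h2 , tt)
      lost (inj₂ (inj₂ eq)) = second _ _ _ _ _ _ (below a∉Y b) (below a∉Y x) (gone b∉Y bx eq)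
        where
        second : ∀ i j k i' j' k' → i ≤ i' → j ≤ j' → 1 + k ≤ k' → 1 + (i + j + k) ≤ i' + j' + k'
        second i j k i' j' k' h0 h1 h2 = deduce (i ∷ j ∷ k ∷ i' ∷ j' ∷ k' ∷ []) 1 (K 1 ⊕ (x0 ⊕ x1 ⊕ x2) ⊑ x3 ⊕ x4 ⊕ x5)
            (1 , x0 ⊑ x3 · 1 , x1 ⊑ x4 · 1 , K 1 ⊕ x2 ⊑ x5 · done) (h0 , h1 , h2 , tt)
      drop : ∀ i j p k q i' j' p' k' q' → 1 + (i + j + k) ≤ i' + j' + k' → p ≤ p' → q ≤ q' → 1 + (i + (j + p + (k + q))) ≤ i' +
          (j' + p' + (k' + q'))
      drop i j p k q i' j' p' k' q' h0 h1 h2 = deduce (i ∷ j ∷ p ∷ k ∷ q ∷ i' ∷ j' ∷ p' ∷ k' ∷ q' ∷ []) 1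
          (K 1 ⊕ (x0 ⊕ (x1 ⊕ x2 ⊕ (x3 ⊕ x4))) ⊑ x5 ⊕ (x6 ⊕ x7 ⊕ (x8 ⊕ x9))) (1 , K 1 ⊕ (x0 ⊕ x1 ⊕ x3) ⊑ x5 ⊕ x6 ⊕ x8 · 1 , x2 ⊑
          x7 · 1 , x4 ⊑ x9 · done) (h0 , h1 , h2 , tt)
      step : ∀ n n' t' t r b → n ≤ n' → n' ≡ t' + r → r ≤ b → 1 + t' ≤ t → 1 + n ≤ b + t
      step n n' t' t r b h0 h1 h2 h3 = deduce (n ∷ n' ∷ t' ∷ t ∷ r ∷ b ∷ []) 1 (K 1 ⊕ x0 ⊑ x5 ⊕ x3)
          (1 , x0 ⊑ x1 · 1 , x1 ⊑ x2 ⊕ x4 · 1 , x4 ⊑ x5 · 1 , K 1 ⊕ x2 ⊑ x3 · done) (h0 , ≤-reflexive h1 , h2 , h3 , tt)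

    -- If no colour of the triangle recurs on Y, a packing of Y extends by the triangle.
    triangle-touch : ∀ {a b x Y} → L ↭ a ∷ b ∷ x ∷ Y → IsTri g (a , b , x) → 4 * j + 12 + m ≤ touch g a b (x ∷ Y)
    triangle-touch {a} {b} {x} {Y} σ tri@(ab , ax , bx) with colour? (c a b) Y | colour? (c a x) Y | colour? (c b x) Y
    ... | inj₁ (p , q , Z , τ , p≢q , eq) | _ | _ = step j m _ _ _ _ (bound-two (suc j) m) dense
        (recoloured-touch σ tri (front-∈ τ) (front₂-∈ τ) p≢q (inj₁ eq))
      where
      step : ∀ j m a b n t → a + (4 * (1 + j) + 4) + (2 + m) ≤ b → b < n → 1 + n ≤ a + t → 4 * j + 12 + m ≤ t
      step j m a b n t h0 h1 h2 = deduce (j ∷ m ∷ a ∷ b ∷ n ∷ t ∷ []) 1 (4 ⊗ x0 ⊕ K 12 ⊕ x1 ⊑ x5)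
          (1 , x2 ⊕ (4 ⊗ (K 1 ⊕ x0) ⊕ K 4) ⊕ (K 2 ⊕ x1) ⊑ x3 · 1 , K 1 ⊕ x3 ⊑ x4 · 1 , K 1 ⊕ x4 ⊑ x2 ⊕ x5 · done)
          (h0 , h1 , h2 , tt)
    ... | inj₂ _ | inj₁ (p , q , Z , τ , p≢q , eq) | _ = step j m _ _ _ _ (bound-two (suc j) m) dense
        (recoloured-touch σ tri (front-∈ τ) (front₂-∈ τ) p≢q (inj₂ (inj₁ eq)))
      where
      step : ∀ j m a b n t → a + (4 * (1 + j) + 4) + (2 + m) ≤ b → b < n → 1 + n ≤ a + t → 4 * j + 12 + m ≤ t
      step j m a b n t h0 h1 h2 = deduce (j ∷ m ∷ a ∷ b ∷ n ∷ t ∷ []) 1 (4 ⊗ x0 ⊕ K 12 ⊕ x1 ⊑ x5)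
          (1 , x2 ⊕ (4 ⊗ (K 1 ⊕ x0) ⊕ K 4) ⊕ (K 2 ⊕ x1) ⊑ x3 · 1 , K 1 ⊕ x3 ⊑ x4 · 1 , K 1 ⊕ x4 ⊑ x2 ⊕ x5 · done)
          (h0 , h1 , h2 , tt)
    ... | inj₂ _ | inj₂ _ | inj₁ (p , q , Z , τ , p≢q , eq) = step j m _ _ _ _ (bound-two (suc j) m) dense
        (recoloured-touch σ tri (front-∈ τ) (front₂-∈ τ) p≢q (inj₂ (inj₂ eq)))
      where
      step : ∀ j m a b n t → a + (4 * (1 + j) + 4) + (2 + m) ≤ b → b < n → 1 + n ≤ a + t → 4 * j + 12 + m ≤ t
      step j m a b n t h0 h1 h2 = deduce (j ∷ m ∷ a ∷ b ∷ n ∷ t ∷ []) 1 (4 ⊗ x0 ⊕ K 12 ⊕ x1 ⊑ x5)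
          (1 , x2 ⊕ (4 ⊗ (K 1 ⊕ x0) ⊕ K 4) ⊕ (K 2 ⊕ x1) ⊑ x3 · 1 , K 1 ⊕ x3 ⊑ x4 · 1 , K 1 ⊕ x4 ⊑ x2 ⊕ x5 · done)
          (h0 , h1 , h2 , tt)
    ... | inj₂ f₁ | inj₂ f₂ | inj₂ f₃ = step j m (length L) (length Y) (deg g x Y) (e g Y) _ _ (e g L) (touch g a b (x ∷ Y)) len
        (↭-length σ) (deg≤length g x Y)
            (ihₖ (AllPairs.tail (AllPairs.tail (AllPairs.tail (Unique-↭ σ uL)))) size R
              (λ rp → ¬rp (RainbowPacking-↭ (↭-sym σ) (join-triangle R tri (λ p∈ q∈ d → f₁ p∈ q∈ d , f₂ p∈ q∈ d , f₃ p∈ q∈ d)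
                  rp))))
            (bound-suc j (2 + m)) dense (remove-edge s σ)
      where
      size : length Y ≡ 3 * j + 6 + (2 + m)
      size = ≤-antisym (below (length L) (length Y) j m (↭-length σ) len) (above (length L) (length Y) j m (↭-length σ) len)
        where
        below : ∀ l y j m → l ≡ 3 + y → l ≡ 3 * j + 9 + (2 + m) → y ≤ 3 * j + 6 + (2 + m)
        below l y j m h0 h1 = deduce (l ∷ y ∷ j ∷ m ∷ []) 1 (x1 ⊑ 3 ⊗ x2 ⊕ K 6 ⊕ (K 2 ⊕ x3))
            (1 , K 3 ⊕ x1 ⊑ x0 · 1 , x0 ⊑ 3 ⊗ x2 ⊕ K 9 ⊕ (K 2 ⊕ x3) · done) (≤-reflexive (sym h0) , ≤-reflexive h1 , tt)
        above : ∀ l y j m → l ≡ 3 + y → l ≡ 3 * j + 9 + (2 + m) → 3 * j + 6 + (2 + m) ≤ y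
        above l y j m h0 h1 = deduce (l ∷ y ∷ j ∷ m ∷ []) 1 (3 ⊗ x2 ⊕ K 6 ⊕ (K 2 ⊕ x3) ⊑ x1)
            (1 , x0 ⊑ K 3 ⊕ x1 · 1 , 3 ⊗ x2 ⊕ K 9 ⊕ (K 2 ⊕ x3) ⊑ x0 · done) (≤-reflexive h0 , ≤-reflexive (sym h1) , tt)
      step : ∀ j m l y d r a b n t → l ≡ 3 * j + 9 + (2 + m) → l ≡ 3 + y → d ≤ y → r ≤ a → a + (7 * j + 15) + 2 * (2 + m) ≤ b → b
          < n → n ≡ t + (d + r) → 4 * j + 12 + m ≤ t
      step j m l y d r a b n t h0 h1 h2 h3 h4 h5 h6 = deduce (j ∷ m ∷ l ∷ y ∷ d ∷ r ∷ a ∷ b ∷ n ∷ t ∷ []) 1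
          (4 ⊗ x0 ⊕ K 12 ⊕ x1 ⊑ x9) (1 , x2 ⊑ 3 ⊗ x0 ⊕ K 9 ⊕ (K 2 ⊕ x1) · 1 , K 3 ⊕ x3 ⊑ x2 · 1 , x4 ⊑ x3 · 1 , x5 ⊑ x6 · 1 , x6
          ⊕ (7 ⊗ x0 ⊕ K 15) ⊕ 2 ⊗ (K 2 ⊕ x1) ⊑ x7 · 1 , K 1 ⊕ x7 ⊑ x8 · 1 , x8 ⊑ x9 ⊕ (x4 ⊕ x5) · done)
          (≤-reflexive h0 , ≤-reflexive (sym h1) , h2 , h3 , h4 , h5 , ≤-reflexive h6 , tt)

    -- Without a common neighbour, `a` and `b` touch too few edges for the bound on two vertices
    -- fewer. With one, that bound alone falls short of the goal by one edge, which `triangle-touch`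
    -- supplies.
    edge-degree : EdgeDegree s (4 * j + 13 + m) L
    edge-degree {a} {b} {X} σ ab with common? g a b X
    ... | inj₁ (x , Y , τ , ax , bx) = ≤-trans (step j m _ (triangle-touch σ′ (ab , ax , bx)))
        (≤-reflexive (sym (touch-degrees s σ′ ab)))
      where
      σ′ = ptrans σ (prep a (prep b τ))
      step : ∀ j m t → 4 * j + 12 + m ≤ t → 4 * j + 13 + m ≤ 1 + t
      step j m t h0 = deduce (j ∷ m ∷ t ∷ []) 1 (4 ⊗ x0 ⊕ K 13 ⊕ x1 ⊑ K 1 ⊕ x2) (1 , 4 ⊗ x0 ⊕ K 12 ⊕ x1 ⊑ x2 · done) (h0 , tt)
    ... | inj₂ few = ⊥-elim (step j m (length L) (length X) (ind (g a b)) (deg g a X + deg g b X) _ (e g X) _ _ len (↭-length σ)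
        (ind≤1 (g a b)) few (rest-bounded σ R) (remove-edge s σ) (bound-two (suc j) m) dense)
      where
      step : ∀ j m l y i t a r b n → l ≡ 3 * j + 9 + (2 + m) → l ≡ 2 + y → i ≤ 1 → t ≤ y → r ≤ a → n ≡ i + t + r → a +
          (4 * (1 + j) + 4) + (2 + m) ≤ b → b < n → ⊥
      step j m l y i t a r b n h0 h1 h2 h3 h4 h5 h6 h7 = refute (j ∷ m ∷ l ∷ y ∷ i ∷ t ∷ a ∷ r ∷ b ∷ n ∷ [])
          (1 , x2 ⊑ 3 ⊗ x0 ⊕ K 9 ⊕ (K 2 ⊕ x1) · 1 , K 2 ⊕ x3 ⊑ x2 · 1 , x4 ⊑ K 1 · 1 , x5 ⊑ x3 · 1 , x7 ⊑ x6 · 1 , x9 ⊑ x4 ⊕ x5 ⊕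
          x7 · 1 , x6 ⊕ (4 ⊗ (K 1 ⊕ x0) ⊕ K 4) ⊕ (K 2 ⊕ x1) ⊑ x8 · 1 , K 1 ⊕ x8 ⊑ x9 · done)
          (≤-reflexive h0 , ≤-reflexive (sym h1) , h2 , h3 , h4 , ≤-reflexive h5 , h6 , h7 , tt)

  -- Odd m

  -- The number 4j + 2i + 10 is n + (k - 1): enough for k - 1 triangles by Dirac's argument, and one
  -- too small for the last, which `critical` provides.
  odd-finish : ∀ {j i L} {g : Graph V} → Unique L → length L ≡ 3 * j + 6 + suc (double (suc i)) → (R : RainbowGraph g) →
    (∀ {v Y} → L ↭ v ∷ Y → 2 * j + i + 4 ≤ deg g v L) → EdgeDegree (simple R) (4 * j + 2 * i + 10) L → RainbowPacking L (2 + j)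
  odd-finish {j} {i} {L} {g} uL len R degree ed
    with disjoint-triangles (simple R) (1 + j) (All-by-front L λ σ → ≤-trans (small j i) (degree σ)) ed′
        (long j (length L) (double i) len)
    where
    small : ∀ j i → 2 * (1 + j) ≤ 2 * j + i + 4
    small j i = deduce (j ∷ i ∷ []) 1 (2 ⊗ (K 1 ⊕ x0) ⊑ 2 ⊗ x0 ⊕ x1 ⊕ K 4) (done) (tt)
    long : ∀ j n d → n ≡ 3 * j + 6 + (3 + d) → 3 * (1 + j) + 1 ≤ n
    long j n d h0 = deduce (j ∷ n ∷ d ∷ []) 1 (3 ⊗ (K 1 ⊕ x0) ⊕ K 1 ⊑ x1) (1 , 3 ⊗ x0 ⊕ K 6 ⊕ (K 3 ⊕ x2) ⊑ x1 · done)
        (≤-reflexive (sym h0) , tt)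
    ed′ : EdgeDegree (simple R) (length L + (1 + j)) L
    ed′ σ ab = ≤-trans (enough j i (length L) (double i) len (double≡2* i)) (ed σ ab)
      where
      enough : ∀ j i n d → n ≡ 3 * j + 6 + (3 + d) → d ≡ 2 * i → n + (1 + j) ≤ 4 * j + 2 * i + 10
      enough j i n d h0 h1 = deduce (j ∷ i ∷ n ∷ d ∷ []) 1 (x2 ⊕ (K 1 ⊕ x0) ⊑ 4 ⊗ x0 ⊕ 2 ⊗ x1 ⊕ K 10)
          (1 , x2 ⊑ 3 ⊗ x0 ⊕ K 6 ⊕ (K 3 ⊕ x3) · 1 , x3 ⊑ 2 ⊗ x1 · done) (≤-reflexive h0 , ≤-reflexive h1 , tt)
  ... | P , X , size , pk = Critical.critical R uL (suc j) ed′ size pk (room (length P) j (length X) (length L) (double i) size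
      (packing-length pk) len)
          (All-by-front L λ σ → ≤-trans (small j i) (degree σ))
    where
    small : ∀ j i → 2 * (1 + j) + 2 ≤ 2 * j + i + 4
    small j i = deduce (j ∷ i ∷ []) 1 (2 ⊗ (K 1 ⊕ x0) ⊕ K 2 ⊑ 2 ⊗ x0 ⊕ x1 ⊕ K 4) (done) (tt)
    room : ∀ t j r n d → t ≡ 1 + j → 3 * t + r ≡ n → n ≡ 3 * j + 6 + (3 + d) → 6 ≤ r
    room t j r n d h0 h1 h2 = deduce (t ∷ j ∷ r ∷ n ∷ d ∷ []) 1 (K 6 ⊑ x2) (3 , x0 ⊑ K 1 ⊕ x1 · 1 , x3 ⊑ 3 ⊗ x0 ⊕ x2 · 1 , 3 ⊗ x1
        ⊕ K 6 ⊕ (K 3 ⊕ x4) ⊑ x3 · done) (≤-reflexive h0 , ≤-reflexive (sym h1) , ≤-reflexive (sym h2) , tt)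
    ed′ : EdgeDegree (simple R) (length L + (1 + j)) L
    ed′ σ ab = ≤-trans (enough j i (length L) (double i) len (double≡2* i)) (ed σ ab)
      where
      enough : ∀ j i n d → n ≡ 3 * j + 6 + (3 + d) → d ≡ 2 * i → n + (1 + j) ≤ 4 * j + 2 * i + 10
      enough j i n d h0 h1 = deduce (j ∷ i ∷ n ∷ d ∷ []) 1 (x2 ⊕ (K 1 ⊕ x0) ⊑ 4 ⊗ x0 ⊕ 2 ⊗ x1 ⊕ K 10)
          (1 , x2 ⊑ 3 ⊗ x0 ⊕ K 6 ⊕ (K 3 ⊕ x3) · 1 , x3 ⊑ 2 ⊗ x1 · done) (≤-reflexive h0 , ≤-reflexive h1 , tt)

  -- For k = 2 there is no smaller k to fall back on, but by `bound-odd₀` deleting single vertices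
  -- is enough. For k ≥ 3 the degree sums come from `edge-degree`.
  odd-case : ∀ {j i} → Bounded j (double (suc i)) → Bounded j (suc (double i)) →
      (∀ {j′} → j ≡ suc j′ → Bounded j′ (suc (double (suc i)))) →
    Bounded j (suc (double (suc i)))
  odd-case {zero} {i} ih₁ _ _ {L} uL len {g} R ¬rp = ≮⇒≥ λ dense → ¬rp (odd-finish {0} {i} uL len R
    (λ σ → ≤-trans (weaken i) (degree dense σ))
    (λ {a} {b} {X} σ ab → sum i _ _ (degree dense σ) (degree dense (ptrans σ (pswap a b refl)))))
    where
    degree : bound 0 (suc (double (suc i))) < e g L → ∀ {v Y} → L ↭ v ∷ Y → 5 + i ≤ deg g v L
    degree dense σ = step i (bound 0 (double (suc i))) _ _ _ (bound-odd₀ i) dense (minimum-degree {0} uL len R ¬rp ih₁ σ)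
      where
      step : ∀ i a b n d → a + 3 + (1 + i) ≤ b → b < n → n ≤ d + a → 5 + i ≤ d
      step i a b n d h0 h1 h2 = deduce (i ∷ a ∷ b ∷ n ∷ d ∷ []) 1 (K 5 ⊕ x0 ⊑ x4) (1 , x1 ⊕ K 3 ⊕ (K 1 ⊕ x0) ⊑ x2 · 1 , K 1 ⊕ x2
          ⊑ x3 · 1 , x3 ⊑ x4 ⊕ x1 · done) (h0 , h1 , h2 , tt)
    weaken : ∀ i → i + 4 ≤ 5 + i
    weaken i = deduce (i ∷ []) 1 (x0 ⊕ K 4 ⊑ K 5 ⊕ x0) (done) (tt)
    sum : ∀ i x y → 5 + i ≤ x → 5 + i ≤ y → 2 * i + 10 ≤ x + y
    sum i x y h0 h1 = deduce (i ∷ x ∷ y ∷ []) 1 (2 ⊗ x0 ⊕ K 10 ⊑ x1 ⊕ x2) (1 , K 5 ⊕ x0 ⊑ x1 · 1 , K 5 ⊕ x0 ⊑ x2 · done)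
        (h0 , h1 , tt)
  odd-case {suc j} {i} ih₁ ih₂ ihₖ {L} uL len {g} R ¬rp = ≮⇒≥ λ dense → ¬rp (odd-finish {suc j} {i} uL len R (degree dense)
    (λ σ ab → ≤-trans (enough j i (double i) (double≡2* i)) (edge-degree uL len′ R ¬rp dense ih₂ (ihₖ refl) σ ab)))
    where
    degree : bound (suc j) (suc (double (suc i))) < e g L → ∀ {v Y} → L ↭ v ∷ Y → 2 * suc j + i + 4 ≤ deg g v L
    degree dense σ = step (suc j) i (bound (suc j) (double (suc i))) _ _ _ (bound-odd (suc j) i) dense
        (minimum-degree {suc j} uL len R ¬rp ih₁ σ)
      where
      step : ∀ j i a b n d → a + (2 * j + 2) + (1 + i) ≤ b → b < n → n ≤ d + a → 2 * j + i + 4 ≤ d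
      step j i a b n d h0 h1 h2 = deduce (j ∷ i ∷ a ∷ b ∷ n ∷ d ∷ []) 1 (2 ⊗ x0 ⊕ x1 ⊕ K 4 ⊑ x5)
          (1 , x2 ⊕ (2 ⊗ x0 ⊕ K 2) ⊕ (K 1 ⊕ x1) ⊑ x3 · 1 , K 1 ⊕ x3 ⊑ x4 · 1 , x4 ⊑ x5 ⊕ x2 · done) (h0 , h1 , h2 , tt)
    len′ : length L ≡ 3 * j + 9 + (3 + double i)
    len′ = trans len (size j (double i))
      where
      size : ∀ j d → 3 * suc j + 6 + (3 + d) ≡ 3 * j + 9 + (3 + d)
      size = solve-∀
    enough : ∀ j i d → d ≡ 2 * i → 4 * (1 + j) + 2 * i + 10 ≤ 4 * j + 13 + (1 + d)
    enough j i d h0 = deduce (j ∷ i ∷ d ∷ []) 1 (4 ⊗ (K 1 ⊕ x0) ⊕ 2 ⊗ x1 ⊕ K 10 ⊑ 4 ⊗ x0 ⊕ K 13 ⊕ (K 1 ⊕ x2))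
        (1 , 2 ⊗ x1 ⊑ x2 · done) (≤-reflexive (sym h0) , tt)

  -- Complements

  co : Graph V → Graph V
  co g a b = not (same a b) ∧ not (g a b)

  same-sym : ∀ a b → same a b ≡ same b a
  same-sym a b = bool-ext (flip a b) (flip b a)
    where
    flip : ∀ a b → same a b ≡ true → same b a ≡ true
    flip a b p with same⇒≡ a b p
    ... | refl = p

  co-simple : ∀ {g} → Simple g → Simple (co g)
  co-simple s .symm a b = cong₂ (λ p q → not p ∧ not q) (same-sym a b) (symm s a b)
  co-simple s .irrefl a rewrite same-refl a = refl

  co-false : ∀ {g : Graph V} {a b} → g a b ≡ true → co g a b ≡ false
  co-false {g} {a} {b} p rewrite p with same a b
  ... | true = refl
  ... | false = refl

  co-true : ∀ {g : Graph V} {a b} → a ≢ b → g a b ≡ false → co g a b ≡ true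
  co-true {g} {a} {b} d p rewrite p | dec-false (a ≟ᶠ b) d = refl

  co-absent : ∀ {g : Graph V} {a b} → co g a b ≡ true → g a b ≡ false
  co-absent {g} {a} {b} p = false-if λ q → contradict (trans (sym p) (co-false {g} q))
    where
    contradict : true ≡ false → ⊥
    contradict ()

  true-or-false : ∀ b → b ≡ true ⊎ b ≡ false
  true-or-false true = inj₁ refl
  true-or-false false = inj₂ refl

  co-present : ∀ {g : Graph V} {a b} → a ≢ b → co g a b ≡ false → g a b ≡ true
  co-present {g} {a} {b} d p with true-or-false (g a b)
  ... | inj₁ q = q
  ... | inj₂ q with trans (sym p) (co-true {g} d q)
  ...   | ()

  co-deg : ∀ (g : Graph V) {v X} → All (v ≢_) X → deg g v X + deg (co g) v X ≡ length X
  co-deg g [] = refl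
  co-deg g {v} {w ∷ X} (d ∷ ds) with true-or-false (g v w)
  ... | inj₁ p = trans (cong₂ (λ p q → ind p + deg g v X + (ind q + deg (co g) v X)) p (co-false {g} p)) (cong suc (co-deg g ds))
  ... | inj₂ p = trans (cong₂ (λ p q → ind p + deg g v X + (ind q + deg (co g) v X)) p (co-true {g} d p))
                   (trans (+-suc _ _) (cong suc (co-deg g ds)))

  co-e : ∀ (g : Graph V) {X} → Unique X → e g X + e (co g) X ≡ pairs (length X)
  co-e g [] = refl
  co-e g {v ∷ X} (d ∷ uX) = trans (interleave (deg g v X) (e g X) (deg (co g) v X) (e (co g) X))
      (cong₂ _+_ (co-deg g d) (co-e g uX))
    where
    interleave : ∀ a b s t → a + b + (s + t) ≡ a + s + (b + t)
    interleave = solve-∀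

  handshake : ∀ {h : Graph V} → Simple h → ∀ X → ∑ (λ v → deg h v X) X ≡ 2 * e h X
  handshake s [] = refl
  handshake {h} s (v ∷ X) rewrite irrefl s v | ∑-distrib (λ x → ind (h x v)) (λ x → deg h x X) X
    | ∑-cong X (λ x → cong ind (symm s x v)) | handshake s X = rearrange (deg h v X) (e h X)
    where
    rearrange : ∀ a b → a + (a + 2 * b) ≡ 2 * (a + b)
    rearrange = solve-∀

  deg-all : ∀ (h : Graph V) v {X} → All (λ x → h v x ≡ true) X → deg h v X ≡ length X
  deg-all h v [] = refl
  deg-all h v (p ∷ ps) rewrite p = cong suc (deg-all h v ps)

  deg-none : ∀ (h : Graph V) v {X} → All (λ x → h v x ≡ false) X → deg h v X ≡ 0
  deg-none h v [] = refl
  deg-none h v (p ∷ ps) rewrite p = deg-none h v ps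

  argmax : {A : Set} (f : A → ℕ) (x : A) (X : List A) → ∃[ v ] ∃[ Y ] x ∷ X ↭ v ∷ Y × All (λ y → f y ≤ f v) Y
  argmax f x [] = x , [] , refl , []
  argmax f x (y ∷ X) with argmax f y X
  ... | v , Y , σ , ms with f x ≤? f v
  ...   | yes p = v , x ∷ Y , ptrans (prep x σ) (pswap x v refl) , p ∷ ms
  ...   | no ¬p = x , y ∷ X , refl , All-resp-↭ (↭-sym σ) (≰⇒≥ ¬p ∷ All.map (λ m → ≤-trans m (≰⇒≥ ¬p)) ms)

  split : {A : Set} (p : A → Bool) (X : List A) →
    ∃[ Y ] ∃[ Z ] X ↭ Y ++ Z × All (λ x → p x ≡ true) Y × All (λ x → p x ≡ false) Z
  split p [] = [] , [] , refl , [] , []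
  split p (x ∷ X) with split p X | p x in eq
  ... | Y , Z , σ , ys , zs | true = x ∷ Y , Z , prep x σ , eq ∷ ys , zs
  ... | Y , Z , σ , ys , zs | false = Y , x ∷ Z , ptrans (prep x σ) (↭-sym (shift x Y Z)) , ys , eq ∷ zs

  -- Choosing a triangle that covers many non-edges

  module Sparse {g : Graph V} (s : Simple g) where

    private
      h = co g
      sₕ = co-simple s

    deg-front : ∀ {L v Y} → L ↭ v ∷ Y → deg h v L ≡ deg h v Y
    deg-front {v = v} {Y} σ = trans (∑-↭ _ σ) (cong (λ b → ind b + deg h v Y) (irrefl sₕ v))

    cover₂ : ∀ {L v u Y} → L ↭ v ∷ u ∷ Y → g v u ≡ true → e h L ≡ deg h v L + deg h u L + e h Y
    cover₂ {L} {v} {u} {Y} σ vu rewrite e-↭ sₕ σ | deg-front σ | deg-front (ptrans σ (pswap v u refl))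
      | co-false {g} vu | co-false {g} (flip-edge s vu) = sym (+-assoc (deg h v Y) _ _)

    -- No non-edge joins two of the three vertices, so none is counted twice.
    cover₃ : ∀ {L v u w Y} → L ↭ v ∷ u ∷ w ∷ Y → IsTri g (v , u , w) → e h L ≡ deg h v L + deg h u L + deg h w L + e h Y
    cover₃ {L} {v} {u} {w} {Y} σ (vu , vw , uw) rewrite cover₂ σ vu | deg-front {L} {w} (ptrans σ (shift w (v ∷ u ∷ []) Y))
      | co-false {g} (flip-edge s vw) | co-false {g} (flip-edge s uw) = sym (+-assoc (deg h v L + deg h u L) _ _)

    -- Each vertex of `X` that is no common neighbour accounts for a non-edge of its own at `v` or
    -- `u`.
    third : ∀ {L v u X} → Unique L → L ↭ v ∷ u ∷ X → g v u ≡ true → e h L < length X →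
      ∃[ w ] ∃[ Y ] L ↭ v ∷ u ∷ w ∷ Y × IsTri g (v , u , w)
    third {L} {v} {u} {X} uL σ vu few with common? g v u X
    ... | inj₁ (w , Y , τ , vw , uw) = w , Y , ptrans σ (prep v (prep u τ)) , vu , vw , uw
    ... | inj₂ le with Unique-↭ σ uL
    ...   | (_ ∷ v∉) ∷ u∉ ∷ _ = ⊥-elim (contradict _ _ _ _ _ _ _ _ (co-deg g v∉) (co-deg g u∉) le few (cover₂ σ vu)
              (≤-trans (m≤n+m _ (ind (h v u))) (≤-reflexive (sym (deg-front σ))))
              (≤-trans (m≤n+m _ (ind (h u v))) (≤-reflexive (sym (deg-front (ptrans σ (pswap v u refl)))))))
      where
      contradict : ∀ p p′ q q′ x y z l {n} → p + p′ ≡ l → q + q′ ≡ l → p + q ≤ l → n < l → n ≡ x + y + z → p′ ≤ x → q′ ≤ y → ⊥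
      contradict p p′ q q′ x y z l {n} = step p p′ q q′ x y z l n
        where
        step : ∀ p p' q q' x y z l n → p + p' ≡ l → q + q' ≡ l → p + q ≤ l → n < l → n ≡ x + y + z → p' ≤ x → q' ≤ y → ⊥
        step p p' q q' x y z l n h0 h1 h2 h3 h4 h5 h6 = refute (p ∷ p' ∷ q ∷ q' ∷ x ∷ y ∷ z ∷ l ∷ n ∷ [])
            (1 , x7 ⊑ x0 ⊕ x1 · 1 , x7 ⊑ x2 ⊕ x3 · 1 , x0 ⊕ x2 ⊑ x7 · 1 , K 1 ⊕ x8 ⊑ x7 · 1 , x4 ⊕ x5 ⊕ x6 ⊑ x8 · 1 , x1 ⊑ x4 · 1
            , x3 ⊑ x5 · done) (≤-reflexive (sym h0) , ≤-reflexive (sym h1) , h2 , h3 , ≤-reflexive (sym h4) , h5 , h6 , tt)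

    -- A greedy choice: `v` has the most non-edges, `u` the most among the neighbours of `v`, and
    -- `w` the most among the `cs` common neighbours. In `total`, the handshake sum is split into
    -- non-neighbours of `v`, remaining non-neighbours of `u`, and common neighbours, each bounded
    -- by its maximum.
    record Selection (L : List V) : Set where
      field
        {v u w} : V
        {Y A B} : List V
        {cs} : ℕ
        picked : L ↭ v ∷ u ∷ w ∷ Y
        tri : IsTri g (v , u , w)
        around : L ↭ v ∷ (A ++ B)
        missing : All (λ b → h v b ≡ true) B
        missing-size : length B ≡ deg h v L
        A-small : All (λ a → deg h a L ≤ deg h u L) A
        B-small : All (λ b → deg h b L ≤ deg h v L) B
        ordered : deg h w L ≤ deg h u L × deg h u L ≤ deg h v L
        cs-size : cs + 2 + deg h v L ≤ length L
        total : 2 * e h L ≤ deg h v L + deg h v L * deg h v L + (deg h u L + deg h u L * deg h u L) + cs * deg h w L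

    -- If `v` had no neighbour, or `v` and `u` no common one, the non-edges at these vertices alone
    -- would be too many.
    select : ∀ {L} → Unique L → e h L + 3 ≤ length L → Selection L
    select {[]} uL ()
    select {l ∷ L′} uL few with argmax (λ x → deg h x (l ∷ L′)) l L′
    ... | v , X , σ , v-max with split (g v) X
    ...   | A , B , τ , as , bs = choose A τ as (All.++⁻ˡ A v-max′)
      where
      L = l ∷ L′
      f = λ x → deg h x L
      v-max′ : All (λ y → f y ≤ f v) (A ++ B)
      v-max′ = All-resp-↭ τ v-max
      uX = Unique-↭ σ uL
      bs′ : All (λ b → h v b ≡ true) B
      bs′ = All.zipWith (λ (d , p) → co-true {g} d p) (All.++⁻ʳ A (All-resp-↭ τ (AllPairs.head uX)) , bs)
      B-size : length B ≡ f v
      B-size = sym (trans (deg-front σ) (trans (∑-↭ _ τ)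
          (trans (∑-++ _ A B) (cong₂ _+_ (deg-none h v (All.map (co-false {g}) as)) (deg-all h v bs′)))))
      choose : ∀ A → X ↭ A ++ B → All (λ x → g v x ≡ true) A → All (λ y → f y ≤ f v) A → Selection L
      choose [] τ as _ = ⊥-elim (contradict (length L) _ (f v) _ _ (trans (↭-length σ) (cong suc (↭-length τ))) B-size
          (remove-vertex sₕ σ) few)
        where
        contradict : ∀ n b d x y → n ≡ 1 + b → b ≡ d → x ≡ d + y → x + 3 ≤ n → ⊥
        contradict n b d x y h0 h1 h2 h3 = refute (n ∷ b ∷ d ∷ x ∷ y ∷ []) (1 , x0 ⊑ K 1 ⊕ x1 · 1 , x1 ⊑ x2 · 1 , x2 ⊕ x4 ⊑ x3 ·
            1 , x3 ⊕ K 3 ⊑ x0 · done) (≤-reflexive h0 , ≤-reflexive h1 , ≤-reflexive (sym h2) , h3 , tt)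
      choose (a ∷ A′) τ as am with argmax f a A′
      ... | u , A₂ , ρ , u-max with split (g u) A₂
      ...   | E , D , κ , cs , ds = finish E κ cs
        where
        around : L ↭ v ∷ u ∷ (A₂ ++ B)
        around = ptrans σ (prep v (ptrans τ (++⁺ʳ B ρ)))
        uA = Unique-↭ around uL
        vu = All.head (All-resp-↭ ρ as)
        du≤dv = All.head (All-resp-↭ ρ am)
        D-size : ∀ E → A₂ ↭ E ++ D → length D ≤ f u
        D-size E κ = ≤-trans (≤-reflexive (sym (deg-all h u (All.zipWith (λ (d , p) → co-true {g} d p)
            (All.++⁻ʳ E (All-resp-↭ κ (All.++⁻ˡ A₂ (AllPairs.head (AllPairs.tail uA)))) , ds)))))
          (step (f u) (ind (h u v)) _ _ _ (deg h u D) (trans (deg-front (ptrans around (pswap v u refl)))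
              (cong (ind (h u v) +_) (∑-++ _ A₂ B)))
            (trans (∑-↭ _ κ) (∑-++ _ E D)))
          where
          step : ∀ x i a b c d → x ≡ i + (a + b) → a ≡ c + d → d ≤ x
          step x i a b c d refl refl = ≤-trans (m≤n+m d c) (≤-trans (m≤m+n (c + d) b) (m≤n+m (c + d + b) i))
        finish : ∀ E → A₂ ↭ E ++ D → All (λ x → g u x ≡ true) E → Selection L
        finish [] κ cs = ⊥-elim (contradict _ _ _ _ _ _ _ _ (↭-length around) (length-++ A₂) (↭-length κ) (D-size [] κ) B-size
            (cover₂ around vu) few)
          where
          contradict : ∀ n ab a b d x y z {w} → n ≡ 2 + ab → ab ≡ a + b → a ≡ d → d ≤ y → b ≡ x → w ≡ x + y + z → w + 3 ≤ n → ⊥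
          contradict n ab a b d x y z {w} = step n ab a b d x y z w
            where
            step : ∀ n ab a b d x y z w → n ≡ 2 + ab → ab ≡ a + b → a ≡ d → d ≤ y → b ≡ x → w ≡ x + y + z → w + 3 ≤ n → ⊥
            step n ab a b d x y z w h0 h1 h2 h3 h4 h5 h6 = refute (n ∷ ab ∷ a ∷ b ∷ d ∷ x ∷ y ∷ z ∷ w ∷ [])
                (1 , x0 ⊑ K 2 ⊕ x1 · 1 , x1 ⊑ x2 ⊕ x3 · 1 , x2 ⊑ x4 · 1 , x4 ⊑ x6 · 1 , x3 ⊑ x5 · 1 , x5 ⊕ x6 ⊕ x7 ⊑ x8 · 1 , x8
                ⊕ K 3 ⊑ x0 · done) (≤-reflexive h0 , ≤-reflexive h1 , ≤-reflexive h2 , h3 , ≤-reflexive h4 , ≤-reflexive (sym h5)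
                , h6 , tt)
        finish (c₀ ∷ C′) κ cs with argmax f c₀ C′
        ... | w , C₂ , π , w-max = record
          { picked = picked ; tri = vu , vw , uw ; around = ptrans σ (prep v τ) ; missing = bs′ ; missing-size = B-size
          ; A-small = All-resp-↭ (↭-sym ρ) (≤-refl ∷ u-max) ; B-small = All.++⁻ʳ A v-max′
          ; ordered = dw≤du , du≤dv
          ; cs = length (w ∷ C₂)
          ; cs-size = size (length L) (length C₂) (length D) (length B) (f v)
              (trans (↭-length picked) (cong (3 +_) (trans (length-++ (C₂ ++ D)) (cong (_+ length B) (length-++ C₂))))) B-size
          ; total = total (2 * e h L) (f v) (f v * f v) (f u) (f u * f u) (f w) (length C₂ * f w) (∑ f ((C₂ ++ D) ++ B))
              (∑ f (C₂ ++ D)) (∑ f C₂) (∑ f D) (∑ f B)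
              (trans (sym (handshake sₕ L)) (∑-↭ f picked)) (∑-++ f (C₂ ++ D) B) (∑-++ f C₂ D)
              (≤-trans (∑-bound f (f w) w-max) (≤-reflexive (*-comm (f w) (length C₂))))
              (≤-trans (∑-bound f (f u) (All.++⁻ʳ (c₀ ∷ C′) (All-resp-↭ κ u-max))) (*-monoʳ-≤ (f u) (D-size (c₀ ∷ C′) κ)))
              (≤-trans (∑-bound f (f v) (All.++⁻ʳ A v-max′)) (≤-reflexive (cong (f v *_) B-size))) }
          where
          picked : L ↭ v ∷ u ∷ w ∷ ((C₂ ++ D) ++ B)
          picked = ptrans around (prep v (prep u (++⁺ʳ B (ptrans κ (++⁺ʳ D π)))))
          in-A₂ : ∀ {P : V → Set} → All P A₂ → P w
          in-A₂ ps = All.head (All-resp-↭ π (All.++⁻ˡ (c₀ ∷ C′) (All-resp-↭ κ ps)))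
          vw = in-A₂ (All.tail (All-resp-↭ ρ as))
          uw = All.head (All-resp-↭ π cs)
          dw≤du = in-A₂ u-max
          size : ∀ n k d b x → n ≡ 3 + (k + d + b) → b ≡ x → 1 + k + 2 + x ≤ n
          size n k d b x h0 h1 = deduce (n ∷ k ∷ d ∷ b ∷ x ∷ []) 1 (K 1 ⊕ x1 ⊕ K 2 ⊕ x4 ⊑ x0)
              (1 , K 3 ⊕ (x1 ⊕ x2 ⊕ x3) ⊑ x0 · 1 , x4 ⊑ x3 · done) (≤-reflexive (sym h0) , ≤-reflexive (sym h1) , tt)
          total : ∀ n x xx y yy z kz t t' k d b → n ≡ x + (y + (z + t)) → t ≡ t' + b → t' ≡ k + d → k ≤ kz → d ≤ yy → b ≤ xx → n
              ≤ x + xx + (y + yy) + (z + kz)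
          total n x xx y yy z kz t t' k d b h0 h1 h2 h3 h4 h5 = deduce (n ∷ x ∷ xx ∷ y ∷ yy ∷ z ∷ kz ∷ t ∷ t' ∷ k ∷ d ∷ b ∷ []) 1
              (x0 ⊑ x1 ⊕ x2 ⊕ (x3 ⊕ x4) ⊕ (x5 ⊕ x6)) (1 , x0 ⊑ x1 ⊕ (x3 ⊕ (x5 ⊕ x7)) · 1 , x7 ⊑ x8 ⊕ x11 · 1 , x8 ⊑ x9 ⊕ x10 · 1
              , x9 ⊑ x6 · 1 , x10 ⊑ x4 · 1 , x11 ⊑ x2 · done) (≤-reflexive h0 , ≤-reflexive h1 , ≤-reflexive h2 , h3 , h4 , h5 ,
              tt)

  -- The case n = 3k

  ∑-mono-All : {A : Set} {f h : A → ℕ} {xs : List A} → All (λ x → f x ≤ h x) xs → ∑ f xs ≤ ∑ h xs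
  ∑-mono-All [] = z≤n
  ∑-mono-All (p ∷ ps) = +-mono-≤ p (∑-mono-All ps)

  -- Here `x`, `y`, `z` are the numbers of non-edges at the selected vertices, `r` the non-edges
  -- that survive their removal, and `n` all of them.
  Greedy : (x y z cs r n : ℕ) → Set
  Greedy x y z cs r n = n ≡ x + y + z + r × z ≤ y × y ≤ x × 2 * n ≤ x + x * x + (y + y * y) + cs * z

  -- When the triangle covers at most two non-edges, the maxima are so small that the handshake sum
  -- leaves none. The exception is a vertex `v` whose two non-neighbours may themselves be
  -- non-adjacent.
  greedy-two : ∀ x y z cs r n → Greedy x y z cs r n → x + y + z ≤ 2 → r ≡ 0 ⊎ (x ≡ 2 × y ≡ 0 × z ≡ 0 × r ≤ 1)
  greedy-two 0 0 0 cs r n (refl , _ , _ , le) _ = inj₁ (n≤0⇒n≡0 (step r _ (*-zeroʳ cs) le))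
    where
    step : ∀ r k → k ≡ 0 → 2 * r ≤ k → r ≤ 0
    step r k h0 h1 = deduce (r ∷ k ∷ []) 2 (x0 ⊑ K 0) (1 , x1 ⊑ K 0 · 1 , 2 ⊗ x0 ⊑ x1 · done) (≤-reflexive h0 , h1 , tt)
  greedy-two 1 0 0 cs r n (refl , _ , _ , le) _ = inj₁ (n≤0⇒n≡0 (step r _ (*-zeroʳ cs) le))
    where
    step : ∀ r k → k ≡ 0 → 2 * (1 + r) ≤ 2 + k → r ≤ 0
    step r k h0 h1 = deduce (r ∷ k ∷ []) 2 (x0 ⊑ K 0) (1 , x1 ⊑ K 0 · 1 , 2 ⊗ (K 1 ⊕ x0) ⊑ K 2 ⊕ x1 · done)
        (≤-reflexive h0 , h1 , tt)
  greedy-two 1 1 0 cs r n (refl , _ , _ , le) _ = inj₁ (n≤0⇒n≡0 (step r _ (*-zeroʳ cs) le))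
    where
    step : ∀ r k → k ≡ 0 → 2 * (2 + r) ≤ 4 + k → r ≤ 0
    step r k h0 h1 = deduce (r ∷ k ∷ []) 2 (x0 ⊑ K 0) (1 , x1 ⊑ K 0 · 1 , 2 ⊗ (K 2 ⊕ x0) ⊑ K 4 ⊕ x1 · done)
        (≤-reflexive h0 , h1 , tt)
  greedy-two 2 0 0 cs r n (refl , _ , _ , le) _ = inj₂ (refl , refl , refl , step r _ (*-zeroʳ cs) le)
    where
    step : ∀ r k → k ≡ 0 → 2 * (2 + r) ≤ 6 + k → r ≤ 1
    step r k h0 h1 = deduce (r ∷ k ∷ []) 2 (x0 ⊑ K 1) (1 , x1 ⊑ K 0 · 1 , 2 ⊗ (K 2 ⊕ x0) ⊑ K 6 ⊕ x1 · done)
        (≤-reflexive h0 , h1 , tt)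
  greedy-two 0 (suc _) _ _ _ _ (_ , _ , () , _) _
  greedy-two _ 0 (suc _) _ _ _ (_ , () , _) _
  greedy-two 1 (suc (suc _)) _ _ _ _ (_ , _ , s≤s () , _) _
  greedy-two 1 1 (suc _) _ _ _ _ (s≤s (s≤s ()))
  greedy-two 2 (suc _) _ _ _ _ _ (s≤s (s≤s ()))
  greedy-two (suc (suc (suc _))) _ _ _ _ _ _ (s≤s (s≤s ()))

  -- The three outcomes belong to the distributions 3 + 0 + 0, 2 + 1 + 0 and 1 + 1 + 1. In the last
  -- one the non-edges form a matching, and those that survive need many common neighbours as ends.
  greedy-three : ∀ x y z cs r n → Greedy x y z cs r n → x + y + z ≡ 3 → (x ≡ 3 × y ≡ 0 × z ≡ 0 × r ≤ 3) ⊎ r ≤ 1 ⊎ 2 * r + 2 ≤ cs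
  greedy-three 3 0 0 cs r n (refl , _ , _ , le) _ = inj₁ (refl , refl , refl , step r _ (*-zeroʳ cs) le)
    where
    step : ∀ r k → k ≡ 0 → 2 * (3 + r) ≤ 12 + k → r ≤ 3
    step r k h0 h1 = deduce (r ∷ k ∷ []) 2 (x0 ⊑ K 3) (1 , x1 ⊑ K 0 · 1 , 2 ⊗ (K 3 ⊕ x0) ⊑ K 12 ⊕ x1 · done)
        (≤-reflexive h0 , h1 , tt)
  greedy-three 2 1 0 cs r n (refl , _ , _ , le) _ = inj₂ (inj₁ (step r _ (*-zeroʳ cs) le))
    where
    step : ∀ r k → k ≡ 0 → 2 * (3 + r) ≤ 8 + k → r ≤ 1
    step r k h0 h1 = deduce (r ∷ k ∷ []) 2 (x0 ⊑ K 1) (1 , x1 ⊑ K 0 · 1 , 2 ⊗ (K 3 ⊕ x0) ⊑ K 8 ⊕ x1 · done)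
        (≤-reflexive h0 , h1 , tt)
  greedy-three 1 1 1 cs r n (refl , _ , _ , le) _ = inj₂ (inj₂ (step r _ cs (*-identityʳ cs) le))
    where
    step : ∀ r k c → k ≡ c → 2 * (3 + r) ≤ 4 + k → 2 * r + 2 ≤ c
    step r k c h0 h1 = deduce (r ∷ k ∷ c ∷ []) 1 (2 ⊗ x0 ⊕ K 2 ⊑ x2) (1 , x1 ⊑ x2 · 1 , 2 ⊗ (K 3 ⊕ x0) ⊑ K 4 ⊕ x1 · done)
        (≤-reflexive h0 , h1 , tt)
  greedy-three 0 0 0 _ _ _ _ ()
  greedy-three 0 0 (suc _) _ _ _ (_ , () , _) _
  greedy-three 0 (suc _) _ _ _ _ (_ , _ , () , _) _
  greedy-three 1 0 0 _ _ _ _ ()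
  greedy-three (suc _) 0 (suc _) _ _ _ (_ , () , _) _
  greedy-three 1 1 0 _ _ _ _ ()
  greedy-three 1 1 (suc (suc _)) _ _ _ (_ , s≤s () , _) _
  greedy-three 1 (suc (suc _)) _ _ _ _ (_ , _ , s≤s () , _) _
  greedy-three 2 0 0 _ _ _ _ ()
  greedy-three 2 1 (suc _) _ _ _ _ ()
  greedy-three 2 (suc (suc _)) _ _ _ _ _ ()
  greedy-three 3 (suc _) _ _ _ _ _ ()
  greedy-three (suc (suc (suc (suc _)))) _ _ _ _ _ _ ()

  module _ {g : Graph V} (s : Simple g) where
    open Sparse s
    open Selection

    private
      h = co g

    Packs-∷ : ∀ {t L x y z Y} → L ↭ x ∷ y ∷ z ∷ Y → IsTri g (x , y , z) → Packs g t Y → Packs g (suc t) L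
    Packs-∷ {x = x} {y} {z} σ tri (P , R , len , (ts , π)) =
      (x , y , z) ∷ P , R , cong suc len , (tri ∷ ts , ptrans (prep x (prep y (prep z π))) (↭-sym σ))

    complete-triple : ∀ {Y} → Unique Y → length Y ≡ 3 → e h Y ≡ 0 → Packs g 1 Y
    complete-triple {x ∷ y ∷ z ∷ []} ((xy ∷ xz ∷ []) ∷ (yz ∷ []) ∷ _) refl none =
      (x , y , z) ∷ [] , [] , refl , ((edge xy (here refl) (there (here refl)) , edge xz (here refl) (there (there (here refl))) ,
        edge yz (there (here refl)) (there (there (here refl)))) ∷ [] , refl)
      where
      edge : ∀ {p q} → p ≢ q → p ∈ x ∷ y ∷ z ∷ [] → q ∈ x ∷ y ∷ z ∷ [] → g p q ≡ true
      edge {p} {q} d p∈ q∈ = co-present {g} d (false-if λ t → e-zero (co-simple s) none p∈ q∈ d t)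

    greedy : ∀ {L} (S : Selection L) → Greedy (deg h (v S) L) (deg h (u S) L) (deg h (w S) L) (cs S) (e h (Y S)) (e h L)
    greedy S = cover₃ (picked S) (tri S) , proj₁ (ordered S) , proj₂ (ordered S) , total S

    rest-unique : ∀ {L} → Unique L → (S : Selection L) → Unique (Y S)
    rest-unique uL S = AllPairs.tail (AllPairs.tail (AllPairs.tail (Unique-↭ (picked S) uL)))

    rest-length : ∀ {L m} (S : Selection L) → length L ≡ 3 + m → length (Y S) ≡ m
    rest-length S len = suc-injective (suc-injective (suc-injective (trans (sym (↭-length (picked S))) len)))

    split-length : ∀ j {n} → n ≡ 3 * suc j + 6 → n ≡ 3 + (3 * j + 6)
    split-length j eq = trans eq (rearrange j)
      where
      rearrange : ∀ j → 3 * suc j + 6 ≡ 3 + (3 * j + 6)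
      rearrange = solve-∀

    cover-size : ∀ {L} → Selection L → ℕ
    cover-size {L} S = deg h (v S) L + deg h (u S) L + deg h (w S) L

    -- A selected triangle either covers three non-edges, as many as the allowance drops when `j`
    -- does, or leaves at most one behind.
    sparse-packs : ∀ j {L} → Unique L → length L ≡ 3 * j + 6 → e h L ≤ 3 * j + 2 → Packs g (2 + j) L
    sparse-packs zero {L} uL len few = pack (select uL (≤-trans (+-monoˡ-≤ 3 few) (≤-trans (n≤1+n 5) (≤-reflexive (sym len)))))
      where
      none : (S : Selection L) → 2 < cover-size S ⊎ cover-size S ≤ 2 → e h (Y S) ≡ 0
      none S (inj₁ big) = n≤0⇒n≡0 (step (cover-size S) (e h (Y S)) (e h L) (proj₁ (greedy S)) few big)
        where
        step : ∀ x r n → n ≡ x + r → n ≤ 2 → 2 < x → r ≤ 0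
        step x r n h0 h1 h2 = deduce (x ∷ r ∷ n ∷ []) 1 (x1 ⊑ K 0) (1 , x0 ⊕ x1 ⊑ x2 · 1 , x2 ⊑ K 2 · 1 , K 1 ⊕ K 2 ⊑ x0 · done)
            (≤-reflexive (sym h0) , h1 , h2 , tt)
      none S (inj₂ small) with greedy-two _ _ _ (cs S) _ _ (greedy S) small
      ... | inj₁ z = z
      ... | inj₂ (dv , du , dw , _) = n≤0⇒n≡0 (step (deg h (v S) L) (deg h (u S) L) (deg h (w S) L) (e h (Y S)) (e h L)
          (proj₁ (greedy S)) few dv)
        where
        step : ∀ x y z r n → n ≡ x + y + z + r → n ≤ 2 → x ≡ 2 → r ≤ 0
        step x y z r n h0 h1 h2 = deduce (x ∷ y ∷ z ∷ r ∷ n ∷ []) 1 (x3 ⊑ K 0) (1 , x0 ⊕ x1 ⊕ x2 ⊕ x3 ⊑ x4 · 1 , x4 ⊑ K 2 · 1 , K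
            2 ⊑ x0 · done) (≤-reflexive (sym h0) , h1 , ≤-reflexive (sym h2) , tt)
      pack : Selection L → Packs g 2 L
      pack S = Packs-∷ (picked S) (tri S) (complete-triple (rest-unique uL S) (rest-length S len)
          (none S (<-≤-connex 2 (cover-size S))))
    sparse-packs (suc j) {L} uL len few = pack (select uL (room j (e h L) (length L) few len))
      where
      room : ∀ j n m → n ≤ 3 * (1 + j) + 2 → m ≡ 3 * (1 + j) + 6 → n + 3 ≤ m
      room j n m h0 h1 = deduce (j ∷ n ∷ m ∷ []) 1 (x1 ⊕ K 3 ⊑ x2) (1 , x1 ⊑ 3 ⊗ (K 1 ⊕ x0) ⊕ K 2 · 1 , 3 ⊗ (K 1 ⊕ x0) ⊕ K 6 ⊑ x2
          · done) (h0 , ≤-reflexive (sym h1) , tt)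
      fewer : (S : Selection L) → 2 < cover-size S ⊎ cover-size S ≤ 2 → e h (Y S) ≤ 3 * j + 2
      fewer S (inj₁ big) = step j (cover-size S) (e h (Y S)) (e h L) (proj₁ (greedy S)) few big
        where
        step : ∀ j x r n → n ≡ x + r → n ≤ 3 * (1 + j) + 2 → 2 < x → r ≤ 3 * j + 2
        step j x r n h0 h1 h2 = deduce (j ∷ x ∷ r ∷ n ∷ []) 1 (x2 ⊑ 3 ⊗ x0 ⊕ K 2) (1 , x1 ⊕ x2 ⊑ x3 · 1 , x3 ⊑ 3 ⊗ (K 1 ⊕ x0) ⊕ K
            2 · 1 , K 1 ⊕ K 2 ⊑ x1 · done) (≤-reflexive (sym h0) , h1 , h2 , tt)
      fewer S (inj₂ small) with greedy-two _ _ _ (cs S) _ _ (greedy S) small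
      ... | inj₁ z = ≤-trans (≤-reflexive z) z≤n
      ... | inj₂ (_ , _ , _ , le) = ≤-trans le (≤-trans (s≤s z≤n) (m≤n+m 2 (3 * j)))
      pack : Selection L → Packs g (3 + j) L
      pack S = Packs-∷ (picked S) (tri S) (sparse-packs j (rest-unique uL S) (rest-length S (split-length j len))
          (fewer S (<-≤-connex 2 (cover-size S))))

  -- At most 3k - 3 non-edges on 3k vertices

  module _ {g : Graph V} (R : RainbowGraph g) {L : List V} (uL : Unique L) where

    private
      h = co g
      s = simple R

    co-exchange-e : ∀ {u w} → u ≢ w → u ∈ L → w ∈ L → e (co (exchange-edge g u w)) L ≤ e h L
    co-exchange-e {u} {w} d u∈ w∈ = step (e g L) (e h L) (e (exchange-edge g u w) L) (e (co (exchange-edge g u w)) L)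
        (pairs (length L))
      (co-e g uL) (co-e (exchange-edge g u w) uL) (e-exchange R d uL u∈ w∈)
      where
      step : ∀ a b c d p → a + b ≡ p → c + d ≡ p → a ≤ c → d ≤ b
      step a b c d p h0 h1 h2 = deduce (a ∷ b ∷ c ∷ d ∷ p ∷ []) 1 (x3 ⊑ x1) (1 , x4 ⊑ x0 ⊕ x1 · 1 , x2 ⊕ x3 ⊑ x4 · 1 , x0 ⊑ x2 ·
          done) (≤-reflexive (sym h0) , ≤-reflexive h1 , h2 , tt)

    -- Of the non-edges at `u` only `uw` itself is filled.
    co-exchange-deg : ∀ {u w X} → L ↭ u ∷ w ∷ X → u ≢ w → deg h u L ≤ 1 + deg (co (exchange-edge g u w)) u L
    co-exchange-deg {u} {w} {X} σ d = begin
      deg h u L                         ≡⟨ Sparse.deg-front s σ ⟩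
      ind (h u w) + deg h u X           ≤⟨ +-mono-≤ (ind≤1 (h u w))
          (∑-mono-All (All.zipWith (λ (p , q) → ind-mono (still p q))
          (All.tail (AllPairs.head uσ) , AllPairs.head (AllPairs.tail uσ)))) ⟩
      1 + deg h′ u X                    ≤⟨ s≤s (m≤n+m _ (ind (h′ u w))) ⟩
      1 + (ind (h′ u w) + deg h′ u X)   ≡⟨ cong suc (Sparse.deg-front (simple (exchange-rainbow R d)) σ) ⟨
      1 + deg h′ u L                    ∎
      where
      open ≤-Reasoning
      uσ = Unique-↭ σ uL
      h′ = co (exchange-edge g u w)
      still : ∀ {y} → u ≢ y → w ≢ y → h u y ≡ true → h′ u y ≡ true
      still u≢y w≢y t = co-true {exchange-edge g u w} u≢y (false-if λ t′ → absurd (exchanged R d t′))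
        where
        absurd : SameEdge u _ u w ⊎ (g u _ ≡ true × _) → ⊥
        absurd (inj₁ (inj₁ (_ , refl))) = w≢y refl
        absurd (inj₁ (inj₂ (q , _))) = d q
        absurd (inj₂ (q , _)) with trans (sym q) (co-absent {g} t)
        ... | ()

    open Sparse s using (Selection; select)
    open Sparse.Selection

    -- Nine vertices whose non-edges form a K₄: recolour one of them.
    nine-vertices : length L ≡ 9 → (S : Selection L) → deg h (v S) L ≡ 3 → deg h (u S) L ≡ 0 → e h L ≡ 6 → RainbowPacking L 3
    nine-vertices len S dv du six with pigeonhole (λ x → deg h x L) 2 (B S) heavy
      where
      f = λ x → deg h x L
      -- Six non-edges have degree sum 12. The vertex `v` takes 3 and its neighbours take none, so
      -- the three vertices of `B S` share 9.
      heavy : 2 * length (B S) < ∑ f (B S)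
      heavy = step (length (B S)) (f (v S)) (∑ f (A S)) (length (A S)) (∑ f (B S)) (∑ f (A S ++ B S)) (∑ f L) (e h L)
        (trans (missing-size S) dv) dv (∑-bound f 0 (All.map (λ le → subst (_ ≤_) du le) (A-small S))) (∑-++ f (A S) (B S))
            (∑-↭ f (around S))
        (handshake (co-simple s) L) six
        where
        step : ∀ l x a la b ab t n → l ≡ 3 → x ≡ 3 → a ≤ 0 * la → ab ≡ a + b → t ≡ x + ab → t ≡ 2 * n → n ≡ 6 → 2 * l < b
        step l x a la b ab t n h0 h1 h2 h3 h4 h5 h6 = deduce (l ∷ x ∷ a ∷ la ∷ b ∷ ab ∷ t ∷ n ∷ []) 1 (K 1 ⊕ 2 ⊗ x0 ⊑ x4)
            (2 , x0 ⊑ K 3 · 1 , x1 ⊑ K 3 · 1 , x2 ⊑ 0 ⊗ x3 · 1 , x5 ⊑ x2 ⊕ x4 · 1 , x6 ⊑ x1 ⊕ x5 · 1 , 2 ⊗ x7 ⊑ x6 · 2 , K 6 ⊑ x7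
            · done) (≤-reflexive h0 , ≤-reflexive h1 , h2 , ≤-reflexive h3 , ≤-reflexive h4 , ≤-reflexive (sym h5) , ≤-reflexive
            (sym h6) , tt)
    ... | x , B′ , τ , big = close (Sparse.third (simple R′) uL σ (added R d)
        (room (e h′ L) (e h L) (length (A S ++ B′)) (length L) few six (↭-length σ) len))
      where
      σ : L ↭ v S ∷ x ∷ (A S ++ B′)
      σ = ptrans (around S) (prep (v S) (ptrans (++⁺ˡ (A S) τ) (shift x (A S) B′)))
      d : v S ≢ x
      d = edge-≢ (co-simple s) (All.head (All-resp-↭ τ (missing S)))
      R′ = exchange-rainbow R d
      h′ = co (exchange-edge g (v S) x)
      few = co-exchange-e d (front-∈ σ) (front₂-∈ σ)
      room : ∀ a b l n → a ≤ b → b ≡ 6 → n ≡ 2 + l → n ≡ 9 → a < l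
      room a b l n h0 h1 h2 h3 = deduce (a ∷ b ∷ l ∷ n ∷ []) 1 (K 1 ⊕ x0 ⊑ x2) (1 , x0 ⊑ x1 · 1 , x1 ⊑ K 6 · 1 , x3 ⊑ K 2 ⊕ x2 ·
          1 , K 9 ⊑ x3 · done) (h0 , ≤-reflexive h1 , ≤-reflexive h2 , ≤-reflexive (sym h3) , tt)
      -- Exchanging along `xv` and along `vx` gives the same graph, though not by computation.
      flipped : ∀ {y} → deg (co (exchange-edge g x (v S))) y L ≤ deg h′ y L
      flipped {y} = ∑-mono L λ w → ind-mono λ t → co-true {exchange-edge g (v S) x}
          (edge-≢ (co-simple (simple (exchange-rainbow R (λ eq → d (sym eq))))) t)
        (false-if λ t′ → absurd (exchanged R d t′) t)
        where
        absurd : ∀ {w} → SameEdge y w (v S) x ⊎ (g y w ≡ true × c y w ≢ c (v S) x) → co (exchange-edge g x (v S)) y w ≡ true → ⊥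
        absurd {w} p t with trans (sym (present p)) (co-absent {exchange-edge g x (v S)} t)
          where
          present : SameEdge y w (v S) x ⊎ (g y w ≡ true × c y w ≢ c (v S) x) → exchange-edge g x (v S) y w ≡ true
          present (inj₁ (inj₁ p)) = ∨-introˡ (sameEdge-complete (inj₂ p))
          present (inj₁ (inj₂ p)) = ∨-introˡ (sameEdge-complete (inj₁ p))
          present (inj₂ (p , q)) = kept R (λ eq → d (sym eq)) p (λ eq → q (trans eq (col-sym 𝒞 x (v S))))
        ... | ()
      -- Each of `v` and `x` keeps at least two non-edges, so a triangle on the new edge covers four
      -- of at most six.
      close : ∃[ w ] ∃[ Y ] L ↭ v S ∷ x ∷ w ∷ Y × IsTri (exchange-edge g (v S) x) (v S , x , w) → RainbowPacking L 3
      close (w , Y , ρ , tri) = exchange-edge g (v S) x , R′ , Packs-∷ (simple R′) ρ tri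
        (sparse-packs (simple R′) 0 (AllPairs.tail (AllPairs.tail (AllPairs.tail (Unique-↭ ρ uL))))
          (suc-injective (suc-injective (suc-injective (trans (sym (↭-length ρ)) len))))
          (step (deg h (v S) L) (deg h x L) (deg h′ (v S) L) (deg (co (exchange-edge g x (v S))) x L) (deg h′ x L) (deg h′ w L)
              (e h′ Y) (e h′ L) (e h L)
            dv big (co-exchange-deg σ d) (co-exchange-deg (ptrans σ (pswap (v S) x refl)) (λ eq → d (sym eq))) (flipped {x})
            (Sparse.cover₃ (simple R′) ρ tri) few six))
        where
        step : ∀ a b a' b'' b' w r n' n → a ≡ 3 → 2 < b → a ≤ 1 + a' → b ≤ 1 + b'' → b'' ≤ b' → n' ≡ a' + b' + w + r → n' ≤ n → n
            ≡ 6 → r ≤ 2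
        step a b a' b'' b' w r n' n h0 h1 h2 h3 h4 h5 h6 h7 = deduce (a ∷ b ∷ a' ∷ b'' ∷ b' ∷ w ∷ r ∷ n' ∷ n ∷ []) 1 (x6 ⊑ K 2)
            (1 , K 3 ⊑ x0 · 1 , K 1 ⊕ K 2 ⊑ x1 · 1 , x0 ⊑ K 1 ⊕ x2 · 1 , x1 ⊑ K 1 ⊕ x3 · 1 , x3 ⊑ x4 · 1 , x2 ⊕ x4 ⊕ x5 ⊕ x6 ⊑ x7
            · 1 , x7 ⊑ x8 · 1 , x8 ⊑ K 6 · done) (≤-reflexive (sym h0) , h1 , h2 , h3 , h4 , ≤-reflexive (sym h5) , h6 ,
            ≤-reflexive h7 , tt)

    -- Six vertices whose non-edges form a triangle: recolour one of them.
    six-vertices : length L ≡ 6 → (S : Selection L) → deg h (v S) L ≡ 2 → deg h (u S) L ≡ 0 → e h L ≡ 3 → RainbowPacking L 2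
    six-vertices len S dv du three = close (around S) (missing S) (trans (missing-size S) dv)
        (A-size (length L) (length (A S)) (length (B S)) (trans (↭-length (around S)) (cong suc (length-++ (A S)))) len
        (trans (missing-size S) dv))
        (All.map (λ le → n≤0⇒n≡0 (subst (_ ≤_) du le)) (A-small S))
      where
      A-size : ∀ n a b → n ≡ 1 + (a + b) → n ≡ 6 → b ≡ 2 → a ≡ 3
      A-size n a b p q r = ≤-antisym (below n a b p q r) (above n a b p q r)
        where
        below : ∀ n a b → n ≡ 1 + (a + b) → n ≡ 6 → b ≡ 2 → a ≤ 3
        below n a b h0 h1 h2 = deduce (n ∷ a ∷ b ∷ []) 1 (x1 ⊑ K 3) (1 , K 1 ⊕ (x1 ⊕ x2) ⊑ x0 · 1 , x0 ⊑ K 6 · 1 , K 2 ⊑ x2 ·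
            done) (≤-reflexive (sym h0) , ≤-reflexive h1 , ≤-reflexive (sym h2) , tt)
        above : ∀ n a b → n ≡ 1 + (a + b) → n ≡ 6 → b ≡ 2 → 3 ≤ a
        above n a b h0 h1 h2 = deduce (n ∷ a ∷ b ∷ []) 1 (K 3 ⊑ x1) (1 , x0 ⊑ K 1 ⊕ (x1 ⊕ x2) · 1 , K 6 ⊑ x0 · 1 , x2 ⊑ K 2 ·
            done) (≤-reflexive h0 , ≤-reflexive (sym h1) , ≤-reflexive h2 , tt)
      close : ∀ {v A B} → L ↭ v ∷ (A ++ B) → All (λ b → h v b ≡ true) B → length B ≡ 2 → length A ≡ 3 →
        All (λ a → deg h a L ≡ 0) A → RainbowPacking L 2
      close {v} {a ∷ b ∷ c₀ ∷ []} {x ∷ y ∷ []} σ (vx ∷ vy ∷ []) refl refl (a0 ∷ b0 ∷ c0 ∷ []) =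
        build (exhaust shape ((0F , 1F) ∷ [])
             ((0F , 3F) ∷ (0F , 4F) ∷ (0F , 5F) ∷ (1F , 3F) ∷ (1F , 4F) ∷ (1F , 5F) ∷ (2F , 3F) ∷ (2F , 4F) ∷ (2F , 5F) ∷
                 (3F , 4F) ∷ (3F , 5F) ∷ (4F , 5F) ∷ [])
             -- At most three of the fifteen pairs are non-edges, and `vy` and `xy` are two of them;
             -- at most one of the twelve unknown pairs is missing.
             11 πs refl (isEdge g′′ vs) (λ i j → symm (simple R′) (lookup vs i) (lookup vs j)) (added R d ∷ [])
             (enough (ind (g′′ v x)) (ind (g′′ v y)) (ind (g′′ v a)) (ind (g′′ v b)) (ind (g′′ v c₀)) (ind (g′′ x y))
                 (ind (g′′ x a)) (ind (g′′ x b)) (ind (g′′ x c₀))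
               (ind (g′′ y a)) (ind (g′′ y b)) (ind (g′′ y c₀)) (ind (g′′ a b)) (ind (g′′ a c₀)) (ind (g′′ b c₀)) (e (co g′′) L)
                   (e h L)
               (trans (cong (_+ e (co g′′) L) (sym (e-↭ (simple R′) τ))) (trans (co-e g′′ uL) (cong pairs len)))
               (co-exchange-e d (front-∈ τ) (front₂-∈ τ)) three (ind≤1 (g′′ v x)) (cong ind (absent vy)) (cong ind (absent xy))))
        where
        τ : L ↭ v ∷ x ∷ y ∷ a ∷ b ∷ c₀ ∷ []
        τ = ptrans σ (prep v (shuffle (x ∷ y ∷ a ∷ b ∷ c₀ ∷ []) (2F ∷ 3F ∷ 4F ∷ 0F ∷ 1F ∷ []) refl))
        uτ = Unique-↭ τ uL
        d : v ≢ x
        d = unique-apart uτ (here refl)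
        v≢y : v ≢ y
        v≢y = unique-apart uτ (there (here refl))
        x≢y : x ≢ y
        x≢y = unique-apart (AllPairs.tail uτ) (here refl)
        R′ = exchange-rainbow R d
        g′′ = exchange-edge g v x
        vs = v ∷ x ∷ y ∷ a ∷ b ∷ c₀ ∷ []
        shape : List (Fin 6 × Fin 6)
        shape = (0F , 1F) ∷ (0F , 2F) ∷ (1F , 2F) ∷ (3F , 4F) ∷ (3F , 5F) ∷ (4F , 5F) ∷ []
        πs : List (Arrangement 6)
        πs = (0F ∷ 1F ∷ 3F ∷ 2F ∷ 4F ∷ 5F ∷ []) ∷ (0F ∷ 1F ∷ 4F ∷ 2F ∷ 3F ∷ 5F ∷ []) ∷ (0F ∷ 1F ∷ 5F ∷ 2F ∷ 3F ∷ 4F ∷ []) ∷ []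
        absent : ∀ {p} → h p y ≡ true → g′′ p y ≡ false
        absent {p} t = false-if λ t′ → absurd (exchanged R d t′)
          where
          absurd : SameEdge p y v x ⊎ (g p y ≡ true × c p y ≢ c v x) → ⊥
          absurd (inj₁ (inj₁ (_ , eq))) = x≢y (sym eq)
          absurd (inj₁ (inj₂ (_ , eq))) = v≢y (sym eq)
          absurd (inj₂ (q , _)) with trans (sym q) (co-absent {g} t)
          ... | ()
        -- No non-edge meets `a`, `b` or `c₀`, so the three non-edges are `vx`, `vy` and `xy`.
        xy : h x y ≡ true
        xy = ind-true (last (ind (h a b)) (ind (h a c₀)) (ind (h a v)) (ind (h a x)) (ind (h a y)) (ind (h b c₀)) (ind (h b v))
            (ind (h b x)) (ind (h b y))
          (ind (h c₀ v)) (ind (h c₀ x)) (ind (h c₀ y)) (ind (h v x)) (ind (h v y)) (ind (h x y)) (ind (h b a)) (ind (h c₀ a))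
              (ind (h c₀ b))
          (trans (sym (e-↭ (co-simple s) (ρ (0F ∷ 1F ∷ 2F ∷ []) refl))) three)
          (trans (sym (Sparse.deg-front s (ρ (0F ∷ 1F ∷ 2F ∷ []) refl))) a0)
          (trans (sym (Sparse.deg-front s (ρ (1F ∷ 0F ∷ 2F ∷ []) refl))) b0)
          (trans (sym (Sparse.deg-front s (ρ (2F ∷ 0F ∷ 1F ∷ []) refl))) c0)
          (ind≤1 (h v x)) (ind≤1 (h v y)))
          where
          ρ : ∀ is → isort is ≡ idx 3 → L ↭ map (lookup (a ∷ b ∷ c₀ ∷ [])) is ++ v ∷ x ∷ y ∷ []
          ρ is ok = ptrans τ (ptrans (shifts (v ∷ x ∷ y ∷ []) (a ∷ b ∷ c₀ ∷ []))
              (++⁺ʳ (v ∷ x ∷ y ∷ []) (↭-sym (shuffle (a ∷ b ∷ c₀ ∷ []) is ok))))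
          last : ∀ ab ac av ax ay bc bv bx by cv cx cy vx vy xy ba ca cb → ab + (ac + (av + (ax + (ay + 0)))) +
              (bc + (bv + (bx + (by + 0))) + (cv + (cx + (cy + 0)) + (vx + (vy + 0) + (xy + 0 + 0)))) ≡ 3 → ab +
              (ac + (av + (ax + (ay + 0)))) ≡ 0 → ba + (bc + (bv + (bx + (by + 0)))) ≡ 0 → ca + (cb + (cv + (cx + (cy + 0)))) ≡ 0
              → vx ≤ 1 → vy ≤ 1 → 1 ≤ xy
          last ab ac av ax ay bc bv bx by cv cx cy vx vy xy ba ca cb h0 h1 h2 h3 h4 h5 = deduce
              (ab ∷ ac ∷ av ∷ ax ∷ ay ∷ bc ∷ bv ∷ bx ∷ by ∷ cv ∷ cx ∷ cy ∷ vx ∷ vy ∷ xy ∷ ba ∷ ca ∷ cb ∷ []) 1 (K 1 ⊑ x14)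
              (1 , K 3 ⊑ x0 ⊕ (x1 ⊕ (x2 ⊕ (x3 ⊕ (x4 ⊕ K 0)))) ⊕
              (x5 ⊕ (x6 ⊕ (x7 ⊕ (x8 ⊕ K 0))) ⊕ (x9 ⊕ (x10 ⊕ (x11 ⊕ K 0)) ⊕ (x12 ⊕ (x13 ⊕ K 0) ⊕ (x14 ⊕ K 0 ⊕ K 0)))) · 1 , x0 ⊕
              (x1 ⊕ (x2 ⊕ (x3 ⊕ (x4 ⊕ K 0)))) ⊑ K 0 · 1 , x15 ⊕ (x5 ⊕ (x6 ⊕ (x7 ⊕ (x8 ⊕ K 0)))) ⊑ K 0 · 1 , x16 ⊕
              (x17 ⊕ (x9 ⊕ (x10 ⊕ (x11 ⊕ K 0)))) ⊑ K 0 · 1 , x12 ⊑ K 1 · 1 , x13 ⊑ K 1 · done)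
              (≤-reflexive (sym h0) , ≤-reflexive h1 , ≤-reflexive h2 , ≤-reflexive h3 , h4 , h5 , tt)
        enough : ∀ vx vy va vb vc xy xa xb xc ya yb yc ab ac bc n' n → vx + (vy + (va + (vb + (vc + 0)))) +
            (xy + (xa + (xb + (xc + 0))) + (ya + (yb + (yc + 0)) + (ab + (ac + 0) + (bc + 0 + 0)))) + n' ≡ 15 → n' ≤ n → n ≡ 3 →
            vx ≤ 1 → vy ≡ 0 → xy ≡ 0 → 11 ≤ va + (vb + (vc + (xa + (xb + (xc + (ya + (yb + (yc + (ab + (ac + (bc + 0)))))))))))
        enough vx vy va vb vc xy xa xb xc ya yb yc ab ac bc n' n h0 h1 h2 h3 h4 h5 = deduce
            (vx ∷ vy ∷ va ∷ vb ∷ vc ∷ xy ∷ xa ∷ xb ∷ xc ∷ ya ∷ yb ∷ yc ∷ ab ∷ ac ∷ bc ∷ n' ∷ n ∷ []) 1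
            (K 11 ⊑ x2 ⊕ (x3 ⊕ (x4 ⊕ (x6 ⊕ (x7 ⊕ (x8 ⊕ (x9 ⊕ (x10 ⊕ (x11 ⊕ (x12 ⊕ (x13 ⊕ (x14 ⊕ K 0))))))))))))
            (1 , K 15 ⊑ x0 ⊕ (x1 ⊕ (x2 ⊕ (x3 ⊕ (x4 ⊕ K 0)))) ⊕
            (x5 ⊕ (x6 ⊕ (x7 ⊕ (x8 ⊕ K 0))) ⊕ (x9 ⊕ (x10 ⊕ (x11 ⊕ K 0)) ⊕ (x12 ⊕ (x13 ⊕ K 0) ⊕ (x14 ⊕ K 0 ⊕ K 0)))) ⊕ x15 · 1 ,
            x15 ⊑ x16 · 1 , x16 ⊑ K 3 · 1 , x0 ⊑ K 1 · 1 , x1 ⊑ K 0 · 1 , x5 ⊑ K 0 · done)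
            (≤-reflexive (sym h0) , h1 , ≤-reflexive h2 , h3 , ≤-reflexive h4 , ≤-reflexive h5 , tt)
        build : Fits shape (isEdge g′′ vs) → RainbowPacking L 2
        build ((i ∷ j ∷ k ∷ l ∷ m ∷ n ∷ []) , (ij ∷ ik ∷ jk ∷ lm ∷ ln ∷ mn ∷ []) , sorted) =
          g′′ , R′ , (at i , at j , at k) ∷ (at l , at m , at n) ∷ [] , [] , refl ,
          ((ij , ik , jk) ∷ (lm , ln , mn) ∷ [] , ptrans (shuffle vs (i ∷ j ∷ k ∷ l ∷ m ∷ n ∷ []) sorted) (↭-sym τ))
          where at = lookup vs

    -- A triangle contains at most one of k + 1 pairwise non-adjacent vertices, so such a set blocks
    -- a partition into k triangles. It has C(k + 1, 2) non-edges, which is at most 3k - 3 exactly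
    -- when (k - 2)(k - 3) ≤ 0. These are the cases in which recolouring is called for.
    nearly-complete : ∀ j → length L ≡ 3 * j + 6 → e h L ≤ 3 * j + 3 → RainbowPacking L (2 + j)
    nearly-complete zero len few = pack (select uL (≤-trans (+-monoˡ-≤ 3 few) (≤-reflexive (sym len))))
      where
      finish : (S : Selection L) → e h (Y S) ≡ 0 → RainbowPacking L 2
      finish S none = g , R , Packs-∷ s (picked S) (tri S) (complete-triple s (rest-unique s uL S) (rest-length s S len) none)
      pack : Selection L → RainbowPacking L 2
      pack S with <-≤-connex 2 (cover-size s S)
      ... | inj₁ big = finish S (n≤0⇒n≡0 (step (cover-size s S) (e h (Y S)) (e h L) (proj₁ (greedy s S)) few big))
        where
        step : ∀ x r n → n ≡ x + r → n ≤ 3 → 2 < x → r ≤ 0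
        step x r n h0 h1 h2 = deduce (x ∷ r ∷ n ∷ []) 1 (x1 ⊑ K 0) (1 , x0 ⊕ x1 ⊑ x2 · 1 , x2 ⊑ K 3 · 1 , K 1 ⊕ K 2 ⊑ x0 · done)
            (≤-reflexive (sym h0) , h1 , h2 , tt)
      ... | inj₂ small with greedy-two _ _ _ (cs S) _ _ (greedy s S) small
      ...   | inj₁ none = finish S none
      ...   | inj₂ (dv , du , dw , le) with m≤n⇒m<n∨m≡n le
      ...     | inj₁ lt = finish S (n<1⇒n≡0 lt)
      ...     | inj₂ one = six-vertices len S dv du (trans (proj₁ (greedy s S)) (cong₂ _+_ (cong₂ _+_ (cong₂ _+_ dv du) dw) one))
    nearly-complete (suc j) len few = pack (select uL (room j (e h L) (length L) few len))
      where
      room : ∀ j n m → n ≤ 3 * (1 + j) + 3 → m ≡ 3 * (1 + j) + 6 → n + 3 ≤ m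
      room j n m h0 h1 = deduce (j ∷ n ∷ m ∷ []) 1 (x1 ⊕ K 3 ⊑ x2) (1 , x1 ⊑ 3 ⊗ (K 1 ⊕ x0) ⊕ K 3 · 1 , 3 ⊗ (K 1 ⊕ x0) ⊕ K 6 ⊑ x2
          · done) (h0 , ≤-reflexive (sym h1) , tt)
      finish : (S : Selection L) → e h (Y S) ≤ 3 * j + 2 → RainbowPacking L (3 + j)
      finish S le = g , R , Packs-∷ s (picked S) (tri S)
          (sparse-packs s j (rest-unique s uL S) (rest-length s S (split-length s j len)) le)
      one-more : ∀ {r} → r ≤ 1 → r ≤ 3 * j + 2
      one-more le = ≤-trans le (≤-trans (s≤s z≤n) (m≤n+m 2 (3 * j)))
      pack : Selection L → RainbowPacking L (3 + j)
      pack S with <-≤-connex 2 (cover-size s S)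
      ... | inj₂ small with greedy-two _ _ _ (cs S) _ _ (greedy s S) small
      ...   | inj₁ none = finish S (one-more (≤-trans (≤-reflexive none) z≤n))
      ...   | inj₂ (_ , _ , _ , le) = finish S (one-more le)
      pack S | inj₁ big with m≤n⇒m<n∨m≡n big
      ... | inj₁ four = finish S (step j (cover-size s S) (e h (Y S)) (e h L) (proj₁ (greedy s S)) few four)
        where
        step : ∀ j x r n → n ≡ x + r → n ≤ 3 * (1 + j) + 3 → 3 < x → r ≤ 3 * j + 2
        step j x r n h0 h1 h2 = deduce (j ∷ x ∷ r ∷ n ∷ []) 1 (x2 ⊑ 3 ⊗ x0 ⊕ K 2) (1 , x1 ⊕ x2 ⊑ x3 · 1 , x3 ⊑ 3 ⊗ (K 1 ⊕ x0) ⊕ K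
            3 · 1 , K 1 ⊕ K 3 ⊑ x1 · done) (≤-reflexive (sym h0) , h1 , h2 , tt)
      ... | inj₂ three with greedy-three _ _ _ (cs S) _ _ (greedy s S) (sym three)
      ...   | inj₂ (inj₁ le) = finish S (one-more le)
      ...   | inj₂ (inj₂ le) = finish S (step j (deg h (v S) L) (deg h (u S) L) (deg h (w S) L) (e h (Y S)) (cs S) (length L) len
                three (proj₁ (ordered S)) (proj₂ (ordered S)) (cs-size S) le)
        where
        step : ∀ j x y z r k n → n ≡ 3 * (1 + j) + 6 → 3 ≡ x + y + z → z ≤ y → y ≤ x → k + 2 + x ≤ n → 2 * r + 2 ≤ k → r ≤ 3 * j
            + 2
        step j x y z r k n h0 h1 h2 h3 h4 h5 = deduce (j ∷ x ∷ y ∷ z ∷ r ∷ k ∷ n ∷ []) 6 (x4 ⊑ 3 ⊗ x0 ⊕ K 2)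
            (3 , x6 ⊑ 3 ⊗ (K 1 ⊕ x0) ⊕ K 6 · 1 , K 3 ⊑ x1 ⊕ x2 ⊕ x3 · 1 , x3 ⊑ x2 · 2 , x2 ⊑ x1 · 3 , x5 ⊕ K 2 ⊕ x1 ⊑ x6 · 3 , 2
            ⊗ x4 ⊕ K 2 ⊑ x5 · done) (≤-reflexive h0 , ≤-reflexive h1 , h2 , h3 , h4 , h5 , tt)
      ...   | inj₁ (dv , du , dw , le) = exceptional j len finish dv du dw le
        where
        exceptional : ∀ j → length L ≡ 3 * suc j + 6 → ((S : Selection L) → e h (Y S) ≤ 3 * j + 2 → RainbowPacking L (3 + j)) →
          deg h (v S) L ≡ 3 → deg h (u S) L ≡ 0 → deg h (w S) L ≡ 0 → e h (Y S) ≤ 3 → RainbowPacking L (3 + j)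
        exceptional (suc j) _ finish _ _ _ le = finish S (≤-trans le (step j))
          where
          step : ∀ j → 3 ≤ 3 * (1 + j) + 2
          step j = deduce (j ∷ []) 1 (K 3 ⊑ 3 ⊗ (K 1 ⊕ x0) ⊕ K 2) (done) (tt)
        exceptional zero len finish dv du dw le with m≤n⇒m<n∨m≡n le
        ... | inj₁ (s≤s lt) = finish S lt
        ... | inj₂ full = nine-vertices len S dv du (trans (proj₁ (greedy s S)) (cong₂ _+_ (cong₂ _+_ (cong₂ _+_ dv du) dw) full))

  bounded-zero : ∀ j → Bounded j 0
  bounded-zero j {L} uL len {g} R ¬rp = ≮⇒≥ λ dense → ¬rp (nearly-complete R uL j len′
    (few j (e g L) (e (co g) L) (pairs (length L)) (pairs (3 * j + 6)) (bound j 0) dense (co-e g uL) (cong pairs len′)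
        (bound-zero j)))
    where
    len′ : length L ≡ 3 * j + 6
    len′ = trans len (+-identityʳ _)
    few : ∀ j n m p p' b → b < n → n + m ≡ p → p ≡ p' → p' ≤ b + (3 * j + 4) → m ≤ 3 * j + 3
    few j n m p p' b h0 h1 h2 h3 = deduce (j ∷ n ∷ m ∷ p ∷ p' ∷ b ∷ []) 1 (x2 ⊑ 3 ⊗ x0 ⊕ K 3)
        (1 , K 1 ⊕ x5 ⊑ x1 · 1 , x1 ⊕ x2 ⊑ x3 · 1 , x3 ⊑ x4 · 1 , x4 ⊑ x5 ⊕ (3 ⊗ x0 ⊕ K 4) · done)
        (h0 , ≤-reflexive h1 , ≤-reflexive h2 , h3 , tt)

  -- Soundness of the search on seven vertices

  pairsOf-complete : {A : Set} {p q : A} {xs : List A} → p ∈ xs → q ∈ xs → p ≢ q → (p , q) ∈ pairsOf xs ⊎ (q , p) ∈ pairsOf xs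
  pairsOf-complete (here refl) (here refl) d = ⊥-elim (d refl)
  pairsOf-complete {xs = x ∷ xs} (here refl) (there q∈) d = inj₁ (∈-++⁺ˡ (∈-map⁺ (x ,_) q∈))
  pairsOf-complete {xs = x ∷ xs} (there p∈) (here refl) d = inj₂ (∈-++⁺ˡ (∈-map⁺ (x ,_) p∈))
  pairsOf-complete {xs = x ∷ xs} (there p∈) (there q∈) d with pairsOf-complete p∈ q∈ d
  ... | inj₁ m = inj₁ (∈-++⁺ʳ (map (x ,_) xs) m)
  ... | inj₂ m = inj₂ (∈-++⁺ʳ (map (x ,_) xs) m)

  idx-complete : ∀ {m} (i : Fin m) → i ∈ idx m
  idx-complete zero = here refl
  idx-complete (suc i) = there (∈-map⁺ suc (idx-complete i))

  ==-refl : ∀ {m} (i : Fin m) → (i == i) ≡ true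
  ==-refl zero = refl
  ==-refl (suc i) = ==-refl i

  lookup-∈ : {A : Set} {n : ℕ} (vs : Vec A n) (i : Fin n) → lookup vs i ∈ toList vs
  lookup-∈ (v ∷ vs) zero = here refl
  lookup-∈ (v ∷ vs) (suc i) = there (lookup-∈ vs i)

  lookup-injective : ∀ {n} {vs : Vec V n} → Unique (toList vs) → ∀ i j → lookup vs i ≡ lookup vs j → i ≡ j
  lookup-injective u zero zero eq = refl
  lookup-injective {vs = v ∷ vs} u zero (suc j) eq = ⊥-elim (unique-apart u (lookup-∈ vs j) eq)
  lookup-injective {vs = v ∷ vs} u (suc i) zero eq = ⊥-elim (unique-apart u (lookup-∈ vs i) (sym eq))
  lookup-injective {vs = v ∷ vs} (_ ∷ u) (suc i) (suc j) eq = cong suc (lookup-injective u i j eq)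

  ∑-map : {A B : Set} (f : B → ℕ) (h : A → B) (xs : List A) → ∑ f (map h xs) ≡ ∑ (λ x → f (h x)) xs
  ∑-map f h [] = refl
  ∑-map f h (x ∷ xs) = cong (f (h x) +_) (∑-map f h xs)

  module SevenVertices {L : List V} (uL : Unique L) (vs : Vec V 7) (σ : L ↭ toList vs) (b : ℕ) (¬rp : ¬ RainbowPacking L 2)
    (degrees : ∀ {g} → RainbowGraph g → b < e g L → ∀ {v Y} → L ↭ v ∷ Y → 3 ≤ deg g v L) where

    private
      uvs = Unique-↭ σ uL

    Represents : Upper 7 → Graph V → Set
    Represents M g = ∀ i j → cell M i j ≡ isEdge g vs i j

    member : ∀ i → lookup vs i ∈ L
    member i = ∈-resp-↭ (↭-sym σ) (lookup-∈ vs i)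

    fits⇒packing : ∀ {g} → RainbowGraph g → Fits two-triangle-shape (isEdge g vs) → ⊥
    fits⇒packing {g} R ((i ∷ j ∷ k ∷ l ∷ m ∷ n ∷ o ∷ []) , (ij ∷ ik ∷ jk ∷ lm ∷ ln ∷ mn ∷ []) , sorted) =
      ¬rp (g , R , (lookup vs i , lookup vs j , lookup vs k) ∷ (lookup vs l , lookup vs m , lookup vs n) ∷ [] , lookup vs o ∷ []
          , refl ,
        ((ij , ik , jk) ∷ (lm , ln , mn) ∷ [] , ptrans (shuffle vs (i ∷ j ∷ k ∷ l ∷ m ∷ n ∷ o ∷ []) sorted) (↭-sym σ)))

    spoiled-sound : ∀ {M} → spoiled M ≡ true → ∀ {g} → RainbowGraph g → b < e g L → Represents M g → ⊥
    spoiled-sound {M} sp {g} R dense rep with ∨-true {any (λ i → rowCount M i <ᵇ 3) (idx 7)} sp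
    ... | inj₂ fit = fits⇒packing R (anyFits-sound two-triangle-shape arrangements (λ i j p → trans (sym (rep i j)) p) fit)
    ... | inj₁ low with any-sound (λ i → rowCount M i <ᵇ 3) (idx 7) low
    ...   | i , lt with ∈-front (member i)
    ...     | Y , τ = <⇒≱ (<ᵇ⇒< (rowCount M i) 3 (subst T (sym lt) tt)) (≤-trans (degrees R dense τ) (≤-reflexive (begin
      deg g (lookup vs i) L                                      ≡⟨ ∑-↭ _ σ ⟩
      deg g (lookup vs i) (toList vs)                            ≡⟨ cong (deg g (lookup vs i)) (map-lookup-idx vs) ⟨
      deg g (lookup vs i) (map (lookup vs) (idx 7))              ≡⟨ ∑-map (λ w → ind (g (lookup vs i) w)) (lookup vs) (idx 7) ⟩
      ∑ (λ j → ind (isEdge g vs i j)) (idx 7)                    ≡⟨ ∑-cong (idx 7) (λ j → cong ind (rep i j)) ⟨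
      rowCount M i                                               ∎)))
      where open ≡-Reasoning

    matches-sound : ∀ {p q i j} → matches (p , q) i j ≡ true → SameEdge (lookup vs i) (lookup vs j) (lookup vs p) (lookup vs q)
    matches-sound {p} {q} {i} {j} m with ∨-true {p == i ∧ q == j} m
    ... | inj₁ t = inj₁ (cong (lookup vs) (sym (==⇒≡ p i (proj₁ (∧-true t)))) , cong (lookup vs)
        (sym (==⇒≡ q j (proj₂ (∧-true {p == i} t)))))
    ... | inj₂ t = inj₂ (cong (lookup vs) (sym (==⇒≡ q i (proj₂ (∧-true {p == j} t)))) , cong (lookup vs)
        (sym (==⇒≡ p j (proj₁ (∧-true t)))))

    matches-complete : ∀ {p q i j} → SameEdge (lookup vs i) (lookup vs j) (lookup vs p) (lookup vs q) → matches (p , q) i j ≡ true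
    matches-complete {p} {q} {i} {j} (inj₁ (s , t)) with lookup-injective uvs i p s | lookup-injective uvs j q t
    ... | refl | refl rewrite ==-refl i | ==-refl j = refl
    matches-complete {p} {q} {i} {j} (inj₂ (s , t)) with lookup-injective uvs i q s | lookup-injective uvs j p t
    ... | refl | refl rewrite ==-refl i | ==-refl j = ∨-introʳ refl

    -- It suffices that `e` agrees with the colour on edges of `g`, since `cell M` vanishes
    -- elsewhere.
    represents-insert-delete : ∀ {M g} (R : RainbowGraph g) → Represents M g → ∀ f e →
        (d : lookup vs (proj₁ f) ≢ lookup vs (proj₂ f)) →
      let γ = c (lookup vs (proj₁ f)) (lookup vs (proj₂ f)) in
      (∀ i j → isEdge g vs i j ≡ true → matches e i j ≡ hasColour γ (lookup vs i) (lookup vs j)) →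
      Represents (insert-delete M f e) (exchange-edge g (lookup vs (proj₁ f)) (lookup vs (proj₂ f)))
    represents-insert-delete {M} {g} R rep f@(p , q) e d agree i j = trans (cell-upper simple-G i j) (pointwise i j)
      where
      u = lookup vs p
      w = lookup vs q
      S = exchange-rainbow R d
      G : Graph (Fin 7)
      G i j = matches f i j ∨ (cell M i j ∧ not (matches e i j))
      second : ∀ {x y m k} → x ≡ y → (y ≡ true → m ≡ k) → x ∧ not m ≡ y ∧ not k
      second {y = true} refl h = cong not (h refl)
      second {y = false} refl h = refl
      pointwise : ∀ i j → G i j ≡ isEdge (exchange-edge g u w) vs i j
      pointwise i j = cong₂ _∨_ (bool-ext (λ m → sameEdge-complete (matches-sound {p} {q} {i} {j} m))
          (λ m → matches-complete {p} {q} {i} {j} (sameEdge-sound m)))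
        (second (rep i j) (agree i j))
      simple-G : Simple G
      simple-G .symm i j = trans (pointwise i j) (trans (symm (simple S) (lookup vs i) (lookup vs j)) (sym (pointwise j i)))
      simple-G .irrefl i = trans (pointwise i i) (irrefl (simple S) (lookup vs i))

    -- A game: the check names the edge to insert, the colouring answers with the edge of `g` that
    -- it expels, if any. The number of edges does not drop, so the next round starts from the same
    -- hypotheses.
    refutable-sound : ∀ fss {M} → refutable fss M ≡ true → ∀ {g} → RainbowGraph g → b < e g L → Represents M g → ⊥
    insertable-sound : ∀ fss {M p q} → insertable fss M (p , q) ≡ true → ∀ {g} → RainbowGraph g → b < e g L → Represents M g → ⊥
    refutable-sound [] sp = spoiled-sound sp
    refutable-sound (fs ∷ fss) {M} rf {g} R dense rep = cases (∨-true {spoiled M} rf)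
      where
      found : (∃[ f ] insertable fss M f ≡ true) → ⊥
      found ((p , q) , ok) = insertable-sound fss {M} {p} {q} ok R dense rep
      cases : spoiled M ≡ true ⊎ any (insertable fss M) fs ≡ true → ⊥
      cases (inj₁ sp) = spoiled-sound sp R dense rep
      cases (inj₂ hit) = found (any-sound (insertable fss M) fs hit)
    insertable-sound fss {M} {p} {q} ok {g} R dense rep = cases (search colour-of (pairsOf (idx 7)))
      where
      γ = c (lookup vs p) (lookup vs q)
      new = proj₂ (∧-true {not (cell M p q)} (proj₁ (∧-true {not (cell M p q) ∧ not (p == q)} ok)))
      options = proj₂ (∧-true {not (cell M p q) ∧ not (p == q)} ok)
      unchanged = proj₁ (∧-true {refutable fss (insert-delete M (p , q) (0F , 0F))} options)
      replaced = proj₂ (∧-true {refutable fss (insert-delete M (p , q) (0F , 0F))} options)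
      d : lookup vs p ≢ lookup vs q
      d eq = not-true new (trans (cong (p ==_) (sym (lookup-injective uvs p q eq))) (==-refl p))
      S = exchange-rainbow R d
      dense′ = ≤-trans dense (e-exchange R d uL (member p) (member q))
      Coloured Uncoloured : Fin 7 × Fin 7 → Set
      Coloured (i , j) = isEdge g vs i j ≡ true × hasColour γ (lookup vs i) (lookup vs j) ≡ true
      Uncoloured (i , j) = isEdge g vs i j ≡ true → hasColour γ (lookup vs i) (lookup vs j) ≡ true → ⊥
      colour-of : ∀ e → Coloured e ⊎ Uncoloured e
      colour-of (i , j) with true-or-false (isEdge g vs i j) | true-or-false (hasColour γ (lookup vs i) (lookup vs j))
      ... | inj₁ s | inj₁ t = inj₁ (s , t)
      ... | inj₁ s | inj₂ t = inj₂ λ _ t′ → not-true (cong not t) t′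
      ... | inj₂ s | _ = inj₂ λ s′ _ → not-true (cong not s) s′
      cases : (∃[ e ] ∃[ es ] pairsOf (idx 7) ↭ e ∷ es × Coloured e) ⊎ All Uncoloured (pairsOf (idx 7)) → ⊥
      cases (inj₁ ((i′ , j′) , es , τ , edge , colour)) =
        after (∨-true {not (cell M i′ j′)} (all-sound (deletable fss M (p , q)) replaced (∈-resp-↭ (↭-sym τ) (here refl))))
        where
        agree : ∀ i j → isEdge g vs i j ≡ true → matches (i′ , j′) i j ≡ hasColour γ (lookup vs i) (lookup vs j)
        agree i j ij = bool-ext
          (λ m → trans (cong (λ k → does (k ≟ γ)) (sameEdge-colour (matches-sound {i′} {j′} {i} {j} m))) colour)
          (λ h → matches-complete {i′} {j′} {i} {j} (injective R ij edge (trans (hasColour⇒≡ γ (lookup vs i) (lookup vs j) h)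
              (sym (hasColour⇒≡ γ (lookup vs i′) (lookup vs j′) colour)))))
        after : not (cell M i′ j′) ≡ true ⊎ refutable fss (insert-delete M (p , q) (i′ , j′)) ≡ true → ⊥
        after (inj₁ n) = not-true n (trans (rep i′ j′) edge)
        after (inj₂ r) = refutable-sound fss r S dense′ (represents-insert-delete R rep (p , q) (i′ , j′) d agree)
      -- No edge of `g` has the colour, so the diagonal pair `(0F , 0F)` stands for the deletion.
      cases (inj₂ none) = refutable-sound fss unchanged S dense′ (represents-insert-delete R rep (p , q) (0F , 0F) d agree)
        where
        agree : ∀ i j → isEdge g vs i j ≡ true → matches (0F , 0F) i j ≡ hasColour γ (lookup vs i) (lookup vs j)
        agree i j ij = bool-ext (λ m → ⊥-elim (loop (matches-sound {0F} {0F} {i} {j} m))) (λ h → ⊥-elim (uncoloured h))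
          where
          i≢j : i ≢ j
          i≢j refl = edge-≢ (simple R) ij refl
          loop : SameEdge (lookup vs i) (lookup vs j) (lookup vs 0F) (lookup vs 0F) → ⊥
          loop (inj₁ (s , t)) = edge-≢ (simple R) ij (trans s (sym t))
          loop (inj₂ (s , t)) = edge-≢ (simple R) ij (trans s (sym t))
          uncoloured : hasColour γ (lookup vs i) (lookup vs j) ≡ true → ⊥
          uncoloured h with pairsOf-complete (idx-complete i) (idx-complete j) i≢j
          ... | inj₁ m = All.lookup none m ij h
          ... | inj₂ m = All.lookup none m (flip-edge (simple R) ij) (trans (sym (hasColour-sym γ (lookup vs i) (lookup vs j))) h)

  seven-vertices : ∀ {L} → Unique L → ¬ RainbowPacking L 2 → (∀ {g} → RainbowGraph g → 13 < e g L → ∀ {v Y} → L ↭ v ∷ Y → 3 ≤ deg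
      g v L) →
    ∀ {g x y z p q r t} → RainbowGraph g → 13 < e g L → L ↭ x ∷ y ∷ z ∷ p ∷ q ∷ r ∷ t ∷ [] → IsTri g (x , y , z) →
    g p q ≡ true → g q r ≡ true → g r t ≡ true → ⊥
  seven-vertices {L} uL ¬rp degrees {g} {x} {y} {z} {p} {q} {r} {t} R dense σ (xy , xz , yz) pq qr rt =
    impossible (∨-true {edgeCount (matrix g vs) <ᵇ 14} (subst Checked represented (checked xy xz yz pq qr rt pr qt bits)))
    where
    vs = x ∷ y ∷ z ∷ p ∷ q ∷ r ∷ t ∷ []
    bits = g x p ∷ g x q ∷ g x r ∷ g x t ∷ g y p ∷ g y q ∷ g y r ∷ g y t ∷ g z p ∷ g z q ∷ g z r ∷ g z t ∷ g p t ∷ []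
    Checked : Upper 7 → Set
    Checked M = (edgeCount M <ᵇ 14) ∨ refutable candidates M ≡ true
    -- Because `seven` takes the known entries as arguments, this holds by computation; their values
    -- are substituted only in `checked`.
    represented : seven (g x y) (g x z) (g y z) (g p q) (g q r) (g r t) (g p r) (g q t) bits ≡ matrix g vs
    represented = refl
    checked : ∀ {k₁ k₂ k₃ k₄ k₅ k₆ k₇ k₈} → k₁ ≡ true → k₂ ≡ true → k₃ ≡ true → k₄ ≡ true → k₅ ≡ true → k₆ ≡ true → k₇ ≡ false →
        k₈ ≡ false →
      ∀ b → Checked (seven k₁ k₂ k₃ k₄ k₅ k₆ k₇ k₈ b)
    checked refl refl refl refl refl refl refl refl = allBools-sound 13 seven-check seven-refutable
    tri : ∀ {a b c′ d} → p ∷ q ∷ r ∷ t ∷ [] ↭ a ∷ b ∷ c′ ∷ d ∷ [] → IsTri g (a , b , c′) → ⊥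
    tri {a} {b} {c′} {d} τ abc = ¬rp (g , R , (x , y , z) ∷ (a , b , c′) ∷ [] , d ∷ [] , refl ,
      ((xy , xz , yz) ∷ abc ∷ [] , ↭-sym (ptrans σ (prep x (prep y (prep z τ))))))
    pr : g p r ≡ false
    pr = false-if λ pr → tri refl (pq , pr , qr)
    qt : g q t ≡ false
    qt = false-if λ qt → tri (shuffle (q ∷ r ∷ t ∷ p ∷ []) (3F ∷ 0F ∷ 1F ∷ 2F ∷ []) refl) (qr , qt , rt)
    impossible : (edgeCount (matrix g vs) <ᵇ 14) ≡ true ⊎ refutable candidates (matrix g vs) ≡ true → ⊥
    impossible (inj₁ few) = <⇒≱ (<ᵇ⇒< (edgeCount (matrix g vs)) 14 (subst T (sym few) tt))
      (≤-trans dense (≤-reflexive (trans (e-↭ (simple R) σ) (sym (edgeCount-matrix g vs)))))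
    impossible (inj₂ rf) = SevenVertices.refutable-sound uL vs σ 13 ¬rp degrees candidates rf R dense (cell-matrix (simple R) vs)

  -- The case n = 3k + 1

  deg-↭ : ∀ (g : Graph V) v {X Y} → X ↭ Y → deg g v X ≡ deg g v Y
  deg-↭ g v = ∑-↭ (λ w → ind (g v w))

  two-corners : ∀ {g : Graph V} (s : Simple g) {a t} → IsTri g t → 2 ≤ deg g a (corners t) →
    ∃[ p ] ∃[ q ] ∃[ r ] corners t ↭ p ∷ q ∷ r ∷ [] × IsTri g (p , q , r) × g a p ≡ true × g a q ≡ true
  two-corners {g} s {a} {x , y , z} (xy , xz , yz) two with g a x in ax | g a y in ay | g a z in az
  ... | true | true | _ = x , y , z , refl , (xy , xz , yz) , ax , ay
  ... | true | false | true = x , z , y , prep x (pswap y z refl) , (xz , xy , flip-edge s yz) , ax , az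
  ... | false | true | true = y , z , x , shuffle (y ∷ z ∷ x ∷ []) (2F ∷ 0F ∷ 1F ∷ []) refl ,
      (yz , flip-edge s xy , flip-edge s xz) , ay , az
  ... | true | false | false = ⊥-elim (<⇒≱ two ≤-refl)
  ... | false | true | false = ⊥-elim (<⇒≱ two ≤-refl)
  ... | false | false | true = ⊥-elim (<⇒≱ two ≤-refl)
  ... | false | false | false = ⊥-elim (<⇒≱ two z≤n)

  module OneExtra {j : ℕ} {L : List V} (uL : Unique L) (len : length L ≡ 3 * j + 6 + 1) (¬rp : ¬ RainbowPacking L (2 + j))
    (degrees : ∀ {g} → RainbowGraph g → bound j 1 < e g L → ∀ {v Y} → L ↭ v ∷ Y → 2 * j + 3 ≤ deg g v L) where

    no-larger : ∀ {g} → RainbowGraph g → Packs g (2 + j) L → ⊥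
    no-larger R pks = ¬rp (_ , R , pks)

    member-degree : ∀ {g v} → RainbowGraph g → bound j 1 < e g L → v ∈ L → 2 * j + 3 ≤ deg g v L
    member-degree R dense v∈L = degrees R dense (proj₂ (∈-front v∈L))

    -- The two disjoint edges may appear only after an exchange, so the graph is part of the result.
    record DenseMatched : Set where
      constructor denseMatched
      field
        {graph} : Graph V
        rainbow′ : RainbowGraph graph
        dense : bound j 1 < e graph L
        matching : Matched (simple rainbow′) (1 + j) L

    module Star {g : Graph V} (R : RainbowGraph g) (dense : bound j 1 < e g L) where

      private
        s = simple R
        weight : V → Triple V → ℕ
        weight v T = deg g v (corners T)

      in-rest : ∀ {P X v} → Packing g P X L → v ∈ X → v ∈ L
      in-rest {P} pk v∈ = ∈-resp-↭ (partition pk) (∈-++⁺ʳ (flat P) v∈)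

      leaf : ∀ {P u l l′ l″} → length P ≡ 1 + j → Packing g P (u ∷ l ∷ l′ ∷ l″ ∷ []) L → g u l ≡ true → g u l′ ≡ true → g u l″ ≡
          true →
        deg g l (u ∷ l ∷ l′ ∷ l″ ∷ []) ≡ 1
      leaf {P} {u} {l} {l′} {l″} size pk ul ul′ ul″ = cong₂ _+_ (cong ind (flip-edge s ul)) (cong₂ _+_ (cong ind (irrefl s l))
        (cong₂ _+_ (cong ind (false-if λ ll′ → no-larger R
            (subst (λ n → Packs g (suc n) L) size (grow-by-triangle (u , l , l′ , l″ ∷ [] , refl , ul , ul′ , ll′) pk))))
          (cong (λ i → ind i + 0) (false-if λ ll″ → no-larger R (subst (λ n → Packs g (suc n) L) size
            (grow-by-triangle (u , l , l″ , l′ ∷ [] , prep u (prep l (pswap l′ l″ refl)) , ul , ul″ , ll″) pk))))))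

      -- With t triangles both leaves have degree at least 2t + 1, of which one edge goes to the
      -- centre. The remaining 4t fill the limit of four at every triangle.
      pair-tight : ∀ {P u l l′ l″} → length P ≡ 1 + j → Packing g P (u ∷ l ∷ l′ ∷ l″ ∷ []) L → g u l ≡ true → g u l′ ≡ true → g u
          l″ ≡ true →
        All (λ T → weight l T + weight l′ T ≤ 4) P → All (λ T → weight l T + weight l′ T ≡ 4) P
      pair-tight {P} {u} {l} {l′} {l″} size pk ul ul′ ul″ small = All.zipWith (λ (x , y) → ≤-antisym x y)
        (small , ∑-tight (λ T → weight l T + weight l′ T) 4 small
          (≤-trans (step (length P) j (deg g l L) (deg g l′ L) (load g l P) (load g l′ P) _ _ size
            (member-degree R dense (in-rest pk (there (here refl))))
                (member-degree R dense (in-rest pk (there (there (here refl)))))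
            (packing-deg pk l) (packing-deg pk l′) (leaf size pk ul ul′ ul″)
            (trans (deg-↭ g l′ (prep u (pswap l l′ (↭-refl {x = l″ ∷ []}))))
                (leaf size (reorder-rest (prep u (pswap l l′ refl)) pk) ul′ ul ul″)))
            (≤-reflexive (sym (∑-distrib (weight l) (weight l′) P)))))
        where
        step : ∀ t j x y a b p q → t ≡ 1 + j → 2 * j + 3 ≤ x → 2 * j + 3 ≤ y → x ≡ a + p → y ≡ b + q → p ≡ 1 → q ≡ 1 → 4 * t ≤ a
            + b
        step t j x y a b p q h0 h1 h2 h3 h4 h5 h6 = deduce (t ∷ j ∷ x ∷ y ∷ a ∷ b ∷ p ∷ q ∷ []) 1 (4 ⊗ x0 ⊑ x4 ⊕ x5)
            (4 , x0 ⊑ K 1 ⊕ x1 · 1 , 2 ⊗ x1 ⊕ K 3 ⊑ x2 · 1 , 2 ⊗ x1 ⊕ K 3 ⊑ x3 · 1 , x2 ⊑ x4 ⊕ x6 · 1 , x3 ⊑ x5 ⊕ x7 · 1 , x6 ⊑ K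
            1 · 1 , x7 ⊑ K 1 · done) (≤-reflexive h0 , h1 , h2 , ≤-reflexive h3 , ≤-reflexive h4 , ≤-reflexive h5 , ≤-reflexive
            h6 , tt)

      -- Inserting `vw` expels no edge at `w′`, whose degree is already the minimum that every dense
      -- rainbow graph guarantees. If the packing survives, `vw` and `uw′` are disjoint. Otherwise a
      -- side of some triangle `T` is lost; `uvw` replaces `T`, and `w′` has two neighbours `p`, `q`
      -- in `T`. Either `w′pq` enlarges the packing, or `pq` is the lost side and `w′p`, `qr` are
      -- disjoint edges.
      exchange-leaves : ∀ {P u v w w′} → length P ≡ 1 + j → Packing g P (u ∷ v ∷ w ∷ w′ ∷ []) L →
        g u v ≡ true → g u w ≡ true → g u w′ ≡ true → All (λ T → weight w′ T ≡ 2) P → DenseMatched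
      exchange-leaves {P} {u} {v} {w} {w′} size pk uv uw uw′ twos with search (sideColour? (c v w)) P
        where
        uR = Unique-↭ (ptrans (↭-sym (partition pk)) (++-comm (flat P) (u ∷ v ∷ w ∷ w′ ∷ []))) uL
      ... | found = cases found
        where
        uR : Unique (u ∷ v ∷ w ∷ w′ ∷ flat P)
        uR = Unique-↭ (ptrans (↭-sym (partition pk)) (++-comm (flat P) (u ∷ v ∷ w ∷ w′ ∷ []))) uL
        v≢w : v ≢ w
        v≢w = unique-apart (AllPairs.tail uR) (here refl)
        w′≢v : w′ ≢ v
        w′≢v eq = unique-apart (AllPairs.tail uR) (there (here refl)) (sym eq)
        w′≢w : w′ ≢ w
        w′≢w eq = unique-apart (AllPairs.tail (AllPairs.tail uR)) (here refl) (sym eq)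
        h = exchange-edge g v w
        S = exchange-rainbow R v≢w
        dense′ : bound j 1 < e h L
        dense′ = ≤-trans dense (e-exchange R v≢w uL (in-rest pk (there (here refl))) (in-rest pk (there (there (here refl)))))
        old : ∀ {z} → h w′ z ≡ true → g w′ z ≡ true
        old t with exchanged R v≢w t
        ... | inj₁ (inj₁ (eq , _)) = ⊥-elim (w′≢v eq)
        ... | inj₁ (inj₂ (eq , _)) = ⊥-elim (w′≢w eq)
        ... | inj₂ (p , _) = p
        low-degree : deg g w′ L ≤ 2 * j + 3
        low-degree = step (length P) j (deg g w′ L) (load g w′ P) _ size (packing-deg pk w′)
          (∑-bound (weight w′) 2 (All.map ≤-reflexive twos))
          (trans (deg-↭ g w′ (prep u (shuffle (w′ ∷ w ∷ v ∷ []) (2F ∷ 1F ∷ 0F ∷ []) refl)))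
              (leaf size (reorder-rest (prep u (shuffle (w′ ∷ w ∷ v ∷ []) (2F ∷ 1F ∷ 0F ∷ []) refl)) pk) uw′ uw uv))
          where
          step : ∀ t j x a p → t ≡ 1 + j → x ≡ a + p → a ≤ 2 * t → p ≡ 1 → x ≤ 2 * j + 3
          step t j x a p h0 h1 h2 h3 = deduce (t ∷ j ∷ x ∷ a ∷ p ∷ []) 1 (x2 ⊑ 2 ⊗ x1 ⊕ K 3)
              (2 , x0 ⊑ K 1 ⊕ x1 · 1 , x2 ⊑ x3 ⊕ x4 · 1 , x3 ⊑ 2 ⊗ x0 · 1 , x4 ⊑ K 1 · done)
              (≤-reflexive h0 , ≤-reflexive h1 , h2 , ≤-reflexive h3 , tt)
        keep : ∀ {z} → z ∈ L → g w′ z ≡ true → h w′ z ≡ true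
        keep {z} z∈L wz with true-or-false (h w′ z)
        ... | inj₁ t = t
        ... | inj₂ t with ∈-front z∈L
        ...   | Z , σ = ⊥-elim (step j (deg h w′ L) (deg g w′ L) (ind (h w′ z)) (ind (g w′ z)) (deg h w′ Z) (deg g w′ Z)
            (∑-↭ _ σ) (∑-↭ _ σ) (cong ind t) (cong ind wz)
                (∑-mono Z (λ y → ind-mono old)) low-degree (member-degree S dense′
                    (in-rest pk (there (there (there (here refl)))))))
          where
          step : ∀ j x' x i' i y' y → x' ≡ i' + y' → x ≡ i + y → i' ≡ 0 → i ≡ 1 → y' ≤ y → x ≤ 2 * j + 3 → 2 * j + 3 ≤ x' → ⊥
          step j x' x i' i y' y h0 h1 h2 h3 h4 h5 h6 = refute (j ∷ x' ∷ x ∷ i' ∷ i ∷ y' ∷ y ∷ [])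
              (1 , x1 ⊑ x3 ⊕ x5 · 1 , x4 ⊕ x6 ⊑ x2 · 1 , x3 ⊑ K 0 · 1 , K 1 ⊑ x4 · 1 , x5 ⊑ x6 · 1 , x2 ⊑ 2 ⊗ x0 ⊕ K 3 · 1 , 2 ⊗
              x0 ⊕ K 3 ⊑ x1 · done) (≤-reflexive h0 , ≤-reflexive (sym h1) , ≤-reflexive h2 , ≤-reflexive (sym h3) , h4 , h5 , h6
              , tt)
        cases : (∃[ T ] ∃[ Q ] P ↭ T ∷ Q × SideColour (c v w) T) ⊎ All (λ T → let x , y , z = T in c x y ≢ c v w × c x z ≢ c v w × c y z ≢ c v w) P → DenseMatched
        cases (inj₂ free) = denseMatched S dense′ (matched size
            (reorder-rest (shuffle (v ∷ w ∷ u ∷ w′ ∷ []) (2F ∷ 0F ∷ 1F ∷ 3F ∷ []) refl)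
          (kept-triangles R v≢w (triangles pk) free , partition pk))
          (added R v≢w) (flip-edge (simple S) (keep (in-rest pk (here refl)) (flip-edge s uw′))))
        cases (inj₁ (T , Q , σ , side)) = corner (two-corners s tri (≤-reflexive (sym (All.head (All-resp-↭ σ twos)))))
          where
          pk₁ : Packing g (T ∷ Q) (u ∷ v ∷ w ∷ w′ ∷ []) L
          pk₁ = reorder σ pk
          tri = All.head (triangles pk₁)
          uT : Unique (corners T ++ (flat Q ++ (u ∷ v ∷ w ∷ w′ ∷ [])))
          uT = Unique-↭ (↭-sym (partition pk₁)) uL
          outside : ∀ {a b} → a ∈ u ∷ v ∷ w ∷ w′ ∷ [] → g a b ≡ true → h a b ≡ true
          outside a∈ = kept-outside R v≢w tri side uT (∈-++⁺ʳ (flat Q) a∈)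
          uvw : IsTri h (u , v , w)
          uvw = outside (here refl) uv , outside (here refl) uw , added R v≢w
          others : All (IsTri h) Q
          others = kept-all-outside R v≢w tri side uT ∈-++⁺ˡ (All.tail (triangles pk₁))
          size′ : length Q ≡ j
          size′ = suc-injective (trans (sym (↭-length σ)) size)
          in-T : ∀ {p} → p ∈ corners T → p ∈ L
          in-T p∈ = ∈-resp-↭ (partition pk₁) (∈-++⁺ˡ {ys = u ∷ v ∷ w ∷ w′ ∷ []} (∈-++⁺ˡ {xs = corners T} {ys = flat Q} p∈))
          corner : (∃[ p ] ∃[ q ] ∃[ r ] corners T ↭ p ∷ q ∷ r ∷ [] × IsTri g (p , q , r) × g w′ p ≡ true × g w′ q ≡ true) →
              DenseMatched
          corner (p , q , r , τ , (pq , pr , qr) , wp , wq) with c p q ≟ c v w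
          ... | no other = ⊥-elim (no-larger S (_ , _ , cong (λ n → suc (suc n)) size′ ,
                  ((uvw ∷ (w′p , w′q , kept R v≢w pq other) ∷ others) ,
                   repartition (T ∷ []) ((u , v , w) ∷ (w′ , p , q) ∷ []) (u ∷ v ∷ w ∷ w′ ∷ []) (r ∷ []) {Q} {[]} moved
                       (partition pk₁))))
            where
            w′p = keep (in-T (front-∈ τ)) wp
            w′q = keep (in-T (front₂-∈ τ)) wq
            moved : u ∷ v ∷ w ∷ w′ ∷ p ∷ q ∷ r ∷ [] ↭ (corners T ++ []) ++ (u ∷ v ∷ w ∷ w′ ∷ [])
            moved = ptrans (++-comm (u ∷ v ∷ w ∷ w′ ∷ []) (p ∷ q ∷ r ∷ []))
                (++⁺ʳ (u ∷ v ∷ w ∷ w′ ∷ []) (↭-sym (ptrans (↭-reflexive (++-identityʳ (corners T))) τ)))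
          ... | yes same-colour = denseMatched S dense′ (matched {P = (u , v , w) ∷ Q} (cong suc size′)
                  (uvw ∷ others , repartition (T ∷ []) ((u , v , w) ∷ []) (u ∷ v ∷ w ∷ w′ ∷ []) (w′ ∷ p ∷ q ∷ r ∷ []) {Q} {[]}
                      moved (partition pk₁))
                  (keep (in-T (front-∈ τ)) wp) (kept R v≢w qr different))
            where
            moved : u ∷ v ∷ w ∷ w′ ∷ p ∷ q ∷ r ∷ [] ↭ (corners T ++ []) ++ (u ∷ v ∷ w ∷ w′ ∷ [])
            moved = ptrans (++-comm (u ∷ v ∷ w ∷ w′ ∷ []) (p ∷ q ∷ r ∷ []))
                (++⁺ʳ (u ∷ v ∷ w ∷ w′ ∷ []) (↭-sym (ptrans (↭-reflexive (++-identityʳ (corners T))) τ)))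
            different : c q r ≢ c v w
            different eq with injective R qr pq (trans eq (sym same-colour))
            ... | inj₁ (q≡p , _) = edge-≢ s pq (sym q≡p)
            ... | inj₂ (_ , r≡p) = edge-≢ s pr (sym r≡p)

      -- If no exchange at two leaves creates a second edge, any two leaves send exactly four edges
      -- to each triangle, hence each leaf exactly two.
      star : Starred s (1 + j) L → DenseMatched
      star (starred {X = _ ∷ X} size pk _ _ _ _ _) = ⊥-elim (too-long _ j (length X) (length L) size (packing-length pk) len)
        where
        too-long : ∀ t j x n → t ≡ 1 + j → 3 * t + (5 + x) ≡ n → n ≡ 3 * j + 6 + 1 → ⊥
        too-long t j x n h0 h1 h2 = refute (t ∷ j ∷ x ∷ n ∷ []) (3 , K 1 ⊕ x1 ⊑ x0 · 1 , 3 ⊗ x0 ⊕ (K 5 ⊕ x2) ⊑ x3 · 1 , x3 ⊑ 3 ⊗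
            x1 ⊕ K 6 ⊕ K 1 · done) (≤-reflexive (sym h0) , ≤-reflexive h1 , ≤-reflexive h2 , tt)
      star (starred {P} {u} {v} {w} {w′} {[]} size pk uv uw uw′ _ small)
        with exchange-step s (reorder-rest (shuffle (v ∷ w ∷ u ∷ w′ ∷ []) (2F ∷ 0F ∷ 1F ∷ 3F ∷ []) refl) pk)
           | exchange-step s (reorder-rest (shuffle (v ∷ w′ ∷ u ∷ w ∷ []) (2F ∷ 0F ∷ 3F ∷ 1F ∷ []) refl) pk)
      ... | inj₁ (Q , p , q , size′ , pk′ , pq) | _ = denseMatched R dense (matched (trans size′ size) pk′ pq uw′)
      ... | inj₂ _ | inj₁ (Q , p , q , size′ , pk′ , pq) = denseMatched R dense (matched (trans size′ size) pk′ pq uw)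
      ... | inj₂ vw-small | inj₂ vw′-small = exchange-leaves size pk uv uw uw′
        (All.zipWith (λ {T} (x , y , z) → halve {weight v T} {weight w T} {weight w′ T} x y z)
          (pair-tight size pk uv uw uw′ vw-small ,
           All.zip (pair-tight size (reorder-rest (prep u (prep v (pswap w w′ refl))) pk) uv uw′ uw vw′-small ,
                    pair-tight size (reorder-rest (prep u (shuffle (w ∷ w′ ∷ v ∷ []) (2F ∷ 0F ∷ 1F ∷ []) refl)) pk) uw uw′ uv
                        small)))
        where
        halve : ∀ {a b d} → a + b ≡ 4 → a + d ≡ 4 → b + d ≡ 4 → d ≡ 2
        halve {a} {b} {d} p q r = ≤-antisym (below a b d p q r) (above a b d p q r)
          where
          below : ∀ a b d → a + b ≡ 4 → a + d ≡ 4 → b + d ≡ 4 → d ≤ 2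
          below a b d h0 h1 h2 = deduce (a ∷ b ∷ d ∷ []) 2 (x2 ⊑ K 2) (1 , K 4 ⊑ x0 ⊕ x1 · 1 , x0 ⊕ x2 ⊑ K 4 · 1 , x1 ⊕ x2 ⊑ K 4
              · done) (≤-reflexive (sym h0) , ≤-reflexive h1 , ≤-reflexive h2 , tt)
          above : ∀ a b d → a + b ≡ 4 → a + d ≡ 4 → b + d ≡ 4 → 2 ≤ d
          above a b d h0 h1 h2 = deduce (a ∷ b ∷ d ∷ []) 2 (K 2 ⊑ x2) (1 , x0 ⊕ x1 ⊑ K 4 · 1 , K 4 ⊑ x0 ⊕ x2 · 1 , K 4 ⊑ x1 ⊕ x2
              · done) (≤-reflexive h0 , ≤-reflexive (sym h1) , ≤-reflexive (sym h2) , tt)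

    find-dense-matching : ∀ {g} → RainbowGraph g → bound j 1 < e g L → Packs g (1 + j) L → DenseMatched
    find-dense-matching {g} R dense (P , X , size , pk) = cases
        (find-matching (simple R) pk (room (length P) j (length X) (length L) size (packing-length pk) len)
        (All-by-front L λ σ → ≤-trans (enough (length P) j size) (degrees R dense σ)))
      where
      room : ∀ t j x n → t ≡ 1 + j → 3 * t + x ≡ n → n ≡ 3 * j + 6 + 1 → 4 ≤ x
      room t j x n h0 h1 h2 = deduce (t ∷ j ∷ x ∷ n ∷ []) 1 (K 4 ⊑ x2) (3 , x0 ⊑ K 1 ⊕ x1 · 1 , x3 ⊑ 3 ⊗ x0 ⊕ x2 · 1 , 3 ⊗ x1 ⊕ K
          6 ⊕ K 1 ⊑ x3 · done) (≤-reflexive h0 , ≤-reflexive (sym h1) , ≤-reflexive (sym h2) , tt)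
      enough : ∀ t j → t ≡ 1 + j → 2 * t + 1 ≤ 2 * j + 3
      enough t j h0 = deduce (t ∷ j ∷ []) 1 (2 ⊗ x0 ⊕ K 1 ⊑ 2 ⊗ x1 ⊕ K 3) (2 , x0 ⊑ K 1 ⊕ x1 · done) (≤-reflexive h0 , tt)
      cases : Packs g (suc (length P)) L ⊎ Matched (simple R) (length P) L ⊎ Starred (simple R) (length P) L → DenseMatched
      cases (inj₁ larger) = ⊥-elim (no-larger R (subst (λ n → Packs g (suc n) L) size larger))
      cases (inj₂ (inj₁ m)) = denseMatched R dense (subst (λ n → Matched (simple R) n L) size m)
      cases (inj₂ (inj₂ st)) = Star.star R dense (subst (λ n → Starred (simple R) n L) size st)

  -- Counting edges when four vertices are left

  e≤pairs : ∀ (g : Graph V) X → e g X ≤ pairs (length X)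
  e≤pairs g [] = z≤n
  e≤pairs g (v ∷ X) = +-mono-≤ (deg≤length g v X) (e≤pairs g X)

  cut≤ : ∀ (g : Graph V) X Y → cut g X Y ≤ length X * length Y
  cut≤ g [] Y = z≤n
  cut≤ g (v ∷ X) Y = +-mono-≤ (deg≤length g v Y) (cut≤ g X Y)

  cut-↭ : ∀ (g : Graph V) {X X′ Y Y′} → X ↭ X′ → Y ↭ Y′ → cut g X Y ≡ cut g X′ Y′
  cut-↭ g {X} {X′} {Y} {Y′} σ τ = trans (∑-↭ (λ v → deg g v Y) σ) (∑-cong X′ (λ v → deg-↭ g v τ))

  both? : ∀ b b′ → (b ≡ true × b′ ≡ true) ⊎ ind b + ind b′ ≤ 1
  both? true true = inj₁ (refl , refl)
  both? true false = inj₂ ≤-refl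
  both? false b′ = inj₂ (ind≤1 b′)

  common-corner : ∀ {g : Graph V} (s : Simple g) {a b t} → IsTri g t → 4 ≤ deg g a (corners t) + deg g b (corners t) →
    ∃[ x ] ∃[ y ] ∃[ z ] corners t ↭ x ∷ y ∷ z ∷ [] × g y z ≡ true × g a x ≡ true × g b x ≡ true
  common-corner {g} s {a} {b} {x , y , z} (xy , xz , yz) four with both? (g a x) (g b x) | both? (g a y) (g b y) | both? (g a z)
      (g b z)
  ... | inj₁ (p , q) | _ | _ = x , y , z , refl , yz , p , q
  ... | inj₂ _ | inj₁ (p , q) | _ = y , x , z , pswap x y refl , xz , p , q
  ... | inj₂ _ | inj₂ _ | inj₁ (p , q) = z , x , y , shuffle (z ∷ x ∷ y ∷ []) (1F ∷ 2F ∷ 0F ∷ []) refl , xy , p , q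
  ... | inj₂ p | inj₂ q | inj₂ r = ⊥-elim (contradict (ind (g a x)) (ind (g a y)) (ind (g a z)) (ind (g b x)) (ind (g b y))
      (ind (g b z)) p q r four)
    where
    contradict : ∀ a b c d f h → a + d ≤ 1 → b + f ≤ 1 → c + h ≤ 1 → 4 ≤ a + (b + (c + 0)) + (d + (f + (h + 0))) → ⊥
    contradict a b c d f h h0 h1 h2 h3 = refute (a ∷ b ∷ c ∷ d ∷ f ∷ h ∷ []) (1 , x0 ⊕ x3 ⊑ K 1 · 1 , x1 ⊕ x4 ⊑ K 1 · 1 , x2 ⊕ x5
        ⊑ K 1 · 1 , K 4 ⊑ x0 ⊕ (x1 ⊕ (x2 ⊕ K 0)) ⊕ (x3 ⊕ (x4 ⊕ (x5 ⊕ K 0))) · done) (h0 , h1 , h2 , h3 , tt)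

  module FourLeft {j : ℕ} {L : List V} (uL : Unique L) (len : length L ≡ 3 * j + 6 + 1) (¬rp : ¬ RainbowPacking L (2 + j))
    (degrees : ∀ {g} → RainbowGraph g → bound j 1 < e g L → ∀ {v Y} → L ↭ v ∷ Y → 2 * j + 3 ≤ deg g v L)
    {g : Graph V} (R : RainbowGraph g) (dense : bound j 1 < e g L) {P : List (Triple V)} (size : length P ≡ 1 + j) where

    open OneExtra {j} uL len ¬rp degrees using (no-larger; member-degree)

    private
      s : Simple g
      s = simple R
      weight : V → Triple V → ℕ
      weight v T = deg g v (corners T)

    Rest : V → V → V → V → Set
    Rest p q p′ q′ = Packing g P (p ∷ q ∷ p′ ∷ q′ ∷ []) L

    not-larger : Packs g (suc (length P)) L → ⊥
    not-larger pks = no-larger R (subst (λ n → Packs g (suc n) L) size pks)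

    no-triangle : ∀ {X x y z} → Packing g P X L → ∀ {Y} → X ↭ x ∷ y ∷ z ∷ Y → g x y ≡ true → g x z ≡ true → g y z ≡ true → ⊥
    no-triangle pk σ xy xz yz = not-larger (grow-by-triangle (_ , _ , _ , _ , σ , xy , xz , yz) pk)

    module Counting {p q p′ q′ : V} (pk : Rest p q p′ q′) (pq : g p q ≡ true) (p′q′ : g p′ q′ ≡ true) where

      rest : List V
      rest = p ∷ q ∷ p′ ∷ q′ ∷ []

      f : Triple V → ℕ
      f T = weight p T + weight q T + (weight p′ T + weight q′ T)

      eights : All (λ T → f T ≤ 8) P
      eights with augment-step s pk pq p′q′
      ... | inj₁ pks = ⊥-elim (not-larger pks)
      ... | inj₂ small = small

      edge-in-rest : ∀ {u w X} → rest ↭ u ∷ w ∷ X → g u w ≡ true → deg g u rest + deg g w rest ≤ 4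
      edge-in-rest σ uw with triangle-on-edge? s σ uw
      ... | inj₁ tri = ⊥-elim (not-larger (grow-by-triangle tri pk))
      ... | inj₂ le = le

      -- Neither of the two disjoint edges lies in a triangle of the rest, so each has degree sum at
      -- most 4 there.
      few-in-rest : e g rest ≤ 4
      few-in-rest = step (deg g p rest) (deg g q rest) (deg g p′ rest) (deg g q′ rest) (e g rest)
        (edge-in-rest refl pq) (edge-in-rest (shifts (p ∷ q ∷ []) (p′ ∷ q′ ∷ [])) p′q′) (handshake s rest)
        where
        step : ∀ a b c d n → a + b ≤ 4 → c + d ≤ 4 → a + (b + (c + (d + 0))) ≡ 2 * n → n ≤ 4
        step a b c d n h0 h1 h2 = deduce (a ∷ b ∷ c ∷ d ∷ n ∷ []) 2 (x4 ⊑ K 4) (1 , x0 ⊕ x1 ⊑ K 4 · 1 , x2 ⊕ x3 ⊑ K 4 · 1 , 2 ⊗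
            x4 ⊑ x0 ⊕ (x1 ⊕ (x2 ⊕ (x3 ⊕ K 0))) · done) (h0 , h1 , ≤-reflexive (sym h2) , tt)

      total : ∑ f P ≡ load g p P + load g q P + (load g p′ P + load g q′ P)
      total = trans (∑-distrib (λ T → weight p T + weight q T) (λ T → weight p′ T + weight q′ T) P)
        (cong₂ _+_ (∑-distrib (weight p) (weight q) P) (∑-distrib (weight p′) (weight q′) P))

      e-split : e g L ≡ e g (flat P) + e g rest + ∑ f P
      e-split = trans (sym (e-↭ s (partition pk))) (trans (e-++ g (flat P) rest) (cong (e g (flat P) + e g rest +_)
        (trans (cut-flip s (flat P) rest) (trans
          (cong₂ _+_ (deg-flat g p P) (cong₂ _+_ (deg-flat g q P) (cong₂ _+_ (deg-flat g p′ P) (cong (_+ 0) (deg-flat g q′ P)))))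
          (trans (reassociate (load g p P) (load g q P) (load g p′ P) (load g q′ P)) (sym total))))))
        where
        reassociate : ∀ a b c d → a + (b + (c + (d + 0))) ≡ a + b + (c + d)
        reassociate = solve-∀

      size₃ : length (flat P) ≡ 3 * j + 3
      size₃ = trans (length-flat P) (trans (cong (3 *_) size) (rearrange j))
        where
        rearrange : ∀ j → 3 * (1 + j) ≡ 3 * j + 3
        rearrange = solve-∀

      inner : e g (flat P) ≤ pairs (3 * j + 3)
      inner = subst (λ n → e g (flat P) ≤ pairs n) size₃ (e≤pairs g (flat P))

      sum≤ : ∑ f P ≤ 8 * j + 8
      sum≤ = ≤-trans (∑-bound f 8 eights) (≤-reflexive (trans (cong (8 *_) size) (rearrange j)))
        where
        rearrange : ∀ j → 8 * (1 + j) ≡ 8 * j + 8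
        rearrange = solve-∀

      many-in-rest : 3 ≤ e g rest
      many-in-rest = step j (pairs (3 * j + 3)) (bound j 1) (e g L) (e g (flat P)) (e g rest) (∑ f P) (bound-one-pairs j) dense
          e-split inner sum≤
        where
        step : ∀ j r b n x y z → r + (8 * j + 10) ≤ b → b < n → n ≡ x + y + z → x ≤ r → z ≤ 8 * j + 8 → 3 ≤ y
        step j r b n x y z h0 h1 h2 h3 h4 = deduce (j ∷ r ∷ b ∷ n ∷ x ∷ y ∷ z ∷ []) 1 (K 3 ⊑ x5)
            (1 , x1 ⊕ (8 ⊗ x0 ⊕ K 10) ⊑ x2 · 1 , K 1 ⊕ x2 ⊑ x3 · 1 , x3 ⊑ x4 ⊕ x5 ⊕ x6 · 1 , x4 ⊑ x1 · 1 , x6 ⊑ 8 ⊗ x0 ⊕ K 8 ·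
            done) (h0 , h1 , ≤-reflexive h2 , h3 , h4 , tt)

      sum≥ : 8 * j + 7 ≤ ∑ f P
      sum≥ = step j (pairs (3 * j + 3)) (bound j 1) (e g L) (e g (flat P)) (e g rest) (∑ f P) (bound-one-pairs j) dense e-split
          inner few-in-rest
        where
        step : ∀ j r b n x y z → r + (8 * j + 10) ≤ b → b < n → n ≡ x + y + z → x ≤ r → y ≤ 4 → 8 * j + 7 ≤ z
        step j r b n x y z h0 h1 h2 h3 h4 = deduce (j ∷ r ∷ b ∷ n ∷ x ∷ y ∷ z ∷ []) 1 (8 ⊗ x0 ⊕ K 7 ⊑ x6)
            (1 , x1 ⊕ (8 ⊗ x0 ⊕ K 10) ⊑ x2 · 1 , K 1 ⊕ x2 ⊑ x3 · 1 , x3 ⊑ x4 ⊕ x5 ⊕ x6 · 1 , x4 ⊑ x1 · 1 , x5 ⊑ K 4 · done)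
            (h0 , h1 , ≤-reflexive h2 , h3 , h4 , tt)

      inner≥ : ∀ {d} → ∑ f P ≤ 8 * j + 7 + d → pairs (3 * j + 3) ≤ d + e g (flat P)
      inner≥ {d} le = step j (pairs (3 * j + 3)) (bound j 1) (e g L) (e g (flat P)) (e g rest) (∑ f P) d (bound-one-pairs j)
          dense e-split le few-in-rest
        where
        step : ∀ j r b n x y z d → r + (8 * j + 10) ≤ b → b < n → n ≡ x + y + z → z ≤ 8 * j + 7 + d → y ≤ 4 → r ≤ d + x
        step j r b n x y z d h0 h1 h2 h3 h4 = deduce (j ∷ r ∷ b ∷ n ∷ x ∷ y ∷ z ∷ d ∷ []) 1 (x1 ⊑ x7 ⊕ x4)
            (1 , x1 ⊕ (8 ⊗ x0 ⊕ K 10) ⊑ x2 · 1 , K 1 ⊕ x2 ⊑ x3 · 1 , x3 ⊑ x4 ⊕ x5 ⊕ x6 · 1 , x6 ⊑ 8 ⊗ x0 ⊕ K 7 ⊕ x7 · 1 , x5 ⊑ K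
            4 · done) (h0 , h1 , ≤-reflexive h2 , h3 , h4 , tt)

      sevens : ∀ {T Q} → P ↭ T ∷ Q → 7 ≤ f T
      sevens {T} {Q} σ = step j (∑ f P) (f T) (∑ f Q) (length Q) (length P) sum≥ (∑-↭ f σ)
          (∑-bound f 8 (All.tail (All-resp-↭ σ eights))) (↭-length σ) size
        where
        step : ∀ j z x y q t → 8 * j + 7 ≤ z → z ≡ x + y → y ≤ 8 * q → t ≡ 1 + q → t ≡ 1 + j → 7 ≤ x
        step j z x y q t h0 h1 h2 h3 h4 = deduce (j ∷ z ∷ x ∷ y ∷ q ∷ t ∷ []) 1 (K 7 ⊑ x2)
            (1 , 8 ⊗ x0 ⊕ K 7 ⊑ x1 · 1 , x1 ⊑ x2 ⊕ x3 · 1 , x3 ⊑ 8 ⊗ x4 · 8 , K 1 ⊕ x4 ⊑ x5 · 8 , x5 ⊑ K 1 ⊕ x0 · done)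
            (h0 , ≤-reflexive h1 , h2 , ≤-reflexive (sym h3) , ≤-reflexive h4 , tt)

      -- Here `d` bounds the pairs missing inside the packing: 1 in general, and 0 when the edges to
      -- the rest already fall one short of eight per triangle.
      crossing : ∀ {T T′ Q d} → P ↭ T ∷ T′ ∷ Q → ∑ f P ≤ 8 * j + 7 + d → 9 ≤ d + cut g (corners T) (corners T′)
      crossing {T} {T′} {Q} {d} σ le = conclude (length Q) (pairs (3 + 3 * length Q)) (pairs (3 * j + 3)) (length (flat Q))
        (pairs (length (corners T′ ++ flat Q))) (e g (flat P)) (e g (corners T)) (e g (corners T′ ++ flat Q))
        (cut g (corners T) (corners T′ ++ flat Q)) (cut g (corners T) (corners T′)) (cut g (corners T) (flat Q)) d
        (inner≥ {d} le) (cong pairs (trans (sym size₃) (trans (↭-length (flat-↭ σ)) (cong (6 +_) (length-flat Q)))))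
        (trans (e-↭ s (flat-↭ σ)) (e-++ g (corners T) (corners T′ ++ flat Q))) (e≤pairs g (corners T))
            (e≤pairs g (corners T′ ++ flat Q))
        (cong (λ l → pairs (3 + l)) (length-flat Q)) (cut-++ʳ g (corners T) (corners T′) (flat Q)) (cut≤ g (corners T) (flat Q))
            (length-flat Q)
        where
        conclude : ∀ q w r l u x a b c f h d → r ≤ d + x → r ≡ 5 + 3 * q + (4 + 3 * q + (3 + 3 * q + w)) → x ≡ a + b + c → a ≤ 3
            → b ≤ u → u ≡ w → c ≡ f + h → h ≤ 3 * l → l ≡ 3 * q → 9 ≤ d + f
        conclude q w r l u x a b c f h d h0 h1 h2 h3 h4 h5 h6 h7 h8 = deduce (q ∷ w ∷ r ∷ l ∷ u ∷ x ∷ a ∷ b ∷ c ∷ f ∷ h ∷ d ∷ [])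
            1 (K 9 ⊑ x11 ⊕ x9) (1 , x2 ⊑ x11 ⊕ x5 · 1 , K 5 ⊕ 3 ⊗ x0 ⊕ (K 4 ⊕ 3 ⊗ x0 ⊕ (K 3 ⊕ 3 ⊗ x0 ⊕ x1)) ⊑ x2 · 1 , x5 ⊑ x6 ⊕
            x7 ⊕ x8 · 1 , x6 ⊑ K 3 · 1 , x7 ⊑ x4 · 1 , x4 ⊑ x1 · 1 , x8 ⊑ x9 ⊕ x10 · 1 , x10 ⊑ 3 ⊗ x3 · 3 , x3 ⊑ 3 ⊗ x0 · done)
            (h0 , ≤-reflexive (sym h1) , ≤-reflexive h2 , h3 , h4 , ≤-reflexive h5 , ≤-reflexive h6 , h7 , ≤-reflexive h8 , tt)

    -- Nearly all edges between T and T′ are present, so besides a triangle through pq and one through p′q′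
    -- the remaining corners of T and T′ carry a third.
    cross-triangles : ∀ {p q p′ q′ T T′ Q} → Rest p q p′ q′ → g p q ≡ true → g p′ q′ ≡ true → P ↭ T ∷ T′ ∷ Q →
      4 ≤ weight p T + weight q T → 4 ≤ weight p′ T′ + weight q′ T′ → 8 ≤ cut g (corners T) (corners T′) → ⊥
    cross-triangles {p} {q} {p′} {q′} {T} {T′} {Q} pk pq p′q′ σ heavy heavy′ dense-cut = finish
      (common-corner s (All.head (triangles pk₁)) heavy) (common-corner s (All.head (All.tail (triangles pk₁))) heavy′)
      where
      pk₁ : Packing g (T ∷ T′ ∷ Q) (p ∷ q ∷ p′ ∷ q′ ∷ []) L
      pk₁ = reorder σ pk
      Corner : V → V → Triple V → Set
      Corner a b t = ∃[ x ] ∃[ y ] ∃[ z ] corners t ↭ x ∷ y ∷ z ∷ [] × g y z ≡ true × g a x ≡ true × g b x ≡ true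
      finish : Corner p q T → Corner p′ q′ T′ → ⊥
      finish (x , y , z , τ , yz , px , qx) (x′ , y′ , z′ , τ′ , y′z′ , p′x′ , q′x′) = pick (both? (g y y′) (g z y′))
          (both? (g y z′) (g z z′))
        where
        build : ∀ {w w′} → y ∷ z ∷ w ∷ w′ ∷ [] ↭ y ∷ z ∷ y′ ∷ z′ ∷ [] → g y w ≡ true → g z w ≡ true → ⊥
        build {w} {w′} ρ yw zw = not-larger (_ , _ , cong suc (sym (↭-length σ)) ,
          replace (T ∷ T′ ∷ []) ((p , q , x) ∷ (p′ , q′ , x′) ∷ (y , z , w) ∷ []) (p ∷ q ∷ p′ ∷ q′ ∷ []) (w′ ∷ []) {Q} {[]}
            ((pq , px , qx) ∷ (p′q′ , p′x′ , q′x′) ∷ (yz , yw , zw) ∷ []) moved pk₁)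
          where
          moved : p ∷ q ∷ x ∷ p′ ∷ q′ ∷ x′ ∷ y ∷ z ∷ w ∷ w′ ∷ [] ↭ (corners T ++ (corners T′ ++ [])) ++ (p ∷ q ∷ p′ ∷ q′ ∷ [])
          moved = begin
            p ∷ q ∷ x ∷ p′ ∷ q′ ∷ x′ ∷ y ∷ z ∷ w ∷ w′ ∷ []  ↭⟨ ++⁺ˡ (p ∷ q ∷ x ∷ p′ ∷ q′ ∷ x′ ∷ []) ρ ⟩
            p ∷ q ∷ x ∷ p′ ∷ q′ ∷ x′ ∷ y ∷ z ∷ y′ ∷ z′ ∷ [] ↭⟨ shuffle (x ∷ y ∷ z ∷ x′ ∷ y′ ∷ z′ ∷ p ∷ q ∷ p′ ∷ q′ ∷ [])
                                                               (6F ∷ 7F ∷ 0F ∷ 8F ∷ 9F ∷ 3F ∷ 1F ∷ 2F ∷ 4F ∷ 5F ∷ []) refl ⟩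
            (x ∷ y ∷ z ∷ x′ ∷ y′ ∷ z′ ∷ []) ++ (p ∷ q ∷ p′ ∷ q′ ∷ []) ↭⟨ ++⁺ʳ (p ∷ q ∷ p′ ∷ q′ ∷ [])
                (++⁺ τ (++⁺ τ′ (↭-refl {x = []}))) ⟨
            (corners T ++ (corners T′ ++ [])) ++ (p ∷ q ∷ p′ ∷ q′ ∷ []) ∎
            where open PermutationReasoning
        pick : (g y y′ ≡ true × g z y′ ≡ true) ⊎ ind (g y y′) + ind (g z y′) ≤ 1 → (g y z′ ≡ true × g z z′ ≡ true) ⊎ ind (g y z′)
            + ind (g z z′) ≤ 1 → ⊥
        pick (inj₁ (yy′ , zy′)) _ = build refl yy′ zy′
        pick (inj₂ _) (inj₁ (yz′ , zz′)) = build (prep y (prep z (pswap z′ y′ refl))) yz′ zz′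
        pick (inj₂ a) (inj₂ b) = contradict (ind (g x x′)) (ind (g x y′)) (ind (g x z′)) (ind (g y x′)) (ind (g y y′))
            (ind (g y z′)) (ind (g z x′)) (ind (g z y′)) (ind (g z z′)) _
          dense-cut (cut-↭ g τ τ′) (ind≤1 (g x x′)) (ind≤1 (g x y′)) (ind≤1 (g x z′)) (ind≤1 (g y x′)) (ind≤1 (g z x′)) a b
          where
          contradict : ∀ a b c d f h i j k t → 8 ≤ t → t ≡ a + (b + (c + 0)) + (d + (f + (h + 0)) + (i + (j + (k + 0)) + 0)) → a
              ≤ 1 → b ≤ 1 → c ≤ 1 → d ≤ 1 → i ≤ 1 → f + j ≤ 1 → h + k ≤ 1 → ⊥
          contradict a b c d f h i j k t h0 h1 h2 h3 h4 h5 h6 h7 h8 = refute (a ∷ b ∷ c ∷ d ∷ f ∷ h ∷ i ∷ j ∷ k ∷ t ∷ [])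
              (1 , K 8 ⊑ x9 · 1 , x9 ⊑ x0 ⊕ (x1 ⊕ (x2 ⊕ K 0)) ⊕ (x3 ⊕ (x4 ⊕ (x5 ⊕ K 0)) ⊕ (x6 ⊕ (x7 ⊕ (x8 ⊕ K 0)) ⊕ K 0)) · 1 ,
              x0 ⊑ K 1 · 1 , x1 ⊑ K 1 · 1 , x2 ⊑ K 1 · 1 , x3 ⊑ K 1 · 1 , x6 ⊑ K 1 · 1 , x4 ⊕ x7 ⊑ K 1 · 1 , x5 ⊕ x8 ⊑ K 1 ·
              done) (h0 , ≤-reflexive h1 , h2 , h3 , h4 , h5 , h6 , h7 , h8 , tt)

    Light : V → V → Set
    Light p q = All (λ T → weight p T + weight q T ≤ 3) P

    -- Four or more edges from `pq` to one triangle and from `p′q′` to another are excluded by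
    -- `cross-triangles`. If both are heavy only at the same `T`, any other triangle receives at
    -- least seven edges, at most three of them from `p′q′`, so `pq` is heavy there as well.
    one-side-light : 1 ≤ j → ∀ {p q p′ q′} → Rest p q p′ q′ → g p q ≡ true → g p′ q′ ≡ true → Light p q ⊎ Light p′ q′
    one-side-light j≥1 {p} {q} {p′} {q′} pk pq p′q′ with search (λ T → Sum.swap (≤-<-connex (weight p T + weight q T) 3)) P
    ... | inj₂ light = inj₁ light
    ... | inj₁ (T , Q , σ , heavy) with search (λ T → Sum.swap (≤-<-connex (weight p′ T + weight q′ T) 3)) Q
    ...   | inj₁ (T′ , Q′ , τ , heavy′) = ⊥-elim (cross-triangles pk pq p′q′ σ′ heavy heavy′ (cross σ′))
      where
      open Counting pk pq p′q′
      σ′ = ptrans σ (prep T τ)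
      cross : ∀ {T T′ Q} → P ↭ T ∷ T′ ∷ Q → 8 ≤ cut g (corners T) (corners T′)
      cross σ = ≤-pred (crossing {d = 1} σ (≤-trans sum≤ (≤-reflexive (step j))))
        where
        step : ∀ j → 8 * j + 8 ≡ 8 * j + 7 + 1
        step = solve-∀
    ...   | inj₂ light with ≤-<-connex (weight p′ T + weight q′ T) 3
    ...     | inj₁ small = inj₂ (All-resp-↭ (↭-sym σ) (small ∷ light))
    ...     | inj₂ heavy′ with Q
    ...       | [] = ⊥-elim (contradict j j≥1 (trans (sym (↭-length σ)) size))
      where
      contradict : ∀ j → 1 ≤ j → 1 ≡ 1 + j → ⊥
      contradict j h0 h1 = refute (j ∷ []) (1 , K 1 ⊑ x0 · 1 , K 1 ⊕ x0 ⊑ K 1 · done) (h0 , ≤-reflexive (sym h1) , tt)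
    ...       | T″ ∷ Q′ = ⊥-elim (cross-triangles pk pq p′q′ σ′ (left (sevens σ′) (All.head light)) heavy′ (cross σ′))
      where
      open Counting pk pq p′q′
      σ′ : P ↭ T″ ∷ T ∷ Q′
      σ′ = ptrans σ (pswap T T″ refl)
      cross : ∀ {T T′ Q} → P ↭ T ∷ T′ ∷ Q → 8 ≤ cut g (corners T) (corners T′)
      cross σ = ≤-pred (crossing {d = 1} σ (≤-trans sum≤ (≤-reflexive (step j))))
        where
        step : ∀ j → 8 * j + 8 ≡ 8 * j + 7 + 1
        step = solve-∀
      left : ∀ {x y} → 7 ≤ x + y → y ≤ 3 → 4 ≤ x
      left {x} {y} a b = step x y a b
        where
        step : ∀ x y → 7 ≤ x + y → y ≤ 3 → 4 ≤ x
        step x y h0 h1 = deduce (x ∷ y ∷ []) 1 (K 4 ⊑ x0) (1 , K 7 ⊑ x0 ⊕ x1 · 1 , x1 ⊑ K 3 · done) (h0 , h1 , tt)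

    private
      in-rest : ∀ {X v} → Packing g P X L → v ∈ X → v ∈ L
      in-rest pk v∈ = ∈-resp-↭ (partition pk) (∈-++⁺ʳ (flat P) v∈)

      swap-light : ∀ {p q} → Light p q → Light q p
      swap-light {p} {q} = All.map (λ {T} → subst (_≤ 3) (+-comm (weight p T) (weight q T)))

      light-load : ∀ {p q} → Light p q → load g p P + load g q P ≤ 3 * (1 + j)
      light-load {p} {q} light = subst₂ _≤_ (∑-distrib (weight p) (weight q) P) (cong (3 *_) size)
          (∑-bound (λ T → weight p T + weight q T) 3 light)

      degree-in-rest : ∀ {X x} → Packing g P X L → x ∈ X → 2 * j + 3 ≤ load g x P + deg g x X
      degree-in-rest {x = x} pk x∈ = subst (2 * j + 3 ≤_) (packing-deg pk x) (member-degree R dense (in-rest pk x∈))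

    record Square : Set where
      constructor square
      field
        {a b a′ b′} : V
        packing : Rest a b a′ b′
        ab : g a b ≡ true
        ba′ : g b a′ ≡ true
        a′b′ : g a′ b′ ≡ true
        b′a : g b′ a ≡ true
        light : Light a′ b′

    -- Two degrees of at least 2j + 3 face at most 3j + 3 edges to the triangles and 4 in the rest,
    -- so `j = 1` with equality. Then `p′` and `q′` send two edges to `p`, `q`; these end
    -- differently at both sides, as the rest has no triangle.
    light-square : 1 ≤ j → ∀ {p q p′ q′} → Rest p q p′ q′ → g p q ≡ true → g p′ q′ ≡ true → Light p′ q′ → j ≡ 1 × Square
    light-square j≥1 {p} {q} {p′} {q′} pk pq p′q′ light = ≤-antisym j≤1 j≥1 , cases (both? (g q p′) (g q′ p))
        (both? (g p p′) (g q′ q))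
      where
      rest : List V
      rest = p ∷ q ∷ p′ ∷ q′ ∷ []
      low = degree-in-rest pk (there (there (here refl)))
      low′ = degree-in-rest pk (there (there (there (here refl))))
      j≤1 : j ≤ 1
      j≤1 = step j (load g p′ P) (load g q′ P) (deg g p′ rest) (deg g q′ rest) low low′
        (Counting.edge-in-rest pk pq p′q′ (shifts (p ∷ q ∷ []) (p′ ∷ q′ ∷ [])) p′q′) (light-load light)
        where
        step : ∀ j x y d d' → 2 * j + 3 ≤ x + d → 2 * j + 3 ≤ y + d' → d + d' ≤ 4 → x + y ≤ 3 * (1 + j) → j ≤ 1
        step j x y d d' h0 h1 h2 h3 = deduce (j ∷ x ∷ y ∷ d ∷ d' ∷ []) 1 (x0 ⊑ K 1) (1 , 2 ⊗ x0 ⊕ K 3 ⊑ x1 ⊕ x3 · 1 , 2 ⊗ x0 ⊕ K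
            3 ⊑ x2 ⊕ x4 · 1 , x3 ⊕ x4 ⊑ K 4 · 1 , x1 ⊕ x2 ⊑ 3 ⊗ (K 1 ⊕ x0) · done) (h0 , h1 , h2 , h3 , tt)
      not-both : ∀ {b b′} → (b ≡ true → b′ ≡ true → ⊥) → ind b + ind b′ ≤ 1
      not-both {b} {b′} f with both? b b′
      ... | inj₁ (x , y) = ⊥-elim (f x y)
      ... | inj₂ le = le
      cases : (g q p′ ≡ true × g q′ p ≡ true) ⊎ ind (g q p′) + ind (g q′ p) ≤ 1 → (g p p′ ≡ true × g q′ q ≡ true) ⊎ ind (g p p′)
          + ind (g q′ q) ≤ 1 → Square
      cases (inj₁ (qp′ , q′p)) _ = square pk pq qp′ p′q′ q′p light
      cases (inj₂ _) (inj₁ (pp′ , q′q)) = square (reorder-rest (pswap p q refl) pk) (flip-edge s pq) pp′ p′q′ q′q light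
      cases (inj₂ le) (inj₂ le′) = ⊥-elim (sparse j (load g p′ P) (load g q′ P) (ind (g p′ p)) (ind (g p p′)) (ind (g p′ q))
          (ind (g q p′)) (ind (g p′ p′)) (ind (g p′ q′)) (ind (g q′ p)) (ind (g q′ q)) (ind (g q′ p′)) (ind (g q′ q′))
        low low′ (light-load light) j≥1 (cong ind (symm s p′ p)) (cong ind (symm s p′ q)) (cong ind (irrefl s p′))
            (cong ind (irrefl s q′)) (ind≤1 (g p′ q′)) (ind≤1 (g q′ p′))
        (at-most-one (g p p′) (g q p′) (g q′ p) (g q′ q)
          (not-both λ pp′ qp′ → no-triangle pk refl pq pp′ qp′)
          (not-both λ pp′ q′p → no-triangle pk (prep p (ptrans (pswap q p′ refl) (prep p′ (pswap q q′ refl)))) pp′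
              (flip-edge s q′p) p′q′)
          le′ le
          (not-both λ qp′ q′q → no-triangle pk (↭-sym (shift p (q ∷ p′ ∷ q′ ∷ []) [])) qp′ (flip-edge s q′q) p′q′)
          (not-both λ q′p q′q → no-triangle pk (prep p (prep q (pswap p′ q′ refl))) pq (flip-edge s q′p) (flip-edge s q′q))))
        where
        at-most-one : ∀ α β γ δ → ind α + ind β ≤ 1 → ind α + ind γ ≤ 1 → ind α + ind δ ≤ 1 → ind β + ind γ ≤ 1 → ind β + ind δ ≤
            1 → ind γ + ind δ ≤ 1 →
          ind α + ind β + (ind γ + ind δ) ≤ 1
        at-most-one true β γ δ x y z _ _ _ = step (ind β) (ind γ) (ind δ) x y z
          where
          step : ∀ b c d → 1 + b ≤ 1 → 1 + c ≤ 1 → 1 + d ≤ 1 → 1 + b + (c + d) ≤ 1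
          step b c d h0 h1 h2 = deduce (b ∷ c ∷ d ∷ []) 1 (K 1 ⊕ x0 ⊕ (x1 ⊕ x2) ⊑ K 1)
              (1 , K 1 ⊕ x0 ⊑ K 1 · 1 , K 1 ⊕ x1 ⊑ K 1 · 1 , K 1 ⊕ x2 ⊑ K 1 · done) (h0 , h1 , h2 , tt)
        at-most-one false true γ δ _ _ _ x y _ = step (ind γ) (ind δ) x y
          where
          step : ∀ c d → 1 + c ≤ 1 → 1 + d ≤ 1 → 1 + (c + d) ≤ 1
          step c d h0 h1 = deduce (c ∷ d ∷ []) 1 (K 1 ⊕ (x0 ⊕ x1) ⊑ K 1) (1 , K 1 ⊕ x0 ⊑ K 1 · 1 , K 1 ⊕ x1 ⊑ K 1 · done)
              (h0 , h1 , tt)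
        at-most-one false false γ δ _ _ _ _ _ x = x
        sparse : ∀ j x y a a' b b' i c d f k h → 2 * j + 3 ≤ x + (a + (b + (i + (c + 0)))) → 2 * j + 3 ≤ y +
            (d + (f + (k + (h + 0)))) → x + y ≤ 3 * (1 + j) → 1 ≤ j → a ≡ a' → b ≡ b' → i ≡ 0 → h ≡ 0 → c ≤ 1 → k ≤ 1 → a' + b' +
            (d + f) ≤ 1 → ⊥
        sparse j x y a a' b b' i c d f k h h0 h1 h2 h3 h4 h5 h6 h7 h8 h9 h10 = refute
            (j ∷ x ∷ y ∷ a ∷ a' ∷ b ∷ b' ∷ i ∷ c ∷ d ∷ f ∷ k ∷ h ∷ []) (1 , 2 ⊗ x0 ⊕ K 3 ⊑ x1 ⊕ (x3 ⊕ (x5 ⊕ (x7 ⊕ (x8 ⊕ K 0)))) ·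
            1 , 2 ⊗ x0 ⊕ K 3 ⊑ x2 ⊕ (x9 ⊕ (x10 ⊕ (x11 ⊕ (x12 ⊕ K 0)))) · 1 , x1 ⊕ x2 ⊑ 3 ⊗ (K 1 ⊕ x0) · 1 , K 1 ⊑ x0 · 1 , x3 ⊑
            x4 · 1 , x5 ⊑ x6 · 1 , x7 ⊑ K 0 · 1 , x12 ⊑ K 0 · 1 , x8 ⊑ K 1 · 1 , x11 ⊑ K 1 · 1 , x4 ⊕ x6 ⊕ (x9 ⊕ x10) ⊑ K 1 ·
            done) (h0 , h1 , h2 , h3 , ≤-reflexive h4 , ≤-reflexive h5 , ≤-reflexive h6 , ≤-reflexive h7 , h8 , h9 , h10 , tt)

    private
      pair-of : ∀ (Q : List (Triple V)) → length Q ≡ 2 → ∃[ T ] ∃[ T′ ] Q ↭ T ∷ T′ ∷ []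
      pair-of (T ∷ T′ ∷ []) _ = T , T′ , refl

    module DoublyLight (j≡1 : j ≡ 1) {a b a′ b′ : V} (pk : Rest a b a′ b′) (ab : g a b ≡ true) (ba′ : g b a′ ≡ true)
      (a′b′ : g a′ b′ ≡ true) (b′a : g b′ a ≡ true) (light : Light a′ b′) (light′ : Light a b′) where

      open Counting pk ab a′b′

      -- A diagonal of the square would close a triangle, so at most two of five edges stay in the
      -- rest.
      path-end : ∀ {x y z w} → rest ↭ x ∷ y ∷ z ∷ w ∷ [] → x ∈ rest → g x y ≡ true → g y w ≡ true → 3 ≤ load g x P
      path-end {x} {y} {z} {w} σ x∈ xy yw = step j (load g x P) (deg g x rest) (ind (g x x)) (ind (g x y)) (ind (g x z))
          (ind (g x w)) (degree-in-rest pk x∈) (deg-↭ g x σ)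
        (cong ind (irrefl s x)) (ind≤1 (g x y)) (ind≤1 (g x z))
        (cong ind (false-if λ xw → no-triangle pk (ptrans σ (prep x (prep y (pswap z w refl)))) xy xw yw)) j≡1
        where
        step : ∀ j l d i a b f → 2 * j + 3 ≤ l + d → d ≡ i + (a + (b + (f + 0))) → i ≡ 0 → a ≤ 1 → b ≤ 1 → f ≡ 0 → j ≡ 1 → 3 ≤ l
        step j l d i a b f h0 h1 h2 h3 h4 h5 h6 = deduce (j ∷ l ∷ d ∷ i ∷ a ∷ b ∷ f ∷ []) 1 (K 3 ⊑ x1)
            (1 , 2 ⊗ x0 ⊕ K 3 ⊑ x1 ⊕ x2 · 1 , x2 ⊑ x3 ⊕ (x4 ⊕ (x5 ⊕ (x6 ⊕ K 0))) · 1 , x3 ⊑ K 0 · 1 , x4 ⊑ K 1 · 1 , x5 ⊑ K 1 · 1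
            , x6 ⊑ K 0 · 2 , K 1 ⊑ x0 · done) (h0 , ≤-reflexive h1 , ≤-reflexive h2 , h3 , h4 , ≤-reflexive h5 , ≤-reflexive
            (sym h6) , tt)

      load-a : 3 ≤ load g a P
      load-a = path-end {z = b′} (prep a (prep b (pswap a′ b′ refl))) (here refl) ab ba′

      load-b′ : 3 ≤ load g b′ P
      load-b′ = path-end {b′} {a} {a′} {b} (shuffle (b′ ∷ a ∷ a′ ∷ b ∷ []) (1F ∷ 3F ∷ 2F ∷ 0F ∷ []) refl)
          (there (there (there (here refl)))) b′a ab

      -- The pair `a′`, `b′` sends at most 6 edges; so does `a`, `b′`, which leaves at most 3 for
      -- `a`; and `b` sends at most 6. The sum 15 is also the minimum, so `b` sees all six corners
      -- and no pair is missing between the two triangles.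
      tight : ∑ f P ≤ 8 * j + 7 + 0
      tight = step j (load g a P) (load g b P) (load g a′ P) (load g b′ P) (∑ f P) total (light-load light) (light-load light′)
          load-b′
        (subst (λ n → load g b P ≤ 3 * n) size (∑-bound (weight b) 3 (All.universal (λ T → deg≤length g b (corners T)) P))) j≡1
        where
        step : ∀ j a b a' b' f → f ≡ a + b + (a' + b') → a' + b' ≤ 3 * (1 + j) → a + b' ≤ 3 * (1 + j) → 3 ≤ b' → b ≤ 3 * (1 + j)
            → j ≡ 1 → f ≤ 8 * j + 7 + 0
        step j a b a' b' f h0 h1 h2 h3 h4 h5 = deduce (j ∷ a ∷ b ∷ a' ∷ b' ∷ f ∷ []) 1 (x5 ⊑ 8 ⊗ x0 ⊕ K 7 ⊕ K 0)
            (1 , x5 ⊑ x1 ⊕ x2 ⊕ (x3 ⊕ x4) · 1 , x3 ⊕ x4 ⊑ 3 ⊗ (K 1 ⊕ x0) · 1 , x1 ⊕ x4 ⊑ 3 ⊗ (K 1 ⊕ x0) · 1 , K 3 ⊑ x4 · 1 , x2 ⊑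
            3 ⊗ (K 1 ⊕ x0) · 1 , x0 ⊑ K 1 · done) (≤-reflexive h0 , h1 , h2 , h3 , h4 , ≤-reflexive h5 , tt)

      full : ∀ {T T′} → P ↭ T ∷ T′ ∷ [] → 3 ≤ weight b T
      full {T} {T′} σ = step j (load g a P) (load g b P) (load g a′ P) (load g b′ P) (∑ f P) (weight b T) (weight b T′) total
          (light-load light) (light-load light′) load-b′ sum≥
        (∑-↭ (weight b) σ) (deg≤length g b (corners T′)) j≡1
        where
        step : ∀ j a b a' b' f x y → f ≡ a + b + (a' + b') → a' + b' ≤ 3 * (1 + j) → a + b' ≤ 3 * (1 + j) → 3 ≤ b' → 8 * j + 7 ≤
            f → b ≡ x + (y + 0) → y ≤ 3 → j ≡ 1 → 3 ≤ x
        step j a b a' b' f x y h0 h1 h2 h3 h4 h5 h6 h7 = deduce (j ∷ a ∷ b ∷ a' ∷ b' ∷ f ∷ x ∷ y ∷ []) 1 (K 3 ⊑ x6)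
            (1 , x5 ⊑ x1 ⊕ x2 ⊕ (x3 ⊕ x4) · 1 , x3 ⊕ x4 ⊑ 3 ⊗ (K 1 ⊕ x0) · 1 , x1 ⊕ x4 ⊑ 3 ⊗ (K 1 ⊕ x0) · 1 , K 3 ⊑ x4 · 1 , 8 ⊗
            x0 ⊕ K 7 ⊑ x5 · 1 , x2 ⊑ x6 ⊕ (x7 ⊕ K 0) · 1 , x7 ⊑ K 3 · 2 , K 1 ⊑ x0 · done)
            (≤-reflexive h0 , h1 , h2 , h3 , h4 , ≤-reflexive h5 , h6 , ≤-reflexive (sym h7) , tt)

      -- Three triangles arise: `a` with two corners of `T`, `b′` with two corners of `T′`, and `b`
      -- with the two corners left over.
      close : ∀ {T T′} → P ↭ T ∷ T′ ∷ [] → 2 ≤ weight a T → 2 ≤ weight b′ T′ → ⊥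
      close {T} {T′} σ two two′ = finish (two-corners s (All.head (triangles pk₁)) two)
          (two-corners s (All.head (All.tail (triangles pk₁))) two′)
        where
        pk₁ : Packing g (T ∷ T′ ∷ []) rest L
        pk₁ = reorder σ pk
        Corners : V → Triple V → Set
        Corners x t = ∃[ p ] ∃[ q ] ∃[ r ] corners t ↭ p ∷ q ∷ r ∷ [] × IsTri g (p , q , r) × g x p ≡ true × g x q ≡ true
        last-corner : ∀ {t p q r} → corners t ↭ p ∷ q ∷ r ∷ [] → 3 ≤ weight b t → g b r ≡ true
        last-corner {t} {p} {q} {r} τ three = ind-true (step (weight b t) (ind (g b p)) (ind (g b q)) (ind (g b r)) three
            (deg-↭ g b τ) (ind≤1 (g b p)) (ind≤1 (g b q)))
          where
          step : ∀ n x y z → 3 ≤ n → n ≡ x + (y + (z + 0)) → x ≤ 1 → y ≤ 1 → 1 ≤ z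
          step n x y z h0 h1 h2 h3 = deduce (n ∷ x ∷ y ∷ z ∷ []) 1 (K 1 ⊑ x3) (1 , K 3 ⊑ x0 · 1 , x0 ⊑ x1 ⊕ (x2 ⊕ (x3 ⊕ K 0)) · 1
              , x1 ⊑ K 1 · 1 , x2 ⊑ K 1 · done) (h0 , ≤-reflexive h1 , h2 , h3 , tt)
        finish : Corners a T → Corners b′ T′ → ⊥
        finish (p , q , r , τ , (pq , _ , _) , ap , aq) (p′ , q′ , r′ , τ′ , (p′q′ , _ , _) , b′p′ , b′q′) = not-larger
            (_ , _ , cong suc (sym (↭-length σ)) ,
          replace (T ∷ T′ ∷ []) ((a , p , q) ∷ (b′ , p′ , q′) ∷ (b , r , r′) ∷ []) rest (a′ ∷ []) {[]} {[]}
            ((ap , aq , pq) ∷ (b′p′ , b′q′ , p′q′) ∷ (last-corner τ (full σ) , last-corner τ′ (full (ptrans σ (pswap T T′ refl)))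
                , rr′) ∷ []) moved pk₁)
          where
          rr′ : g r r′ ≡ true
          rr′ = ind-true (step (cut g (corners T) (corners T′)) (deg g p (p′ ∷ q′ ∷ r′ ∷ [])) (deg g q (p′ ∷ q′ ∷ r′ ∷ []))
              (ind (g r p′)) (ind (g r q′)) (ind (g r r′))
            (crossing {d = 0} σ tight) (cut-↭ g τ τ′) (deg≤length g p (p′ ∷ q′ ∷ r′ ∷ [])) (deg≤length g q (p′ ∷ q′ ∷ r′ ∷ []))
                (ind≤1 (g r p′)) (ind≤1 (g r q′)))
            where
            step : ∀ n x y a b d → 9 ≤ 0 + n → n ≡ x + (y + (a + (b + (d + 0)) + 0)) → x ≤ 3 → y ≤ 3 → a ≤ 1 → b ≤ 1 → 1 ≤ d
            step n x y a b d h0 h1 h2 h3 h4 h5 = deduce (n ∷ x ∷ y ∷ a ∷ b ∷ d ∷ []) 1 (K 1 ⊑ x5)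
                (1 , K 9 ⊑ K 0 ⊕ x0 · 1 , x0 ⊑ x1 ⊕ (x2 ⊕ (x3 ⊕ (x4 ⊕ (x5 ⊕ K 0)) ⊕ K 0)) · 1 , x1 ⊑ K 3 · 1 , x2 ⊑ K 3 · 1 , x3
                ⊑ K 1 · 1 , x4 ⊑ K 1 · done) (h0 , ≤-reflexive h1 , h2 , h3 , h4 , h5 , tt)
          moved : a ∷ p ∷ q ∷ b′ ∷ p′ ∷ q′ ∷ b ∷ r ∷ r′ ∷ a′ ∷ [] ↭ (corners T ++ (corners T′ ++ [])) ++ (a ∷ b ∷ a′ ∷ b′ ∷ [])
          moved = begin
            a ∷ p ∷ q ∷ b′ ∷ p′ ∷ q′ ∷ b ∷ r ∷ r′ ∷ a′ ∷ [] ↭⟨ shuffle (p ∷ q ∷ r ∷ p′ ∷ q′ ∷ r′ ∷ a ∷ b ∷ a′ ∷ b′ ∷ [])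
                                                               (6F ∷ 0F ∷ 1F ∷ 9F ∷ 3F ∷ 4F ∷ 7F ∷ 2F ∷ 5F ∷ 8F ∷ []) refl ⟩
            (p ∷ q ∷ r ∷ p′ ∷ q′ ∷ r′ ∷ []) ++ (a ∷ b ∷ a′ ∷ b′ ∷ []) ↭⟨ ++⁺ʳ (a ∷ b ∷ a′ ∷ b′ ∷ [])
                (++⁺ τ (++⁺ τ′ (↭-refl {x = []}))) ⟨
            (corners T ++ (corners T′ ++ [])) ++ (a ∷ b ∷ a′ ∷ b′ ∷ []) ∎
            where open PermutationReasoning

      -- Two edges from `a` to one triangle leave `b′` at most one there, as `a` and `b′` are light
      -- together; so `b′` has two at the other triangle.
      impossible : ⊥
      impossible with pair-of P (trans size (cong suc j≡1))
      ... | T , T′ , σ = choose (<-≤-connex 1 (weight a T))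
        where
        a-sum : load g a P ≡ weight a T + (weight a T′ + 0)
        a-sum = ∑-↭ (weight a) σ
        b′-sum : load g b′ P ≡ weight b′ T + (weight b′ T′ + 0)
        b′-sum = ∑-↭ (weight b′) σ
        other : ∀ l x y z → l ≡ x + (y + 0) → 3 ≤ l → 2 ≤ z → z + x ≤ 3 → 2 ≤ y
        other l x y z h0 h1 h2 h3 = deduce (l ∷ x ∷ y ∷ z ∷ []) 1 (K 2 ⊑ x2) (1 , x0 ⊑ x1 ⊕ (x2 ⊕ K 0) · 1 , K 3 ⊑ x0 · 1 , K 2 ⊑
            x3 · 1 , x3 ⊕ x1 ⊑ K 3 · done) (≤-reflexive h0 , h1 , h2 , h3 , tt)
        second : ∀ l x y → l ≡ x + (y + 0) → 3 ≤ l → x ≤ 1 → 2 ≤ y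
        second l x y h0 h1 h2 = deduce (l ∷ x ∷ y ∷ []) 1 (K 2 ⊑ x2) (1 , x0 ⊑ x1 ⊕ (x2 ⊕ K 0) · 1 , K 3 ⊑ x0 · 1 , x1 ⊑ K 1 ·
            done) (≤-reflexive h0 , h1 , h2 , tt)
        first : ∀ l x y z → l ≡ x + (y + 0) → 3 ≤ l → 2 ≤ z → z + y ≤ 3 → 2 ≤ x
        first l x y z h0 h1 h2 h3 = deduce (l ∷ x ∷ y ∷ z ∷ []) 1 (K 2 ⊑ x1) (1 , x0 ⊑ x1 ⊕ (x2 ⊕ K 0) · 1 , K 3 ⊑ x0 · 1 , K 2 ⊑
            x3 · 1 , x3 ⊕ x2 ⊑ K 3 · done) (≤-reflexive h0 , h1 , h2 , h3 , tt)
        choose : 1 < weight a T ⊎ weight a T ≤ 1 → ⊥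
        choose (inj₁ two) = close σ two (other (load g b′ P) (weight b′ T) (weight b′ T′) (weight a T) b′-sum load-b′ two
            (All.head (All-resp-↭ σ light′)))
        choose (inj₂ one) = close (ptrans σ (pswap T T′ refl)) two (first (load g b′ P) (weight b′ T) (weight b′ T′)
            (weight a T′) b′-sum load-b′ two (All.head (All.tail (All-resp-↭ σ light′))))
          where
          two = second (load g a P) (weight a T) (weight a T′) a-sum load-a one

    -- The square has a second pair of opposite edges, one of which is light again. The two light
    -- edges share a vertex, which a reflection turns into `b′`.
    several-triangles : 1 ≤ j → ∀ {p q p′ q′} → Rest p q p′ q′ → g p q ≡ true → g p′ q′ ≡ true → ⊥
    several-triangles j≥1 {p} {q} {p′} {q′} pk pq p′q′ = start (one-side-light j≥1 pk pq p′q′)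
      where
      turned : ∀ {a b a′ b′} → Rest a b a′ b′ → Rest b a′ a b′
      turned {a} {b} {a′} {b′} = reorder-rest (ptrans (pswap a b refl) (prep b (pswap a a′ refl)))
      mirrored : ∀ {a b a′ b′} → Rest a b a′ b′ → Rest b a b′ a′
      mirrored {a} {b} {a′} {b′} = reorder-rest (pswap a b (pswap a′ b′ refl))
      continue : j ≡ 1 × Square → ⊥
      continue (j≡1 , square {a} {b} {a′} {b′} pk ab ba′ a′b′ b′a light) with one-side-light j≥1 (turned pk) ba′ (flip-edge s b′a)
      ... | inj₁ light′ = DoublyLight.impossible j≡1 (mirrored pk) (flip-edge s ab) (flip-edge s b′a) (flip-edge s a′b′)
          (flip-edge s ba′) (swap-light light) light′
      ... | inj₂ light′ = DoublyLight.impossible j≡1 pk ab ba′ a′b′ b′a light light′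
      start : Light p q ⊎ Light p′ q′ → ⊥
      start (inj₁ light) = continue (light-square j≥1 (reorder-rest (shifts (p ∷ q ∷ []) (p′ ∷ q′ ∷ [])) pk) p′q′ pq light)
      start (inj₂ light) = continue (light-square j≥1 pk pq p′q′ light)

  -- At least three edges lie among the four outer vertices, so a further edge links the two
  -- disjoint ones into a path.
  one-triangle : ∀ {L : List V} → Unique L → length L ≡ 7 → ¬ RainbowPacking L 2 →
    (∀ {g} → RainbowGraph g → 13 < e g L → ∀ {v Y} → L ↭ v ∷ Y → 3 ≤ deg g v L) →
    ∀ {g} → RainbowGraph g → 13 < e g L → ∀ {P p q p′ q′} → length P ≡ 1 → Packing g P (p ∷ q ∷ p′ ∷ q′ ∷ []) L → g p q ≡ true →
        g p′ q′ ≡ true → ⊥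
  one-triangle {L} uL len ¬rp degrees {g} R dense {T ∷ []} {p} {q} {p′} {q′} size pk pq p′q′ = link (g q p′) (g q q′) (g p p′)
      (g p q′) refl refl refl refl
    where
    s : Simple g
    s = simple R
    path : ∀ {x y z w} → p ∷ q ∷ p′ ∷ q′ ∷ [] ↭ x ∷ y ∷ z ∷ w ∷ [] → g x y ≡ true → g y z ≡ true → g z w ≡ true → ⊥
    path σ = seven-vertices uL ¬rp degrees R dense (↭-sym (partition (reorder-rest σ pk))) (All.head (triangles pk))
    link : ∀ α β γ δ → g q p′ ≡ α → g q q′ ≡ β → g p p′ ≡ γ → g p q′ ≡ δ → ⊥
    link true _ _ _ qp′ _ _ _ = path refl pq qp′ p′q′
    link _ true _ _ _ qq′ _ _ = path (prep p (prep q (pswap p′ q′ refl))) pq qq′ (flip-edge s p′q′)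
    link _ _ true _ _ _ pp′ _ = path (pswap p q refl) (flip-edge s pq) pp′ p′q′
    link _ _ _ true _ _ _ pq′ = path (pswap p q (pswap p′ q′ refl)) (flip-edge s pq) pq′ (flip-edge s p′q′)
    link false false false false α β γ δ = sparse (ind (g p q)) (ind (g p p′)) (ind (g p q′)) (ind (g q p′)) (ind (g q q′))
        (ind (g p′ q′))
      (FourLeft.Counting.many-in-rest uL len ¬rp degrees R dense size pk pq p′q′)
      (ind≤1 (g p q)) (ind≤1 (g p′ q′)) (cong ind α) (cong ind β) (cong ind γ) (cong ind δ)
      where
      sparse : ∀ a b d f h i → 3 ≤ a + (b + (d + 0)) + (f + (h + 0) + (i + 0 + (0 + 0))) → a ≤ 1 → i ≤ 1 → f ≡ 0 → h ≡ 0 → b ≡ 0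
          → d ≡ 0 → ⊥
      sparse a b d f h i h0 h1 h2 h3 h4 h5 h6 = refute (a ∷ b ∷ d ∷ f ∷ h ∷ i ∷ [])
          (1 , K 3 ⊑ x0 ⊕ (x1 ⊕ (x2 ⊕ K 0)) ⊕ (x3 ⊕ (x4 ⊕ K 0) ⊕ (x5 ⊕ K 0 ⊕ (K 0 ⊕ K 0))) · 1 , x0 ⊑ K 1 · 1 , x5 ⊑ K 1 · 1 , x3
          ⊑ K 0 · 1 , x4 ⊑ K 0 · 1 , x1 ⊑ K 0 · 1 , x2 ⊑ K 0 · done) (h0 , h1 , h2 , ≤-reflexive h3 , ≤-reflexive h4 ,
          ≤-reflexive h5 , ≤-reflexive h6 , tt)

  -- Mantel's theorem and the induction

  -- The ends of an edge in no triangle have degree sum at most `length X`, which counts the edge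
  -- twice; deleting them loses at most `length X ∸ 1` edges.
  mantel : ∀ {g : Graph V} → Simple g → ∀ n {X} → length X ≡ n → TriangleIn g X ⊎ e g X ≤ quarter n
  mantel s 0 {[]} _ = inj₂ z≤n
  mantel s 1 {_ ∷ []} _ = inj₂ z≤n
  mantel {g} s (suc (suc n)) {X} len with edge? g X
  ... | inj₂ none = inj₂ (subst (_≤ _) (sym none) z≤n)
  ... | inj₁ (u , v , Y , σ , uv) with triangle-on-edge? s σ uv | mantel s n {Y}
      (suc-injective (suc-injective (trans (sym (↭-length σ)) len)))
  ...   | inj₁ tri | _ = inj₁ tri
  ...   | _ | inj₁ (x , y , z , Z , τ , t) = inj₁ (x , y , z , u ∷ v ∷ Z ,
          ptrans σ (ptrans (prep u (prep v τ)) (shifts (u ∷ v ∷ []) (x ∷ y ∷ z ∷ []))) , t)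
  ...   | inj₂ few | inj₂ le = inj₂ (count-edges (ind (g u v)) (ind (g u u)) (ind (g v u)) (ind (g v v)) (deg g u Y) (deg g v Y)
      (deg g u X) (deg g v X) (e g X) (e g Y) n (length X) (quarter n)
          (e-↭ s σ) (deg-↭ g u σ) (deg-↭ g v σ) (cong ind uv) (cong ind (flip-edge s uv)) few len le)
    where
    count-edges : ∀ a i b k x y d d' n n' m l q → n ≡ a + x + (y + n') → d ≡ i + (a + x) → d' ≡ b + (k + y) → a ≡ 1 → b ≡ 1 → d +
        d' ≤ l → l ≡ 2 + m → n' ≤ q → n ≤ q + (1 + m)
    count-edges a i b k x y d d' n n' m l q h0 h1 h2 _ h4 h5 h6 h7 = deduce (a ∷ i ∷ b ∷ k ∷ x ∷ y ∷ d ∷ d' ∷ n ∷ n' ∷ m ∷ l ∷ q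
        ∷ []) 1 (x8 ⊑ x12 ⊕ (K 1 ⊕ x10)) (1 , x8 ⊑ x0 ⊕ x4 ⊕ (x5 ⊕ x9) · 1 , x1 ⊕ (x0 ⊕ x4) ⊑ x6 · 1 , x2 ⊕ (x3 ⊕ x5) ⊑ x7 · 1 ,
        K 1 ⊑ x2 · 1 , x6 ⊕ x7 ⊑ x11 · 1 , x11 ⊑ K 2 ⊕ x10 · 1 , x9 ⊑ x12 · done)
        (≤-reflexive h0 , ≤-reflexive (sym h1) , ≤-reflexive (sym h2) , ≤-reflexive (sym h4) , h5 , ≤-reflexive h6 , h7 , tt)

  bounded-one : ∀ j → Bounded j 0 → (∀ {j′} → j ≡ suc j′ → Bounded j′ 4) → Bounded j 1
  bounded-one j ih ihₖ {L} uL len {g} R ¬rp = ≮⇒≥ λ dense → first-packing j refl dense λ (g′ , S , dense′ , pks) →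
    conclude (OneExtra.find-dense-matching uL len ¬rp degrees S dense′ pks)
    where
    degrees : ∀ {g} → RainbowGraph g → bound j 1 < e g L → ∀ {v Y} → L ↭ v ∷ Y → 2 * j + 3 ≤ deg g v L
    degrees {g} R dense {v} σ = step j (bound j 0) (bound j 1) (e g L) (deg g v L) (minimum-degree {j} uL len R ¬rp ih σ)
        (bound-one j) dense
      where
      step : ∀ j a b n d → n ≤ d + a → a + (2 * j + 2) ≤ b → b < n → 2 * j + 3 ≤ d
      step j a b n d h0 h1 h2 = deduce (j ∷ a ∷ b ∷ n ∷ d ∷ []) 1 (2 ⊗ x0 ⊕ K 3 ⊑ x4)
          (1 , x3 ⊑ x4 ⊕ x1 · 1 , x1 ⊕ (2 ⊗ x0 ⊕ K 2) ⊑ x2 · 1 , K 1 ⊕ x2 ⊑ x3 · done) (h0 , h1 , h2 , tt)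
    Start : Set
    Start = ∃[ g′ ] RainbowGraph g′ × bound j 1 < e g′ L × Packs g′ (1 + j) L
    -- `Bounded` only refutes the absence of a packing of k - 1 triangles, so the packing is handed
    -- to a continuation with goal `⊥`.
    first-packing : ∀ i → j ≡ i → bound j 1 < e g L → (Start → ⊥) → ⊥
    first-packing zero refl dense k with mantel (simple R) 7 len
    ... | inj₁ (x , y , z , X , σ , t) = k (g , R , dense , (x , y , z) ∷ [] , X , refl , ((t ∷ []) , ↭-sym σ))
    -- Mantel's bound on seven vertices is 12, and `bound 0 1` is 13.
    ... | inj₂ few = <⇒≱ dense (≤-trans few (n≤1+n 12))
    first-packing (suc j′) refl dense k = <⇒≱ dense (≤-trans
      (ihₖ refl uL (trans len (rearrange j′)) R λ rp → let (g′ , S , larger , pks) = with-packing R uL rp in k (g′ , S , ≤-trans dense larger , pks))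
      (bound-previous j′))
      where
      rearrange : ∀ i → 3 * suc i + 6 + 1 ≡ 3 * i + 6 + 4
      rearrange = solve-∀
    conclude : OneExtra.DenseMatched uL len ¬rp degrees → ⊥
    conclude (OneExtra.denseMatched S dense (matched {P} {a} {b} {a′} {b′} {X} size pk ab a′b′)) = finish X pk
      where
      too-long : ∀ t j x n → t ≡ 1 + j → 3 * t + (5 + x) ≡ n → n ≡ 3 * j + 6 + 1 → ⊥
      too-long t j x n h0 h1 h2 = refute (t ∷ j ∷ x ∷ n ∷ []) (3 , K 1 ⊕ x1 ⊑ x0 · 1 , 3 ⊗ x0 ⊕ (K 5 ⊕ x2) ⊑ x3 · 1 , x3 ⊑ 3 ⊗ x1
          ⊕ K 6 ⊕ K 1 · done) (≤-reflexive (sym h0) , ≤-reflexive h1 , ≤-reflexive h2 , tt)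
      finish : ∀ X → Packing _ P (a ∷ b ∷ a′ ∷ b′ ∷ X) L → ⊥
      finish (_ ∷ X) pk = too-long (length P) j (length X) (length L) size (packing-length pk) len
      finish [] pk = split-on j len ¬rp degrees dense size
        where
        -- The hypotheses that depend on `j` are abstracted so that its value can be split.
        split-on : ∀ i → length L ≡ 3 * i + 6 + 1 → ¬ RainbowPacking L (2 + i) →
          (∀ {g} → RainbowGraph g → bound i 1 < e g L → ∀ {v Y} → L ↭ v ∷ Y → 2 * i + 3 ≤ deg g v L) →
          bound i 1 < e _ L → length P ≡ 1 + i → ⊥
        split-on zero len ¬rp degrees dense size = one-triangle uL len ¬rp degrees S dense size pk ab a′b′
        split-on (suc i) len ¬rp degrees dense size = FourLeft.several-triangles uL len ¬rp degrees S dense size (s≤s z≤n) pk ab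
            a′b′

  bounded-row : ∀ j → (∀ {j′} → j ≡ suc j′ → ∀ m → Bounded j′ m) → ∀ i → Bounded j (double i) × Bounded j (suc (double i))
  bounded-row j previous zero = bounded-zero j , bounded-one j (bounded-zero j) λ eq → previous eq 4
  bounded-row j previous (suc i) with bounded-row j previous i
  ... | even , odd = even′ , odd-case {j} {i} even′ odd λ eq → previous eq (suc (double (suc i)))
    where
    even′ = even-case {j} {i} odd

  private
    from-row : ∀ {j} → (∀ i → Bounded j (double i) × Bounded j (suc (double i))) → ∀ m → Bounded j m
    from-row row m with even-or-odd m
    ... | i , inj₁ refl = proj₁ (row i)
    ... | i , inj₂ refl = proj₂ (row i)

  bounded : ∀ j m → Bounded j m
  bounded zero = from-row (bounded-row zero λ ())
  bounded (suc j) = from-row (bounded-row (suc j) λ { refl → bounded j })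

  -- Colourings

  edge-colours : Graph V → List V → List ℕ
  edge-colours g [] = []
  edge-colours g (v ∷ X) = map (c v) (filterᵇ (g v) X) ++ edge-colours g X

  length-filterᵇ : ∀ (f : V → Bool) X → length (filterᵇ f X) ≡ ∑ (λ v → ind (f v)) X
  length-filterᵇ f [] = refl
  length-filterᵇ f (v ∷ X) with f v
  ... | true = cong suc (length-filterᵇ f X)
  ... | false = length-filterᵇ f X

  length-edge-colours : ∀ g X → length (edge-colours g X) ≡ e g X
  length-edge-colours g [] = refl
  length-edge-colours g (v ∷ X) = trans (length-++ (map (c v) (filterᵇ (g v) X)))
    (cong₂ _+_ (trans (length-map (c v) (filterᵇ (g v) X)) (length-filterᵇ (g v) X)) (length-edge-colours g X))

  ∈-edge-colours : ∀ {g : Graph V} → Simple g → ∀ {a b X} → a ∈ X → b ∈ X → g a b ≡ true → c a b ∈ edge-colours g X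
  ∈-edge-colours s (here refl) (here refl) ab = ⊥-elim (edge-≢ s ab refl)
  ∈-edge-colours {g} s {a} (here refl) (there b∈) ab = ∈-++⁺ˡ (∈-map⁺ (c a) (∈-filter⁺ (T? ∘ g a) b∈ (subst T (sym ab) tt)))
  ∈-edge-colours {g} s {a} {b} {_ ∷ X} (there a∈) (here refl) ab = ∈-++⁺ˡ (subst (_∈ map (c b) (filterᵇ (g b) X)) (col-sym 𝒞 b a)
    (∈-map⁺ (c b) (∈-filter⁺ (T? ∘ g b) a∈ (subst T (sym (flip-edge s ab)) tt))))
  ∈-edge-colours {g} s {X = v ∷ X} (there a∈) (there b∈) ab = ∈-++⁺ʳ (map (c v) (filterᵇ (g v) X)) (∈-edge-colours s a∈ b∈ ab)

  length-Unique-≤ : ∀ {A : Set} {xs ys : List A} → Unique xs → All (_∈ ys) xs → length xs ≤ length ys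
  length-Unique-≤ [] [] = z≤n
  length-Unique-≤ (x∉ ∷ u) (x∈ ∷ xs∈) with ∈-∃++ x∈
  ... | as , bs , refl = subst (_ ≤_) (sym (↭-length (shift _ as bs))) (s≤s (length-Unique-≤ u
    (All.zipWith (λ { (≢x , y∈) → other ≢x (∈-resp-↭ (shift _ as bs) y∈) }) (x∉ , xs∈))))
    where
    other : ∀ {x y zs} → x ≢ y → y ∈ x ∷ zs → y ∈ zs
    other ≢x (here refl) = ⊥-elim (≢x refl)
    other _ (there y∈) = y∈

  Realised : Graph V → ℕ → Set
  Realised g γ = ∃[ a ] ∃[ b ] g a b ≡ true × c a b ≡ γ

  -- An inserted edge expels only an edge of its own colour, so every colour realised before remains
  -- realised.
  spanning : ∀ {Γ} → All (λ γ → ∃[ a ] ∃[ b ] a ≢ b × c a b ≡ γ) Γ → ∃[ g ] RainbowGraph g × All (Realised g) Γ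
  spanning [] = (λ _ _ → false) , rainbow (record { symm = λ _ _ → refl ; irrefl = λ _ → refl }) (λ ()) , []
  spanning ((u , w , u≢w , refl) ∷ Γ) with spanning Γ
  ... | g , R , realised = _ , exchange-rainbow R u≢w , (u , w , added R u≢w , refl) ∷ All.map still realised
    where
    still : ∀ {γ} → Realised g γ → Realised (exchange-edge g u w) γ
    still (a , b , ab , refl) with c a b Data.Nat.≟ c u w
    ... | yes eq = u , w , added R u≢w , sym eq
    ... | no new = a , b , kept R u≢w ab new , refl

  edges-≢ : ∀ n → All (λ (u , w) → u ≢ w) (edges n)
  edges-≢ n = All.concat⁺ (All.map⁺ (All.universal (λ i → All.concat⁺ (All.map⁺ (All.universal (entry i) (allFin n))))
      (allFin n)))
    where
    entry : ∀ i j → All (λ (u , w) → u ≢ w) (if toℕ i <ᵇ toℕ j then (i , j) ∷ [] else [])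
    entry i j with toℕ i <ᵇ toℕ j in lt
    ... | true = (λ { refl → <-irrefl refl (<ᵇ⇒< (toℕ i) (toℕ i) (subst T (sym lt) tt)) }) ∷ []
    ... | false = []

  numColours≤ : ∃[ g ] RainbowGraph g × numColours 𝒞 ≤ e g (allFin N)
  numColours≤ with spanning (All.tabulate λ γ∈ → realise
      (∈-map⁻ _ (∈-deduplicate⁻ Data.Nat._≟_ (map (λ uw → c (proj₁ uw) (proj₂ uw)) (edges N)) γ∈)))
    where
    realise : ∀ {γ} → ∃[ uw ] uw ∈ edges N × γ ≡ c (proj₁ uw) (proj₂ uw) → ∃[ a ] ∃[ b ] a ≢ b × c a b ≡ γ
    realise ((u , w) , uw∈ , refl) = u , w , All.lookup (edges-≢ N) uw∈ , refl
  ... | g , R , realised = g , R , subst (numColours 𝒞 ≤_) (length-edge-colours g (allFin N))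
    (length-Unique-≤ (deduplicate-! Data.Nat._≟_ _)
        (All.map (λ { (a , b , ab , refl) → ∈-edge-colours (simple R) (∈-allFin a) (∈-allFin b) ab }) realised))

  -- From packings to copies of kC₃

  corner : Triple V → Fin 3 → V
  corner (x , y , z) 0F = x
  corner (x , y , z) 1F = y
  corner (x , y , z) 2F = z

  corner-∈ : ∀ t i → corner t i ∈ corners t
  corner-∈ t 0F = here refl
  corner-∈ t 1F = there (here refl)
  corner-∈ t 2F = there (there (here refl))

  vertexAt : (P : List (Triple V)) → Fin (length P) × Fin 3 → V
  vertexAt (t ∷ P) (zero , i) = corner t i
  vertexAt (t ∷ P) (suc a , i) = vertexAt P (a , i)

  vertexAt-∈ : ∀ P ai → vertexAt P ai ∈ flat P
  vertexAt-∈ (t ∷ P) (zero , i) = ∈-++⁺ˡ (corner-∈ t i)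
  vertexAt-∈ (t ∷ P) (suc a , i) = ∈-++⁺ʳ (corners t) (vertexAt-∈ P (a , i))

  corner-injective : ∀ t {i i′} → Unique (corners t) → corner t i ≡ corner t i′ → i ≡ i′
  corner-injective t {0F} {0F} _ _ = refl
  corner-injective t {1F} {1F} _ _ = refl
  corner-injective t {2F} {2F} _ _ = refl
  corner-injective t {0F} {1F} ((≢₁ ∷ _) ∷ _) eq = ⊥-elim (≢₁ eq)
  corner-injective t {0F} {2F} ((_ ∷ ≢₂ ∷ _) ∷ _) eq = ⊥-elim (≢₂ eq)
  corner-injective t {1F} {2F} (_ ∷ (≢₁ ∷ _) ∷ _) eq = ⊥-elim (≢₁ eq)
  corner-injective t {1F} {0F} ((≢₁ ∷ _) ∷ _) eq = ⊥-elim (≢₁ (sym eq))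
  corner-injective t {2F} {0F} ((_ ∷ ≢₂ ∷ _) ∷ _) eq = ⊥-elim (≢₂ (sym eq))
  corner-injective t {2F} {1F} (_ ∷ (≢₁ ∷ _) ∷ _) eq = ⊥-elim (≢₁ (sym eq))

  corner-∉ : ∀ t i {Y} → Unique (corners t ++ Y) → corner t i ∈ Y → ⊥
  corner-∉ t 0F ((_ ∷ _ ∷ y≢) ∷ _) ∈Y = All.lookup y≢ ∈Y refl
  corner-∉ t 1F (_ ∷ (_ ∷ y≢) ∷ _) ∈Y = All.lookup y≢ ∈Y refl
  corner-∉ t 2F (_ ∷ _ ∷ y≢ ∷ _) ∈Y = All.lookup y≢ ∈Y refl

  vertexAt-injective : ∀ P → Unique (flat P) → ∀ {ai bi} → vertexAt P ai ≡ vertexAt P bi → ai ≡ bi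
  vertexAt-injective (t ∷ P) ((p ∷ q ∷ _) ∷ (r ∷ _) ∷ _ ∷ _) {zero , i} {zero , i′} eq =
    cong (zero ,_) (corner-injective t ((p ∷ q ∷ []) ∷ (r ∷ []) ∷ [] ∷ []) eq)
  vertexAt-injective (t ∷ P) u {zero , i} {suc b , i′} eq = ⊥-elim
      (corner-∉ t i u (subst (_∈ flat P) (sym eq) (vertexAt-∈ P (b , i′))))
  vertexAt-injective (t ∷ P) u {suc a , i} {zero , i′} eq = ⊥-elim (corner-∉ t i′ u (subst (_∈ flat P) eq (vertexAt-∈ P (a , i))))
  vertexAt-injective (t ∷ P) (_ ∷ _ ∷ _ ∷ u) {suc a , i} {suc b , i′} eq = cong (λ (a , i) → suc a , i)
      (vertexAt-injective P u {a , i} {b , i′} eq)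

  -- The ends of side `i` in the numbering that `edgeColour` prescribes.
  tail end : Fin 3 → Fin 3
  tail 0F = 0F
  tail 1F = 1F
  tail 2F = 0F
  end 0F = 1F
  end 1F = 2F
  end 2F = 2F

  ends-injective : ∀ i i′ → (tail i ≡ tail i′ × end i ≡ end i′) ⊎ (tail i ≡ end i′ × end i ≡ tail i′) → i ≡ i′
  ends-injective 0F 0F _ = refl
  ends-injective 1F 1F _ = refl
  ends-injective 2F 2F _ = refl
  ends-injective 0F 1F (inj₁ (() , _))
  ends-injective 0F 1F (inj₂ (() , _))
  ends-injective 0F 2F (inj₁ (_ , ()))
  ends-injective 0F 2F (inj₂ (() , _))
  ends-injective 1F 0F (inj₁ (() , _))
  ends-injective 1F 0F (inj₂ (_ , ()))
  ends-injective 1F 2F (inj₁ (() , _))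
  ends-injective 1F 2F (inj₂ (() , _))
  ends-injective 2F 0F (inj₁ (_ , ()))
  ends-injective 2F 0F (inj₂ (() , _))
  ends-injective 2F 1F (inj₁ (() , _))
  ends-injective 2F 1F (inj₂ (() , _))

  tail-edge : ∀ {g : Graph V} {P} → All (IsTri g) P → ∀ a i → g (vertexAt P (a , tail i)) (vertexAt P (a , end i)) ≡ true
  tail-edge ((xy , _ , _) ∷ _) zero 0F = xy
  tail-edge ((_ , _ , yz) ∷ _) zero 1F = yz
  tail-edge ((_ , xz , _) ∷ _) zero 2F = xz
  tail-edge (_ ∷ ts) (suc a) i = tail-edge ts a i

  no-packing : ∀ {k} → NoRainbowKC3 k 𝒞 → ¬ RainbowPacking (allFin N) k
  no-packing none (g , R , P , X , refl , pk) = none copy rainbow-copy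
    where
    unique : Unique (flat P)
    unique = unique-++ˡ (flat P) (Unique-↭ (↭-sym (partition pk)) (allFin⁺ N))
      where
      unique-++ˡ : ∀ (Y : List V) {Z} → Unique (Y ++ Z) → Unique Y
      unique-++ˡ [] _ = []
      unique-++ˡ (v ∷ Y) (v∉ ∷ u) = All.++⁻ˡ Y v∉ ∷ unique-++ˡ Y u
    copy : CopyKC3 N (length P)
    copy = record { vtx = vertexAt P ; inj = vertexAt-injective P unique }
    colour-of : ∀ a i → edgeColour 𝒞 copy (a , i) ≡ c (vertexAt P (a , tail i)) (vertexAt P (a , end i))
    colour-of a 0F = refl
    colour-of a 1F = refl
    colour-of a 2F = refl
    rainbow-copy : Rainbow 𝒞 copy
    rainbow-copy {a , i} {b , i′} eq with injective R (tail-edge (triangles pk) a i) (tail-edge (triangles pk) b i′)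
        (trans (sym (colour-of a i)) (trans eq (colour-of b i′)))
    ... | inj₁ (p , q) with vertexAt-injective P unique {a , tail i} {b , tail i′} p | vertexAt-injective P unique {a , end i}
        {b , end i′} q
    ...   | p′ | q′ = cong₂ _,_ (cong proj₁ p′) (ends-injective i i′ (inj₁ (cong proj₂ p′ , cong proj₂ q′)))
    rainbow-copy {a , i} {b , i′} eq | inj₂ (p , q) with vertexAt-injective P unique {a , tail i} {b , end i′} p |
        vertexAt-injective P unique {a , end i} {b , tail i′} q
    ...   | p′ | q′ = cong₂ _,_ (cong proj₁ p′) (ends-injective i i′ (inj₂ (cong proj₂ p′ , cong proj₂ q′)))

  numColours-bounded : ∀ j m → N ≡ 3 * j + 6 + m → NoRainbowKC3 (2 + j) 𝒞 → numColours 𝒞 ≤ bound j m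
  numColours-bounded j m size none with numColours≤
  ... | g , R , le = ≤-trans le (bounded j m (allFin⁺ N) (trans (length-tabulate (λ i → i)) size) R (no-packing none))

-- Comparison of the bounds

pairs≡C : ∀ n → pairs n ≡ n C 2
pairs≡C zero = refl
pairs≡C (suc n) = trans (cong₂ _+_ (sym (nC1≡n n)) (pairs≡C n)) (nCk+nC[k+1]≡[n+1]C[k+1] n 1)

quarter*4≤ : ∀ m → quarter m * 4 ≤ m * m
quarter*4≤ zero = z≤n
quarter*4≤ (suc zero) = z≤n
quarter*4≤ (suc (suc m)) = subst₂ _≤_ (left (quarter m) m) (right m) (+-monoˡ-≤ (4 * m + 4) (quarter*4≤ m))
  where
  left : ∀ q m → q * 4 + (4 * m + 4) ≡ (q + suc m) * 4
  left = solve-∀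
  right : ∀ m → m * m + (4 * m + 4) ≡ suc (suc m) * suc (suc m)
  right = solve-∀

-- For a = k + 1 and m = n - 3k the base 2a + m is n - k + 2.
square/4 : ∀ a m → a * a + a * m + quarter m ≤ (2 * a + m) ^ 2 / 4
square/4 a m = subst (_≤ (2 * a + m) ^ 2 / 4) (m*n/n≡m (a * a + a * m + quarter m) 4)
  (/-monoˡ-≤ 4 (subst₂ _≤_ (left a m (quarter m)) (right a m) (+-monoʳ-≤ (4 * (a * a) + 4 * (a * m)) (quarter*4≤ m))))
  where
  left : ∀ a m q → 4 * (a * a) + 4 * (a * m) + q * 4 ≡ (a * a + a * m + q) * 4
  left = solve-∀
  right : ∀ a m → 4 * (a * a) + 4 * (a * m) + m * m ≡ (2 * a + m) * ((2 * a + m) * 1)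
  right = solve-∀

-- The hypothesis prevents truncation, for odd `m` because the right-hand side is even; then twice
-- ⌈m/2⌉ is at least `m`.
excess≤ : ∀ j m → m ≤ 2 * ((1 + j) * (1 + j)) → 2 * excess j m + m ≤ 2 * ((1 + j) * (1 + j))
excess≤ j m small with even-or-odd m
... | i , inj₁ refl = step i ((1 + j) * (1 + j)) (excess j (double i)) ⌈ double i /2⌉ (double i)
  (m∸n+n≡m (subst (_≤ (1 + j) * (1 + j)) (sym (half-even i)) (*-cancelˡ-≤ 2 (subst (_≤ _) (double≡2* i) small)))) (half-even i)
      (double≡2* i)
  where
  step : ∀ i s x h d → x + h ≡ s → h ≡ i → d ≡ 2 * i → 2 * x + d ≤ 2 * s
  step i s x h d h0 h1 h2 = deduce (i ∷ s ∷ x ∷ h ∷ d ∷ []) 1 (2 ⊗ x2 ⊕ x4 ⊑ 2 ⊗ x1) (2 , x2 ⊕ x3 ⊑ x1 · 2 , x0 ⊑ x3 · 1 , x4 ⊑ 2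
      ⊗ x0 · done) (≤-reflexive h0 , ≤-reflexive (sym h1) , ≤-reflexive h2 , tt)
... | i , inj₂ refl = step i ((1 + j) * (1 + j)) (excess j (suc (double i))) ⌈ suc (double i) /2⌉ (double i)
  (m∸n+n≡m (subst (_≤ (1 + j) * (1 + j)) (sym (half-odd i)) (*-cancelˡ-< 2 i _ (subst (_< _) (double≡2* i) small)))) (half-odd i)
      (double≡2* i)
  where
  step : ∀ i s x h d → x + h ≡ s → h ≡ 1 + i → d ≡ 2 * i → 2 * x + (1 + d) ≤ 2 * s
  step i s x h d h0 h1 h2 = deduce (i ∷ s ∷ x ∷ h ∷ d ∷ []) 1 (2 ⊗ x2 ⊕ (K 1 ⊕ x4) ⊑ 2 ⊗ x1)
      (2 , x2 ⊕ x3 ⊑ x1 · 2 , K 1 ⊕ x0 ⊑ x3 · 1 , x4 ⊑ 2 ⊗ x0 · done) (≤-reflexive h0 , ≤-reflexive (sym h1) , ≤-reflexive h2 ,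
      tt)

bound≤ : ∀ j m → m ≤ 2 * ((1 + j) * (1 + j)) →
  2 * bound j m + m ≤ 2 * ((2 * j + 6 + m) ^ 2 / 4 + j * (2 * j + 6 + m) + j C 2 + (1 + j) ^ 2 + 1)
bound≤ j m small = step (bound j m) ((j + 3) * (j + 3) + (j + 3) * m + quarter m) ((2 * j + 6 + m) ^ 2 / 4) (j * (2 * j + 6 + m))
  (pairs j) (j C 2) (excess j m) m ((1 + j) * (1 + j)) ((1 + j) ^ 2) refl
  (subst (λ a → (j + 3) * (j + 3) + (j + 3) * m + quarter m ≤ (a + m) ^ 2 / 4) (*-distribˡ-+ 2 j 3) (square/4 (j + 3) m))
  (pairs≡C j) (excess≤ j m small) (cong ((1 + j) *_) (*-identityʳ (1 + j)))
  where
  step : ∀ b q q' r p p' x m s s' → b ≡ q + r + p + 1 + x → q ≤ q' → p ≡ p' → 2 * x + m ≤ 2 * s → s' ≡ s → 2 * b + m ≤ 2 *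
      (q' + r + p' + s' + 1)
  step b q q' r p p' x m s s' h0 h1 h2 h3 h4 = deduce (b ∷ q ∷ q' ∷ r ∷ p ∷ p' ∷ x ∷ m ∷ s ∷ s' ∷ []) 1
      (2 ⊗ x0 ⊕ x7 ⊑ 2 ⊗ (x2 ⊕ x3 ⊕ x5 ⊕ x9 ⊕ K 1)) (2 , x0 ⊑ x1 ⊕ x3 ⊕ x4 ⊕ K 1 ⊕ x6 · 2 , x1 ⊑ x2 · 2 , x4 ⊑ x5 · 1 , 2 ⊗ x6 ⊕
      x7 ⊑ 2 ⊗ x8 · 2 , x8 ⊑ x9 · done) (≤-reflexive h0 , h1 , ≤-reflexive h2 , h3 , ≤-reflexive (sym h4) , tt)

theorem1p3 : (k n : ℕ) → 2 ≤ k → 3 * k ≤ n → n ≤ 2 * k ^ 2 ∸ k + 2 →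
  -- ar(n,kC3) ≤ ⌊(n-k+2)²/4⌋ + (k-2)(n-k+2) + C(k-2,2) + (k-1)² - (n-3k)/2 + 1,
  -- stated as: every colouring of K_n with no rainbow kC3 has
  -- 2·#colours + (n-3k) ≤ 2·(remaining terms)
  ∀ (c : EdgeColouring n) → NoRainbowKC3 k c →
    2 * numColours c + (n ∸ 3 * k)
      ≤ 2 * ((n ∸ k + 2) ^ 2 / 4 + (k ∸ 2) * (n ∸ k + 2) + (k ∸ 2) C 2 + (k ∸ 1) ^ 2 + 1)
theorem1p3 (suc (suc j)) n (s≤s (s≤s z≤n)) lower upper c none = subst
  (λ l → 2 * numColours c + m ≤ 2 * (l ^ 2 / 4 + j * l + j C 2 + (1 + j) ^ 2 + 1)) (sym length≡)
  (≤-trans (+-monoˡ-≤ m (*-monoʳ-≤ 2 (Coloured.numColours-bounded c j m size none))) (bound≤ j m small))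
  where
  k = 2 + j
  m = n ∸ 3 * k
  n≡ : n ≡ 3 * k + m
  n≡ = sym (m+[n∸m]≡n lower)
  size : n ≡ 3 * j + 6 + m
  size = trans n≡ (cong (_+ m) (rearrange j))
    where
    rearrange : ∀ j → 3 * (2 + j) ≡ 3 * j + 6
    rearrange = solve-∀
  length≡ : n ∸ k + 2 ≡ 2 * j + 6 + m
  length≡ = trans (cong (λ l → l ∸ k + 2) (trans n≡ (rearrange j m))) (trans (cong (_+ 2) (m+n∸m≡n k (2 * j + 4 + m)))
      (rearrange′ j m))
    where
    rearrange : ∀ j m → 3 * (2 + j) + m ≡ 2 + j + (2 * j + 4 + m)
    rearrange = solve-∀
    rearrange′ : ∀ j m → 2 * j + 4 + m + 2 ≡ 2 * j + 6 + m
    rearrange′ = solve-∀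
  -- Since 3k + 2(k - 1)² = 2k² - k + 2, the upper limit for `n` is the point where the excess
  -- vanishes.
  small : m ≤ 2 * ((1 + j) * (1 + j))
  small = step j m (j * j) ((1 + j) * (1 + j)) n (subst (λ l → n ≤ l + 2) upper≡ upper) size (square j)
    where
    upper≡ : 2 * k ^ 2 ∸ k ≡ 2 * (j * j) + 7 * j + 6
    upper≡ = trans (cong (_∸ k) (rearrange j)) (m+n∸m≡n k (2 * (j * j) + 7 * j + 6))
      where
      rearrange : ∀ j → 2 * ((2 + j) * ((2 + j) * 1)) ≡ 2 + j + (2 * (j * j) + 7 * j + 6)
      rearrange = solve-∀
    square : ∀ j → (1 + j) * (1 + j) ≡ j * j + 2 * j + 1
    square = solve-∀
    step : ∀ j m s s' n → n ≤ 2 * s + 7 * j + 6 + 2 → n ≡ 3 * j + 6 + m → s' ≡ s + 2 * j + 1 → m ≤ 2 * s'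
    step j m s s' n h0 h1 h2 = deduce (j ∷ m ∷ s ∷ s' ∷ n ∷ []) 1 (x1 ⊑ 2 ⊗ x3) (1 , x4 ⊑ 2 ⊗ x2 ⊕ 7 ⊗ x0 ⊕ K 6 ⊕ K 2 · 1 , 3 ⊗
        x0 ⊕ K 6 ⊕ x1 ⊑ x4 · 2 , x2 ⊕ 2 ⊗ x0 ⊕ K 1 ⊑ x3 · done) (h0 , ≤-reflexive (sym h1) , ≤-reflexive (sym h2) , tt)
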